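{- Let $\lambda\in\mathbb{R}$ be an algebraic number of degree $d$ with minimal polynomial $p(x)=a_dx^d+\cdots+a_0\in\mathbb{Z}[x]$, where $a_0,\dots,a_d$ have no common prime factor. Then there are constants $D>0$ and $\sigma>0$ such that $$|A+\lambda\cdot A|\geq \left(|a_d|^{1/d}+|a_0|^{1/d}\right)^d|A|-D|A|^{1-\sigma}$$ holds for all finite subsets $A$ of $\mathbb{R}$.
   Context: For a set $A$ and scalar $\lambda$, $\lambda\cdot A=\{\lambda a:a\in A\}$ and $A+\lambda\cdot A=\{a+\lambda b: a,b\in A\}$. -}

module Defs where

open import Level using (0ℓ; suc)
open import Algebra.Bundles using (CommutativeRing)
open import Axiom.ExcludedMiddle using (ExcludedMiddle)
open import Data.Fin.Base using (Fin; toℕ; fromℕ)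
open import Data.Integer.Base using (ℤ; +_; -[1+_]; 0ℤ)
open import Data.Integer.Divisibility using (_∣_)
open import Data.List.Base using (List; length; map; deduplicate; cartesianProductWith)
open import Data.Nat.Base as ℕ using (ℕ)
open import Data.Nat.Primality using (Prime)
open import Data.Product.Base using (∃; ∃-syntax; _×_)
open import Relation.Binary.Core using (Rel)
open import Relation.Binary.Structures using (IsTotalOrder)
open import Relation.Binary.PropositionalEquality.Core using (_≡_; _≢_)
open import Relation.Nullary.Negation.Core using (¬_)

-- The real numbers, axiomatised (classically) as a complete ordered field.
-- Such a field is unique up to isomorphism.  The operations _⁻¹ and sup are
-- total, with unspecified values at 0# and at predicates that are empty or
-- not bounded above.
record RealField : Set (suc 0ℓ) where
  infix 4 _≤_ _<_
  infix 8 _⁻¹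

  field
    commutativeRing : CommutativeRing 0ℓ 0ℓ

  open CommutativeRing commutativeRing public

  field
    _≤_          : Rel Carrier 0ℓ
    isTotalOrder : IsTotalOrder _≈_ _≤_
    +-monoˡ-≤    : ∀ {x y} z → x ≤ y → x + z ≤ y + z
    *-nonNeg     : ∀ {x y} → 0# ≤ x → 0# ≤ y → 0# ≤ x * y
    0≉1          : ¬ (0# ≈ 1#)
    _⁻¹          : Carrier → Carrier
    ⁻¹-inverse   : ∀ {x} → ¬ (x ≈ 0#) → x * x ⁻¹ ≈ 1#

  UpperBound : (Carrier → Set) → Carrier → Set
  UpperBound P u = ∀ {x} → P x → x ≤ u

  field
    sup       : (Carrier → Set) → Carrier
    sup-upper : ∀ P → ∃ P → ∃ (UpperBound P) → UpperBound P (sup P)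
    sup-least : ∀ P → ∃ P → ∀ {u} → UpperBound P u → sup P ≤ u

  _<_ : Rel Carrier 0ℓ
  x < y = x ≤ y × ¬ (x ≈ y)

module Reals (R : RealField) where
  open RealField R public hiding (zero)
  open import Algebra.Properties.CommutativeMonoid.Sum +-commutativeMonoid public
    using (sum)
  open import Algebra.Properties.Semiring.Exp semiring public
    using (_^_)
  open import Algebra.Properties.Semiring.Mult semiring
    using () renaming (_×_ to _·1×_)

  fromNat : ℕ → Carrier
  fromNat n = n ·1× 1#

  fromInt : ℤ → Carrier
  fromInt (+ n)    = fromNat n
  fromInt -[1+ n ] = - fromNat (ℕ.suc n)

  -- PowerBelow b t y says that 0 ≤ y ≤ b^r for some rational r ≤ t.  Here
  -- r = (p - m) / q with q > 0, so that r ≤ t reads p ≤ q t + m, and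
  -- y ≤ b^r reads y^q b^m ≤ b^p.
  PowerBelow : ℕ → Carrier → Carrier → Set
  PowerBelow b t y =
    0# ≤ y ×
    ∃[ p ] ∃[ m ] ∃[ q ]
      (0 ℕ.< q
       × fromNat p ≤ fromNat q * t + fromNat m
       × y ^ q * fromNat b ^ m ≤ fromNat b ^ p)

  infixr 8 _^ᴿ_

  -- Real powers of natural numbers: b^t = sup { b^r : r rational, r ≤ t } for
  -- b ≥ 1.  The base 0 is sent to 0, which is the usual value for t > 0.
  _^ᴿ_ : ℕ → Carrier → Carrier
  0         ^ᴿ t = 0#
  (ℕ.suc b) ^ᴿ t = sup (PowerBelow (ℕ.suc b) t)

  -- The coefficient a i belongs to the monomial of degree i.
  eval : ∀ {n} → (Fin n → ℤ) → Carrier → Carrier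
  eval a x = sum (λ i → fromInt (a i) * x ^ toℕ i)

  -- a is the minimal polynomial of α with coprime integer coefficients, which is
  -- determined up to sign.
  record IsMinimalPolynomial {d : ℕ} (a : Fin (ℕ.suc d) → ℤ) (α : Carrier) : Set where
    field
      leading≢0 : a (fromℕ d) ≢ 0ℤ
      root      : eval a α ≈ 0#
      minimal   : ∀ (b : Fin d → ℤ) → eval b α ≈ 0# → ∀ i → b i ≡ 0ℤ
      coprime   : ∀ q → Prime q → ¬ (∀ i → + q ∣ a i)

  -- Finite subsets are given by lists of their elements, in which repetitions
  -- are allowed and do not count towards the cardinality.
  FiniteSubset : Set
  FiniteSubset = List Carrier

  infixl 6 _⊕_
  infixr 7 _·_

  _⊕_ : FiniteSubset → FiniteSubset → FiniteSubset
  _⊕_ = cartesianProductWith _+_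

  _·_ : Carrier → FiniteSubset → FiniteSubset
  α · A = map (α *_) A

  card : ExcludedMiddle 0ℓ → FiniteSubset → ℕ
  card em A = length (deduplicate (λ x y → em {x ≈ y}) A)

module Submission where

-- Put H = (∣a_d∣^(1/d) + ∣a₀∣^(1/d))^d, S = A + αA and β = α⁻¹, and suppose that the bound holds for all smaller
-- sets and fails for A. Let G be the group generated by A − A and N = G ∩ αG ∩ βG. If A is split into classes
-- modulo a subgroup so that the sums inside different classes are disjoint, then the bounds for the classes add
-- up to that for A; so there is no room for many elements of S outside of these sums. It follows that there are
-- few classes modulo N, that each is a positive proportion of A, and that each meets every residue of N modulo
-- αN and modulo βN. There are at least ∣a₀∣ residues modulo αN, since the sums Σ cⱼ αʲ x with 0 ≤ cⱼ < ∣a₀∣ are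
-- essentially distinct, and at least ∣a_d∣ modulo βN. On the other hand ∣S∣ = O(∣A∣), and by the inequalities of
-- Plünnecke and Ruzsa and the pigeonhole principle S lies, for some e ≠ 0 and each j, on few strings of step αʲe.
-- Ordering a lattice in the directions e, αe, …, αᵈ⁻¹e lexicographically then gives a discrete Brunn–Minkowski
-- inequality with a small error. Its application to the smallest residue class of a class of A, against all
-- residue classes, produces H ∣A∣ elements of S up to that error. The errors of the scales ∣A∣ ≈ Bᴶ decay
-- geometrically in J, which makes them a power of ∣A∣.

open import Defs
open import Level using (0ℓ)
open import Axiom.ExcludedMiddle using (ExcludedMiddle)
open import Data.Empty using (⊥; ⊥-elim)
open import Data.Fin.Base using (Fin; zero; suc; toℕ; fromℕ; fromℕ<)
open import Data.Integer.Base as ℤ using (ℤ; 0ℤ; 1ℤ; ∣_∣)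
import Data.Integer.Properties as ℤ
open import Data.List.Base using (List; []; _∷_; _++_; length; map; filter; concatMap; deduplicate; cartesianProduct; [_]; cartesianProductWith; upTo; _∷ʳ_; tabulate; reverse; replicate)
open import Data.List.Membership.Propositional using (_∈_; find; lose)
open import Data.List.Membership.Propositional.Properties using (∈-map⁻; ∈-++⁺ˡ; ∈-++⁺ʳ; ∈-concatMap⁻; ∈-++⁻; ∈-map⁺; ∈-filter⁻; ∈-filter⁺; ∈-deduplicate⁻; ∈-concatMap⁺; ∈-cartesianProduct⁻; ∈-cartesianProduct⁺; ∈-cartesianProductWith⁻; ∈-cartesianProductWith⁺; ∈-upTo⁻; ∈-upTo⁺)
open import Data.List.Properties using (length-++; length-map; filter-notAll; length-upTo; unfold-reverse; reverse-++; reverse-involutive; length-reverse; length-tabulate)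
open import Data.List.Relation.Unary.All as All using (All; []; _∷_)
import Data.List.Relation.Unary.All.Properties as All
open import Data.List.Relation.Unary.AllPairs as AllPairs using (AllPairs; []; _∷_)
open import Data.List.Relation.Unary.Any as Any using (Any; here; there; _─_)
import Data.List.Relation.Unary.Unique.Propositional.Properties as Unique
open import Data.Nat.Base as ℕ using (ℕ; zero; suc; z≤n; s≤s; NonZero)
import Data.Nat.Divisibility as ℕ
open import Data.Nat.Primality using (Prime; euclidsLemma; prime⇒nonTrivial)
import Data.Nat.Properties as ℕ
open import Data.Nat.Solver using () renaming (module +-*-Solver to N)
open import Data.Product.Base using (∃; ∃-syntax; _×_; _,_; proj₁; proj₂)
open import Data.Sum.Base using (_⊎_; inj₁; inj₂)
open import Function.Base using (_∘_)
open import Relation.Binary.PropositionalEquality as ≡ using (_≡_; _≢_)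
open import Relation.Nullary using (¬_; yes; no; Dec)

-- The difficulty lies in the error term: the errors of the classes add up, and a class, being
-- smaller than A by a factor of up to B, may belong to the previous scale, where the relative error
-- is larger. At scale J the permitted error is q v ∣A∣ with v = D₀ (q/(q+1))ᴶ; a class then has
-- error at most (q+1) v times its size, so that going down one scale costs no more than v ∣A∣. In
-- the final count a single class modulo N ∩ αN, with ρ ≥ ∣A∣/k₂ elements, is treated by
-- Brunn-Minkowski instead of the hypothesis. This saves (q+1) v ρ, which for q = 2 k₂ exceeds the
-- sum of v ∣A∣ and of the Brunn-Minkowski error, itself at most v ∣A∣. This fixes q, and q and B
-- determine σ. N is symmetric in α and β because it cannot be known in advance whether the
-- relatively smallest residue class occurs modulo αN or modulo βN; A + αA and A + βA are dilates of
-- each other, so either case leads to a contradiction.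

-- Counting the classes of an equivalence relation in a list.

module Counting (em : ExcludedMiddle 0ℓ) where

  import Data.List.Relation.Unary.AllPairs.Properties as AllPairs
  import Data.List.Relation.Unary.Any.Properties as Any
  open import Data.Nat.ListAction using (sum)
  open import Data.Nat.Base
  open import Data.Nat.Properties
  open import Relation.Binary.PropositionalEquality using (_≡_; refl; sym; trans; cong; cong₂; subst)

  private variable
    X Y Z : Set

  record Equivalence (X : Set) : Set₁ where
    field
      _~_     : X → X → Set
      ~-refl  : ∀ {x} → x ~ x
      ~-sym   : ∀ {x y} → x ~ y → y ~ x
      ~-trans : ∀ {x y z} → x ~ y → y ~ z → x ~ z

    _≁_ : X → X → Set
    x ≁ y = ¬ (x ~ y)

  open Equivalence

  infix 4 _∈[_]_ _⊆[_]_

  _∈[_]_ : X → Equivalence X → List X → Set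
  x ∈[ E ] ys = ∃[ y ] (y ∈ ys × _~_ E x y)

  _⊆[_]_ : List X → Equivalence X → List X → Set
  xs ⊆[ E ] ys = ∀ {x} → x ∈ xs → x ∈[ E ] ys

  ⊆⇒⊆[] : (E : Equivalence X) {xs ys : List X} → (∀ {x} → x ∈ xs → x ∈ ys) → xs ⊆[ E ] ys
  ⊆⇒⊆[] E sub x∈ = _ , sub x∈ , ~-refl E

  opaque
    select : (X → Set) → List X → List X
    select P = filter (λ x → em {P x})

    ∈-select⁺ : {P : X → Set} {xs : List X} {x : X} → x ∈ xs → P x → x ∈ select P xs
    ∈-select⁺ {P = P} = ∈-filter⁺ (λ x → em {P x})

    ∈-select⁻ : {P : X → Set} {xs : List X} {x : X} → x ∈ select P xs → x ∈ xs × P x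
    ∈-select⁻ {P = P} = ∈-filter⁻ (λ x → em {P x})

    length-select-< : {P : X → Set} {xs : List X} {x : X} → x ∈ xs → ¬ P x → length (select P xs) < length xs
    length-select-< {P = P} {xs} x∈ ¬p = filter-notAll (λ x → em {P x}) xs (lose x∈ ¬p)

  reps : Equivalence X → List X → List X
  reps E = deduplicate (λ x y → em {_~_ E x y})

  opaque
    -- One function counts elements (for the equality of the field), residue classes modulo a
    -- subgroup and strings, so that the same counting lemmas serve all three.
    # : Equivalence X → List X → ℕ
    # E xs = length (reps E xs)

    #-reps : (E : Equivalence X) (xs : List X) → # E xs ≡ length (reps E xs)
    #-reps E xs = refl

  reps-⊆ : (E : Equivalence X) {xs : List X} {x : X} → x ∈ reps E xs → x ∈ xs
  reps-⊆ E = ∈-deduplicate⁻ (λ x y → em {_~_ E x y}) _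

  reps-cover : (E : Equivalence X) {xs : List X} {x : X} → x ∈ xs → x ∈[ E ] reps E xs
  reps-cover E {xs} {x} x∈ = find (Any.deduplicate⁺ (λ x y → em {_~_ E x y})
    (λ {y} {z} z~y x~y → ~-trans E x~y (~-sym E z~y)) (lose x∈ (~-refl E)))

  reps-indep : (E : Equivalence X) (xs : List X) → AllPairs (_≁_ E) (reps E xs)
  reps-indep E []       = []
  reps-indep E (x ∷ xs) = All.all-filter _ (reps E xs) ∷ AllPairs.filter⁺ _ (reps-indep E xs)

  length-─ : {P : X → Set} (xs : List X) (i : Any P xs) → length xs ≡ suc (length (xs ─ i))
  length-─ (x ∷ xs) (here _)  = refl
  length-─ (x ∷ xs) (there i) = cong suc (length-─ xs i)

  Any-─ : {P Q : X → Set} {xs : List X} (i : Any P xs) → (∀ {x} → x ∈ xs → P x → Q x → ⊥) →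
          Any Q xs → Any Q (xs ─ i)
  Any-─ (here p)  ¬pq (here q)  = ⊥-elim (¬pq (here refl) p q)
  Any-─ (here p)  ¬pq (there j) = j
  Any-─ (there i) ¬pq (here q)  = here q
  Any-─ (there i) ¬pq (there j) = there (Any-─ i (¬pq ∘ there) j)

  -- `Q` is a relation, so no coherent choice of images is involved: the element of `ys` hit by the
  -- head is deleted, and the remaining elements still hit something else, because a common image
  -- would make them `R`-related to the head.
  pigeonhole : {R : X → X → Set} (Q : X → Y → Set) {xs : List X} {ys : List Y} →
    AllPairs (λ x x′ → ¬ R x x′) xs →
    (∀ {x} → x ∈ xs → ∃[ y ] (y ∈ ys × Q x y)) →
    (∀ {x x′ y} → x ∈ xs → x′ ∈ xs → Q x y → Q x′ y → R x x′) →
    length xs ≤ length ys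
  pigeonhole Q []                   hit inj = z≤n
  pigeonhole {R = R} Q {x ∷ xs} {ys} (x≁ ∷ ap) hit inj with hit (here refl)
  ... | y , y∈ , qxy = subst (suc (length xs) ≤_) (sym (length-─ ys i)) (s≤s rec)
    where
    i = lose {P = Q x} y∈ qxy
    rec : length xs ≤ length (ys ─ i)
    rec = pigeonhole {R = R} Q ap
      (λ {x′} x′∈ → let (y′ , y′∈ , q′) = hit (there x′∈) in
         find (Any-─ i (λ _ q q″ → All.lookup x≁ x′∈ (inj (here refl) (there x′∈) q q″)) (lose y′∈ q′)))
      (λ a b → inj (there a) (there b))

  opaque
    unfolding #
    #-≤ : (E : Equivalence X) (F : Equivalence Y) (Q : X → Y → Set) {xs : List X} {ys : List Y} →
      (∀ {x} → x ∈ xs → ∃[ y ] (y ∈ ys × Q x y)) →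
      (∀ {x x′ y y′} → x ∈ xs → x′ ∈ xs → Q x y → Q x′ y′ → _~_ F y y′ → _~_ E x x′) →
      # E xs ≤ # F ys
    #-≤ E F Q {xs} {ys} hit inj = pigeonhole {R = _~_ E} (λ x r → ∃[ y ] (Q x y × _~_ F y r)) (reps-indep E xs)
      (λ x∈ → let (y , y∈ , q) = hit (reps-⊆ E x∈)
                  (r , r∈ , y~r) = reps-cover F y∈
              in r , r∈ , y , q , y~r)
      (λ x∈ x′∈ (y , q , y~r) (y′ , q′ , y′~r) →
         inj (reps-⊆ E x∈) (reps-⊆ E x′∈) q q′ (~-trans F y~r (~-sym F y′~r)))

  #-mono : (E : Equivalence X) {xs ys : List X} → xs ⊆[ E ] ys → # E xs ≤ # E ys
  #-mono E sub = #-≤ E E (_~_ E) sub (λ _ _ p q r → ~-trans E p (~-trans E r (~-sym E q)))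

  #-coarser : (E F : Equivalence X) → (∀ {x y} → _~_ F x y → _~_ E x y) → (xs : List X) → # E xs ≤ # F xs
  #-coarser E F imp xs = #-≤ E F _≡_ (λ x∈ → _ , x∈ , refl) (λ { _ _ refl refl → imp })

  #-map : (E : Equivalence X) (F : Equivalence Y) (f : X → Y) → (∀ {x y} → _~_ F (f x) (f y) → _~_ E x y) →
    (xs : List X) → # E xs ≤ # F (map f xs)
  #-map E F f inj xs = #-≤ E F (λ x y → f x ≡ y) (λ x∈ → _ , ∈-map⁺ f x∈ , refl) (λ { _ _ refl refl → inj })

  #-map-≤ : (E : Equivalence X) (F : Equivalence Y) (f : X → Y) → (∀ {x y} → _~_ E x y → _~_ F (f x) (f y)) →
    (xs : List X) → # F (map f xs) ≤ # E xs
  #-map-≤ E F f cg xs = #-≤ F E (λ y x → y ≡ f x) (λ y∈ → let (x , x∈ , eq) = ∈-map⁻ f y∈ in x , x∈ , eq)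
    (λ { _ _ refl refl → cg })

  opaque
    unfolding #
    #-length : (E : Equivalence X) (xs : List X) {ys : List Y} (Q : X → Y → Set) →
      (∀ {x} → x ∈ xs → ∃[ y ] (y ∈ ys × Q x y)) →
      (∀ {x x′ y} → Q x y → Q x′ y → _~_ E x x′) → # E xs ≤ length ys
    #-length E xs Q hit inj = pigeonhole {R = _~_ E} Q (reps-indep E xs) (hit ∘ reps-⊆ E) (λ _ _ → inj)

  opaque
    unfolding #
    #-pos : (E : Equivalence X) {xs : List X} {x : X} → x ∈ xs → 1 ≤ # E xs
    #-pos E {_ ∷ _} _ = s≤s z≤n

  opaque
    unfolding #
    #-indep : (E : Equivalence X) {xs : List X} → AllPairs (_≁_ E) xs → length xs ≤ # E xs
    #-indep E ap = pigeonhole {R = _~_ E} (_~_ E) ap (reps-cover E) (λ _ _ p q → ~-trans E p (~-sym E q))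

  opaque
    unfolding #
    #-++ : (E : Equivalence X) (xs ys : List X) → # E (xs ++ ys) ≤ # E xs + # E ys
    #-++ E xs ys = ≤-trans
      (#-length E (xs ++ ys) {reps E xs ++ reps E ys} (_~_ E)
        (λ z∈ → go (∈-++⁻ xs z∈)) (λ p q → ~-trans E p (~-sym E q)))
      (≤-reflexive (length-++ (reps E xs)))
      where
      go : ∀ {z} → z ∈ xs ⊎ z ∈ ys → z ∈[ E ] (reps E xs ++ reps E ys)
      go (inj₁ z∈) = let (r , r∈ , p) = reps-cover E z∈ in r , ∈-++⁺ˡ r∈ , p
      go (inj₂ z∈) = let (r , r∈ , p) = reps-cover E z∈ in r , ∈-++⁺ʳ (reps E xs) r∈ , p

  opaque
    unfolding #
    #-disjoint : (E : Equivalence X) {xs ys zs : List X} → xs ⊆[ E ] zs → ys ⊆[ E ] zs →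
      (∀ {x y} → x ∈ xs → y ∈ ys → _≁_ E x y) → # E xs + # E ys ≤ # E zs
    #-disjoint E {xs} {ys} {zs} xs⊆ ys⊆ dis = ≤-trans (≤-reflexive (sym (length-++ (reps E xs))))
      (pigeonhole {R = _~_ E} (_~_ E)
        (AllPairs.++⁺ (reps-indep E xs) (reps-indep E ys)
          (All.tabulate (λ x∈ → All.tabulate (λ y∈ → dis (reps-⊆ E x∈) (reps-⊆ E y∈)))))
        (λ w∈ → go (∈-++⁻ (reps E xs) w∈))
        (λ _ _ p q → ~-trans E p (~-sym E q)))
      where
      go : ∀ {w} → w ∈ reps E xs ⊎ w ∈ reps E ys → ∃[ z ] (z ∈ reps E zs × _~_ E w z)
      into : ∀ {w} → w ∈[ E ] zs → ∃[ z ] (z ∈ reps E zs × _~_ E w z)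
      into (z , z∈ , p) = let (r , r∈ , q) = reps-cover E z∈ in r , r∈ , ~-trans E p q
      go (inj₁ x∈) = into (xs⊆ (reps-⊆ E x∈))
      go (inj₂ y∈) = into (ys⊆ (reps-⊆ E y∈))

  opaque
    unfolding #
    #-concat-≤ : (E : Equivalence X) (C : Y → List X) (rs : List Y) {zs : List X} →
      (∀ {z} → z ∈ zs → ∃[ r ] (r ∈ rs × z ∈[ E ] C r)) → # E zs ≤ sum (map (λ r → # E (C r)) rs)
    #-concat-≤ E C rs {zs} cov = ≤-trans (#-mono E sub) (all rs)
      where
      sub : zs ⊆[ E ] concatMap C rs
      sub z∈ = let (r , r∈ , y , y∈ , p) = cov z∈ in y , ∈-concatMap⁺ C (lose r∈ y∈) , p
      all : ∀ rs → # E (concatMap C rs) ≤ sum (map (λ r → # E (C r)) rs)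
      all []       = z≤n
      all (r ∷ rs) = ≤-trans (#-++ E (C r) (concatMap C rs)) (+-monoʳ-≤ (# E (C r)) (all rs))

  opaque
    unfolding #
    sum-#-≤ : (E : Equivalence X) (C : Y → List X) {D : Y → Y → Set} {rs : List Y} {zs : List X} →
      AllPairs (λ r s → ¬ D r s) rs → (∀ {r} → r ∈ rs → C r ⊆[ E ] zs) →
      (∀ {r s x y} → r ∈ rs → s ∈ rs → x ∈ C r → y ∈ C s → _~_ E x y → D r s) →
      sum (map (λ r → # E (C r)) rs) ≤ # E zs
    sum-#-≤ {X = X} {Y = Y} E C {D} ap C⊆ dis = ≤-trans (go ap dis)
      (#-mono E (λ x∈ → let (r , r∈ , x∈C) = find (∈-concatMap⁻ C x∈) in C⊆ r∈ x∈C))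
      where
      go : ∀ {rs} → AllPairs (λ r s → ¬ D r s) rs →
        (∀ {r s x y} → r ∈ rs → s ∈ rs → x ∈ C r → y ∈ C s → _~_ E x y → D r s) →
        sum (map (λ r → # E (C r)) rs) ≤ # E (concatMap C rs)
      go [] _ = z≤n
      go {r ∷ rs} (r≁ ∷ ap) dis = ≤-trans (+-monoʳ-≤ (# E (C r)) (go ap (λ a b → dis (there a) (there b))))
        (#-disjoint E (⊆⇒⊆[] E ∈-++⁺ˡ) (⊆⇒⊆[] E (∈-++⁺ʳ (C r)))
          (λ x∈ y∈ x~y → let (s , s∈ , y∈C) = find (∈-concatMap⁻ C y∈) in
             All.lookup r≁ s∈ (dis (here refl) (there s∈) x∈ y∈C x~y)))

  sum-≥ : {f : X → ℕ} {c : ℕ} (rs : List X) → (∀ {r} → r ∈ rs → c ≤ f r) → length rs * c ≤ sum (map f rs)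
  sum-≥ []       h = z≤n
  sum-≥ (r ∷ rs) h = +-mono-≤ (h (here refl)) (sum-≥ rs (h ∘ there))

  sum-≤ : {f : X → ℕ} {c : ℕ} (rs : List X) → (∀ {r} → r ∈ rs → f r ≤ c) → sum (map f rs) ≤ length rs * c
  sum-≤ []       h = z≤n
  sum-≤ (r ∷ rs) h = +-mono-≤ (h (here refl)) (sum-≤ rs (h ∘ there))

  opaque
    unfolding #
    #-classes : (D : Equivalence Y) (E : Equivalence X) (C : Y → List X) {ys : List Y} {zs : List X} {c : ℕ} →
      (∀ {y} → y ∈ ys → C y ⊆[ E ] zs) → (∀ {y} → y ∈ ys → c ≤ # E (C y)) →
      (∀ {y y′ x x′} → y ∈ ys → y′ ∈ ys → x ∈ C y → x′ ∈ C y′ → _~_ E x x′ → _~_ D y y′) →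
      # D ys * c ≤ # E zs
    #-classes D E C {ys} C⊆ big dis = ≤-trans (sum-≥ (reps D ys) (big ∘ reps-⊆ D))
      (sum-#-≤ E C {D = _~_ D} (reps-indep D ys) (C⊆ ∘ reps-⊆ D) (λ a b → dis (reps-⊆ D a) (reps-⊆ D b)))

  #-product-≥ : (D : Equivalence X) (E : Equivalence Y) (F : Equivalence Z) (f : X → Y → Z)
    {xs : List X} {ys : List Y} {zs : List Z} →
    (∀ {x y} → x ∈ xs → y ∈ ys → f x y ∈[ F ] zs) →
    (∀ {x y x′ y′} → x ∈ xs → y ∈ ys → x′ ∈ xs → y′ ∈ ys → _~_ F (f x y) (f x′ y′) → _~_ D x x′) →
    (∀ {x y y′} → _~_ F (f x y) (f x y′) → _~_ E y y′) →
    # D xs * # E ys ≤ # F zs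
  #-product-≥ D E F f {xs} {ys} hit injˡ injʳ = #-classes D F (λ x → map (f x) ys)
    (λ x∈ z∈ → let (y , y∈ , eq) = ∈-map⁻ (f _) z∈ in subst (_∈[ F ] _) (sym eq) (hit x∈ y∈))
    (λ {x} x∈ → #-map E F (f x) injʳ ys)
    (λ {x} {x′} x∈ x′∈ z∈ z′∈ z~z′ → let (y , y∈ , eq) = ∈-map⁻ (f x) z∈
                                         (y′ , y′∈ , eq′) = ∈-map⁻ (f x′) z′∈ in
       injˡ x∈ y∈ x′∈ y′∈ (subst (λ u → _~_ F u _) eq (subst (_~_ F _) eq′ z~z′)))

  length-cartesianProduct : (xs : List X) (ys : List Y) → length (cartesianProduct xs ys) ≡ length xs * length ys
  length-cartesianProduct []       ys = refl
  length-cartesianProduct (x ∷ xs) ys = trans (length-++ (map (x ,_) ys))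
    (cong₂ _+_ (length-map (x ,_) ys) (length-cartesianProduct xs ys))

  _⊗_ : Equivalence X → Equivalence Y → Equivalence (X × Y)
  (E ⊗ F) ._~_ (x , y) (x′ , y′)         = _~_ E x x′ × _~_ F y y′
  (E ⊗ F) .~-refl                        = ~-refl E , ~-refl F
  (E ⊗ F) .~-sym (p , q)                 = ~-sym E p , ~-sym F q
  (E ⊗ F) .~-trans (p , q) (p′ , q′)     = ~-trans E p p′ , ~-trans F q q′

  opaque
    unfolding #
    #-⊗ : (E : Equivalence X) (F : Equivalence Y) (xs : List X) (ys : List Y) →
      # (E ⊗ F) (cartesianProduct xs ys) ≤ # E xs * # F ys
    #-⊗ E F xs ys = ≤-trans
      (#-length (E ⊗ F) (cartesianProduct xs ys) {cartesianProduct (reps E xs) (reps F ys)} (_~_ (E ⊗ F))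
        (λ z∈ → let (x∈ , y∈) = ∈-cartesianProduct⁻ xs ys z∈
                    (r , r∈ , p) = reps-cover E x∈
                    (s , s∈ , q) = reps-cover F y∈
                in (r , s) , ∈-cartesianProduct⁺ r∈ s∈ , (p , q))
        (λ p q → ~-trans (E ⊗ F) p (~-sym (E ⊗ F) q)))
      (≤-reflexive (length-cartesianProduct (reps E xs) (reps F ys)))

  #-select : (E : Equivalence X) (P : X → Set) (xs : List X) →
    # E xs ≤ # E (select P xs) + # E (select (λ x → ¬ P x) xs)
  #-select E P xs = ≤-trans (#-mono E (⊆⇒⊆[] E go)) (#-++ E (select P xs) _)
    where
    go : ∀ {x} → x ∈ xs → x ∈ select P xs ++ select (λ x → ¬ P x) xs
    go {x} x∈ with em {P x}
    ... | yes p = ∈-++⁺ˡ (∈-select⁺ x∈ p)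
    ... | no ¬p = ∈-++⁺ʳ (select P xs) (∈-select⁺ x∈ ¬p)

  maximiser : (f : X → ℕ) {xs : List X} {x : X} → x ∈ xs → ∃[ m ] (m ∈ xs × (∀ {y} → y ∈ xs → f y ≤ f m))
  maximiser f {x ∷ []} _ = x , here refl , λ { (here refl) → ≤-refl }
  maximiser f {x ∷ xs@(_ ∷ _)} _ with maximiser f {xs} (here refl)
  ... | m , m∈ , max with ≤-total (f x) (f m)
  ... | inj₁ fx≤fm = m , there m∈ , λ { (here refl) → fx≤fm ; (there y∈) → max y∈ }
  ... | inj₂ fm≤fx = x , here refl , λ { (here refl) → ≤-refl ; (there y∈) → ≤-trans (max y∈) fm≤fx }

module _ (em : ExcludedMiddle 0ℓ) (R : RealField) where

  -- Ordered-field arithmetic and the embedding of the integers.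

  module Field where

    open Reals R
    open import Algebra.Solver.Ring.AlmostCommutativeRing using (AlmostCommutativeRing; fromCommutativeRing; _-Raw-AlmostCommutative⟶_)
    open import Data.Integer.Base using (+_; -[1+_])
    open import Data.Maybe.Base using (Maybe; just; nothing)
    open import Relation.Binary.Bundles using (Poset)
    open import Relation.Binary.Structures using (IsTotalOrder)
    open import Algebra.Properties.Ring ring using (-‿involutive; -‿+-comm; -0#≈0#; -‿distribˡ-*; -‿distribʳ-*; x∙y⁻¹≈ε⇒x≈y; x≈y⇒x∙y⁻¹≈ε)
    open import Algebra.Properties.Semiring.Mult semiring using (×-homo-+; ×1-homo-*)

    open IsTotalOrder isTotalOrder public using (total)
      renaming (refl to ≤-refl; reflexive to ≤-reflexive; trans to ≤-trans; antisym to ≤-antisym)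

    poset : Poset 0ℓ 0ℓ 0ℓ
    poset = record { isPartialOrder = IsTotalOrder.isPartialOrder isTotalOrder }

    module ≤-R where
      open import Relation.Binary.Reasoning.PartialOrder poset public

    private variable
      x y z u v w : Carrier

    fromNat-+ : ∀ m n → fromNat (m ℕ.+ n) ≈ fromNat m + fromNat n
    fromNat-+ m n = ×-homo-+ 1# m n

    fromNat-* : ∀ m n → fromNat (m ℕ.* n) ≈ fromNat m * fromNat n
    fromNat-* m n = ×1-homo-* m n

    fromNat-1 : fromNat 1 ≈ 1#
    fromNat-1 = +-identityʳ 1#

    fromNat-^ : ∀ m n → fromNat (m ℕ.^ n) ≈ fromNat m ^ n
    fromNat-^ m zero    = fromNat-1
    fromNat-^ m (suc n) = trans (fromNat-* m (m ℕ.^ n)) (*-congˡ (fromNat-^ m n))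

    fromInt-neg : ∀ i → fromInt (ℤ.- i) ≈ - fromInt i
    fromInt-neg (+ zero)  = sym -0#≈0#
    fromInt-neg (+ suc n) = refl
    fromInt-neg -[1+ n ]  = sym (-‿involutive _)

    private
      cancel₁ : ∀ a b c → b - c ≈ (a + b) - (a + c)
      cancel₁ a b c = sym (begin
        (a + b) - (a + c)       ≈⟨ +-congˡ (-‿+-comm a c) ⟨
        (a + b) + (- a - c)     ≈⟨ +-congʳ (+-comm a b) ⟩
        (b + a) + (- a - c)     ≈⟨ +-assoc b a _ ⟩
        b + (a + (- a - c))     ≈⟨ +-congˡ (+-assoc a (- a) (- c)) ⟨
        b + ((a - a) - c)       ≈⟨ +-congˡ (+-congʳ (-‿inverseʳ a)) ⟩
        b + (0# - c)            ≈⟨ +-congˡ (+-identityˡ _) ⟩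
        b - c                   ∎)
        where open import Relation.Binary.Reasoning.Setoid setoid

    fromInt-⊖ : ∀ m n → fromInt (m ℤ.⊖ n) ≈ fromNat m - fromNat n
    fromInt-⊖ m       zero    = trans (reflexive (≡.cong fromInt (ℤ.⊖-≥ {m} {0} z≤n)))
      (sym (trans (+-congˡ -0#≈0#) (+-identityʳ _)))
    fromInt-⊖ zero    (suc n) = sym (+-identityˡ _)
    fromInt-⊖ (suc m) (suc n) = trans (reflexive (≡.cong fromInt (ℤ.[1+m]⊖[1+n]≡m⊖n m n)))
      (trans (fromInt-⊖ m n) (cancel₁ 1# _ _))

    fromInt-+ : ∀ i j → fromInt (i ℤ.+ j) ≈ fromInt i + fromInt j
    fromInt-+ (+ m)    (+ n)    = fromNat-+ m n
    fromInt-+ (+ m)    -[1+ n ] = fromInt-⊖ m (suc n)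
    fromInt-+ -[1+ m ] (+ n)    = trans (fromInt-⊖ n (suc m)) (+-comm _ _)
    fromInt-+ -[1+ m ] -[1+ n ] = trans
      (-‿cong (trans (reflexive (≡.cong fromNat (≡.cong suc (≡.sym (ℕ.+-suc m n))))) (fromNat-+ (suc m) (suc n))))
      (sym (-‿+-comm _ _))

    private
      fromInt-+* : ∀ m j → fromInt (+ m ℤ.* j) ≈ fromNat m * fromInt j
      fromInt-+* m (+ n)    = trans (reflexive (≡.cong fromInt (≡.sym (ℤ.pos-* m n)))) (fromNat-* m n)
      fromInt-+* m -[1+ n ] = trans (reflexive (≡.cong fromInt (≡.sym (ℤ.neg-distribʳ-* (+ m) (+ suc n)))))
        (trans (fromInt-neg (+ m ℤ.* + suc n)) (trans (-‿cong (fromInt-+* m (+ suc n))) (-‿distribʳ-* _ _)))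

    fromInt-* : ∀ i j → fromInt (i ℤ.* j) ≈ fromInt i * fromInt j
    fromInt-* (+ m)    j = fromInt-+* m j
    fromInt-* -[1+ m ] j = trans (reflexive (≡.cong fromInt (≡.sym (ℤ.neg-distribˡ-* (+ suc m) j))))
      (trans (fromInt-neg (+ suc m ℤ.* j)) (trans (-‿cong (fromInt-+* (suc m) j)) (-‿distribˡ-* _ _)))

    private
      -- Agrees with fromInt, except that 1 is sent to 1# instead of 1# + 0#.
      ι : ℤ → Carrier
      ι (+ 1) = 1#
      ι i     = fromInt i

      ι≈ : ∀ i → ι i ≈ fromInt i
      ι≈ (+ 0)           = refl
      ι≈ (+ 1)           = sym fromNat-1
      ι≈ (+ suc (suc n)) = refl
      ι≈ -[1+ n ]        = refl

      R′ : AlmostCommutativeRing 0ℓ 0ℓ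
      R′ = fromCommutativeRing commutativeRing

      morphism : ℤ.+-*-rawRing -Raw-AlmostCommutative⟶ R′
      morphism = record
        { ⟦_⟧    = ι
        ; +-homo = λ i j → trans (ι≈ (i ℤ.+ j)) (trans (fromInt-+ i j) (+-cong (sym (ι≈ i)) (sym (ι≈ j))))
        ; *-homo = λ i j → trans (ι≈ (i ℤ.* j)) (trans (fromInt-* i j) (*-cong (sym (ι≈ i)) (sym (ι≈ j))))
        ; -‿homo = λ i → trans (ι≈ (ℤ.- i)) (trans (fromInt-neg i) (-‿cong (sym (ι≈ i))))
        ; 0-homo = refl
        ; 1-homo = refl }

      dec : ∀ i j → Maybe (ι i ≈ ι j)
      dec i j with i ℤ.≟ j
      ... | yes eq = just (reflexive (≡.cong ι eq))
      ... | no  _  = nothing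

    module Solver where
      open import Algebra.Solver.Ring ℤ.+-*-rawRing R′ morphism dec public

    open Solver using (solve; _:=_; _:+_; _:*_; _:-_; :-_; con) public

    ≤-respˡ : x ≈ y → x ≤ z → y ≤ z
    ≤-respˡ eq p = ≤-trans (≤-reflexive (sym eq)) p

    ≤-respʳ : x ≈ y → z ≤ x → z ≤ y
    ≤-respʳ eq p = ≤-trans p (≤-reflexive eq)

    +-mono-≤ : x ≤ y → u ≤ v → x + u ≤ y + v
    +-mono-≤ {x} {y} {u} {v} p q = ≤-trans (+-monoˡ-≤ u p)
      (≤-respˡ (+-comm u y) (≤-respʳ (+-comm v y) (+-monoˡ-≤ y q)))

    0≤y-x : x ≤ y → 0# ≤ y - x
    0≤y-x {x} {y} p = ≤-respˡ (-‿inverseʳ x) (+-monoˡ-≤ (- x) p)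

    x≤y : 0# ≤ y - x → x ≤ y
    x≤y {y} {x} p = ≤-respˡ (+-identityˡ x)
      (≤-respʳ (solve 2 (λ y x → (y :- x) :+ x := y) refl y x) (+-monoˡ-≤ x p))

    -- The standard way to prove a polynomial inequality here: the difference of the two sides is
    -- exhibited as a nonnegative term, and the remaining identity is left to the ring solver.
    ≤-by : ∀ {x y d} → 0# ≤ d → x + d ≈ y → x ≤ y
    ≤-by {x} {y} {d} p eq = ≤-respˡ (+-identityʳ x) (≤-respʳ eq (+-mono-≤ (≤-refl {x}) p))

    +-cancelʳ-≤ : ∀ z → x + z ≤ y + z → x ≤ y
    +-cancelʳ-≤ {x} {y} z p = ≤-respˡ (solve 2 (λ x z → (x :+ z) :- z := x) refl x z)
      (≤-respʳ (solve 2 (λ x z → (x :+ z) :- z := x) refl y z) (+-monoˡ-≤ (- z) p))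

    +-cancelˡ-≤ : ∀ z → z + x ≤ z + y → x ≤ y
    +-cancelˡ-≤ {x} {y} z p = +-cancelʳ-≤ z (≤-respˡ (+-comm z x) (≤-respʳ (+-comm z y) p))

    -‿anti : x ≤ y → - y ≤ - x
    -‿anti {x} {y} p = ≤-by (0≤y-x p) (solve 2 (λ x y → :- y :+ (y :- x) := :- x) refl x y)

    0≤x² : ∀ x → 0# ≤ x * x
    0≤x² x with total 0# x
    ... | inj₁ p = *-nonNeg p p
    ... | inj₂ p = ≤-respʳ (solve 1 (λ x → (:- x) :* (:- x) := x :* x) refl x) (*-nonNeg q q)
      where q = ≤-respˡ -0#≈0# (-‿anti p)

    0≤1 : 0# ≤ 1#
    0≤1 = ≤-respʳ (*-identityˡ 1#) (0≤x² 1#)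

    0≤fromNat : ∀ n → 0# ≤ fromNat n
    0≤fromNat zero    = ≤-refl
    0≤fromNat (suc n) = ≤-respˡ (+-identityˡ 0#) (+-mono-≤ 0≤1 (0≤fromNat n))

    fromNat-mono : ∀ {m n} → m ℕ.≤ n → fromNat m ≤ fromNat n
    fromNat-mono {n = n} z≤n = 0≤fromNat n
    fromNat-mono (s≤s p)     = +-mono-≤ ≤-refl (fromNat-mono p)

    ¬1≤0 : ¬ (1# ≤ 0#)
    ¬1≤0 p = 0≉1 (≤-antisym 0≤1 p)

    fromNat-suc≰0 : ∀ n → ¬ (fromNat (suc n) ≤ 0#)
    fromNat-suc≰0 n p = ¬1≤0 (≤-trans (≤-by (0≤fromNat n) refl) p)

    fromNat-cancel : ∀ {m n} → fromNat m ≤ fromNat n → m ℕ.≤ n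
    fromNat-cancel {zero}          p = z≤n
    fromNat-cancel {suc m} {zero}  p = ⊥-elim (fromNat-suc≰0 m p)
    fromNat-cancel {suc m} {suc n} p = s≤s (fromNat-cancel (+-cancelˡ-≤ 1# p))

    fromNat-≈0 : ∀ {n} → fromNat n ≈ 0# → n ≡ 0
    fromNat-≈0 {n} eq = ℕ.n≤0⇒n≡0 (fromNat-cancel {n} {0} (≤-reflexive eq))

    fromInt-≈0 : ∀ {i} → fromInt i ≈ 0# → i ≡ 0ℤ
    fromInt-≈0 {+ n}      eq = ≡.cong +_ (fromNat-≈0 eq)
    fromInt-≈0 { -[1+ n ] } eq = ⊥-elim (fromNat-suc≰0 n (≤-reflexive
      (trans (sym (-‿involutive _)) (trans (-‿cong eq) -0#≈0#))))

    ≰⇒≥ : ¬ (x ≤ y) → y ≤ x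
    ≰⇒≥ {x} {y} ¬p with total x y
    ... | inj₁ p = ⊥-elim (¬p p)
    ... | inj₂ p = p

    *-monoˡ-≤ : 0# ≤ z → x ≤ y → z * x ≤ z * y
    *-monoˡ-≤ {z} {x} {y} p q = ≤-by (*-nonNeg p (0≤y-x q))
      (solve 3 (λ x y z → z :* x :+ z :* (y :- x) := z :* y) refl x y z)

    *-monoʳ-≤ : 0# ≤ z → x ≤ y → x * z ≤ y * z
    *-monoʳ-≤ {z} p q = ≤-respˡ (*-comm z _) (≤-respʳ (*-comm z _) (*-monoˡ-≤ p q))

    *-mono-≤ : 0# ≤ x → 0# ≤ v → x ≤ y → u ≤ v → x * u ≤ y * v
    *-mono-≤ 0≤x 0≤v p q = ≤-trans (*-monoˡ-≤ 0≤x q) (*-monoʳ-≤ 0≤v p)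

    x-y≈0⇒x≈y : x - y ≈ 0# → x ≈ y
    x-y≈0⇒x≈y {x} {y} = x∙y⁻¹≈ε⇒x≈y x y

    *-zero-factor : x * y ≈ 0# → ¬ (x ≈ 0#) → y ≈ 0#
    *-zero-factor {x} {y} eq x≉0 = begin
      y                 ≈⟨ *-identityˡ y ⟨
      1# * y            ≈⟨ *-congʳ (⁻¹-inverse x≉0) ⟨
      (x * x ⁻¹) * y    ≈⟨ solve 3 (λ x i y → (x :* i) :* y := i :* (x :* y)) refl x (x ⁻¹) y ⟩
      x ⁻¹ * (x * y)    ≈⟨ *-congˡ eq ⟩
      x ⁻¹ * 0#         ≈⟨ zeroʳ _ ⟩
      0#                ∎
      where open import Relation.Binary.Reasoning.Setoid setoid

    *-cancelˡ-≈ : ¬ (z ≈ 0#) → z * x ≈ z * y → x ≈ y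
    *-cancelˡ-≈ {z} {x} {y} z≉0 eq = x-y≈0⇒x≈y (*-zero-factor {z}
      (trans (solve 3 (λ x y z → z :* (x :- y) := z :* x :- z :* y) refl x y z) (x≈y⇒x∙y⁻¹≈ε eq)) z≉0)

    *-cancelˡ-≤ : 0# ≤ z → ¬ (z ≈ 0#) → z * x ≤ z * y → x ≤ y
    *-cancelˡ-≤ {z} {x} {y} 0≤z z≉0 p with total x y
    ... | inj₁ q = q
    ... | inj₂ q = ≤-reflexive (*-cancelˡ-≈ z≉0 (≤-antisym p (*-monoˡ-≤ 0≤z q)))

    fromNat≉0 : ∀ {n} → 0 ℕ.< n → ¬ (fromNat n ≈ 0#)
    fromNat≉0 {suc n} _ eq = fromNat-suc≰0 n (≤-reflexive eq)

    fromNat-*-cancelˡ : ∀ {n} → 0 ℕ.< n → fromNat n * x ≤ fromNat n * y → x ≤ y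
    fromNat-*-cancelˡ {n = n} 0<n = *-cancelˡ-≤ (0≤fromNat n) (fromNat≉0 0<n)

    ≉0⇒⁻¹≥0 : 0# ≤ x → ¬ (x ≈ 0#) → 0# ≤ x ⁻¹
    ≉0⇒⁻¹≥0 {x} p x≉0 = *-cancelˡ-≤ p x≉0 (≤-respˡ (sym (zeroʳ x)) (≤-respʳ (sym (⁻¹-inverse x≉0)) 0≤1))

    ^-nonNeg : ∀ n → 0# ≤ x → 0# ≤ x ^ n
    ^-nonNeg zero    p = 0≤1
    ^-nonNeg (suc n) p = *-nonNeg p (^-nonNeg n p)

    ^-mono : ∀ n → 0# ≤ x → x ≤ y → x ^ n ≤ y ^ n
    ^-mono zero    p q = ≤-refl
    ^-mono (suc n) p q = *-mono-≤ p (^-nonNeg n (≤-trans p q)) q (^-mono n p q)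

    ^-≉0 : ∀ n → ¬ (x ≈ 0#) → ¬ (x ^ n ≈ 0#)
    ^-≉0 zero    x≉0 eq = 0≉1 (sym eq)
    ^-≉0 (suc n) x≉0 eq = ^-≉0 n x≉0 (*-zero-factor eq x≉0)

    -- From xⁿ⁺¹ ≤ yⁿ⁺¹ and y ≤ x it follows that x xⁿ ≤ y yⁿ ≤ y xⁿ. Here xⁿ can be cancelled
    -- unless x = 0, and then y = 0 as well.
    ^-strict : ∀ n → 0# ≤ y → y ≤ x → ¬ (x ≈ y) → 0 ℕ.< n → ¬ (x ^ n ≤ y ^ n)
    ^-strict {y} {x} (suc n) 0≤y y≤x x≉y _ p with em {x ≈ 0#}
    ... | yes x≈0 = x≉y (≤-antisym (≤-respˡ (sym x≈0) 0≤y) y≤x)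
    ... | no x≉0  = x≉y (≤-antisym (*-cancelˡ-≤ (^-nonNeg n 0≤x) (^-≉0 n x≉0) (begin
        x ^ n * x ≈⟨ *-comm _ x ⟩
        x * x ^ n ≤⟨ p ⟩
        y * y ^ n ≤⟨ *-monoˡ-≤ 0≤y (^-mono n 0≤y y≤x) ⟩
        y * x ^ n ≈⟨ *-comm y _ ⟩
        x ^ n * y ∎)) y≤x)
      where
      open ≤-R
      0≤x = ≤-trans 0≤y y≤x

    ^-cancel-≤ : ∀ n → 0 ℕ.< n → 0# ≤ y → x ^ n ≤ y ^ n → x ≤ y
    ^-cancel-≤ {y} {x} n 0<n 0≤y p with total x y
    ... | inj₁ q = q
    ... | inj₂ q with em {x ≈ y}
    ...   | yes eq = ≤-reflexive eq
    ...   | no x≉y = ⊥-elim (^-strict n 0≤y q x≉y 0<n p)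

    -- Bernoulli in homogeneous form: the graph of tⁿ⁺¹ lies above its tangent at s.
    tangent : ∀ n {s t} → 0# ≤ s → 0# ≤ t →
      fromNat (suc n) * (s ^ n * t) ≤ t ^ suc n + fromNat n * s ^ suc n
    tangent zero    {s} {t} 0≤s 0≤t = ≤-reflexive
      (solve 2 (λ s t → (con 1ℤ :+ con 0ℤ) :* (con 1ℤ :* t) := t :* con 1ℤ :+ con 0ℤ :* (s :* con 1ℤ)) refl s t)
    tangent (suc n) {s} {t} 0≤s 0≤t = +-cancelʳ-≤ (fromNat n * (s ^ suc n * t)) (begin
      (1# + (1# + a)) * ((s * S) * t) + a * ((s * S) * t)
        ≤⟨ ≤-by (*-nonNeg (*-nonNeg (0≤fromNat (suc n)) (^-nonNeg n 0≤s)) (0≤x² (t - s)))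
           (solve 4 (λ a s S t → (con 1ℤ :+ (con 1ℤ :+ a)) :* ((s :* S) :* t) :+ a :* ((s :* S) :* t)
                                  :+ ((con 1ℤ :+ a) :* S) :* ((t :- s) :* (t :- s))
                                  := t :* ((con 1ℤ :+ a) :* (S :* t)) :+ (con 1ℤ :+ a) :* (s :* (s :* S))) refl a s S t) ⟩
      t * (fromNat (suc n) * (S * t)) + fromNat (suc n) * (s * (s * S))
        ≤⟨ +-mono-≤ (*-monoˡ-≤ 0≤t (tangent n 0≤s 0≤t)) ≤-refl ⟩
      t * (t ^ suc n + a * (s * S)) + fromNat (suc n) * (s * (s * S))
        ≈⟨ solve 5 (λ a s S t T → t :* (T :+ a :* (s :* S)) :+ (con 1ℤ :+ a) :* (s :* (s :* S))
                    := (t :* T :+ (con 1ℤ :+ a) :* (s :* (s :* S))) :+ a :* ((s :* S) :* t)) refl a s S t (t ^ suc n) ⟩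
      (t ^ suc (suc n) + fromNat (suc n) * s ^ suc (suc n)) + a * (s ^ suc n * t) ∎)
      where
      open ≤-R
      a = fromNat n
      S = s ^ n

  -- Roots and real powers.

  module Roots where

    open Reals R
    open Field
    open import Algebra.Properties.Semiring.Exp semiring using (^-congˡ; ^-homo-*; ^-assocʳ)
    open import Algebra.Properties.CommutativeSemiring.Exp commutativeSemiring using (^-distrib-*)

    0^ : ∀ n → 0 ℕ.< n → 0# ^ n ≈ 0#
    0^ (suc n) _ = zeroˡ _

    1^ : ∀ n → 1# ^ n ≈ 1#
    1^ zero    = refl
    1^ (suc n) = trans (*-identityˡ _) (1^ n)

    -- The root is a supremum s, and both inequalities for its power come from `tangent`: a Newton
    -- step at s gives an upper bound of `P`, and a small increase of s stays in `P` as long as the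
    -- power of s is below c.
    root : ∀ n → 0 ℕ.< n → ∀ {c} → 0# ≤ c → ∃[ x ] (0# ≤ x × x ^ n ≈ c)
    root (suc n) 0<n {c} 0≤c = s , 0≤s , ≤-antisym upper lower
      where
      N : Carrier
      N = fromNat (suc n)

      P : Carrier → Set
      P x = 0# ≤ x × x ^ suc n ≤ c

      P0 : P 0#
      P0 = ≤-refl , ≤-respˡ (sym (0^ (suc n) 0<n)) 0≤c

      1≤1+c : 1# ≤ 1# + c
      1≤1+c = ≤-by 0≤c refl

      0≤1+c : 0# ≤ 1# + c
      0≤1+c = ≤-trans 0≤1 1≤1+c

      bound : UpperBound P (1# + c)
      bound {x} (0≤x , p) = ^-cancel-≤ (suc n) 0<n 0≤1+c (begin
        x ^ suc n             ≤⟨ p ⟩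
        c                     ≤⟨ ≤-by 0≤1 (+-comm c 1#) ⟩
        1# + c                ≈⟨ *-identityʳ _ ⟨
        (1# + c) * 1#         ≈⟨ *-congˡ (1^ n) ⟨
        (1# + c) * 1# ^ n     ≤⟨ *-monoˡ-≤ 0≤1+c (^-mono n 0≤1 1≤1+c) ⟩
        (1# + c) ^ suc n      ∎)
        where open ≤-R

      s : Carrier
      s = sup P

      s-upper : UpperBound P s
      s-upper = sup-upper P (0# , P0) (_ , bound)

      0≤s : 0# ≤ s
      0≤s = s-upper P0

      upper : s ^ suc n ≤ c
      upper with em {s ≈ 0#}
      ... | yes s≈0 = ≤-respˡ (sym (trans (^-congˡ (suc n) s≈0) (0^ (suc n) 0<n))) 0≤c
      ... | no  s≉0 = +-cancelˡ-≤ (fromNat n * s ^ suc n) (begin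
        fromNat n * s ^ suc n + s ^ suc n
          ≈⟨ solve 3 (λ a s S → a :* (s :* S) :+ s :* S := ((con 1ℤ :+ a) :* S) :* s) refl (fromNat n) s (s ^ n) ⟩
        k * s                                  ≤⟨ *-monoˡ-≤ 0≤k s≤u ⟩
        k * u                                  ≈⟨ ku ⟩
        fromNat n * s ^ suc n + c              ∎)
        where
        open ≤-R
        k = N * s ^ n
        0≤k : 0# ≤ k
        0≤k = *-nonNeg (0≤fromNat (suc n)) (^-nonNeg n 0≤s)
        k≉0 : ¬ (k ≈ 0#)
        k≉0 k≈0 = ^-≉0 n s≉0 (*-zero-factor k≈0 (fromNat≉0 0<n))
        -- The Newton iterate of s for xⁿ⁺¹ = c. The graph of the power lies above its tangent at s,
        -- so the power of u is at least c and u bounds `P` from above.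
        u = k ⁻¹ * (fromNat n * s ^ suc n + c)
        ku : k * u ≈ fromNat n * s ^ suc n + c
        ku = trans (sym (*-assoc k _ _)) (trans (*-congʳ (⁻¹-inverse k≉0)) (*-identityˡ _))
        0≤u : 0# ≤ u
        0≤u = *-nonNeg (≉0⇒⁻¹≥0 0≤k k≉0)
          (≤-respˡ (+-identityˡ 0#) (+-mono-≤ (*-nonNeg (0≤fromNat n) (^-nonNeg (suc n) 0≤s)) 0≤c))
        c≤uⁿ : c ≤ u ^ suc n
        c≤uⁿ = +-cancelʳ-≤ (fromNat n * s ^ suc n) (begin
          c + fromNat n * s ^ suc n               ≈⟨ +-comm c _ ⟩
          fromNat n * s ^ suc n + c               ≈⟨ ku ⟨
          k * u                                   ≈⟨ *-assoc N _ u ⟩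
          N * (s ^ n * u)                         ≤⟨ tangent n 0≤s 0≤u ⟩
          u ^ suc n + fromNat n * s ^ suc n       ∎)
        s≤u : s ≤ u
        s≤u = sup-least P (0# , P0) (λ (0≤x , p) → ^-cancel-≤ (suc n) 0<n 0≤u (≤-trans p c≤uⁿ))

      lower : c ≤ s ^ suc n
      lower with total c (s ^ suc n)
      ... | inj₁ p = p
      ... | inj₂ sⁿ≤c = x≤y (≤-respʳ (solve 2 (λ a c → :- (c :- a) := a :- c) refl (s ^ suc n) c)
                            (≤-respˡ (solve 0 (:- con 0ℤ := con 0ℤ) refl) (-‿anti δ≤0)))
        where
        open ≤-R
        δ = c - s ^ suc n
        0≤δ = 0≤y-x sⁿ≤c
        M = s + 1#
        0≤M : 0# ≤ M
        0≤M = ≤-trans 0≤s (≤-by 0≤1 refl)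
        q = N * M ^ n
        0≤q : 0# ≤ q
        0≤q = *-nonNeg (0≤fromNat (suc n)) (^-nonNeg n 0≤M)
        δ≤0 : δ ≤ 0#
        δ≤0 with em {q + δ ≈ 0#}
        ... | yes k≈0 = ≤-trans (≤-by 0≤q (+-comm δ q)) (≤-reflexive k≈0)
        ... | no  k≉0 = ≤-respˡ kε (≤-respʳ (zeroʳ (q + δ)) (*-monoˡ-≤ 0≤k ε≤0))
          where
          0≤k : 0# ≤ q + δ
          0≤k = ≤-trans 0≤δ (≤-by 0≤q (+-comm δ q))
          -- The denominator q + δ guarantees ε ≤ 1, so that q bounds the derivative of the power on
          -- the interval from s to s + ε; hence the power grows by at most (q + δ) ε = δ.
          ε = (q + δ) ⁻¹ * δ
          kε : (q + δ) * ε ≈ δ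
          kε = trans (sym (*-assoc (q + δ) _ _)) (trans (*-congʳ (⁻¹-inverse k≉0)) (*-identityˡ _))
          0≤ε : 0# ≤ ε
          0≤ε = *-nonNeg (≉0⇒⁻¹≥0 0≤k k≉0) 0≤δ
          ε≤1 : ε ≤ 1#
          ε≤1 = *-cancelˡ-≤ 0≤k k≉0 (≤-respˡ (sym kε) (≤-respʳ (sym (*-identityʳ _)) (≤-by 0≤q (+-comm δ q))))
          v = s + ε
          0≤v : 0# ≤ v
          0≤v = ≤-respˡ (+-identityˡ 0#) (+-mono-≤ 0≤s 0≤ε)
          vⁿ≤c : v ^ suc n ≤ c
          vⁿ≤c = +-cancelʳ-≤ (N * (v ^ n * s)) (begin
            v ^ suc n + N * (v ^ n * s)
              ≤⟨ +-mono-≤ ≤-refl (tangent n 0≤v 0≤s) ⟩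
            v ^ suc n + (s ^ suc n + fromNat n * v ^ suc n)
              ≈⟨ solve 5 (λ s e V S a → (s :+ e) :* V :+ (S :+ a :* ((s :+ e) :* V))
                    := S :+ ((con 1ℤ :+ a) :* V) :* e :+ (con 1ℤ :+ a) :* (V :* s)) refl s ε (v ^ n) (s ^ suc n) (fromNat n) ⟩
            (s ^ suc n + (N * v ^ n) * ε) + N * (v ^ n * s)
              ≤⟨ +-mono-≤ (+-mono-≤ ≤-refl (*-monoʳ-≤ 0≤ε (*-monoˡ-≤ (0≤fromNat (suc n))
                   (^-mono n 0≤v (+-mono-≤ ≤-refl ε≤1))))) ≤-refl ⟩
            (s ^ suc n + q * ε) + N * (v ^ n * s)
              ≤⟨ +-mono-≤ (+-mono-≤ ≤-refl (≤-by (*-nonNeg 0≤δ 0≤ε) (sym (distribʳ ε q δ)))) ≤-refl ⟩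
            (s ^ suc n + (q + δ) * ε) + N * (v ^ n * s)
              ≈⟨ +-congʳ (+-congˡ kε) ⟩
            (s ^ suc n + δ) + N * (v ^ n * s)
              ≈⟨ +-congʳ (solve 2 (λ c S → S :+ (c :- S) := c) refl c (s ^ suc n)) ⟩
            c + N * (v ^ n * s) ∎)
          ε≤0 : ε ≤ 0#
          ε≤0 = +-cancelˡ-≤ s (≤-respʳ (sym (+-identityʳ s)) (s-upper (0≤v , vⁿ≤c)))

    fromNat-^-≤ : ∀ b {m n} → m ℕ.≤ n → fromNat (suc b) ^ m ≤ fromNat (suc b) ^ n
    fromNat-^-≤ b {m} {n} p = ≤-respˡ (fromNat-^ (suc b) m) (≤-respʳ (fromNat-^ (suc b) n)
      (fromNat-mono (ℕ.^-monoʳ-≤ (suc b) p)))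

    -- With r = (p - m)/q the assumptions say y ≤ bʳ and r ≤ t ≤ 1/d. After raising to the power d
    -- and multiplying by b to the power m d, only natural exponents have to be compared.
    PowerBelow-^ : ∀ b d {t y} → 0 ℕ.< d → fromNat d * t ≤ 1# → PowerBelow (suc b) t y → y ^ d ≤ fromNat (suc b)
    PowerBelow-^ b d {t} {y} 0<d dt≤1 (0≤y , p , m , q , 0<q , p≤ , yᵠ≤) =
      ^-cancel-≤ q 0<q (0≤fromNat (suc b)) (*-cancelˡ-≤ (^-nonNeg (m ℕ.* d) 0≤B) (^-≉0 (m ℕ.* d) B≉0) (begin
        B ^ (m ℕ.* d) * (y ^ d) ^ q
          ≈⟨ *-cong (sym (^-assocʳ B m d)) (trans (^-assocʳ y d q) (trans (reflexive (≡.cong (y ^_) (ℕ.*-comm d q))) (sym (^-assocʳ y q d)))) ⟩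
        (B ^ m) ^ d * (y ^ q) ^ d       ≈⟨ ^-distrib-* (B ^ m) (y ^ q) d ⟨
        (B ^ m * y ^ q) ^ d             ≈⟨ ^-congˡ d (*-comm _ _) ⟩
        (y ^ q * B ^ m) ^ d             ≤⟨ ^-mono d (*-nonNeg (^-nonNeg q 0≤y) (^-nonNeg m 0≤B)) yᵠ≤ ⟩
        (B ^ p) ^ d                     ≈⟨ ^-assocʳ B p d ⟩
        B ^ (p ℕ.* d)                   ≤⟨ fromNat-^-≤ b pd≤ ⟩
        B ^ (m ℕ.* d ℕ.+ q)             ≈⟨ ^-homo-* B (m ℕ.* d) q ⟩
        B ^ (m ℕ.* d) * B ^ q           ∎))
      where
      open ≤-R
      B = fromNat (suc b)
      0≤B = 0≤fromNat (suc b)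
      B≉0 = fromNat≉0 {suc b} (s≤s z≤n)
      pd≤ : p ℕ.* d ℕ.≤ m ℕ.* d ℕ.+ q
      pd≤ = fromNat-cancel (begin
        fromNat (p ℕ.* d)                            ≈⟨ fromNat-* p d ⟩
        fromNat p * fromNat d                        ≤⟨ *-monoʳ-≤ (0≤fromNat d) p≤ ⟩
        (fromNat q * t + fromNat m) * fromNat d
          ≈⟨ solve 4 (λ q t m d → (q :* t :+ m) :* d := m :* d :+ q :* (d :* t)) refl (fromNat q) t (fromNat m) (fromNat d) ⟩
        fromNat m * fromNat d + fromNat q * (fromNat d * t) ≤⟨ +-mono-≤ ≤-refl (*-monoˡ-≤ (0≤fromNat q) dt≤1) ⟩
        fromNat m * fromNat d + fromNat q * 1#       ≈⟨ +-cong (sym (fromNat-* m d)) (*-identityʳ _) ⟩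
        fromNat (m ℕ.* d) + fromNat q                ≈⟨ fromNat-+ (m ℕ.* d) q ⟨
        fromNat (m ℕ.* d ℕ.+ q)                      ∎)

    PowerBelow-0 : ∀ b {t} → 0# ≤ t → PowerBelow (suc b) t 0#
    PowerBelow-0 b {t} 0≤t = ≤-refl , 0 , 0 , 1 , s≤s z≤n ,
      ≤-respʳ (sym (trans (+-identityʳ _) (trans (*-congʳ fromNat-1) (*-identityˡ t)))) 0≤t ,
      ≤-respˡ (sym (trans (*-identityʳ _) (zeroˡ _))) 0≤1

    ^ᴿ-bounded : ∀ b {t} → t ≤ 1# → UpperBound (PowerBelow (suc b) t) (fromNat (suc b))
    ^ᴿ-bounded b t≤1 {y} p = ≤-respˡ (*-identityʳ y)
      (PowerBelow-^ b 1 (s≤s z≤n) (≤-respˡ (sym (trans (*-congʳ fromNat-1) (*-identityˡ _))) t≤1) p)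

    -- Serves for the error term, where a power of ∣A∣ has to be bounded from below.
    ^ᴿ-lower : ∀ b {t y} → t ≤ 1# → PowerBelow (suc b) t y → y ≤ suc b ^ᴿ t
    ^ᴿ-lower b t≤1 p = sup-upper _ (_ , p) (_ , ^ᴿ-bounded b t≤1) p

    -- Serves for ∣a₀∣^(1/d) and ∣a_d∣^(1/d). For these an upper bound suffices, since increasing H
    -- strengthens the conclusion.
    ^ᴿ-upper : ∀ b d {t r} → 0 ℕ.< d → 0# ≤ t → fromNat d * t ≤ 1# → 0# ≤ r → fromNat b ≤ r ^ d → b ^ᴿ t ≤ r
    ^ᴿ-upper zero    d 0<d 0≤t dt≤1 0≤r b≤ = 0≤r
    ^ᴿ-upper (suc b) d 0<d 0≤t dt≤1 0≤r b≤ = sup-least _ (0# , PowerBelow-0 b 0≤t)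
      (λ p → ^-cancel-≤ d 0<d 0≤r (≤-trans (PowerBelow-^ b d 0<d dt≤1 p) b≤))

    ^ᴿ-nonNeg : ∀ b {t} → 0# ≤ t → t ≤ 1# → 0# ≤ b ^ᴿ t
    ^ᴿ-nonNeg zero    0≤t t≤1 = ≤-refl
    ^ᴿ-nonNeg (suc b) 0≤t t≤1 = ^ᴿ-lower b t≤1 (PowerBelow-0 b 0≤t)

  -- Sumsets: the inequalities of Plünnecke and Ruzsa.

  module Sumsets where

    open Reals R hiding (_⊕_; _·_)
    open Field using (solve; _:=_; _:+_; _:*_; _:-_; :-_; *-cancelˡ-≈)
    open Counting em

    open Equivalence

    private variable
      A B C U V X Z : List Carrier
      x y : Carrier

    ≈E : Equivalence Carrier
    ≈E = record { _~_ = _≈_ ; ~-refl = refl ; ~-sym = sym ; ~-trans = trans }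

    size : List Carrier → ℕ
    size A = # ≈E A

    infixl 6 _⊕_ _⊖_
    infixr 7 _·_

    opaque
      _⊕_ _⊖_ : List Carrier → List Carrier → List Carrier
      _⊕_ = Reals._⊕_ R
      _⊖_ = cartesianProductWith _-_

      _·_ : Carrier → List Carrier → List Carrier
      _·_ = Reals._·_ R

      ∈-⊕ : x ∈ A → y ∈ B → (x + y) ∈ (A ⊕ B)
      ∈-⊕ = ∈-cartesianProductWith⁺ _+_

      ⊕-∈ : x ∈ (A ⊕ B) → ∃[ a ] ∃[ b ] (a ∈ A × b ∈ B × x ≡ a + b)
      ⊕-∈ {A = A} {B} = ∈-cartesianProductWith⁻ _+_ A B

      ∈-⊖ : x ∈ A → y ∈ B → (x - y) ∈ (A ⊖ B)
      ∈-⊖ = ∈-cartesianProductWith⁺ _-_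

      ⊖-∈ : x ∈ (A ⊖ B) → ∃[ a ] ∃[ b ] (a ∈ A × b ∈ B × x ≡ a - b)
      ⊖-∈ {A = A} {B} = ∈-cartesianProductWith⁻ _-_ A B

      ∈-· : ∀ {c} → x ∈ A → (c * x) ∈ (c · A)
      ∈-· {c = c} = ∈-map⁺ (c *_)

      ·-∈ : ∀ {c} → x ∈ (c · A) → ∃[ a ] (a ∈ A × x ≡ c * a)
      ·-∈ {c = c} = ∈-map⁻ (c *_)

      card-⊕· : ∀ c A → card em (Reals._⊕_ R A (Reals._·_ R c A)) ≡ # ≈E (A ⊕ c · A)
      card-⊕· c A = ≡.sym (#-reps ≈E (A ⊕ c · A))

    infix 4 _⊆_
    _⊆_ : List Carrier → List Carrier → Set
    A ⊆ B = ∀ {x} → x ∈ A → x ∈ B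

    card≡ : ∀ A → card em A ≡ size A
    card≡ A = ≡.sym (#-reps ≈E A)

    +-cancelˡ-≈ : ∀ z → z + x ≈ z + y → x ≈ y
    +-cancelˡ-≈ {x} {y} z eq = trans (solve 2 (λ z x → x := (z :+ x) :- z) refl z x)
      (trans (+-congʳ eq) (solve 2 (λ z x → (z :+ x) :- z := x) refl z y))

    +-cancelʳ-≈ : ∀ z → x + z ≈ y + z → x ≈ y
    +-cancelʳ-≈ z eq = +-cancelˡ-≈ z (trans (+-comm z _) (trans eq (+-comm _ z)))

    size-mono : A ⊆ B → size A ℕ.≤ (size B)
    size-mono sub = #-mono ≈E (⊆⇒⊆[] ≈E sub)

    size-shift : ∀ c A → size A ℕ.≤ (size (map (c +_) A))
    size-shift c = #-map ≈E ≈E (c +_) (+-cancelˡ-≈ c)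

    size-⊕ˡ : ∀ A {b} → b ∈ B → size A ℕ.≤ (size (A ⊕ B))
    size-⊕ˡ A {b} b∈ = #-≤ ≈E ≈E (λ x y → y ≡ x + b) (λ x∈ → _ , ∈-⊕ x∈ b∈ , ≡.refl)
      (λ { _ _ ≡.refl ≡.refl → +-cancelʳ-≈ b })

    size-⊕ʳ : ∀ B {a} → a ∈ A → size B ℕ.≤ (size (A ⊕ B))
    size-⊕ʳ B {a} a∈ = #-≤ ≈E ≈E (λ x y → y ≡ a + x) (λ x∈ → _ , ∈-⊕ a∈ x∈ , ≡.refl)
      (λ { _ _ ≡.refl ≡.refl → +-cancelˡ-≈ a })

    size-·-≥ : ∀ {c} → ¬ (c ≈ 0#) → ∀ A → size A ℕ.≤ size (c · A)
    size-·-≥ {c} c≉0 A = #-≤ ≈E ≈E (λ x y → y ≡ c * x) (λ x∈ → _ , ∈-· x∈ , ≡.refl)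
      (λ { _ _ ≡.refl ≡.refl → *-cancelˡ-≈ c≉0 })

    size-·-≤ : ∀ c A → size (c · A) ℕ.≤ size A
    size-·-≤ c A = #-≤ ≈E ≈E (λ y x → y ≡ c * x) (λ y∈ → ·-∈ y∈) (λ { _ _ ≡.refl ≡.refl → *-congˡ })

    size-empty : (∀ {x} → x ∈ A → ⊥) → size A ≡ 0
    size-empty {A} none = ℕ.n≤0⇒n≡0 (#-length ≈E A {[]} _≈_ (λ x∈ → ⊥-elim (none x∈)) (λ p q → trans p (sym q)))

    size-≥⇒⊆ : Z ⊆ X → size X ℕ.≤ (size Z) → X ⊆[ ≈E ] Z
    size-≥⇒⊆ {Z} {X} Z⊆X le {x} x∈ with em {x ∈[ ≈E ] Z}
    ... | yes p = p
    ... | no ¬p = ⊥-elim (ℕ.<-irrefl ≡.refl (ℕ.≤-trans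
      (ℕ.+-monoˡ-≤ (size Z) (#-pos ≈E {[ x ]} (here ≡.refl)))
      (ℕ.≤-trans (#-disjoint ≈E {[ x ]} {Z} {X} (λ { (here ≡.refl) → x , x∈ , refl }) (⊆⇒⊆[] ≈E Z⊆X)
        (λ { (here ≡.refl) y∈ x≈y → ¬p (_ , y∈ , x≈y) })) le)))

    -- Plünnecke's inequality after Petridis: X minimises (size (X ⊕ B)) / size X among its subsets.
    Minimal : List Carrier → List Carrier → Set
    Minimal X B = ∀ Z → Z ⊆ X → (size (X ⊕ B)) ℕ.* size Z ℕ.≤ (size X) ℕ.* (size (Z ⊕ B))

    -- Induction on `C`. For a new element c let Z′ consist of the z in X with z + c in X + C. Then
    -- Z′ + B + c already lies in X + B + C, so that only the part V′ of X + B outside Z′ + B can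
    -- contribute; minimality, applied to Z′, compares V′ with the part U′ of X outside Z′, which
    -- does contribute to X + C.
    petridis : Minimal X B → ∀ C → size X ℕ.* (size (X ⊕ B ⊕ C)) ℕ.≤ (size (X ⊕ B)) ℕ.* (size (X ⊕ C))
    petridis {X} {B} min [] = ℕ.≤-trans
      (ℕ.≤-reflexive (≡.trans (≡.cong (size X ℕ.*_) (size-empty {X ⊕ B ⊕ []} (λ x∈ → none (proj₁ (proj₂ (proj₂ (proj₂ (⊕-∈ {A = X ⊕ B} x∈)))))))) (ℕ.*-zeroʳ (size X))))
      z≤n
      where
      none : ∀ {x : Carrier} → x ∈ [] → ⊥
      none ()
    petridis {X} {B} min (c ∷ C) = begin
      s ℕ.* (size (X ⊕ B ⊕ (c ∷ C)))             ≤⟨ ℕ.*-monoʳ-≤ s upper ⟩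
      s ℕ.* ((size (X ⊕ B ⊕ C)) ℕ.+ size V′)       ≡⟨ ℕ.*-distribˡ-+ s _ _ ⟩
      s ℕ.* (size (X ⊕ B ⊕ C)) ℕ.+ s ℕ.* size V′   ≤⟨ ℕ.+-mono-≤ (petridis min C) sV≤rU ⟩
      r ℕ.* (size (X ⊕ C)) ℕ.+ r ℕ.* size U′       ≡⟨ ℕ.*-distribˡ-+ r _ _ ⟨
      r ℕ.* ((size (X ⊕ C)) ℕ.+ size U′)           ≤⟨ ℕ.*-monoʳ-≤ r lower ⟩
      r ℕ.* (size (X ⊕ (c ∷ C)))                 ∎
      where
      open ℕ.≤-Reasoning
      s = size X
      r = (size (X ⊕ B))
      old : Carrier → Set
      old x = (x + c) ∈[ ≈E ] (X ⊕ C)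
      Z′ = select old X
      U′ = select (λ x → ¬ old x) X
      V′ = select (λ y → ¬ (y ∈[ ≈E ] (Z′ ⊕ B))) (X ⊕ B)
      lower : (size (X ⊕ C)) ℕ.+ size U′ ℕ.≤ (size (X ⊕ (c ∷ C)))
      lower = ℕ.≤-trans (ℕ.+-monoʳ-≤ (size (X ⊕ C)) (size-shift c U′))
        (#-disjoint ≈E {X ⊕ C} {map (c +_) U′}
          (λ p → let (a , b , a∈ , b∈ , eq) = ⊕-∈ {A = X} p in _ , ∈-⊕ a∈ (there b∈) , reflexive eq)
          (λ p → let (u , u∈ , eq) = ∈-map⁻ (c +_) p in
             u + c , ∈-⊕ (proj₁ (∈-select⁻ u∈)) (here ≡.refl) , trans (reflexive eq) (+-comm c u))
          (λ {x} {y} x∈ y∈ x≈y → let (u , u∈ , eq) = ∈-map⁻ (c +_) y∈ in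
             proj₂ (∈-select⁻ {P = λ x → ¬ old x} u∈)
               (x , x∈ , trans (+-comm u c) (trans (sym (reflexive eq)) (sym x≈y)))))
      upper : (size (X ⊕ B ⊕ (c ∷ C))) ℕ.≤ (size (X ⊕ B ⊕ C)) ℕ.+ size V′
      upper = ℕ.≤-trans (#-mono ≈E go) (ℕ.≤-trans (#-++ ≈E (X ⊕ B ⊕ C) (map (_+ c) V′))
        (ℕ.+-monoʳ-≤ (size (X ⊕ B ⊕ C)) (#-map-≤ ≈E ≈E (_+ c) +-congʳ V′)))
        where
        go : (X ⊕ B ⊕ (c ∷ C)) ⊆[ ≈E ] (X ⊕ B ⊕ C ++ map (_+ c) V′)
        go p with ⊕-∈ {A = X ⊕ B} {B = c ∷ C} p
        ... | y , c′ , y∈ , there c∈ , ≡.refl = _ , ∈-++⁺ˡ (∈-⊕ y∈ c∈) , refl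
        ... | y , .c , y∈ , here ≡.refl , ≡.refl with em {y ∈[ ≈E ] (Z′ ⊕ B)}
        ...   | no ¬q = y + c , ∈-++⁺ʳ (X ⊕ B ⊕ C) (∈-map⁺ (_+ c) (∈-select⁺ y∈ ¬q)) , refl
        ...   | yes (w , w∈ , y≈w) with ⊕-∈ {A = Z′} w∈
        ...     | z , b , z∈ , b∈ , ≡.refl with ∈-select⁻ {P = old} z∈
        ...       | z∈X , (v , v∈ , zc≈v) with ⊕-∈ {A = X} v∈
        ...         | x , c′ , x∈ , c′∈ , ≡.refl = (x + b) + c′ , ∈-++⁺ˡ (∈-⊕ (∈-⊕ x∈ b∈) c′∈) ,
          trans (+-congʳ y≈w) (trans (solve 3 (λ z b c → (z :+ b) :+ c := (z :+ c) :+ b) refl z b c)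
            (trans (+-congʳ zc≈v) (solve 3 (λ x c b → (x :+ c) :+ b := (x :+ b) :+ c) refl x c′ b)))
      sV≤rU : s ℕ.* size V′ ℕ.≤ r ℕ.* size U′
      sV≤rU = ℕ.+-cancelˡ-≤ (r ℕ.* size Z′) _ _ (begin
        r ℕ.* size Z′ ℕ.+ s ℕ.* size V′          ≤⟨ ℕ.+-monoˡ-≤ _ (min Z′ (proj₁ ∘ ∈-select⁻)) ⟩
        s ℕ.* (size (Z′ ⊕ B)) ℕ.+ s ℕ.* size V′      ≡⟨ ℕ.*-distribˡ-+ s _ _ ⟨
        s ℕ.* ((size (Z′ ⊕ B)) ℕ.+ size V′)          ≤⟨ ℕ.*-monoʳ-≤ s (#-disjoint ≈E {Z′ ⊕ B} {V′}
           (λ p → let (z , b , z∈ , b∈ , eq) = ⊕-∈ {A = Z′} p in _ , ∈-⊕ (proj₁ (∈-select⁻ z∈)) b∈ , reflexive eq)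
           (⊆⇒⊆[] ≈E (proj₁ ∘ ∈-select⁻))
           (λ {x} {y} x∈ y∈ x≈y → proj₂ (∈-select⁻ {P = λ y → ¬ (y ∈[ ≈E ] (Z′ ⊕ B))} y∈) (x , x∈ , sym x≈y))) ⟩
        s ℕ.* r                               ≡⟨ ℕ.*-comm s r ⟩
        r ℕ.* s                               ≤⟨ ℕ.*-monoʳ-≤ r (#-select ≈E old X) ⟩
        r ℕ.* (size Z′ ℕ.+ size U′)              ≡⟨ ℕ.*-distribˡ-+ r _ _ ⟩
        r ℕ.* size Z′ ℕ.+ r ℕ.* size U′          ∎)

    private
      inhabited : 0 ℕ.< size X → ∃[ x ] (x ∈ X)
      inhabited {[]}    p = ⊥-elim (ℕ.<-irrefl (≡.sym (size-empty {[]} (λ ()))) p)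
      inhabited {x ∷ _} p = x , here ≡.refl

      *-cancel : ∀ {m n} k → 0 ℕ.< k → k ℕ.* m ℕ.≤ k ℕ.* n → m ℕ.≤ n
      *-cancel (suc k) _ p = ℕ.*-cancelˡ-≤ (suc k) p

    -- A subset that violates minimality has a smaller ratio and fewer elements, so descending to it
    -- terminates. The last component records that the ratio has not increased on the way.
    minimiser : ∀ {x} → x ∈ X → ∀ B →
      ∃[ Y ] (Y ⊆ X × (∃[ y ] (y ∈ Y)) × Minimal Y B × (size (Y ⊕ B)) ℕ.* size X ℕ.≤ (size (X ⊕ B)) ℕ.* size Y)
    minimiser {X} x∈ B = go (size X) ℕ.≤-refl x∈
      where
      go : ∀ n {X x} → size X ℕ.≤ n → x ∈ X →
        ∃[ Y ] (Y ⊆ X × (∃[ y ] (y ∈ Y)) × Minimal Y B × (size (Y ⊕ B)) ℕ.* size X ℕ.≤ (size (X ⊕ B)) ℕ.* size Y)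
      go zero    le x∈ = ⊥-elim (ℕ.<⇒≱ (#-pos ≈E x∈) le)
      go (suc n) {X} {x} le x∈ with em {∃[ Z ] (Z ⊆ X × ¬ ((size (X ⊕ B)) ℕ.* size Z ℕ.≤ (size X) ℕ.* (size (Z ⊕ B))))}
      ... | no ¬∃ = X , (λ p → p) , (x , x∈) , min , ℕ.≤-refl
        where
        min : Minimal X B
        min Z Z⊆X with em {(size (X ⊕ B)) ℕ.* size Z ℕ.≤ (size X) ℕ.* (size (Z ⊕ B))}
        ... | yes p = p
        ... | no ¬p = ⊥-elim (¬∃ (Z , Z⊆X , ¬p))
      ... | yes (Z , Z⊆X , ¬p) = Y , (λ p → Z⊆X (Y⊆Z p)) , Y∋ , min , *-cancel (size Z) 0<Z (begin
          size Z ℕ.* ((size (Y ⊕ B)) ℕ.* size X)   ≡⟨ ℕ.*-assoc (size Z) _ _ ⟨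
          size Z ℕ.* (size (Y ⊕ B)) ℕ.* size X     ≤⟨ ℕ.*-monoˡ-≤ (size X) (ℕ.≤-trans (ℕ.≤-reflexive (ℕ.*-comm (size Z) _)) ratio) ⟩
          (size (Z ⊕ B)) ℕ.* size Y ℕ.* size X     ≡⟨ N.solve 3 (λ a b c → a N.:* b N.:* c N.:= (c N.:* a) N.:* b) ≡.refl (size (Z ⊕ B)) (size Y) (size X) ⟩
          size X ℕ.* (size (Z ⊕ B)) ℕ.* size Y     ≤⟨ ℕ.*-monoˡ-≤ (size Y) (ℕ.<⇒≤ lt) ⟩
          (size (X ⊕ B)) ℕ.* size Z ℕ.* size Y     ≡⟨ N.solve 3 (λ a b c → a N.:* b N.:* c N.:= b N.:* (a N.:* c)) ≡.refl (size (X ⊕ B)) (size Z) (size Y) ⟩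
          size Z ℕ.* ((size (X ⊕ B)) ℕ.* size Y)   ∎)
        where
        open ℕ.≤-Reasoning
        lt : size X ℕ.* (size (Z ⊕ B)) ℕ.< (size (X ⊕ B)) ℕ.* size Z
        lt = ℕ.≰⇒> ¬p
        0<Z : 0 ℕ.< size Z
        0<Z = ℕ.n≢0⇒n>0 (λ eq → ¬p (ℕ.≤-trans
          (ℕ.≤-reflexive (≡.trans (≡.cong (size (X ⊕ B) ℕ.*_) eq) (ℕ.*-zeroʳ (size (X ⊕ B))))) z≤n))
        Z<X : size Z ℕ.< size X
        Z<X with ℕ.<-≤-connex (size Z) (size X)
        ... | inj₁ p = p
        ... | inj₂ X≤Z = ⊥-elim (¬p (begin
          (size (X ⊕ B)) ℕ.* size Z   ≤⟨ ℕ.*-mono-≤ (#-mono ≈E XB⊆ZB) (size-mono Z⊆X) ⟩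
          (size (Z ⊕ B)) ℕ.* size X   ≡⟨ ℕ.*-comm (size (Z ⊕ B)) _ ⟩
          size X ℕ.* (size (Z ⊕ B))   ∎))
          where
          XB⊆ZB : (X ⊕ B) ⊆[ ≈E ] (Z ⊕ B)
          XB⊆ZB p = let (a , b , a∈ , b∈ , eq) = ⊕-∈ {A = X} p
                        (z , z∈ , a≈z) = size-≥⇒⊆ Z⊆X X≤Z a∈
                    in _ , ∈-⊕ z∈ b∈ , trans (reflexive eq) (+-congʳ a≈z)
        rec = go n (ℕ.≤-pred (ℕ.≤-trans Z<X le)) (proj₂ (inhabited 0<Z))
        Y = proj₁ rec
        Y⊆Z = proj₁ (proj₂ rec)
        Y∋ = proj₁ (proj₂ (proj₂ rec))
        min = proj₁ (proj₂ (proj₂ (proj₂ rec)))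
        ratio = proj₂ (proj₂ (proj₂ (proj₂ rec)))

    -- The set Y serves all `C` at once, which allows iteration: with multiples of `B` for `C`, each
    -- further summand `B` costs a factor K.
    plünnecke : ∀ {x} → x ∈ X → ∀ B K → (size (X ⊕ B)) ℕ.≤ K ℕ.* size X →
      ∃[ Y ] (Y ⊆ X × (∃[ y ] (y ∈ Y)) × (∀ C → (size (Y ⊕ B ⊕ C)) ℕ.≤ K ℕ.* (size (Y ⊕ C))))
    plünnecke {X} x∈ B K le with minimiser x∈ B
    ... | Y , Y⊆X , (y , y∈) , min , ratio = Y , Y⊆X , (y , y∈) , λ C → *-cancel (size Y) (#-pos ≈E y∈) (begin
      size Y ℕ.* (size (Y ⊕ B ⊕ C))         ≤⟨ petridis min C ⟩
      (size (Y ⊕ B)) ℕ.* (size (Y ⊕ C))         ≤⟨ ℕ.*-monoˡ-≤ (size (Y ⊕ C)) YB≤ ⟩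
      size Y ℕ.* K ℕ.* (size (Y ⊕ C))       ≡⟨ ℕ.*-assoc (size Y) K _ ⟩
      size Y ℕ.* (K ℕ.* (size (Y ⊕ C)))     ∎)
      where
      open ℕ.≤-Reasoning
      YB≤ : (size (Y ⊕ B)) ℕ.≤ (size Y) ℕ.* K
      YB≤ = *-cancel (size X) (#-pos ≈E x∈) (begin
        size X ℕ.* (size (Y ⊕ B))       ≡⟨ ℕ.*-comm (size X) _ ⟩
        (size (Y ⊕ B)) ℕ.* size X       ≤⟨ ratio ⟩
        (size (X ⊕ B)) ℕ.* size Y       ≤⟨ ℕ.*-monoˡ-≤ (size Y) le ⟩
        K ℕ.* size X ℕ.* size Y     ≡⟨ N.solve 3 (λ k x y → k N.:* x N.:* y N.:= x N.:* (y N.:* k)) ≡.refl K (size X) (size Y) ⟩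
        size X ℕ.* (size Y ℕ.* K)   ∎)

    -- Each difference d = u - v, with one such representation fixed, gives the pairs (x + u, x + v)
    -- for x in X; a pair determines d as the difference of its entries, and then x.
    ruzsa-triangle : ∀ U V X → (size (U ⊖ V)) ℕ.* size X ℕ.≤ (size (X ⊕ U)) ℕ.* (size (X ⊕ V))
    ruzsa-triangle U V X = ℕ.≤-trans
      (#-classes ≈E (≈E ⊗ ≈E) (λ d → select (image d) grid) {U ⊖ V} {grid}
        (λ _ → ⊆⇒⊆[] (≈E ⊗ ≈E) (proj₁ ∘ ∈-select⁻))
        (λ {d} d∈ → big d∈)
        (λ {y} {y′} _ _ z∈ z′∈ (e , e′) →
           trans (proj₂ (∈-select⁻ {P = image y} z∈)) (trans (+-cong e (-‿cong e′)) (sym (proj₂ (∈-select⁻ {P = image y′} z′∈))))))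
      (#-⊗ ≈E ≈E (X ⊕ U) (X ⊕ V))
      where
      grid = cartesianProduct (X ⊕ U) (X ⊕ V)
      image : Carrier → Carrier × Carrier → Set
      image d (p , q) = d ≈ p - q
      big : ∀ {d} → d ∈ (U ⊖ V) → size X ℕ.≤ # (≈E ⊗ ≈E) (select (image d) grid)
      big d∈ with ⊖-∈ {A = U} d∈
      ... | u , v , u∈ , v∈ , ≡.refl = #-≤ ≈E (≈E ⊗ ≈E) (λ x z → z ≡ (x + u , x + v))
        (λ {x} x∈ → _ , ∈-select⁺ (∈-cartesianProduct⁺ (∈-⊕ x∈ u∈) (∈-⊕ x∈ v∈))
            (solve 3 (λ x u v → u :- v := (x :+ u) :- (x :+ v)) refl x u v) , ≡.refl)
        (λ { _ _ ≡.refl ≡.refl (e , _) → +-cancelʳ-≈ u e })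

    -- A - A as a predicate respecting the equality of the field; it provides both the translates
    -- used in coverings and the generators of the group G.
    Diff : List Carrier → Carrier → Set
    Diff A x = ∃[ a ] ∃[ b ] (a ∈ A × b ∈ A × x ≈ a - b)

    Diff-resp : x ≈ y → Diff A x → Diff A y
    Diff-resp eq (a , b , a∈ , b∈ , p) = a , b , a∈ , b∈ , trans (sym eq) p

    Diff-neg : Diff A x → Diff A (- x)
    Diff-neg (a , b , a∈ , b∈ , p) = b , a , b∈ , a∈ , trans (-‿cong p) (solve 2 (λ a b → :- (a :- b) := b :- a) refl a b)

    -- F is a greedy maximal subset of U for which the translates f + A are disjoint. They all lie
    -- in U + A, which bounds their number. By maximality u + A meets some f + A, whence u - f is a
    -- difference of elements of A.
    ruzsa-cover : ∀ U A {a} → a ∈ A → ∃[ F ] (length F ℕ.* size A ℕ.≤ (size (U ⊕ A)) ×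
      (∀ {u} → u ∈ U → ∃[ f ] (f ∈ F × Diff A (u - f))))
    ruzsa-cover U A {a₀} a₀∈ = F , ℕ.≤-trans
        (sum-≥ F (λ {f} _ → size-shift f A))
        (sum-#-≤ ≈E (λ f → map (f +_) A) {D = meet} {F} {U ⊕ A} ap
          (λ {f} f∈ p → let (a , a∈ , eq) = ∈-map⁻ (f +_) p in _ , ∈-⊕ (F⊆ f∈) a∈ , reflexive eq)
          (λ {f} {g} _ _ p q e → let (a , a∈ , eq) = ∈-map⁻ (f +_) p
                                     (b , b∈ , eq′) = ∈-map⁻ (g +_) q
                                 in a , b , a∈ , b∈ , trans (sym (reflexive eq)) (trans e (reflexive eq′))))
      , cov
      where
      meet : Carrier → Carrier → Set
      meet f g = ∃[ a ] ∃[ b ] (a ∈ A × b ∈ A × f + a ≈ g + b)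
      Good : List Carrier → List Carrier → Set
      Good U F = AllPairs (λ f g → ¬ meet f g) F × F ⊆ U × (∀ {u} → u ∈ U → ∃[ f ] (f ∈ F × (u ≡ f ⊎ meet u f)))
      greedy : ∀ U → ∃ (Good U)
      greedy [] = [] , [] , (λ ()) , λ ()
      greedy (u ∷ U) with greedy U
      ... | F , ap , F⊆ , cov with em {∃[ f ] (f ∈ F × meet u f)}
      ...   | yes (f , f∈ , m) = F , ap , (there ∘ F⊆) ,
                λ { (here ≡.refl) → f , f∈ , inj₂ m ; (there u∈) → cov u∈ }
      ...   | no ¬m = u ∷ F , All.tabulate (λ f∈ m → ¬m (_ , f∈ , m)) ∷ ap ,
                (λ { (here ≡.refl) → here ≡.refl ; (there f∈) → there (F⊆ f∈) }) ,
                λ { (here ≡.refl) → u , here ≡.refl , inj₁ ≡.refl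
                  ; (there u∈) → let (f , f∈ , m) = cov u∈ in f , there f∈ , m }
      F = proj₁ (greedy U)
      ap = proj₁ (proj₂ (greedy U))
      F⊆ : F ⊆ U
      F⊆ = proj₁ (proj₂ (proj₂ (greedy U)))
      cov : ∀ {u} → u ∈ U → ∃[ f ] (f ∈ F × Diff A (u - f))
      cov {u} u∈ with proj₂ (proj₂ (proj₂ (greedy U))) u∈
      ... | f , f∈ , inj₂ (a , b , a∈ , b∈ , e) = f , f∈ , b , a , b∈ , a∈ ,
        trans (solve 3 (λ u f a → u :- f := (u :+ a) :- (f :+ a)) refl u f a)
          (trans (+-congʳ e) (solve 3 (λ f a b → (f :+ b) :- (f :+ a) := b :- a) refl f a b))
      ... | f , f∈ , inj₁ ≡.refl = f , f∈ , a₀ , a₀ , a₀∈ , a₀∈ , solve 2 (λ f a → f :- f := a :- a) refl f a₀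

  -- Long progressions in sets of small doubling.

  module Structure where

    open Reals R hiding (_⊕_; _·_)
    open import Data.Nat.DivMod using (_/_; _%_; m≡m%n+[m/n]*n; m%n<n; m<n*o⇒m/o<n)
    open Field
    open Counting em
    open Sumsets

    open Equivalence

    private variable
      A X Y : List Carrier
      x y : Carrier

    ^-distribʳ-* : ∀ k m n → (m ℕ.* n) ℕ.^ k ≡ m ℕ.^ k ℕ.* n ℕ.^ k
    ^-distribʳ-* zero    m n = ≡.refl
    ^-distribʳ-* (suc k) m n = ≡.trans (≡.cong (m ℕ.* n ℕ.*_) (^-distribʳ-* k m n))
      (N.solve 4 (λ a b c d → a N.:* b N.:* (c N.:* d) N.:= (a N.:* c) N.:* (b N.:* d)) ≡.refl m n (m ℕ.^ k) (n ℕ.^ k))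

    ≡E : {X : Set} → Equivalence X
    ≡E = record { _~_ = _≡_ ; ~-refl = ≡.refl ; ~-sym = ≡.sym ; ~-trans = ≡.trans }

    String : Carrier → Equivalence Carrier
    String c = record
      { _~_     = λ x y → ∃[ z ] (x - y ≈ fromInt z * c)
      ; ~-refl  = λ {x} → 0ℤ , solve 2 (λ x c → x :- x := con 0ℤ :* c) refl x c
      ; ~-sym   = λ {x} {y} (z , p) → ℤ.- z , trans (solve 2 (λ x y → y :- x := :- (x :- y)) refl x y)
          (trans (-‿cong p) (trans (solve 2 (λ z c → :- (z :* c) := (:- z) :* c) refl (fromInt z) c) (*-congʳ (sym (fromInt-neg z)))))
      ; ~-trans = λ {x} {y} {w} (z , p) (z′ , p′) → z ℤ.+ z′ ,
          trans (solve 3 (λ x y w → x :- w := (x :- y) :+ (y :- w)) refl x y w)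
            (trans (+-cong p p′) (trans (sym (distribʳ c _ _)) (*-congʳ (sym (fromInt-+ z z′))))) }

    size-⊕-length : ∀ A B → size (A ⊕ B) ℕ.≤ length A ℕ.* size B
    size-⊕-length A B = ℕ.≤-trans
      (#-concat-≤ ≈E (λ a → map (a +_) B) A {A ⊕ B}
        (λ p → let (a , b , a∈ , b∈ , eq) = ⊕-∈ {A = A} p in a , a∈ , a + b , ∈-map⁺ (a +_) b∈ , reflexive eq))
      (sum-≤ A (λ {a} _ → #-map-≤ ≈E ≈E (a +_) +-congˡ B))

    size-⊕-comm : ∀ A B → size (A ⊕ B) ℕ.≤ size (B ⊕ A)
    size-⊕-comm A B = #-mono ≈E (λ p → let (a , b , a∈ , b∈ , eq) = ⊕-∈ {A = A} p in
      _ , ∈-⊕ b∈ a∈ , trans (reflexive eq) (+-comm a b))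

    size-⊕-assoc : ∀ A B C → size (A ⊕ (B ⊕ C)) ℕ.≤ size (A ⊕ B ⊕ C)
    size-⊕-assoc A B C = #-mono ≈E (λ p → let (a , u , a∈ , u∈ , eq) = ⊕-∈ {A = A} p
                                              (b , c , b∈ , c∈ , eq′) = ⊕-∈ {A = B} u∈ in
      _ , ∈-⊕ (∈-⊕ a∈ b∈) c∈ , trans (reflexive eq) (trans (+-congˡ (reflexive eq′)) (sym (+-assoc a b c))))

    size-⊕0 : ∀ A → size (A ⊕ [ 0# ]) ℕ.≤ size A
    size-⊕0 A = #-mono ≈E (λ p → let (a , u , a∈ , u∈ , eq) = ⊕-∈ {A = A} p in
      a , a∈ , trans (reflexive eq) (trans (+-congˡ (zero′ u∈)) (+-identityʳ a)))
      where
      zero′ : x ∈ [ 0# ] → x ≈ 0#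
      zero′ (here ≡.refl) = refl

    two-elements : 1 ℕ.< size A → ∃[ x ] ∃[ y ] (x ∈ A × y ∈ A × ¬ (x ≈ y))
    two-elements {[]}    p = ⊥-elim (ℕ.n≮0 (ℕ.≤-trans p (ℕ.≤-reflexive (size-empty {[]} (λ ())))))
    two-elements {a ∷ A} p with em {∃[ y ] (y ∈ (a ∷ A) × ¬ (a ≈ y))}
    ... | yes (y , y∈ , a≉y) = a , y , here ≡.refl , y∈ , a≉y
    ... | no ¬∃ = ⊥-elim (ℕ.<⇒≱ p (#-length ≈E (a ∷ A) {[ a ]} _≈_ (λ {x} x∈ → a , here ≡.refl , x≈a x∈)
        (λ q r → trans q (sym r))))
      where
      x≈a : ∀ {x} → x ∈ (a ∷ A) → x ≈ a
      x≈a {x} x∈ with em {a ≈ x}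
      ... | yes e = sym e
      ... | no ne = ⊥-elim (¬∃ (x , x∈ , ne))

    private
      *-cancel : ∀ {m n} k → 0 ℕ.< k → k ℕ.* m ℕ.≤ k ℕ.* n → m ℕ.≤ n
      *-cancel (suc k) _ p = ℕ.*-cancelˡ-≤ (suc k) p

    module SmallDoubling (α : Carrier) (α≉0 : ¬ (α ≈ 0#)) (A : List Carrier) {a₀} (a₀∈ : a₀ ∈ A)
      (K : ℕ) (small : size (A ⊕ α · A) ℕ.≤ K ℕ.* size A) where

      private
        N₀ = size A
        0<N : 0 ℕ.< N₀
        0<N = #-pos ≈E a₀∈

      -- With W = A - A, `κ` will bound the number of translates of W that cover W + W, and `κα` the
      -- number of those that cover αW.
      κ κα : ℕ
      κ  = K ℕ.^ 5
      κα = K ℕ.* K ℕ.* κ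

      opaque
        -- The Plünnecke set Y is a subset of αA, and adding A to it costs a factor K each time. The
        -- triangle inequality through Y costs K³ for 3A and K² for 2A, together K⁵.
        tripling : size ((A ⊕ A ⊕ A) ⊖ (A ⊕ A)) ℕ.≤ κ ℕ.* N₀
        tripling with plünnecke (∈-· {c = α} a₀∈) A K (ℕ.≤-trans (size-⊕-comm (α · A) A)
                        (ℕ.≤-trans small (ℕ.*-monoʳ-≤ K (size-·-≥ α≉0 A))))
        ... | Y , Y⊆ , (y , y∈) , pl = *-cancel (size Y) (#-pos ≈E y∈) (begin
            size Y ℕ.* size (3A ⊖ 2A)                     ≡⟨ ℕ.*-comm (size Y) _ ⟩
            size (3A ⊖ 2A) ℕ.* size Y                     ≤⟨ ruzsa-triangle 3A 2A Y ⟩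
            size (Y ⊕ 3A) ℕ.* size (Y ⊕ 2A)               ≤⟨ ℕ.*-mono-≤ three two ⟩
            K ℕ.* (K ℕ.* (K ℕ.* size Y)) ℕ.* (K ℕ.* (K ℕ.* size Y))
              ≡⟨ N.solve 2 (λ k y → k N.:* (k N.:* (k N.:* y)) N.:* (k N.:* (k N.:* y)) N.:= y N.:* (k N.:^ 5 N.:* y)) ≡.refl K (size Y) ⟩
            size Y ℕ.* (κ ℕ.* size Y)                     ≤⟨ ℕ.*-monoʳ-≤ (size Y) (ℕ.*-monoʳ-≤ κ (ℕ.≤-trans (size-mono Y⊆) (size-·-≤ α A))) ⟩
            size Y ℕ.* (κ ℕ.* N₀)                         ∎)
          where
          open ℕ.≤-Reasoning
          2A 3A : List Carrier
          2A = A ⊕ A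
          3A = A ⊕ A ⊕ A
          one : size (Y ⊕ A) ℕ.≤ K ℕ.* size Y
          one = ℕ.≤-trans (size-⊕ˡ (Y ⊕ A) (here ≡.refl)) (ℕ.≤-trans (pl [ 0# ]) (ℕ.*-monoʳ-≤ K (size-⊕0 Y)))
          two : size (Y ⊕ 2A) ℕ.≤ K ℕ.* (K ℕ.* size Y)
          two = ℕ.≤-trans (size-⊕-assoc Y A A) (ℕ.≤-trans (pl A) (ℕ.*-monoʳ-≤ K one))
          three : size (Y ⊕ 3A) ℕ.≤ K ℕ.* (K ℕ.* (K ℕ.* size Y))
          three = ℕ.≤-trans (size-⊕-assoc Y 2A A) (ℕ.≤-trans (#-mono ≈E swap) (ℕ.≤-trans (pl 2A) (ℕ.*-monoʳ-≤ K two)))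
            where
            swap : (Y ⊕ 2A ⊕ A) ⊆[ ≈E ] (Y ⊕ A ⊕ 2A)
            swap p = let (u , a , u∈ , a∈ , eq) = ⊕-∈ {A = Y ⊕ 2A} p
                         (v , w , v∈ , w∈ , eq′) = ⊕-∈ {A = Y} u∈
                     in _ , ∈-⊕ (∈-⊕ v∈ a∈) w∈ , trans (reflexive eq) (trans (+-congʳ (reflexive eq′))
                          (solve 3 (λ v w a → (v :+ w) :+ a := (v :+ a) :+ w) refl v w a))

      W : Carrier → Set
      W = Diff A

      W-0 : W 0#
      W-0 = a₀ , a₀ , a₀∈ , a₀∈ , sym (-‿inverseʳ a₀)

      Covers : List Carrier → (Carrier → Set) → Set
      Covers F P = ∀ {x} → P x → ∃[ f ] (f ∈ F × W (x - f))

      Dilated : Carrier → Carrier → Set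
      Dilated c y = ∃[ x ] (W x × y ≈ c * x)

      opaque
        -- Ruzsa's covering lemma applies because (A - A) + (A - A) + A lies in 3A - 2A.
        sum-cover : ∃[ F ] (length F ℕ.≤ κ × (∀ {x y} → W x → W y → ∃[ f ] (f ∈ F × W ((x + y) - f))))
        sum-cover with ruzsa-cover ((A ⊖ A) ⊕ (A ⊖ A)) A a₀∈
        ... | F , len , cov = F ,
            *-cancel N₀ 0<N (ℕ.≤-trans (ℕ.≤-reflexive (ℕ.*-comm N₀ _)) (ℕ.≤-trans len
              (ℕ.≤-trans (#-mono ≈E sub) (ℕ.≤-trans tripling (ℕ.≤-reflexive (ℕ.*-comm κ N₀)))))) ,
            λ (a , b , a∈ , b∈ , p) (c , d , c∈ , d∈ , q) →
              let (f , f∈ , w) = cov (∈-⊕ (∈-⊖ a∈ b∈) (∈-⊖ c∈ d∈)) in f , f∈ , Diff-resp (+-congʳ (sym (+-cong p q))) w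
          where
          sub : ((A ⊖ A) ⊕ (A ⊖ A) ⊕ A) ⊆[ ≈E ] ((A ⊕ A ⊕ A) ⊖ (A ⊕ A))
          sub p = let (u , e , u∈ , e∈ , eq) = ⊕-∈ {A = (A ⊖ A) ⊕ (A ⊖ A)} p
                      (v , w , v∈ , w∈ , eq₁) = ⊕-∈ {A = A ⊖ A} u∈
                      (a , b , a∈ , b∈ , eq₂) = ⊖-∈ {A = A} v∈
                      (c , d , c∈ , d∈ , eq₃) = ⊖-∈ {A = A} w∈
                  in _ , ∈-⊖ (∈-⊕ (∈-⊕ a∈ c∈) e∈) (∈-⊕ b∈ d∈) ,
                     trans (reflexive eq) (trans (+-congʳ (trans (reflexive eq₁) (+-cong (reflexive eq₂) (reflexive eq₃))))
                       (solve 5 (λ a b c d e → ((a :- b) :+ (c :- d)) :+ e := ((a :+ c) :+ e) :- (b :+ d)) refl a b c d e))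

      F₂ = proj₁ sum-cover
      F₂-length = proj₁ (proj₂ sum-cover)

      private
        add : W x → W y → ∃[ f ] (f ∈ F₂ × W ((x + y) - f))
        add = proj₂ (proj₂ sum-cover)

      _+L_ : List Carrier → List Carrier → List Carrier
      F +L G = map (λ (f , g) → f + g) (cartesianProduct F G)

      ∈-+L : ∀ {F G} → x ∈ F → y ∈ G → (x + y) ∈ (F +L G)
      ∈-+L x∈ y∈ = ∈-map⁺ _ (∈-cartesianProduct⁺ x∈ y∈)

      length-+L : ∀ F G → length (F +L G) ≡ length F ℕ.* length G
      length-+L F G = ≡.trans (length-map _ (cartesianProduct F G)) (length-cartesianProduct F G)

      length-+L-≤ : ∀ {F G m n} → length F ℕ.≤ m → length G ℕ.≤ n → length (F +L G) ℕ.≤ m ℕ.* n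
      length-+L-≤ {F} {G} p q = ℕ.≤-trans (ℕ.≤-reflexive (length-+L F G)) (ℕ.*-mono-≤ p q)

      opaque
        -- K translates of W cover αA, so K² translates of W + W cover αA - αA, and each of these
        -- costs another factor κ.
        α-cover : ∃[ F ] (length F ℕ.≤ κα × Covers F (Dilated α))
        α-cover with ruzsa-cover (α · A) A a₀∈
        ... | G , len , cov = (G +L map (-_) G) +L F₂ ,
            length-+L-≤ {G +L map (-_) G} (length-+L-≤ {G} lenG (ℕ.≤-trans (ℕ.≤-reflexive (length-map (-_) G)) lenG)) F₂-length ,
            λ (x , (a , b , a∈ , b∈ , p) , q) →
              let (f , f∈ , w)  = cov (∈-· {c = α} a∈)
                  (g , g∈ , w′) = cov (∈-· {c = α} b∈)
                  (h , h∈ , w″) = add w (Diff-neg w′)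
              in _ , ∈-+L (∈-+L f∈ (∈-map⁺ (-_) g∈)) h∈ , Diff-resp (trans
                   (solve 6 (λ α a b f g h → ((α :* a :- f) :+ :- (α :* b :- g)) :- h
                      := α :* (a :- b) :- ((f :+ :- g) :+ h)) refl α a b f g h)
                   (+-congʳ (sym (trans q (*-congˡ p))))) w″
          where
          lenG : length G ℕ.≤ K
          lenG = *-cancel N₀ 0<N (ℕ.≤-trans (ℕ.≤-reflexive (ℕ.*-comm N₀ _)) (ℕ.≤-trans len
              (ℕ.≤-trans (size-⊕-comm (α · A) A) (ℕ.≤-trans small (ℕ.≤-reflexive (ℕ.*-comm K N₀))))))

      αᵏ-cover-suc : ∀ {c m n F G} → length F ℕ.≤ m → length G ℕ.≤ n → Covers F (Dilated c) → Covers G (Dilated α) →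
        ∃[ H ] (length H ℕ.≤ m ℕ.* n × Covers H (Dilated (α * c)))
      αᵏ-cover-suc {c} {m} {n} {F} {G} len len′ cov cov′ = map (α *_) F +L G ,
        length-+L-≤ {map (α *_) F} (ℕ.≤-trans (ℕ.≤-reflexive (length-map (α *_) F)) len) len′ ,
        λ {y} (x , w , p) →
          let (f , f∈ , w′) = cov (x , w , refl)
              (g , g∈ , w″) = cov′ (_ , w′ , refl)
          in _ , ∈-+L (∈-map⁺ (α *_) f∈) g∈ , Diff-resp (trans
               (solve 5 (λ α P x f g → α :* (P :* x :- f) :- g := (α :* P) :* x :- (α :* f :+ g)) refl α c x f g)
               (+-congʳ (sym p))) w″

      opaque
        αᵏ-cover : ∀ k → ∃[ F ] (length F ℕ.≤ κα ℕ.^ k × Covers F (Dilated (α ^ k)))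
        αᵏ-cover zero    = [ 0# ] , ℕ.≤-refl , λ {y} (x , w , p) → 0# , here ≡.refl ,
          Diff-resp (trans (sym (*-identityˡ x)) (trans (sym p) (solve 1 (λ y → y := y :- con 0ℤ) refl y))) w
        αᵏ-cover (suc k) =
          let (F , len , cov)   = αᵏ-cover k
              (G , len′ , cov′) = α-cover
              (H , len″ , cov″) = αᵏ-cover-suc {F = F} {G} len len′ cov cov′
          in H , ℕ.≤-trans len″ (ℕ.≤-reflexive (ℕ.*-comm (κα ℕ.^ k) κα)) , cov″

      opaque
        sumset-cover : ∃[ F ] (length F ℕ.≤ κα ℕ.* κ × Covers F (_∈ (A ⊕ α · A)))
        sumset-cover with α-cover
        ... | G , len , cov = map ((a₀ + α * a₀) +_) (G +L F₂) ,
          ℕ.≤-trans (ℕ.≤-reflexive (length-map _ (G +L F₂))) (length-+L-≤ {G} len F₂-length) ,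
          λ p → let (a , u , a∈ , u∈ , eq) = ⊕-∈ {A = A} p
                    (b , b∈ , eq′) = ·-∈ {c = α} u∈
                    (g , g∈ , w) = cov (_ , (b , a₀ , b∈ , a₀∈ , refl) , refl)
                    (f , f∈ , w′) = add (a , a₀ , a∈ , a₀∈ , refl) w
                in _ , ∈-map⁺ ((a₀ + α * a₀) +_) (∈-+L g∈ f∈) , Diff-resp (trans
                     (solve 6 (λ α a b c g f → ((a :- c) :+ (α :* (b :- c) :- g)) :- f
                        := (a :+ α :* b) :- ((c :+ α :* c) :+ (g :+ f))) refl α a b a₀ g f)
                     (+-congʳ (sym (trans (reflexive eq) (+-congˡ (reflexive eq′)))))) w′

      opaque
        -- Among at most c translates, the most popular one receives a proportion of at least 1/c of
        -- Y.
        refine : ∀ (Y : List Carrier) {y₀} → y₀ ∈ Y → (ψ : Carrier → Carrier) (G : List Carrier) {c : ℕ} → length G ℕ.≤ c →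
          (∀ {y} → y ∈ Y → ∃[ g ] (g ∈ G × W (ψ y - g))) →
          ∃[ Y′ ] (Y′ ⊆ Y × ∃[ g ] ((∀ {y} → y ∈ Y′ → W (ψ y - g)) × size Y ℕ.≤ c ℕ.* size Y′))
        refine Y y₀∈ ψ G {c} len cov with maximiser (λ g → size (select (λ y → W (ψ y - g)) Y)) (proj₁ (proj₂ (cov y₀∈)))
        ... | g , g∈ , max = select (λ y → W (ψ y - g)) Y , (proj₁ ∘ ∈-select⁻) , g ,
          (proj₂ ∘ ∈-select⁻ {P = λ y → W (ψ y - g)}) ,
          ℕ.≤-trans (#-concat-≤ ≈E (λ g → select (λ y → W (ψ y - g)) Y) G
            (λ {y} y∈ → let (g , g∈ , w) = cov y∈ in g , g∈ , y , ∈-select⁺ y∈ w , refl))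
            (ℕ.≤-trans (sum-≤ G max) (ℕ.*-monoˡ-≤ _ len))

      W₂ : Carrier → Set
      W₂ x = ∃[ u ] ∃[ v ] (W u × W v × x ≈ u + v)

      Near : List Carrier → ℕ → Carrier → Set
      Near Y t x = ∀ {y} → y ∈ Y → W (fromNat t * y - x)

      Close : List Carrier → ℕ → Set
      Close Y t = ∀ {y y′} → y ∈ Y → y′ ∈ Y → W₂ (fromNat t * (y - y′))

      near⇒close : ∀ {x Y t} → Near Y t x → Close Y t
      near⇒close {x} {t = t} near {y} {y′} y∈ y′∈ = _ , _ , near y∈ , Diff-neg (near y′∈) ,
        solve 4 (λ t y y′ x → t :* (y :- y′) := (t :* y :- x) :+ :- (t :* y′ :- x)) refl (fromNat t) y y′ x

      private
        nonempty : ∀ {c} → 0 ℕ.< size X → size X ℕ.≤ c ℕ.* size Y → ∃[ y ] (y ∈ Y)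
        nonempty {Y = y ∷ Y} _ _ = y , here ≡.refl
        nonempty {Y = []} {c} p q = ⊥-elim (ℕ.<⇒≱ p (ℕ.≤-trans q (ℕ.≤-reflexive
          (≡.trans (≡.cong (c ℕ.*_) (size-empty {[]} (λ ()))) (ℕ.*-zeroʳ c)))))

      Multiples : List Carrier → ℕ → ℕ → List Carrier → Set
      Multiples Y M i Z = Z ⊆ Y × size Y ℕ.≤ κ ℕ.^ i ℕ.* size Z × (∃[ z ] Near Z (suc i ℕ.* M) z) ×
        (∀ j → j ℕ.≤ i → Close Z (suc j ℕ.* M))

      -- If M y and (i + 1) M y lie in fixed translates of W, their sum lies in a fixed translate of
      -- W + W, hence in one of κ translates of W. The most popular of these defines Z′.
      multiples-suc : ∀ {Y M x Z z₀} i → Near Y M x → z₀ ∈ Z → Multiples Y M i Z → ∃[ Z′ ] Multiples Y M (suc i) Z′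
      multiples-suc {Y} {M} {x} {Z} i near z₀∈ (Z⊆ , sz , (z , nearZ) , close) =
        Z′ , (λ p → Z⊆ (Z′⊆ p)) , sz″ , (g , nearZ′) , close′
        where
        cover : ∀ {y} → y ∈ Z → ∃[ g ] (g ∈ map ((x + z) +_) F₂ × W (fromNat (suc (suc i) ℕ.* M) * y - g))
        cover {y} y∈ = let (f , f∈ , w) = add (near (Z⊆ y∈)) (nearZ y∈) in
          (x + z) + f , ∈-map⁺ ((x + z) +_) f∈ , Diff-resp (trans
            (solve 6 (λ m n y x z f → ((m :* y :- x) :+ (n :* y :- z)) :- f := (m :+ n) :* y :- ((x :+ z) :+ f)) refl
               (fromNat M) (fromNat (suc i ℕ.* M)) y x z f)
            (+-congʳ (*-congʳ (sym (fromNat-+ M (suc i ℕ.* M)))))) w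
        refined : ∃[ Y′ ] (Y′ ⊆ Z × ∃[ g ] ((∀ {y} → y ∈ Y′ → W (fromNat (suc (suc i) ℕ.* M) * y - g)) × size Z ℕ.≤ κ ℕ.* size Y′))
        refined = refine Z z₀∈ (λ y → fromNat (suc (suc i) ℕ.* M) * y) (map ((x + z) +_) F₂)
          (ℕ.≤-trans (ℕ.≤-reflexive (length-map _ F₂)) F₂-length) cover
        Z′ = proj₁ refined
        Z′⊆ : Z′ ⊆ Z
        Z′⊆ = proj₁ (proj₂ refined)
        g = proj₁ (proj₂ (proj₂ refined))
        nearZ′ : Near Z′ (suc (suc i) ℕ.* M) g
        nearZ′ = proj₁ (proj₂ (proj₂ (proj₂ refined)))
        sz′ : size Z ℕ.≤ κ ℕ.* size Z′
        sz′ = proj₂ (proj₂ (proj₂ (proj₂ refined)))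
        open ℕ.≤-Reasoning
        sz″ : size Y ℕ.≤ κ ℕ.^ suc i ℕ.* size Z′
        sz″ = begin
          size Y                             ≤⟨ sz ⟩
          κ ℕ.^ i ℕ.* size Z                 ≤⟨ ℕ.*-monoʳ-≤ (κ ℕ.^ i) sz′ ⟩
          κ ℕ.^ i ℕ.* (κ ℕ.* size Z′)        ≡⟨ ≡.sym (ℕ.*-assoc (κ ℕ.^ i) κ _) ⟩
          κ ℕ.^ i ℕ.* κ ℕ.* size Z′          ≡⟨ ≡.cong (ℕ._* size Z′) (ℕ.*-comm (κ ℕ.^ i) κ) ⟩
          κ ℕ.^ suc i ℕ.* size Z′            ∎
        close-split : ∀ {j} → j ℕ.< suc i ⊎ j ≡ suc i → Close Z′ (suc j ℕ.* M)
        close-split (inj₁ j<)     y∈ y′∈ = close _ (ℕ.≤-pred j<) (Z′⊆ y∈) (Z′⊆ y′∈)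
        close-split (inj₂ ≡.refl)        = near⇒close {x = g} {Y = Z′} {t = suc (suc i) ℕ.* M} nearZ′
        close′ : ∀ j → j ℕ.≤ suc i → Close Z′ (suc j ℕ.* M)
        close′ j j≤ = close-split (ℕ.m≤n⇒m<n∨m≡n j≤)

      opaque
        multiples : ∀ Y M x → 0 ℕ.< size Y → Near Y M x → ∀ i → ∃[ Z ] Multiples Y M i Z
        multiples Y M x 0<Y near zero = Y , (λ p → p) , ℕ.≤-reflexive (≡.sym (ℕ.+-identityʳ _)) , (x , near₁) ,
          λ { .0 z≤n → near⇒close {x = x} {Y = Y} {t = 1 ℕ.* M} near₁ }
          where
          near₁ : Near Y (1 ℕ.* M) x
          near₁ = ≡.subst (λ t → Near Y t x) (≡.sym (ℕ.+-identityʳ M)) near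
        multiples Y M x 0<Y near (suc i) =
          let (Z , m) = multiples Y M x 0<Y near i
          in multiples-suc {Y} {M} {x} {Z} i near (proj₂ (nonempty {c = κ ℕ.^ i} 0<Y (proj₁ (proj₂ m)))) m

      module _ (b′ : ℕ) where
        private
          b = suc b′

        level-size : ∀ J {Y Z} → size A ℕ.≤ (κ ℕ.^ b′) ℕ.^ J ℕ.* size Y → size Y ℕ.≤ κ ℕ.^ b′ ℕ.* size Z →
          size A ℕ.≤ (κ ℕ.^ b′) ℕ.^ suc J ℕ.* size Z
        level-size J {Y} {Z} sz sz′ = begin
          size A                        ≤⟨ sz ⟩
          k ℕ.^ J ℕ.* size Y            ≤⟨ ℕ.*-monoʳ-≤ (k ℕ.^ J) sz′ ⟩
          k ℕ.^ J ℕ.* (k ℕ.* size Z)    ≡⟨ ≡.sym (ℕ.*-assoc (k ℕ.^ J) k _) ⟩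
          k ℕ.^ J ℕ.* k ℕ.* size Z      ≡⟨ ≡.cong (ℕ._* size Z) (ℕ.*-comm (k ℕ.^ J) k) ⟩
          k ℕ.^ suc J ℕ.* size Z        ∎
          where
          open ℕ.≤-Reasoning
          k = κ ℕ.^ b′

        level-close : ∀ {J Y Z} → (∀ j → j ℕ.< J → ∀ i → i ℕ.< b → Close Y (i ℕ.* b ℕ.^ j)) → Z ⊆ Y →
          (∀ i → i ℕ.≤ b′ → Close Z (suc i ℕ.* b ℕ.^ J)) → ∀ {j} i → i ℕ.< b → j ℕ.< J ⊎ j ≡ J → Close Z (i ℕ.* b ℕ.^ j)
        level-close close Z⊆ close′ i       i<b (inj₁ j<J)    y∈ y′∈ = close _ j<J i i<b (Z⊆ y∈) (Z⊆ y′∈)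
        level-close close Z⊆ close′ zero    i<b (inj₂ ≡.refl) y∈ y′∈ = 0# , 0# , W-0 , W-0 , trans (zeroˡ _) (sym (+-identityˡ 0#))
        level-close close Z⊆ close′ (suc i) i<b (inj₂ ≡.refl)        = close′ i (ℕ.≤-trans (ℕ.n≤1+n i) (ℕ.≤-pred i<b))

        opaque
          -- Working in base b keeps the loss small. Each level takes b′ refinements at the price of
          -- a factor κ, so Z retains a proportion κ^(-b′J) of A, while the multiples i bʲ obtained
          -- suffice to compose every t < bᴶ from its digits.
          levels : ∀ J → ∃[ Z ] (size A ℕ.≤ (κ ℕ.^ b′) ℕ.^ J ℕ.* size Z × (∃[ z ] Near Z (b ℕ.^ J) z) ×
            (∀ j → j ℕ.< J → ∀ i → i ℕ.< b → Close Z (i ℕ.* b ℕ.^ j)))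
          levels zero = A , ℕ.≤-reflexive (≡.sym (ℕ.+-identityʳ _)) , (a₀ , λ {y} y∈ → y , a₀ , y∈ , a₀∈ , +-congʳ (trans (*-congʳ fromNat-1) (*-identityˡ y))) ,
            λ _ ()
          levels (suc J) =
            let (Y , sz , (z , near) , close) = levels J
                (Z , Z⊆ , sz′ , (z′ , near′) , close′) =
                  multiples Y (b ℕ.^ J) z (#-pos ≈E (proj₂ (nonempty {X = A} {c = (κ ℕ.^ b′) ℕ.^ J} 0<N sz))) near b′
            in Z , level-size J sz sz′ , (z′ , near′) , λ j j< i i< → level-close close Z⊆ close′ i i< (ℕ.m≤n⇒m<n∨m≡n (ℕ.≤-pred j<))

        opaque
          -- The lower bound on the size of A leaves at least two elements in the last level; e is
          -- their difference.
          step : ∀ J → (κ ℕ.^ b′) ℕ.^ J ℕ.< size A →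
            ∃[ e ] (¬ (e ≈ 0#) × (∀ j → j ℕ.< J → ∀ i → i ℕ.< b → W₂ (fromNat (i ℕ.* b ℕ.^ j) * e)))
          step J lt =
            let (Z , sz , _ , close) = levels J
                (y , y′ , y∈ , y′∈ , y≉y′) = two-elements {Z} (ℕ.≰⇒> (λ Z≤1 → ℕ.<⇒≱ lt
                  (ℕ.≤-trans sz (ℕ.≤-trans (ℕ.*-monoʳ-≤ ((κ ℕ.^ b′) ℕ.^ J) Z≤1) (ℕ.≤-reflexive (ℕ.*-identityʳ _))))))
            in y - y′ , (λ p → y≉y′ (x-y≈0⇒x≈y p)) , λ j j<J i i<b → close j j<J i i<b y∈ y′∈

        Progression : Carrier → ℕ → Carrier → Set
        Progression e B x = ∃[ t ] (t ℕ.< B × x ≈ fromNat t * e)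

        progression-cover-suc : ∀ {e F} B → .⦃ _ : NonZero B ⦄ → Covers F (Progression e B) →
          (∀ i → i ℕ.< b → W₂ (fromNat (i ℕ.* B) * e)) → Covers ((F +L F₂) +L F₂) (Progression e (b ℕ.* B))
        progression-cover-suc {e} {F} B cov close {x} (t , t< , p) =
          let i = t / B
              r = t % B
              (u , v , wu , wv , q) = close i (m<n*o⇒m/o<n t<)
              (f , f∈ , w) = cov (r , m%n<n t B , refl)
              (g , g∈ , w′) = add w wu
              (h , h∈ , w″) = add w′ wv
          in (f + g) + h , ∈-+L (∈-+L f∈ g∈) h∈ , Diff-resp (trans
               (solve 6 (λ r u v f g h → (((r :- f) :+ u) :- g) :+ v :- h := (r :+ (u :+ v)) :- ((f :+ g) :+ h)) refl
                  (fromNat r * e) u v f g h)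
               (+-congʳ (sym (trans p (trans (*-congʳ (trans (reflexive (≡.cong fromNat (m≡m%n+[m/n]*n t B))) (fromNat-+ r (i ℕ.* B))))
                  (trans (distribʳ e _ _) (+-congˡ q))))))) w″

        opaque
          -- Each base-b digit of t adds an element of W + W and hence two factors κ, so a
          -- progression of bᴶ terms fits into κ²ᴶ translates of W. For b = 2κ² there are 2ᴶ times
          -- more terms than translates.
          progression-cover : ∀ {e} J → (∀ j → j ℕ.< J → ∀ i → i ℕ.< b → W₂ (fromNat (i ℕ.* b ℕ.^ j) * e)) →
            ∃[ F ] (length F ℕ.≤ (κ ℕ.* κ) ℕ.^ J × Covers F (Progression e (b ℕ.^ J)))
          progression-cover {e} zero    close = [ 0# ] , ℕ.≤-refl , λ { (zero , _ , p) → 0# , here ≡.refl ,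
            Diff-resp (sym (trans (+-congʳ (trans p (zeroˡ e))) (-‿inverseʳ 0#))) W-0 ; (suc t , s≤s () , _) }
          progression-cover {e} (suc J) close =
            let (F , len , cov) = progression-cover J (λ j j<J → close j (ℕ.m≤n⇒m≤1+n j<J))
            in (F +L F₂) +L F₂ ,
              ℕ.≤-trans (length-+L-≤ {F +L F₂} (length-+L-≤ {F} len F₂-length) F₂-length)
                (ℕ.≤-reflexive (N.solve 2 (λ p k → p N.:* k N.:* k N.:= (k N.:* k) N.:* p) ≡.refl ((κ ℕ.* κ) ℕ.^ J) κ)) ,
              progression-cover-suc {e} {F} (b ℕ.^ J) ⦃ ℕ.m^n≢0 b J ⦄ cov (close J ℕ.≤-refl)

      size-W : size (A ⊖ A) ℕ.≤ κ ℕ.* N₀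
      size-W = ℕ.≤-trans (#-≤ ≈E ≈E (λ x y → x + a₀ ≈ y) hit
        (λ {x} {x′} _ _ p q y≈y′ → +-cancelʳ-≈ a₀ (trans p (trans y≈y′ (sym q))))) tripling
        where
        hit : x ∈ (A ⊖ A) → ∃[ y ] (y ∈ ((A ⊕ A ⊕ A) ⊖ (A ⊕ A)) × x + a₀ ≈ y)
        hit p = let (a , b , a∈ , b∈ , eq) = ⊖-∈ {A = A} p in _ , ∈-⊖ (∈-⊕ (∈-⊕ a∈ a₀∈) a₀∈) (∈-⊕ b∈ a₀∈) ,
          trans (+-congʳ (reflexive eq)) (solve 3 (λ a b c → (a :- b) :+ c := ((a :+ c) :+ c) :- (b :+ c)) refl a b a₀)

      -- Translates of 2ᴶ κ²ᴶ-term progressions with step αᵏe are disjoint along strings, but fit into few translates of W.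
      strings : ∀ J → (κ ℕ.^ (2 ℕ.* (κ ℕ.* κ))) ℕ.^ J ℕ.< size A →
        ∃[ e ] (¬ (e ≈ 0#) × (∀ k → # (String (α ^ k * e)) (A ⊕ α · A) ℕ.* 2 ℕ.^ J ℕ.≤
          κα ℕ.* κ ℕ.* κα ℕ.^ k ℕ.* κ ℕ.* κ ℕ.* size A))
      strings J lt = e , e≉0 , bound
        where
        c = 2 ℕ.* (κ ℕ.* κ)
        0<κ : 0 ℕ.< κ
        0<κ = ℕ.n≢0⇒n>0 (λ κ≡0 → ℕ.<⇒≱ (ℕ.≤-trans 0<N (size-⊖ a₀∈)) (ℕ.≤-trans size-W (ℕ.≤-reflexive (≡.cong (ℕ._* N₀) κ≡0))))
          where
          size-⊖ : ∀ {a} → a ∈ A → size A ℕ.≤ size (A ⊖ A)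
          size-⊖ {a} a∈ = #-≤ ≈E ≈E (λ x y → y ≡ x - a) (λ x∈ → _ , ∈-⊖ x∈ a∈ , ≡.refl)
            (λ { _ _ ≡.refl ≡.refl → +-cancelʳ-≈ (- a) })
        b′ = ℕ.pred c
        sb : suc b′ ≡ c
        sb = ℕ.suc-pred c ⦃ ℕ.>-nonZero (ℕ.≤-trans (ℕ.*-mono-≤ 0<κ 0<κ) (ℕ.m≤m+n (κ ℕ.* κ) _)) ⦄
        κ^b′ : (κ ℕ.^ b′) ℕ.^ J ℕ.< size A
        κ^b′ = ℕ.≤-<-trans (ℕ.^-monoˡ-≤ J (ℕ.^-monoʳ-≤ κ ⦃ ℕ.>-nonZero 0<κ ⦄ (ℕ.pred[n]≤n {c}))) lt
        e = proj₁ (step b′ J κ^b′)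
        e≉0 = proj₁ (proj₂ (step b′ J κ^b′))
        close = proj₂ (proj₂ (step b′ J κ^b′))
        B = suc b′ ℕ.^ J
        F = proj₁ (progression-cover b′ J close)
        F-length = proj₁ (proj₂ (progression-cover b′ J close))
        F-cover = proj₂ (proj₂ (progression-cover b′ J close))
        S = A ⊕ α · A
        bound : ∀ k → # (String (α ^ k * e)) S ℕ.* 2 ℕ.^ J ℕ.≤ κα ℕ.* κ ℕ.* κα ℕ.^ k ℕ.* κ ℕ.* κ ℕ.* size A
        bound k = *-cancel ((κ ℕ.* κ) ℕ.^ J) 0<P (begin
          P ℕ.* (T ℕ.* 2 ℕ.^ J)
            ≡⟨ N.solve 3 (λ p t w → p N.:* (t N.:* w) N.:= t N.:* (w N.:* p)) ≡.refl P T (2 ℕ.^ J) ⟩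
          T ℕ.* (2 ℕ.^ J ℕ.* P)
            ≤⟨ ℕ.*-monoʳ-≤ T (ℕ.≤-trans (ℕ.≤-reflexive (≡.trans (≡.sym (^-distribʳ-* J 2 (κ ℕ.* κ))) (≡.cong (ℕ._^ J) (≡.sym sb)))) upTo-B) ⟩
          T ℕ.* # ≡E (upTo B)            ≤⟨ #-product-≥ (String c′) ≡E ≈E (λ s t → s + fromNat t * c′) hit inj₁′ inj₂′ ⟩
          size (L ⊕ (A ⊖ A))            ≤⟨ size-⊕-length L (A ⊖ A) ⟩
          length L ℕ.* size (A ⊖ A)     ≤⟨ ℕ.*-mono-≤ lenL size-W ⟩
          κα ℕ.* κ ℕ.* P ℕ.* κα ℕ.^ k ℕ.* κ ℕ.* (κ ℕ.* N₀)
            ≡⟨ N.solve 5 (λ a q p h n → a N.:* q N.:* p N.:* h N.:* q N.:* (q N.:* n)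
                 N.:= p N.:* (a N.:* q N.:* h N.:* q N.:* q N.:* n)) ≡.refl κα κ P (κα ℕ.^ k) N₀ ⟩
          P ℕ.* (κα ℕ.* κ ℕ.* κα ℕ.^ k ℕ.* κ ℕ.* κ ℕ.* N₀)   ∎)
          where
          G = proj₁ sumset-cover
          H = proj₁ (αᵏ-cover k)
          open ℕ.≤-Reasoning
          c′ = α ^ k * e
          P = (κ ℕ.* κ) ℕ.^ J
          T = # (String c′) S
          0<P : 0 ℕ.< P
          0<P = ℕ.n≢0⇒n>0 (ℕ.≢-nonZero⁻¹ P ⦃ ℕ.m^n≢0 (κ ℕ.* κ) J ⦃ ℕ.>-nonZero (ℕ.*-mono-≤ 0<κ 0<κ) ⦄ ⦄)
          upTo-B : B ℕ.≤ # ≡E (upTo B)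
          upTo-B = ℕ.≤-trans (ℕ.≤-reflexive (≡.sym (length-upTo B))) (#-indep ≡E (Unique.upTo⁺ B))
          L = ((G +L map (α ^ k *_) F) +L H) +L F₂
          lenL : length L ℕ.≤ κα ℕ.* κ ℕ.* P ℕ.* κα ℕ.^ k ℕ.* κ
          lenL = length-+L-≤ {(G +L map (α ^ k *_) F) +L H} (length-+L-≤ {G +L map (α ^ k *_) F}
            (length-+L-≤ {G} (proj₁ (proj₂ sumset-cover)) (ℕ.≤-trans (ℕ.≤-reflexive (length-map _ F)) F-length)) (proj₁ (proj₂ (αᵏ-cover k)))) F₂-length
          hit : ∀ {s t} → s ∈ S → t ∈ upTo B → (s + fromNat t * c′) ∈[ ≈E ] (L ⊕ (A ⊖ A))
          hit {s} {t} s∈ t∈ =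
            let (g , g∈ , w₁) = proj₂ (proj₂ sumset-cover) s∈
                (f , f∈ , w₂) = F-cover (t , ∈-upTo⁻ t∈ , refl)
                (h , h∈ , w₃) = proj₂ (proj₂ (αᵏ-cover k)) (_ , w₂ , refl)
                (l , l∈ , (a , d , a∈ , d∈ , p)) = add w₁ w₃
            in _ , ∈-⊕ (∈-+L (∈-+L (∈-+L g∈ (∈-map⁺ (α ^ k *_) f∈)) h∈) l∈) (∈-⊖ a∈ d∈) ,
               trans (solve 5 (λ s g x h l → s :+ x := (g :+ h :+ l) :+ (((s :- g) :+ (x :- h)) :- l)) refl s g (fromNat t * c′) (α ^ k * f + h) l)
                 (+-cong (solve 4 (λ g y h l → g :+ (y :+ h) :+ l := ((g :+ y) :+ h) :+ l) refl g (α ^ k * f) h l)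
                   (trans (+-congʳ (+-congˡ (solve 5 (λ t q e f h → t :* (q :* e) :- (q :* f :+ h) := q :* (t :* e :- f) :- h)
                      refl (fromNat t) (α ^ k) e f h))) p))
          inj₁′ : ∀ {s t s′ t′} → s ∈ S → t ∈ upTo B → s′ ∈ S → t′ ∈ upTo B →
            s + fromNat t * c′ ≈ s′ + fromNat t′ * c′ → _~_ (String c′) s s′
          inj₁′ {s} {t} {s′} {t′} _ _ _ _ p = (ℤ.+ t′ ℤ.- ℤ.+ t) ,
            trans (solve 4 (λ s s′ t c → s :- s′ := (s :+ t :* c) :- s′ :- t :* c) refl s s′ (fromNat t) c′)
              (trans (+-congʳ (+-congʳ p)) (trans
                (solve 4 (λ s′ t t′ c → (s′ :+ t′ :* c) :- s′ :- t :* c := (t′ :- t) :* c) refl s′ (fromNat t) (fromNat t′) c′)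
                (*-congʳ (sym (trans (fromInt-+ (ℤ.+ t′) (ℤ.- (ℤ.+ t))) (+-congˡ (fromInt-neg (ℤ.+ t))))))))
          c′≉0 : ¬ (c′ ≈ 0#)
          c′≉0 p = e≉0 (*-zero-factor p (^-≉0 k α≉0))
          inj₂′ : ∀ {s t t′} → s + fromNat t * c′ ≈ s + fromNat t′ * c′ → t ≡ t′
          inj₂′ {s} {t} {t′} p = ℕ.≤-antisym (le p) (le (sym p))
            where
            le : ∀ {t t′} → s + fromNat t * c′ ≈ s + fromNat t′ * c′ → t ℕ.≤ t′
            le {t} {t′} p = fromNat-cancel (≤-reflexive (*-cancelˡ-≈ c′≉0
              (trans (*-comm c′ _) (trans (+-cancelˡ-≈ s p) (*-comm _ c′)))))

  -- Integer polynomials and Gauss's lemma.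

  module Polynomial where

    open Reals R hiding (_⊕_; _·_)
    open import Data.Nat.ListAction using (product)
    open import Data.Nat.Primality.Factorisation using (factorise)
    open Field
    open import Data.Integer.Divisibility.Signed using (divides; ∣ᵤ⇒∣; ∣⇒∣ᵤ; ∣m+n∣m⇒∣n; ∣m⇒∣m*n) renaming (_∣_ to _∣ℤ_)
    open import Data.Integer.Solver using () renaming (module +-*-Solver to Z)

    -- The coefficient of degree n is at position n; missing coefficients are zero.
    Poly : Set
    Poly = List ℤ

    infixl 9 _!_
    _!_ : Poly → ℕ → ℤ
    []      ! n     = 0ℤ
    (a ∷ f) ! zero  = a
    (a ∷ f) ! suc n = f ! n

    infixl 6 _⊞_
    _⊞_ : Poly → Poly → Poly
    []      ⊞ g       = g
    (a ∷ f) ⊞ []      = a ∷ f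
    (a ∷ f) ⊞ (b ∷ g) = (a ℤ.+ b) ∷ (f ⊞ g)

    infixr 7 _⊡_
    _⊡_ : ℤ → Poly → Poly
    c ⊡ []      = []
    c ⊡ (a ∷ f) = c ℤ.* a ∷ c ⊡ f

    infixl 7 _⊠_
    _⊠_ : Poly → Poly → Poly
    p ⊠ []      = []
    p ⊠ (a ∷ h) = a ⊡ p ⊞ (0ℤ ∷ p ⊠ h)

    ⊞-! : ∀ f g n → (f ⊞ g) ! n ≡ f ! n ℤ.+ g ! n
    ⊞-! []      g       n       = ≡.sym (ℤ.+-identityˡ _)
    ⊞-! (a ∷ f) []      n       = ≡.sym (ℤ.+-identityʳ _)
    ⊞-! (a ∷ f) (b ∷ g) zero    = ≡.refl
    ⊞-! (a ∷ f) (b ∷ g) (suc n) = ⊞-! f g n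

    ⊡-! : ∀ c f n → (c ⊡ f) ! n ≡ c ℤ.* f ! n
    ⊡-! c []      n       = ≡.sym (ℤ.*-zeroʳ c)
    ⊡-! c (a ∷ f) zero    = ≡.refl
    ⊡-! c (a ∷ f) (suc n) = ⊡-! c f n

    ⊠-!zero : ∀ p h → (p ⊠ h) ! 0 ≡ p ! 0 ℤ.* h ! 0
    ⊠-!zero p []      = ≡.sym (ℤ.*-zeroʳ (p ! 0))
    ⊠-!zero p (a ∷ h) = ≡.trans (⊞-! (a ⊡ p) _ 0)
      (≡.trans (ℤ.+-identityʳ _) (≡.trans (⊡-! a p 0) (ℤ.*-comm a _)))

    ⊠-!suc : ∀ p a h n → (p ⊠ (a ∷ h)) ! suc n ≡ a ℤ.* p ! suc n ℤ.+ (p ⊠ h) ! n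
    ⊠-!suc p a h n = ≡.trans (⊞-! (a ⊡ p) _ (suc n)) (≡.cong (ℤ._+ _) (⊡-! a p (suc n)))

    ⊠-∷ : ∀ a p h n → ((a ∷ p) ⊠ h) ! suc n ≡ a ℤ.* h ! suc n ℤ.+ (p ⊠ h) ! n
    ⊠-∷ a p []      n       = ≡.sym (≡.trans (ℤ.+-identityʳ _) (ℤ.*-zeroʳ a))
    ⊠-∷ a p (b ∷ h) zero    = begin
      ((a ∷ p) ⊠ (b ∷ h)) ! 1                     ≡⟨ ⊠-!suc (a ∷ p) b h 0 ⟩
      b ℤ.* p ! 0 ℤ.+ ((a ∷ p) ⊠ h) ! 0           ≡⟨ ≡.cong (λ u → b ℤ.* p ! 0 ℤ.+ u) (⊠-!zero (a ∷ p) h) ⟩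
      b ℤ.* p ! 0 ℤ.+ a ℤ.* h ! 0                 ≡⟨ ℤ.+-comm (b ℤ.* p ! 0) _ ⟩
      a ℤ.* h ! 0 ℤ.+ b ℤ.* p ! 0                 ≡⟨ ≡.cong (λ u → a ℤ.* h ! 0 ℤ.+ u) (≡.trans (ℤ.*-comm b (p ! 0)) (≡.sym (⊠-!zero p (b ∷ h)))) ⟩
      a ℤ.* h ! 0 ℤ.+ (p ⊠ (b ∷ h)) ! 0           ∎
      where open ≡.≡-Reasoning
    ⊠-∷ a p (b ∷ h) (suc n) = begin
      ((a ∷ p) ⊠ (b ∷ h)) ! suc (suc n)                       ≡⟨ ⊠-!suc (a ∷ p) b h (suc n) ⟩
      b ℤ.* p ! suc n ℤ.+ ((a ∷ p) ⊠ h) ! suc n               ≡⟨ ≡.cong (λ u → b ℤ.* p ! suc n ℤ.+ u) (⊠-∷ a p h n) ⟩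
      b ℤ.* p ! suc n ℤ.+ (a ℤ.* h ! suc n ℤ.+ (p ⊠ h) ! n)
        ≡⟨ Z.solve 3 (λ x y z → x Z.:+ (y Z.:+ z) Z.:= y Z.:+ (x Z.:+ z)) ≡.refl (b ℤ.* p ! suc n) (a ℤ.* h ! suc n) ((p ⊠ h) ! n) ⟩
      a ℤ.* h ! suc n ℤ.+ (b ℤ.* p ! suc n ℤ.+ (p ⊠ h) ! n)   ≡⟨ ≡.cong (λ u → a ℤ.* h ! suc n ℤ.+ u) (⊠-!suc p b h n) ⟨
      a ℤ.* h ! suc n ℤ.+ (p ⊠ (b ∷ h)) ! suc n               ∎
      where open ≡.≡-Reasoning

    ⊠-⊡ : ∀ p c h n → (p ⊠ (c ⊡ h)) ! n ≡ c ℤ.* (p ⊠ h) ! n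
    ⊠-⊡ p c []      n       = ≡.sym (ℤ.*-zeroʳ c)
    ⊠-⊡ p c (a ∷ h) zero    = ≡.trans (⊠-!zero p (c ⊡ (a ∷ h))) (≡.trans
      (Z.solve 3 (λ p c a → p Z.:* (c Z.:* a) Z.:= c Z.:* (p Z.:* a)) ≡.refl (p ! 0) c a)
      (≡.cong (c ℤ.*_) (≡.sym (⊠-!zero p (a ∷ h)))))
    ⊠-⊡ p c (a ∷ h) (suc n) = begin
      (p ⊠ (c ⊡ (a ∷ h))) ! suc n                       ≡⟨ ⊠-!suc p (c ℤ.* a) (c ⊡ h) n ⟩
      c ℤ.* a ℤ.* p ! suc n ℤ.+ (p ⊠ (c ⊡ h)) ! n       ≡⟨ ≡.cong (λ u → c ℤ.* a ℤ.* p ! suc n ℤ.+ u) (⊠-⊡ p c h n) ⟩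
      c ℤ.* a ℤ.* p ! suc n ℤ.+ c ℤ.* (p ⊠ h) ! n
        ≡⟨ Z.solve 4 (λ c a x y → c Z.:* a Z.:* x Z.:+ c Z.:* y Z.:= c Z.:* (a Z.:* x Z.:+ y)) ≡.refl c a (p ! suc n) ((p ⊠ h) ! n) ⟩
      c ℤ.* (a ℤ.* p ! suc n ℤ.+ (p ⊠ h) ! n)           ≡⟨ ≡.cong (c ℤ.*_) (⊠-!suc p a h n) ⟨
      c ℤ.* (p ⊠ (a ∷ h)) ! suc n                       ∎
      where open ≡.≡-Reasoning

    infix 4 _∣ᴾ_
    _∣ᴾ_ : ℕ → Poly → Set
    q ∣ᴾ f = ∀ n → (ℤ.+ q) ∣ℤ f ! n

    prime-∣* : ∀ {q} → Prime q → ∀ i j → (ℤ.+ q) ∣ℤ i ℤ.* j → (ℤ.+ q) ∣ℤ i ⊎ (ℤ.+ q) ∣ℤ j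
    prime-∣* {q} pr i j d with euclidsLemma ℤ.∣ i ∣ ℤ.∣ j ∣ pr (≡.subst (q ℕ.∣_) (ℤ.abs-* i j) (∣⇒∣ᵤ d))
    ... | inj₁ e = inj₁ (∣ᵤ⇒∣ e)
    ... | inj₂ e = inj₂ (∣ᵤ⇒∣ e)

    -- Everything is read off from the low end. A constant term of p divisible by q is dropped from
    -- p; otherwise q divides the constant term of h, which is dropped from h.
    gauss : ∀ {q} → Prime q → ∀ p h → q ∣ᴾ p ⊠ h → ¬ (q ∣ᴾ p) → q ∣ᴾ h
    gauss pr []      h d ¬p = ⊥-elim (¬p (λ n → divides 0ℤ ≡.refl))
    gauss {q} pr (a ∷ p) h d ¬p with em {(ℤ.+ q) ∣ℤ a}
    ... | yes q∣a = gauss pr p h (λ n → ∣m+n∣m⇒∣n (≡.subst (_ ∣ℤ_) (⊠-∷ a p h n) (d (suc n))) (∣m⇒∣m*n (h ! suc n) q∣a))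
                      (λ q∣p → ¬p λ { zero → q∣a ; (suc n) → q∣p n })
    ... | no  q∤a = go h d
      where
      go : ∀ h → q ∣ᴾ (a ∷ p) ⊠ h → q ∣ᴾ h
      go []      d n       = divides 0ℤ ≡.refl
      go (b ∷ h) d n with prime-∣* pr a b (≡.subst (_ ∣ℤ_) (⊠-!zero (a ∷ p) (b ∷ h)) (d 0))
      ... | inj₁ q∣a = ⊥-elim (q∤a q∣a)
      go (b ∷ h) d zero    | inj₂ q∣b = q∣b
      go (b ∷ h) d (suc n) | inj₂ q∣b =
        go h (λ n → ∣m+n∣m⇒∣n (≡.subst (_ ∣ℤ_) (⊠-!suc (a ∷ p) b h n) (d (suc n))) (∣m⇒∣m*n (p ! n) q∣b)) n

    divide : ∀ {q} h → q ∣ᴾ h → ∃[ g ] (h ≡ (ℤ.+ q) ⊡ g)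
    divide []      d = [] , ≡.refl
    divide {q} (a ∷ h) d with d 0 | divide h (λ n → d (suc n))
    ... | divides b eq | g , eq′ = b ∷ g , ≡.cong₂ _∷_ (≡.trans eq (ℤ.*-comm b (ℤ.+ q))) eq′

    prime-divisor : ∀ n → 2 ℕ.≤ n → ∃[ q ] (Prime q × q ℕ.∣ n)
    prime-divisor n@(suc _) 2≤n with factorise n
    ... | record { factors = []     ; isFactorisation = eq } = ⊥-elim (ℕ.<-irrefl (≡.sym eq) 2≤n)
    ... | record { factors = q ∷ qs ; isFactorisation = eq ; factorsPrime = pr ∷ _ } =
      q , pr , ≡.subst (q ℕ.∣_) (≡.sym eq) (ℕ.m∣m*n (product qs))

    Primitive : Poly → Set
    Primitive p = ∀ q → Prime q → ¬ (q ∣ᴾ p)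

    -- Induction on ∣c∣: by Gauss's lemma a prime factor of c divides h and can be cancelled, until
    -- c = ±1 and the constant terms can be compared directly.
    constant-∣ : ∀ {p} → Primitive p → ∀ c {f h} → c ≢ 0ℤ → (∀ n → c ℤ.* f ! n ≡ (p ⊠ h) ! n) → p ! 0 ∣ℤ f ! 0
    constant-∣ {p} prim c {f₁} {h₁} c≢0 eq = go ℤ.∣ c ∣ {c} {f₁} {h₁} ℕ.≤-refl c≢0 eq
      where
      go : ∀ k {c f h} → ℤ.∣ c ∣ ℕ.≤ k → c ≢ 0ℤ → (∀ n → c ℤ.* f ! n ≡ (p ⊠ h) ! n) → p ! 0 ∣ℤ f ! 0
      go zero    {c} le c≢0 eq = ⊥-elim (c≢0 (ℤ.∣i∣≡0⇒i≡0 (ℕ.n≤0⇒n≡0 le)))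
      go (suc k) {c} {f} {h} le c≢0 eq with ℤ.∣ c ∣ ℕ.≤? 1
      ... | yes ≤1 = ∣ᵤ⇒∣ (≡.subst (ℤ.∣ p ! 0 ∣ ℕ.∣_) abs-eq (∣⇒∣ᵤ (∣m⇒∣m*n {p ! 0} (h ! 0) (divides 1ℤ (≡.sym (ℤ.*-identityˡ _))))))
        where
        ∣c∣≡1 : ℤ.∣ c ∣ ≡ 1
        ∣c∣≡1 = ℕ.≤-antisym ≤1 (ℕ.n≢0⇒n>0 (λ z → c≢0 (ℤ.∣i∣≡0⇒i≡0 z)))
        abs-eq : ℤ.∣ p ! 0 ℤ.* h ! 0 ∣ ≡ ℤ.∣ f ! 0 ∣
        abs-eq = ≡.trans (≡.cong ℤ.∣_∣ (≡.trans (≡.sym (⊠-!zero p h)) (≡.sym (eq 0))))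
          (≡.trans (ℤ.abs-* c (f ! 0)) (≡.trans (≡.cong (ℕ._* _) ∣c∣≡1) (ℕ.*-identityˡ _)))
      ... | no ¬≤1 = let (q , pr , q∣c) = prime-divisor ℤ.∣ c ∣ (ℕ.≰⇒> ¬≤1) in descend q pr (∣ᵤ⇒∣ q∣c)
        where
        descend : ∀ q → Prime q → (ℤ.+ q) ∣ℤ c → p ! 0 ∣ℤ f ! 0
        descend q pr q∣c@(divides c′ eqc) = go k {c′} {f} {proj₁ divh} le′ c′≢0 eq′
          where
          divh : ∃[ g ] (h ≡ (ℤ.+ q) ⊡ g)
          divh = divide h (gauss pr p h (λ n → ≡.subst ((ℤ.+ q) ∣ℤ_) (eq n) (∣m⇒∣m*n (f ! n) q∣c)) (prim q pr))
          instance
            q≢0 : ℤ.NonZero (ℤ.+ q)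
            q≢0 = ℕ.nonTrivial⇒nonZero q ⦃ prime⇒nonTrivial pr ⦄
          c′≢0 : c′ ≢ 0ℤ
          c′≢0 c′≡0 = c≢0 (≡.trans eqc (≡.cong (ℤ._* (ℤ.+ q)) c′≡0))
          le′ : ℤ.∣ c′ ∣ ℕ.≤ k
          le′ = ℕ.≤-pred (ℕ.≤-trans (begin-strict
            ℤ.∣ c′ ∣               <⟨ ℕ.m<m*n ℤ.∣ c′ ∣ q ⦃ ℕ.≢-nonZero (λ z → c′≢0 (ℤ.∣i∣≡0⇒i≡0 z)) ⦄ (ℕ.nonTrivial⇒n>1 q ⦃ prime⇒nonTrivial pr ⦄) ⟩
            ℤ.∣ c′ ∣ ℕ.* q         ≡⟨ ℤ.abs-* c′ (ℤ.+ q) ⟨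
            ℤ.∣ c′ ℤ.* (ℤ.+ q) ∣   ≡⟨ ≡.cong ℤ.∣_∣ eqc ⟨
            ℤ.∣ c ∣                ∎) le)
            where open ℕ.≤-Reasoning
          eq′ : ∀ n → c′ ℤ.* f ! n ≡ (p ⊠ proj₁ divh) ! n
          eq′ n = ℤ.*-cancelˡ-≡ (ℤ.+ q) _ _ (begin
            ℤ.+ q ℤ.* (c′ ℤ.* f ! n)          ≡⟨ Z.solve 3 (λ q c x → q Z.:* (c Z.:* x) Z.:= c Z.:* q Z.:* x) ≡.refl (ℤ.+ q) c′ (f ! n) ⟩
            c′ ℤ.* ℤ.+ q ℤ.* f ! n            ≡⟨ ≡.cong (ℤ._* f ! n) eqc ⟨
            c ℤ.* f ! n                       ≡⟨ eq n ⟩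
            (p ⊠ h) ! n                       ≡⟨ ≡.cong (λ h → (p ⊠ h) ! n) (proj₂ divh) ⟩
            (p ⊠ (ℤ.+ q ⊡ proj₁ divh)) ! n    ≡⟨ ⊠-⊡ p (ℤ.+ q) (proj₁ divh) n ⟩
            ℤ.+ q ℤ.* (p ⊠ proj₁ divh) ! n    ∎)
            where open ≡.≡-Reasoning

    ⟦_⟧ : Poly → Carrier → Carrier
    ⟦ [] ⟧    x = 0#
    ⟦ a ∷ f ⟧ x = fromInt a + x * ⟦ f ⟧ x

    ⟦⊞⟧ : ∀ f g x → ⟦ f ⊞ g ⟧ x ≈ ⟦ f ⟧ x + ⟦ g ⟧ x
    ⟦⊞⟧ []      g       x = sym (+-identityˡ _)
    ⟦⊞⟧ (a ∷ f) []      x = sym (+-identityʳ _)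
    ⟦⊞⟧ (a ∷ f) (b ∷ g) x = trans (+-cong (fromInt-+ a b) (*-congˡ (⟦⊞⟧ f g x)))
      (solve 5 (λ a b x f g → (a :+ b) :+ x :* (f :+ g) := (a :+ x :* f) :+ (b :+ x :* g)) refl (fromInt a) (fromInt b) x (⟦ f ⟧ x) (⟦ g ⟧ x))

    ⟦⊡⟧ : ∀ c f x → ⟦ c ⊡ f ⟧ x ≈ fromInt c * ⟦ f ⟧ x
    ⟦⊡⟧ c []      x = sym (zeroʳ _)
    ⟦⊡⟧ c (a ∷ f) x = trans (+-cong (fromInt-* c a) (*-congˡ (⟦⊡⟧ c f x)))
      (solve 4 (λ c a x f → c :* a :+ x :* (c :* f) := c :* (a :+ x :* f)) refl (fromInt c) (fromInt a) x (⟦ f ⟧ x))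

    ⟦++⟧ : ∀ f g x → ⟦ f ++ g ⟧ x ≈ ⟦ f ⟧ x + x ^ length f * ⟦ g ⟧ x
    ⟦++⟧ []      g x = sym (trans (+-identityˡ _) (*-identityˡ _))
    ⟦++⟧ (a ∷ f) g x = trans (+-congˡ (*-congˡ (⟦++⟧ f g x)))
      (solve 5 (λ a x f g P → a :+ x :* (f :+ P :* g) := (a :+ x :* f) :+ (x :* P) :* g) refl (fromInt a) x (⟦ f ⟧ x) (⟦ g ⟧ x) (x ^ length f))

    length-⊞ : ∀ {n} f g → length f ℕ.≤ n → length g ℕ.≤ n → length (f ⊞ g) ℕ.≤ n
    length-⊞ []      g       p q = q
    length-⊞ (a ∷ f) []      p q = p
    length-⊞ (a ∷ f) (b ∷ g) (s≤s p) (s≤s q) = s≤s (length-⊞ f g p q)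

    length-⊡ : ∀ c f → length (c ⊡ f) ≡ length f
    length-⊡ c []      = ≡.refl
    length-⊡ c (a ∷ f) = ≡.cong suc (length-⊡ c f)

    -- The low coefficient is kept apart because residues modulo multiplication by x are governed by
    -- it. The role of a_d is then played by the low coefficient of the minimal polynomial of the
    -- inverse of x.
    record Minimal (x : Carrier) (d : ℕ) (a₀ : ℤ) (p : Poly) : Set where
      field
        x≉0       : ¬ (x ≈ 0#)
        a₀≢0      : a₀ ≢ 0ℤ
        length-p  : length p ≡ d
        root      : ⟦ a₀ ∷ p ⟧ x ≈ 0#
        minimal   : ∀ f → length f ℕ.≤ d → ⟦ f ⟧ x ≈ 0# → ∀ n → f ! n ≡ 0ℤ
        isPrimitive : Primitive (a₀ ∷ p)

      -- Division from the low end: a₀ f = f₀ p + x g.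
      quotient : Poly → Poly
      quotient []      = []
      quotient (b ∷ f) = a₀ ⊡ f ⊞ (ℤ.- b) ⊡ p

      ⟦quotient⟧ : ∀ f → fromInt a₀ * ⟦ f ⟧ x ≈ x * ⟦ quotient f ⟧ x
      ⟦quotient⟧ []      = trans (zeroʳ _) (sym (zeroʳ _))
      ⟦quotient⟧ (b ∷ f) = trans (solve 5 (λ a b x f p → a :* (b :+ x :* f) := x :* (a :* f :- b :* p) :+ b :* (a :+ x :* p)) refl
          (fromInt a₀) (fromInt b) x (⟦ f ⟧ x) (⟦ p ⟧ x))
        (trans (+-congˡ (trans (*-congˡ root) (zeroʳ _))) (trans (+-identityʳ _) (*-congˡ (sym
          (trans (⟦⊞⟧ (a₀ ⊡ f) ((ℤ.- b) ⊡ p) x) (+-cong (⟦⊡⟧ a₀ f x)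
            (trans (⟦⊡⟧ (ℤ.- b) p x) (trans (*-congʳ (fromInt-neg b))
              (solve 2 (λ b p → (:- b) :* p := :- (b :* p)) refl (fromInt b) (⟦ p ⟧ x))))))))))

      length-quotient : ∀ {n} f → length f ℕ.≤ suc n → d ℕ.≤ n → length (quotient f) ℕ.≤ n
      length-quotient []      _       _ = z≤n
      length-quotient {n} (b ∷ f) (s≤s q) d≤n = length-⊞ (a₀ ⊡ f) _
        (≡.subst (ℕ._≤ n) (≡.sym (length-⊡ a₀ f)) q)
        (≡.subst (ℕ._≤ n) (≡.sym (≡.trans (length-⊡ (ℤ.- b) p) length-p)) d≤n)

      quotient-! : ∀ b f n → (quotient (b ∷ f)) ! n ≡ a₀ ℤ.* f ! n ℤ.- b ℤ.* p ! n
      quotient-! b f n = ≡.trans (⊞-! (a₀ ⊡ f) _ n) (≡.cong₂ ℤ._+_ (⊡-! a₀ f n)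
        (≡.trans (⊡-! (ℤ.- b) p n) (≡.sym (ℤ.neg-distribˡ-* b (p ! n)))))

      -- `quotient` shortens a polynomial that vanishes at x until minimality makes it zero; the
      -- factors a₀ of the successive divisions accumulate in c.
      multiple : ∀ k f → length f ℕ.≤ k → ⟦ f ⟧ x ≈ 0# → ∃[ c ] ∃[ h ] (c ≢ 0ℤ × (∀ n → c ℤ.* f ! n ≡ ((a₀ ∷ p) ⊠ h) ! n))
      multiple k f le eq with length f ℕ.≤? d
      multiple k f le eq | yes len = 1ℤ , [] , (λ ()) , λ n → ≡.trans (ℤ.*-identityˡ _) (minimal f len eq n)
      multiple k [] le eq | no ¬len = ⊥-elim (¬len z≤n)
      multiple (suc k) (b ∷ f) le eq | no ¬len
        with multiple k (quotient (b ∷ f)) (length-quotient (b ∷ f) le (ℕ.≤-pred (ℕ.≤-trans (ℕ.≰⇒> ¬len) le)))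
               (*-zero-factor {x} (trans (sym (⟦quotient⟧ (b ∷ f))) (trans (*-congˡ eq) (zeroʳ _))) x≉0)
      ... | c , h , c≢0 , eqh = c ℤ.* a₀ , c ℤ.* b ∷ h , (λ z → nonzero (ℤ.i*j≡0⇒i≡0∨j≡0 c z)) , eq′
        where
        nonzero : c ≡ 0ℤ ⊎ a₀ ≡ 0ℤ → ⊥
        nonzero (inj₁ z) = c≢0 z
        nonzero (inj₂ z) = a₀≢0 z
        open ≡.≡-Reasoning
        eq′ : ∀ n → c ℤ.* a₀ ℤ.* (b ∷ f) ! n ≡ ((a₀ ∷ p) ⊠ (c ℤ.* b ∷ h)) ! n
        eq′ zero    = ≡.trans (Z.solve 3 (λ c a b → c Z.:* a Z.:* b Z.:= a Z.:* (c Z.:* b)) ≡.refl c a₀ b)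
                        (≡.sym (⊠-!zero (a₀ ∷ p) (c ℤ.* b ∷ h)))
        eq′ (suc n) = begin
          c ℤ.* a₀ ℤ.* f ! n
            ≡⟨ Z.solve 5 (λ c a b x y → c Z.:* a Z.:* x Z.:= c Z.:* b Z.:* y Z.:+ c Z.:* (a Z.:* x Z.:- b Z.:* y)) ≡.refl c a₀ b (f ! n) (p ! n) ⟩
          c ℤ.* b ℤ.* p ! n ℤ.+ c ℤ.* (a₀ ℤ.* f ! n ℤ.- b ℤ.* p ! n)
            ≡⟨ ≡.cong (λ u → c ℤ.* b ℤ.* p ! n ℤ.+ u) (≡.trans (≡.cong (c ℤ.*_) (≡.sym (quotient-! b f n))) (eqh n)) ⟩
          c ℤ.* b ℤ.* p ! n ℤ.+ ((a₀ ∷ p) ⊠ h) ! n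
            ≡⟨ ⊠-!suc (a₀ ∷ p) (c ℤ.* b) h n ⟨
          ((a₀ ∷ p) ⊠ (c ℤ.* b ∷ h)) ! suc n ∎

      -- The arithmetic source of ∣a₀∣: two polynomials with the same value at x have constant terms
      -- congruent modulo a₀, so a lowest digit below ∣a₀∣ is determined by the value.
      constant-divides : ∀ f → ⟦ f ⟧ x ≈ 0# → a₀ ∣ℤ f ! 0
      constant-divides f eq = let (c , h , c≢0 , eqh) = multiple (length f) f ℕ.≤-refl eq in constant-∣ isPrimitive c {f} {h} c≢0 eqh

  -- Residues of a finitely generated group modulo a dilate of itself.

  module Index where

    open Reals R hiding (_⊕_; _·_)
    import Data.Integer.DivMod as ℤ
    open import Data.Integer.Divisibility.Signed using (∣⇒∣ᵤ)
    open Field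
    open Counting em
    open Structure using (≡E)
    open Polynomial
    open import Algebra.Properties.Semiring.Exp semiring using (^-congˡ; ^-homo-*)
    open import Algebra.Properties.CommutativeSemiring.Exp commutativeSemiring using (^-distrib-*)
    open Roots using (1^)

    private variable
      x y : Carrier

    record IsSubgroup (H : Carrier → Set) : Set where
      field
        resp : x ≈ y → H x → H y
        zero′ : H 0#
        add  : H x → H y → H (x + y)
        neg  : H x → H (- x)

      sub : H x → H y → H (x - y)
      sub p q = add p (neg q)

      mulℕ : ∀ n → H x → H (fromNat n * x)
      mulℕ zero    p = resp (sym (zeroˡ _)) zero′
      mulℕ {x} (suc n) p = resp (solve 2 (λ n x → x :+ n :* x := (con 1ℤ :+ n) :* x) refl (fromNat n) x) (add p (mulℕ n p))

      mulℤ : ∀ z → H x → H (fromInt z * x)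
      mulℤ (ℤ.+ n)    p = mulℕ n p
      mulℤ {x} ℤ.-[1+ n ] p = resp (solve 2 (λ n x → :- (n :* x) := (:- n) :* x) refl (fromNat (suc n)) x) (neg (mulℕ (suc n) p))

    data ⟨_⟩ (P : Carrier → Set) : Carrier → Set where
      gen  : P x → ⟨ P ⟩ x
      zero′ : ⟨ P ⟩ 0#
      add  : ⟨ P ⟩ x → ⟨ P ⟩ y → ⟨ P ⟩ (x + y)
      neg  : ⟨ P ⟩ x → ⟨ P ⟩ (- x)
      resp : x ≈ y → ⟨ P ⟩ x → ⟨ P ⟩ y

    ⟨⟩-isSubgroup : ∀ P → IsSubgroup ⟨ P ⟩
    ⟨⟩-isSubgroup P = record { resp = resp ; zero′ = zero′ ; add = add ; neg = neg }

    ⟨⟩-least : ∀ {P H} → IsSubgroup H → (∀ {x} → P x → H x) → ∀ {x} → ⟨ P ⟩ x → H x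
    ⟨⟩-least sg imp (gen p)    = imp p
    ⟨⟩-least sg imp zero′      = IsSubgroup.zero′ sg
    ⟨⟩-least sg imp (add p q)  = IsSubgroup.add sg (⟨⟩-least sg imp p) (⟨⟩-least sg imp q)
    ⟨⟩-least sg imp (neg p)    = IsSubgroup.neg sg (⟨⟩-least sg imp p)
    ⟨⟩-least sg imp (resp e p) = IsSubgroup.resp sg e (⟨⟩-least sg imp p)

    module Torsion (Y : Carrier → Set) (Y-sub : IsSubgroup Y) where

      Tors : Carrier → Set
      Tors v = ∃[ q ] (q ≢ 0ℤ × Y (fromInt q * v))

      -- The subgroup generated by Y and gs. Apart from its use for torsion modulo a lattice Y,
      -- taking Y to be zero gives the lattices of the Brunn-Minkowski inequality.
      Span : List Carrier → Carrier → Set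
      Span []       v = Y v
      Span (g ∷ gs) v = ∃[ c ] Span gs (v - fromInt c * g)

      Span-isSubgroup : ∀ gs → IsSubgroup (Span gs)
      Span-isSubgroup []       = Y-sub
      Span-isSubgroup (g ∷ gs) = record
        { resp  = λ e (c , p) → c , resp₀ (+-congʳ e) p
        ; zero′ = 0ℤ , resp₀ (solve 1 (λ g → con 0ℤ := con 0ℤ :- con 0ℤ :* g) refl g) zero₀
        ; add   = λ {x} {y} (c , p) (c′ , p′) → c ℤ.+ c′ , resp₀
            (trans (solve 5 (λ x y c c′ g → (x :- c :* g) :+ (y :- c′ :* g) := (x :+ y) :- (c :+ c′) :* g) refl x y (fromInt c) (fromInt c′) g)
              (+-congˡ (-‿cong (*-congʳ (sym (fromInt-+ c c′)))))) (add₀ p p′)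
        ; neg   = λ {x} (c , p) → ℤ.- c , resp₀
            (trans (solve 3 (λ x c g → :- (x :- c :* g) := (:- x) :- (:- c) :* g) refl x (fromInt c) g)
              (+-congˡ (-‿cong (*-congʳ (sym (fromInt-neg c)))))) (neg₀ p) }
        where open IsSubgroup (Span-isSubgroup gs) renaming (resp to resp₀; zero′ to zero₀; add to add₀; neg to neg₀)

      Span-∷ : ∀ {g gs v} → Span gs v → Span (g ∷ gs) v
      Span-∷ {g} {gs} {v} p = 0ℤ , IsSubgroup.resp (Span-isSubgroup gs) (solve 2 (λ v g → v := v :- con 0ℤ :* g) refl v g) p

      Span-gen : ∀ {g gs} → g ∈ gs → Span gs g
      Span-gen {gs = g ∷ gs} (here ≡.refl) = 1ℤ , IsSubgroup.resp (Span-isSubgroup gs)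
        (solve 1 (λ g → con 0ℤ := g :- (con 1ℤ :+ con 0ℤ) :* g) refl g) (IsSubgroup.zero′ (Span-isSubgroup gs))
      Span-gen {gs = g ∷ gs} (there g∈) = Span-∷ {g} {gs} (Span-gen g∈)

      Y⊆Span : ∀ gs {v} → Y v → Span gs v
      Y⊆Span []       p = p
      Y⊆Span (g ∷ gs) p = Span-∷ {g} {gs} (Y⊆Span gs p)

      Covers : List Carrier → (Carrier → Set) → Set
      Covers L P = ∀ {v} → P v → ∃[ l ] (l ∈ L × Y (v - l))

      -- In each coset ζ + H one torsion element y is picked, if there is any. The other torsion
      -- elements of the coset differ from y by torsion elements of H, so y + L covers them.
      extend : ∀ {H L} → IsSubgroup H → Covers L (λ v → H v × Tors v) → ∀ Zs →
        ∃[ L′ ] (length L′ ℕ.≤ length Zs ℕ.* length L × Covers L′ (λ v → Tors v × ∃[ ζ ] (ζ ∈ Zs × H (v - ζ))))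
      extend sg cov [] = [] , z≤n , λ { (_ , _ , () , _) }
      extend {H} {L} sg cov (ζ ∷ Zs) with extend sg cov Zs | em {∃[ y ] (Tors y × H (y - ζ))}
      ... | L′ , len , cov′ | no ¬y = L′ , ℕ.≤-trans len (ℕ.m≤n+m _ (length L)) ,
        λ { (t , _ , here ≡.refl , h) → ⊥-elim (¬y (_ , t , h)) ; (t , ζ , there ζ∈ , h) → cov′ (t , ζ , ζ∈ , h) }
      ... | L′ , len , cov′ | yes (y , (q , q≢0 , yq) , hy) = map (y +_) L ++ L′ ,
        ℕ.≤-trans (ℕ.≤-reflexive (≡.trans (length-++ (map (y +_) L)) (≡.cong (ℕ._+ length L′) (length-map _ L)))) (ℕ.+-monoʳ-≤ (length L) len) ,
        λ { {v} ((r , r≢0 , vr) , _ , here ≡.refl , h) →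
              let (l , l∈ , p) = cov {v - y} (H.resp (solve 3 (λ v y z → (v :- z) :- (y :- z) := v :- y) refl v y ζ) (H.sub h hy) ,
                    (q ℤ.* r , (λ z → nonzero q≢0 r≢0 (ℤ.i*j≡0⇒i≡0∨j≡0 q z)) , Y.resp
                      (trans (solve 4 (λ q r v y → q :* (r :* v) :- r :* (q :* y) := (q :* r) :* (v :- y)) refl (fromInt q) (fromInt r) v y)
                        (*-congʳ (sym (fromInt-* q r)))) (Y.sub (Y.mulℤ q vr) (Y.mulℤ r yq))))
              in y + l , ∈-++⁺ˡ (∈-map⁺ (y +_) l∈) , Y.resp (solve 3 (λ v y l → (v :- y) :- l := v :- (y :+ l)) refl v y l) p
          ; (t , ζ′ , there ζ∈ , h) → let (l , l∈ , p) = cov′ (t , ζ′ , ζ∈ , h) in l , ∈-++⁺ʳ (map (y +_) L) l∈ , p }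
        where
        module H = IsSubgroup sg
        module Y = IsSubgroup Y-sub
        nonzero : ∀ {q r} → q ≢ 0ℤ → r ≢ 0ℤ → q ≡ 0ℤ ⊎ r ≡ 0ℤ → ⊥
        nonzero p _ (inj₁ z) = p z
        nonzero _ p (inj₂ z) = p z

      -- A finitely generated group has finite torsion, here relative to Y. If a multiple (c + 1) g
      -- lies in the span of the other generators, then g adds at most c + 1 cosets of that span;
      -- otherwise no torsion element involves g.
      torsion-cover : ∀ gs → ∃[ L ] Covers L (λ v → Span gs v × Tors v)
      torsion-cover [] = [ 0# ] , λ {v} (p , _) → 0# , here ≡.refl , IsSubgroup.resp Y-sub (solve 1 (λ v → v := v :- con 0ℤ) refl v) p
      torsion-cover (g ∷ gs) with torsion-cover gs | em {∃[ c ] (Span gs (fromNat (suc c) * g))}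
      ... | L , cov | yes (c , p) with extend {Span gs} {L} (Span-isSubgroup gs) cov (map (λ i → fromNat i * g) (upTo (suc c)))
      ...   | L′ , _ , cov′ = L′ , λ {v} ((z , s) , t) → cov′ {v} (t , _ ,
              ∈-map⁺ (λ i → fromNat i * g) (∈-upTo⁺ (ℤ.n%ℕd<d z (suc c))) ,
              S.resp (trans (+-congʳ (+-congˡ (-‿cong (*-congʳ (expand z)))))
                 (solve 5 (λ v r w k g → (v :- (r :+ w :* k) :* g) :+ w :* (k :* g) := v :- r :* g) refl
                    v (fromNat (z ℤ.%ℕ suc c)) (fromInt (z ℤ./ℕ suc c)) (fromNat (suc c)) g))
               (S.add s (S.mulℤ (z ℤ./ℕ suc c) p)))
        where
        module S = IsSubgroup (Span-isSubgroup gs)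
        expand : ∀ z → fromInt z ≈ fromNat (z ℤ.%ℕ suc c) + fromInt (z ℤ./ℕ suc c) * fromNat (suc c)
        expand z = trans (reflexive (≡.cong fromInt (ℤ.a≡a%ℕn+[a/ℕn]*n z (suc c))))
          (trans (fromInt-+ (ℤ.+ (z ℤ.%ℕ suc c)) (z ℤ./ℕ suc c ℤ.* ℤ.+ suc c)) (+-congˡ (fromInt-* (z ℤ./ℕ suc c) (ℤ.+ suc c))))
      torsion-cover (g ∷ gs) | L , cov | no ¬c = L , λ {v} ((z , s) , t) → cov (drop v z s t , t)
        where
        module S = IsSubgroup (Span-isSubgroup gs)
        torsion-free : ∀ z → z ≢ 0ℤ → ¬ Span gs (fromInt z * g)
        torsion-free (ℤ.+ zero)  z≢0 p = z≢0 ≡.refl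
        torsion-free (ℤ.+ suc n) z≢0 p = ¬c (n , p)
        torsion-free ℤ.-[1+ n ]  z≢0 p = ¬c (n , S.resp (solve 2 (λ n g → :- ((:- n) :* g) := n :* g) refl (fromNat (suc n)) g) (S.neg p))
        drop : ∀ v z → Span gs (v - fromInt z * g) → Tors v → Span gs v
        drop v z s (q , q≢0 , yq) with z ℤ.≟ 0ℤ
        ... | yes ≡.refl = S.resp (solve 2 (λ v g → v :- con 0ℤ :* g := v) refl v g) s
        ... | no z≢0 = ⊥-elim (torsion-free (q ℤ.* z) (λ e → nonzero (ℤ.i*j≡0⇒i≡0∨j≡0 q e)) (S.resp
              (trans (solve 4 (λ q v z g → q :* v :- q :* (v :- z :* g) := (q :* z) :* g) refl (fromInt q) v (fromInt z) g)
                (*-congʳ (sym (fromInt-* q z)))) (S.sub (Y⊆Span gs yq) (S.mulℤ q s))))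
          where
          nonzero : q ≡ 0ℤ ⊎ z ≡ 0ℤ → ⊥
          nonzero (inj₁ e) = q≢0 e
          nonzero (inj₂ e) = z≢0 e

    -- Bernoulli's inequality (1 + 1/m)ˢ ≥ 1 + s/m, multiplied by mˢ⁺¹.
    bernoulli : ∀ m s → m ℕ.^ s ℕ.* (m ℕ.+ s) ℕ.≤ m ℕ.* suc m ℕ.^ s
    bernoulli m zero    = ℕ.≤-reflexive (N.solve 1 (λ m → N.con 1 N.:* (m N.:+ N.con 0) N.:= m N.:* N.con 1) ≡.refl m)
    bernoulli m (suc s) = begin
      m ℕ.* P ℕ.* (m ℕ.+ suc s)
        ≡⟨ N.solve 3 (λ m P s → m N.:* P N.:* (m N.:+ (N.con 1 N.:+ s)) N.:= m N.:* P N.:* (m N.:+ s) N.:+ P N.:* m) ≡.refl m P s ⟩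
      m ℕ.* P ℕ.* (m ℕ.+ s) ℕ.+ P ℕ.* m              ≤⟨ ℕ.+-monoʳ-≤ _ (ℕ.*-monoʳ-≤ P (ℕ.m≤m+n m s)) ⟩
      m ℕ.* P ℕ.* (m ℕ.+ s) ℕ.+ P ℕ.* (m ℕ.+ s)
        ≡⟨ N.solve 3 (λ m P t → m N.:* P N.:* t N.:+ P N.:* t N.:= (P N.:* t) N.:* (N.con 1 N.:+ m)) ≡.refl m P (m ℕ.+ s) ⟩
      P ℕ.* (m ℕ.+ s) ℕ.* suc m                      ≤⟨ ℕ.*-monoˡ-≤ (suc m) (bernoulli m s) ⟩
      m ℕ.* suc m ℕ.^ s ℕ.* suc m                    ≡⟨ N.solve 3 (λ m Q t → m N.:* Q N.:* t N.:= m N.:* (t N.:* Q)) ≡.refl m (suc m ℕ.^ s) (suc m) ⟩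
      m ℕ.* suc m ℕ.^ suc s                          ∎
      where
      open ℕ.≤-Reasoning
      P = m ℕ.^ s

    -- For large s an exponential with a larger base absorbs the constant C. This is what makes the
    -- index bound sharp although the classes are counted only up to a bounded factor.
    exponential-growth : ∀ a m C → (∀ s → a ℕ.^ s ℕ.≤ m ℕ.^ s ℕ.* C) → a ℕ.≤ m
    exponential-growth a m C h with a ℕ.≤? m
    ... | yes p = p
    ... | no ¬p = ⊥-elim (contra m (λ s → ℕ.≤-trans (ℕ.^-monoˡ-≤ s (ℕ.≰⇒> ¬p)) (h s)))
      where
      contra : ∀ m → (∀ s → suc m ℕ.^ s ℕ.≤ m ℕ.^ s ℕ.* C) → ⊥
      contra zero    h = ℕ.<⇒≱ (s≤s z≤n) (h 1)
      contra m@(suc _) h = ℕ.<⇒≱ (ℕ.m≤n+m (suc (m ℕ.* C)) m)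
        (ℕ.*-cancelˡ-≤ (m ℕ.^ s) ⦃ ℕ.m^n≢0 m s ⦄ (begin
          m ℕ.^ s ℕ.* (m ℕ.+ s)          ≤⟨ bernoulli m s ⟩
          m ℕ.* suc m ℕ.^ s              ≤⟨ ℕ.*-monoʳ-≤ m (h s) ⟩
          m ℕ.* (m ℕ.^ s ℕ.* C)          ≡⟨ N.solve 3 (λ m P C → m N.:* (P N.:* C) N.:= P N.:* (m N.:* C)) ≡.refl m (m ℕ.^ s) C ⟩
          m ℕ.^ s ℕ.* (m ℕ.* C)          ∎))
        where
        open ℕ.≤-Reasoning
        s = suc (m ℕ.* C)

    module IndexBound {ν ν⁻ : Carrier} (νν⁻ : ν * ν⁻ ≈ 1#) {d a₀ p} (M : Minimal ν (suc d) a₀ p) where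
      open Minimal M hiding (x≉0)

      private
        a = ℤ.∣ a₀ ∣

      Digits : ℕ → List Poly
      Digits zero    = [ [] ]
      Digits (suc s) = cartesianProductWith (λ i f → ℤ.+ i ∷ f) (upTo a) (Digits s)

      data Digit : ℕ → Poly → Set where
        []  : Digit 0 []
        _∷_ : ∀ {s i f} → i ℕ.< a → Digit s f → Digit (suc s) (ℤ.+ i ∷ f)

      Digits-Digit : ∀ s {f} → f ∈ Digits s → Digit s f
      Digits-Digit zero    (here ≡.refl) = []
      Digits-Digit (suc s) f∈ with ∈-cartesianProductWith⁻ (λ i f → ℤ.+ i ∷ f) (upTo a) (Digits s) f∈
      ... | i , g , i∈ , g∈ , ≡.refl = ∈-upTo⁻ i∈ ∷ Digits-Digit s g∈

      Digit-length : ∀ {s f} → Digit s f → length f ≡ s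
      Digit-length []      = ≡.refl
      Digit-length (_ ∷ g) = ≡.cong suc (Digit-length g)

      #-Digits : ∀ s → a ℕ.^ s ℕ.≤ # ≡E (Digits s)
      #-Digits zero    = #-pos ≡E {Digits 0} (here ≡.refl)
      #-Digits (suc s) = ℕ.≤-trans (ℕ.*-mono-≤ (ℕ.≤-trans (ℕ.≤-reflexive (≡.sym (length-upTo a))) (#-indep ≡E (Unique.upTo⁺ a))) (#-Digits s))
        (#-product-≥ ≡E ≡E ≡E (λ i f → ℤ.+ i ∷ f)
          (λ i∈ f∈ → _ , ∈-cartesianProductWith⁺ (λ i f → ℤ.+ i ∷ f) i∈ f∈ , ≡.refl)
          (λ { _ _ _ _ ≡.refl → ≡.refl }) (λ { ≡.refl → ≡.refl }))

      private
        small : ∀ {i j} → i ℕ.< a → j ℕ.< a → a ℕ.∣ ℤ.∣ ℤ.+ i ℤ.+ ℤ.-1ℤ ℤ.* ℤ.+ j ∣ → i ≡ j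
        small {i} {j} i<a j<a dvd = [ (λ i≤j → ≡.sym (lemma j<a i≤j (ℤ.∣⊖∣-≤ i≤j) dvd′)) , (λ j≤i → lemma i<a j≤i
            (≡.trans (ℤ.∣m⊖n∣≡∣n⊖m∣ i j) (ℤ.∣⊖∣-≤ j≤i)) dvd′) ]′ (ℕ.≤-total i j)
          where
          open import Data.Sum.Base using ([_,_]′)
          dvd′ : a ℕ.∣ ℤ.∣ i ℤ.⊖ j ∣
          dvd′ = ≡.subst (λ z → a ℕ.∣ ℤ.∣ z ∣) (≡.trans (≡.cong (λ z → ℤ.+ i ℤ.+ z) (ℤ.-1*i≡-i (ℤ.+ j))) (ℤ.m-n≡m⊖n i j)) dvd
          lemma : ∀ {m n k} → n ℕ.< a → m ℕ.≤ n → k ≡ n ℕ.∸ m → a ℕ.∣ k → n ≡ m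
          lemma {m} {n} n<a m≤n ≡.refl dvd with n ℕ.∸ m in eq
          ... | zero  = ℕ.≤-antisym (ℕ.m∸n≡0⇒m≤n eq) m≤n
          ... | suc k = ⊥-elim (ℕ.<⇒≱ (ℕ.≤-<-trans (ℕ.≤-trans (ℕ.≤-reflexive (≡.sym eq)) (ℕ.m∸n≤m n m)) n<a) (ℕ.∣⇒≤ dvd))

      -- By `constant-divides` the lowest digits are congruent modulo a₀ and therefore equal.
      -- Cancelling ν makes the next digits the lowest ones.
      Digit-unique : ∀ {s f f′} → Digit s f → Digit s f′ → ∀ F → ⟦ f ⟧ ν - ⟦ f′ ⟧ ν ≈ ν ^ s * ⟦ F ⟧ ν → f ≡ f′
      Digit-unique [] [] F eq = ≡.refl
      Digit-unique {suc s} {ℤ.+ i ∷ f} {ℤ.+ j ∷ f′} (i<a ∷ g) (j<a ∷ g′) F eq = ≡.cong₂ (λ i f → ℤ.+ i ∷ f) i≡j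
        (Digit-unique g g′ F (*-cancelˡ-≈ (Minimal.x≉0 M) (begin
          ν * (⟦ f ⟧ ν - ⟦ f′ ⟧ ν)
            ≈⟨ solve 4 (λ c x f f′ → x :* (f :- f′) := (c :+ x :* f) :- (c :+ x :* f′)) refl (fromNat j) ν (⟦ f ⟧ ν) (⟦ f′ ⟧ ν) ⟩
          (fromNat j + ν * ⟦ f ⟧ ν) - (fromNat j + ν * ⟦ f′ ⟧ ν)  ≈⟨ +-congʳ (+-congʳ (reflexive (≡.cong fromNat (≡.sym i≡j)))) ⟩
          (fromNat i + ν * ⟦ f ⟧ ν) - (fromNat j + ν * ⟦ f′ ⟧ ν)  ≈⟨ eq ⟩
          ν * ν ^ s * ⟦ F ⟧ ν                                    ≈⟨ *-assoc ν _ _ ⟩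
          ν * (ν ^ s * ⟦ F ⟧ ν)                                  ∎)))
        where
        open import Relation.Binary.Reasoning.Setoid setoid
        f₁ = ℤ.+ i ∷ f
        f₂ = ℤ.+ j ∷ f′
        D P : Poly
        D = f₁ ⊞ ℤ.-1ℤ ⊡ f₂
        P = D ++ ℤ.-1ℤ ⊡ F
        length-D : ∀ {s f g} → Digit s f → Digit s g → length (f ⊞ ℤ.-1ℤ ⊡ g) ≡ s
        length-D []      []      = ≡.refl
        length-D (_ ∷ p) (_ ∷ q) = ≡.cong suc (length-D p q)
        -1≈ : fromInt ℤ.-1ℤ ≈ - 1#
        -1≈ = -‿cong fromNat-1
        ⟦P⟧ : ⟦ P ⟧ ν ≈ 0#
        ⟦P⟧ = begin
          ⟦ P ⟧ ν                                                         ≈⟨ ⟦++⟧ D _ ν ⟩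
          ⟦ D ⟧ ν + ν ^ length D * ⟦ ℤ.-1ℤ ⊡ F ⟧ ν
            ≈⟨ +-cong (trans (⟦⊞⟧ f₁ (ℤ.-1ℤ ⊡ f₂) ν) (+-congˡ (trans (⟦⊡⟧ ℤ.-1ℤ f₂ ν) (*-congʳ -1≈))))
                 (*-cong (reflexive (≡.cong (ν ^_) (length-D (i<a ∷ g) (j<a ∷ g′)))) (trans (⟦⊡⟧ ℤ.-1ℤ F ν) (*-congʳ -1≈))) ⟩
          (⟦ f₁ ⟧ ν + (- 1#) * ⟦ f₂ ⟧ ν) + ν ^ suc s * ((- 1#) * ⟦ F ⟧ ν)
            ≈⟨ solve 4 (λ x y P F → (x :+ (:- con 1ℤ) :* y) :+ P :* ((:- con 1ℤ) :* F) := (x :- y) :- P :* F) refl (⟦ f₁ ⟧ ν) (⟦ f₂ ⟧ ν) (ν ^ suc s) (⟦ F ⟧ ν) ⟩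
          (⟦ f₁ ⟧ ν - ⟦ f₂ ⟧ ν) - ν ^ suc s * ⟦ F ⟧ ν                     ≈⟨ +-congʳ eq ⟩
          ν ^ suc s * ⟦ F ⟧ ν - ν ^ suc s * ⟦ F ⟧ ν                       ≈⟨ -‿inverseʳ _ ⟩
          0#                                                              ∎
        i≡j : i ≡ j
        i≡j = small i<a j<a (∣⇒∣ᵤ (constant-divides P ⟦P⟧))

      module _ {x : Carrier} (x≉0 : ¬ (x ≈ 0#)) where
        w : Carrier
        w = ν⁻ ^ d * x

        -- The lattice spanned by ν⁻ᵈx, ..., ν⁻¹x, x, whose rank is the degree of ν. If two elements
        -- ν^(-s-d) f(ν) x differ by an element of Y, multiplication by νˢ⁺ᵈ puts the difference
        -- into the form νˢ F(ν) x that `Digit-unique` asks for.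
        Y : Carrier → Set
        Y v = ∃[ F ] (length F ℕ.≤ suc d × v ≈ ⟦ F ⟧ ν * w)

        Y-isSubgroup : IsSubgroup Y
        Y-isSubgroup = record
          { resp  = λ e (F , l , p) → F , l , trans (sym e) p
          ; zero′ = [] , z≤n , sym (zeroˡ w)
          ; add   = λ (F , l , p) (F′ , l′ , p′) → F ⊞ F′ , length-⊞ F F′ l l′ ,
              trans (+-cong p p′) (trans (sym (distribʳ w _ _)) (*-congʳ (sym (⟦⊞⟧ F F′ ν))))
          ; neg   = λ (F , l , p) → ℤ.-1ℤ ⊡ F , ≡.subst (ℕ._≤ suc d) (≡.sym (length-⊡ ℤ.-1ℤ F)) l ,
              trans (-‿cong p) (trans (solve 2 (λ F w → :- (F :* w) := ((:- (con 1ℤ :+ con 0ℤ)) :* F) :* w) refl (⟦ F ⟧ ν) w)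
                (*-congʳ (sym (⟦⊡⟧ ℤ.-1ℤ F ν)))) }

        open Torsion Y Y-isSubgroup

        -- One division from the low end replaces F by `quotient F` at the price of a factor a₀,
        -- without exceeding the length allowed in `Y`.
        Tors-ν⁻ : ∀ {v} → Tors v → Tors (ν⁻ * v)
        Tors-ν⁻ {v} (q , q≢0 , F , l , p) = a₀ ℤ.* q , (λ z → nonzero (ℤ.i*j≡0⇒i≡0∨j≡0 a₀ z)) , quotient F ,
          length-quotient F (ℕ.m≤n⇒m≤1+n l) ℕ.≤-refl , (begin
            fromInt (a₀ ℤ.* q) * (ν⁻ * v)
              ≈⟨ *-congʳ (fromInt-* a₀ q) ⟩
            (fromInt a₀ * fromInt q) * (ν⁻ * v)
              ≈⟨ solve 4 (λ a q m v → (a :* q) :* (m :* v) := (a :* m) :* (q :* v)) refl (fromInt a₀) (fromInt q) ν⁻ v ⟩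
            (fromInt a₀ * ν⁻) * (fromInt q * v)            ≈⟨ *-congˡ p ⟩
            (fromInt a₀ * ν⁻) * (⟦ F ⟧ ν * w)
              ≈⟨ solve 4 (λ a m F w → (a :* m) :* (F :* w) := (m :* (a :* F)) :* w) refl (fromInt a₀) ν⁻ (⟦ F ⟧ ν) w ⟩
            (ν⁻ * (fromInt a₀ * ⟦ F ⟧ ν)) * w              ≈⟨ *-congʳ (*-congˡ (⟦quotient⟧ F)) ⟩
            (ν⁻ * (ν * ⟦ quotient F ⟧ ν)) * w
              ≈⟨ solve 4 (λ m n F w → (m :* (n :* F)) :* w := (n :* m) :* (F :* w)) refl ν⁻ ν (⟦ quotient F ⟧ ν) w ⟩
            (ν * ν⁻) * (⟦ quotient F ⟧ ν * w)              ≈⟨ trans (*-congʳ νν⁻) (*-identityˡ _) ⟩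
            ⟦ quotient F ⟧ ν * w                           ∎)
          where
          open import Relation.Binary.Reasoning.Setoid setoid
          nonzero : a₀ ≡ 0ℤ ⊎ q ≡ 0ℤ → ⊥
          nonzero (inj₁ z) = a₀≢0 z
          nonzero (inj₂ z) = q≢0 z

        Tors-isSubgroup : IsSubgroup Tors
        Tors-isSubgroup = record
          { resp  = λ e (q , q≢0 , p) → q , q≢0 , Y.resp (*-congˡ e) p
          ; zero′ = 1ℤ , (λ ()) , Y.resp (sym (zeroʳ _)) Y.zero′
          ; add   = λ {u} {v} (q , q≢0 , p) (r , r≢0 , p′) → q ℤ.* r , (λ z → nonzero q≢0 r≢0 (ℤ.i*j≡0⇒i≡0∨j≡0 q z)) , Y.resp
              (trans (solve 4 (λ q r u v → r :* (q :* u) :+ q :* (r :* v) := (q :* r) :* (u :+ v)) refl (fromInt q) (fromInt r) u v)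
                (*-congʳ (sym (fromInt-* q r)))) (Y.add (Y.mulℤ r p) (Y.mulℤ q p′))
          ; neg   = λ {u} (q , q≢0 , p) → q , q≢0 , Y.resp (solve 2 (λ q u → :- (q :* u) := q :* (:- u)) refl (fromInt q) u) (Y.neg p) }
          where
          module Y = IsSubgroup Y-isSubgroup
          nonzero : ∀ {q r} → q ≢ 0ℤ → r ≢ 0ℤ → q ≡ 0ℤ ⊎ r ≡ 0ℤ → ⊥
          nonzero p _ (inj₁ z) = p z
          nonzero _ p (inj₂ z) = p z

        νⁿν⁻ⁿ : ∀ n → ν ^ n * ν⁻ ^ n ≈ 1#
        νⁿν⁻ⁿ n = trans (sym (^-distrib-* ν ν⁻ n)) (trans (^-congˡ n νν⁻) (1^ n))

        monomial : ∀ n → ∃[ F ] (length F ≡ suc n × ⟦ F ⟧ ν ≈ ν ^ n)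
        monomial zero    = [ 1ℤ ] , ≡.refl , solve 1 (λ x → (con 1ℤ :+ con 0ℤ) :+ x :* con 0ℤ := con 1ℤ) refl ν
        monomial (suc n) = let (F , l , p) = monomial n in 0ℤ ∷ F , ≡.cong suc l , trans (+-identityˡ _) (*-congˡ p)

        Tors-x : Tors x
        Tors-x = let (F , l , p) = monomial d in 1ℤ , (λ ()) , F , ℕ.≤-reflexive l , trans (trans (*-congʳ fromNat-1) (*-identityˡ x))
          (sym (trans (*-congʳ p) (trans (sym (*-assoc _ _ x)) (trans (*-congʳ (νⁿν⁻ⁿ d)) (*-identityˡ x)))))

        Tors-νⁿ : ∀ n → Tors (ν⁻ ^ n * x)
        Tors-νⁿ zero    = IsSubgroup.resp Tors-isSubgroup (sym (*-identityˡ x)) Tors-x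
        Tors-νⁿ (suc n) = IsSubgroup.resp Tors-isSubgroup (sym (*-assoc ν⁻ _ x)) (Tors-ν⁻ (Tors-νⁿ n))

        Tors-poly : ∀ k f → length f ℕ.≤ k → Tors (ν⁻ ^ k * (⟦ f ⟧ ν * x))
        Tors-poly k       []      _       = T.resp (sym (trans (*-congˡ (zeroˡ x)) (zeroʳ _))) T.zero′
          where module T = IsSubgroup Tors-isSubgroup
        Tors-poly (suc k) (c ∷ f) (s≤s l) = T.resp
            (trans (+-cong (sym (trans (*-congˡ (*-identityˡ _)) refl)) refl) split)
            (T.add (T.mulℤ c (T.resp (sym (*-identityˡ _)) (Tors-νⁿ (suc k)))) (Tors-poly k f l))
          where
          module T = IsSubgroup Tors-isSubgroup
          split : fromInt c * (1# * (1# * (ν⁻ ^ suc k * x))) + ν⁻ ^ k * (⟦ f ⟧ ν * x) ≈ ν⁻ ^ suc k * (⟦ c ∷ f ⟧ ν * x)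
          split = trans (+-congˡ (trans (sym (*-identityˡ _)) (*-congʳ (sym νν⁻))))
            (solve 6 (λ c n m P f x → c :* (con 1ℤ :* (con 1ℤ :* ((m :* P) :* x))) :+ (n :* m) :* (P :* (f :* x)) := (m :* P) :* ((c :+ n :* f) :* x))
              refl (fromInt c) ν ν⁻ (ν⁻ ^ k) (⟦ f ⟧ ν) x)

        module _ (N : Carrier → Set) (N-sub : IsSubgroup N) (Nx : N x) (Z₀ : List Carrier)
          (residues : ∀ {n} → N n → ∃[ z ] (z ∈ Z₀ × N (ν⁻ * (n - z)))) where
          private module N′ = IsSubgroup N-sub

          Zs : ℕ → List Carrier
          Zs zero    = [ 0# ]
          Zs (suc k) = cartesianProductWith (λ z ζ → ν⁻ ^ suc k * z + ζ) Z₀ (Zs k)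

          length-cpw : ∀ {A B C : Set} (f : A → B → C) xs ys → length (cartesianProductWith f xs ys) ≡ length xs ℕ.* length ys
          length-cpw f []       ys = ≡.refl
          length-cpw f (x ∷ xs) ys = ≡.trans (length-++ (map (f x) ys)) (≡.cong₂ ℕ._+_ (length-map (f x) ys) (length-cpw f xs ys))

          length-Zs : ∀ k → length (Zs k) ≡ length Z₀ ℕ.^ k
          length-Zs zero    = ≡.refl
          length-Zs (suc k) = ≡.trans (length-cpw _ Z₀ (Zs k)) (≡.cong (length Z₀ ℕ.*_) (length-Zs k))

          -- Horner's scheme with carries: the lowest coefficient times x, plus the carry n, lies in
          -- N and leaves a remainder in Z₀; its quotient by ν is the carry for the next
          -- coefficient.
          residue : ∀ k f {n} → length f ℕ.≤ k → N n → ∃[ ζ ] (ζ ∈ Zs k × N (ν⁻ ^ k * (⟦ f ⟧ ν * x + n) - ζ))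
          residue-suc : ∀ k c f {n} → length f ℕ.≤ k → N n →
            ∃[ ζ ] (ζ ∈ Zs (suc k) × N (ν⁻ ^ suc k * ((fromInt c + ν * ⟦ f ⟧ ν) * x + n) - ζ))
          residue zero    []      {n} l Nn = 0# , here ≡.refl ,
            N′.resp (solve 2 (λ x n → n := con 1ℤ :* (con 0ℤ :* x :+ n) :- con 0ℤ) refl x n) Nn
          residue (suc k) []      {n} l Nn = let (ζ , ζ∈ , p) = residue-suc k 0ℤ [] z≤n Nn in ζ , ζ∈ ,
            N′.resp (+-congʳ (*-congˡ (+-congʳ (*-congʳ (trans (+-identityˡ _) (zeroʳ ν)))))) p
          residue (suc k) (c ∷ f) (s≤s l) Nn = residue-suc k c f l Nn
          residue-suc k c f {n} l Nn =
            let (z , z∈ , p) = residues {fromInt c * x + n} (N′.add (N′.mulℤ c Nx) Nn)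
                (ζ , ζ∈ , q) = residue k f l p
            in _ , ∈-cartesianProductWith⁺ (λ z ζ → ν⁻ ^ suc k * z + ζ) z∈ ζ∈ , N′.resp (begin
              ν⁻ ^ k * (⟦ f ⟧ ν * x + ν⁻ * (fromInt c * x + n - z)) - ζ
                ≈⟨ +-congʳ (*-congˡ (+-congʳ (trans (sym (*-identityˡ _)) (*-congʳ (sym νν⁻))))) ⟩
              ν⁻ ^ k * ((ν * ν⁻) * (⟦ f ⟧ ν * x) + ν⁻ * (fromInt c * x + n - z)) - ζ
                ≈⟨ +-congʳ (solve 7 (λ P n m y cx r z → P :* ((n :* m) :* y :+ m :* (cx :+ r :- z)) := (m :* P) :* ((cx :+ n :* y) :+ r) :- (m :* P) :* z)
                    refl (ν⁻ ^ k) ν ν⁻ (⟦ f ⟧ ν * x) (fromInt c * x) n z) ⟩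
              (ν⁻ ^ suc k * ((fromInt c * x + ν * (⟦ f ⟧ ν * x)) + n) - ν⁻ ^ suc k * z) - ζ
                ≈⟨ solve 3 (λ u v z → (u :- v) :- z := u :- (v :+ z)) refl _ (ν⁻ ^ suc k * z) ζ ⟩
              ν⁻ ^ suc k * ((fromInt c * x + ν * (⟦ f ⟧ ν * x)) + n) - (ν⁻ ^ suc k * z + ζ)
                ≈⟨ +-congʳ (*-congˡ (+-congʳ (solve 4 (λ c n f x → c :* x :+ n :* (f :* x) := (c :+ n :* f) :* x) refl (fromInt c) ν (⟦ f ⟧ ν) x))) ⟩
              ν⁻ ^ suc k * ((fromInt c + ν * ⟦ f ⟧ ν) * x + n) - (ν⁻ ^ suc k * z + ζ) ∎) q
            where open import Relation.Binary.Reasoning.Setoid setoid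

          -- The classes of Σ cⱼ νʲ x with digits 0 ≤ cⱼ < ∣ a₀ ∣ are distinct up to a bounded factor, while modulo
          -- νᵏ N there are at most ∣ Z₀ ∣ᵏ of them.
          index-bound : ∀ gs → (∀ {v} → N v → Span gs v) → a ℕ.≤ length Z₀
          index-bound gs N⊆ = exponential-growth a (length Z₀) (length Z₀ ℕ.^ d ℕ.* length L) bound
            where
            L = proj₁ (torsion-cover gs)
            bound : ∀ s → a ℕ.^ s ℕ.≤ length Z₀ ℕ.^ s ℕ.* (length Z₀ ℕ.^ d ℕ.* length L)
            bound s = begin
              a ℕ.^ s                                          ≤⟨ #-Digits s ⟩
              # ≡E (Digits s)                                  ≤⟨ #-length ≡E (Digits s) Q hit inj ⟩
              length L′                                        ≤⟨ proj₁ (proj₂ ext) ⟩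
              length (Zs k) ℕ.* length L                       ≡⟨ ≡.cong (ℕ._* length L) (≡.trans (length-Zs k) (ℕ.^-distribˡ-+-* (length Z₀) s d)) ⟩
              length Z₀ ℕ.^ s ℕ.* length Z₀ ℕ.^ d ℕ.* length L ≡⟨ ℕ.*-assoc (length Z₀ ℕ.^ s) _ _ ⟩
              length Z₀ ℕ.^ s ℕ.* (length Z₀ ℕ.^ d ℕ.* length L) ∎
              where
              open ℕ.≤-Reasoning
              -- The d additional divisions match the factor ν⁻ᵈ in `w`. They cost a factor
              -- independent of s, which the exponential comparison absorbs.
              k = s ℕ.+ d
              ext : ∃[ L′ ] (length L′ ℕ.≤ length (Zs k) ℕ.* length L × Covers L′ (λ v → Tors v × ∃[ ζ ] (ζ ∈ Zs k × N (v - ζ))))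
              ext = extend N-sub (λ {v} (Nv , t) → proj₂ (torsion-cover gs) (N⊆ Nv , t)) (Zs k)
              L′ = proj₁ ext
              V : Poly → Carrier
              V f = ν⁻ ^ k * (⟦ f ⟧ ν * x)
              Q : Poly → Carrier → Set
              Q f l = Digit s f × Y (V f - l)
              hit : ∀ {f} → f ∈ Digits s → ∃[ l ] (l ∈ L′ × Q f l)
              hit {f} f∈ =
                let dg = Digits-Digit s f∈
                    le = ℕ.≤-trans (ℕ.≤-reflexive (Digit-length dg)) (ℕ.m≤m+n s d)
                    (ζ , ζ∈ , p) = residue k f le N′.zero′
                    (l , l∈ , q) = proj₂ (proj₂ ext) {V f} (Tors-poly k f le , ζ , ζ∈ , N′.resp (+-congʳ (*-congˡ (+-identityʳ _))) p)
                in l , l∈ , dg , q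
              inj : ∀ {f f′ l} → Q f l → Q f′ l → f ≡ f′
              inj {f} {f′} {l} (dg , p) (dg′ , p′) =
                let (F , _ , e) = IsSubgroup.resp Y-isSubgroup (solve 3 (λ u v l → (u :- l) :- (v :- l) := u :- v) refl (V f) (V f′) l)
                                    (IsSubgroup.sub Y-isSubgroup p p′)
                in Digit-unique dg dg′ F (*-cancelˡ-≈ x≉0 (R.begin
                     x * (⟦ f ⟧ ν - ⟦ f′ ⟧ ν)                                     R.≈⟨ trans (sym (*-identityˡ _)) (*-congʳ (sym (νⁿν⁻ⁿ k))) ⟩
                     (ν ^ k * ν⁻ ^ k) * (x * (⟦ f ⟧ ν - ⟦ f′ ⟧ ν))
                       R.≈⟨ solve 5 (λ n m x f g → (n :* m) :* (x :* (f :- g)) := n :* (m :* (f :* x) :- m :* (g :* x))) refl (ν ^ k) (ν⁻ ^ k) x (⟦ f ⟧ ν) (⟦ f′ ⟧ ν) ⟩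
                     ν ^ k * (V f - V f′)                                         R.≈⟨ *-cong (^-homo-* ν s d) e ⟩
                     (ν ^ s * ν ^ d) * (⟦ F ⟧ ν * (ν⁻ ^ d * x))
                       R.≈⟨ solve 5 (λ p n m x F → (p :* n) :* (F :* (m :* x)) := (n :* m) :* (x :* (p :* F))) refl (ν ^ s) (ν ^ d) (ν⁻ ^ d) x (⟦ F ⟧ ν) ⟩
                     (ν ^ d * ν⁻ ^ d) * (x * (ν ^ s * ⟦ F ⟧ ν))                   R.≈⟨ trans (*-congʳ (νⁿν⁻ⁿ d)) (*-identityˡ _) ⟩
                     x * (ν ^ s * ⟦ F ⟧ ν)                                        R.∎))
                where import Relation.Binary.Reasoning.Setoid setoid as R

  -- A discrete Brunn-Minkowski inequality with the number of strings as error.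

  module BrunnMinkowski where

    open Reals R hiding (_⊕_; _·_)
    open Field
    open Roots
    open Counting em
    open Sumsets
    open Structure using (String)
    open Index using (IsSubgroup; module Torsion)
    open import Algebra.Properties.Semiring.Exp semiring using (^-congˡ)
    open import Algebra.Properties.CommutativeSemiring.Exp commutativeSemiring using (^-distrib-*)

    open Equivalence

    *-pos : ∀ {x y} → ¬ (x ≈ 0#) → ¬ (y ≈ 0#) → ¬ (x * y ≈ 0#)
    *-pos x≉0 y≉0 eq = y≉0 (*-zero-factor eq x≉0)

    -- Radon's inequality (x + y)ᵏ⁺¹/(u + v)ᵏ ≤ xᵏ⁺¹/uᵏ + yᵏ⁺¹/vᵏ without denominators. It is a
    -- weighted sum of two instances of `tangent`, comparing x (u + v) with (x + y) u and y (u + v)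
    -- with (x + y) v.
    radon : ∀ k {x y u v} → 0# ≤ x → 0# ≤ y → 0# ≤ u → 0# ≤ v → ¬ (u ≈ 0#) →
      (x + y) ^ suc k * (u ^ k * v ^ k) ≤ (u + v) ^ k * (x ^ suc k * v ^ k + y ^ suc k * u ^ k)
    radon k {x} {y} {u} {v} 0≤x 0≤y 0≤u 0≤v u≉0 = *-cancelˡ-≤ 0≤σ σ≉0 (+-cancelʳ-≤ (fromNat k * (σ * Z)) (begin
        σ * (τ ^ suc k * (U * V)) + fromNat k * (σ * Z)
          ≈⟨ solve 2 (λ a Q → Q :+ a :* Q := (con 1ℤ :+ a) :* Q) refl (fromNat k) (σ * Z) ⟩
        fromNat (suc k) * (σ * Z)
          ≈⟨ solve 7 (λ a x y σ T U V → a :* (σ :* (((x :+ y) :* T) :* (U :* V)))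
               := a :* ((T :* U) :* (x :* σ)) :* V :+ a :* ((T :* V) :* (y :* σ)) :* U) refl (fromNat (suc k)) x y σ (τ ^ k) U V ⟩
        fromNat (suc k) * ((τ ^ k * U) * (x * σ)) * V + fromNat (suc k) * ((τ ^ k * V) * (y * σ)) * U
          ≤⟨ +-mono-≤ (*-monoʳ-≤ 0≤V (half 0≤x 0≤u)) (*-monoʳ-≤ 0≤U (half 0≤y 0≤v)) ⟩
        (x ^ suc k * σ ^ suc k + fromNat k * (τ ^ suc k * u ^ suc k)) * V + (y ^ suc k * σ ^ suc k + fromNat k * (τ ^ suc k * v ^ suc k)) * U
          ≈⟨ collect ⟩
        σ * (σ ^ k * (x ^ suc k * V + y ^ suc k * U)) + fromNat k * (σ * Z) ∎))
      where
      open ≤-R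
      σ = u + v
      τ = x + y
      U = u ^ k
      V = v ^ k
      Z = τ ^ suc k * (U * V)
      0≤U = ^-nonNeg k 0≤u
      0≤V = ^-nonNeg k 0≤v
      0≤σ : 0# ≤ σ
      0≤σ = ≤-trans 0≤u (≤-by 0≤v refl)
      0≤τ : 0# ≤ τ
      0≤τ = ≤-trans 0≤x (≤-by 0≤y refl)
      σ≉0 : ¬ (σ ≈ 0#)
      σ≉0 eq = u≉0 (≤-antisym (≤-trans (≤-by 0≤v refl) (≤-reflexive eq)) 0≤u)
      half : ∀ {x u} → 0# ≤ x → 0# ≤ u →
        fromNat (suc k) * ((τ ^ k * u ^ k) * (x * σ)) ≤ x ^ suc k * σ ^ suc k + fromNat k * (τ ^ suc k * u ^ suc k)
      half {x} {u} 0≤x 0≤u = ≤-respˡ (*-congˡ (*-congʳ (^-distrib-* τ u k)))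
        (≤-respʳ (+-cong (^-distrib-* x σ (suc k)) (*-congˡ (^-distrib-* τ u (suc k))))
          (tangent k {τ * u} {x * σ} (*-nonNeg 0≤τ 0≤u) (*-nonNeg 0≤x 0≤σ)))
      collect : (x ^ suc k * σ ^ suc k + fromNat k * (τ ^ suc k * u ^ suc k)) * V + (y ^ suc k * σ ^ suc k + fromNat k * (τ ^ suc k * v ^ suc k)) * U
        ≈ σ * (σ ^ k * (x ^ suc k * V + y ^ suc k * U)) + fromNat k * (σ * Z)
      collect = trans (+-cong (piece (x ^ suc k) u U V) (trans (piece (y ^ suc k) v V U) (+-congˡ (*-congˡ (*-congˡ (*-congˡ (*-comm V U)))))))
        (trans (solve 5 (λ X Y S p q → (X :* S :+ p) :+ (Y :* S :+ q) := S :* (X :+ Y) :+ (p :+ q)) refl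
                 (x ^ suc k * V) (y ^ suc k * U) (σ ^ suc k) (fromNat k * (u * Z)) (fromNat k * (v * Z)))
          (+-cong (*-assoc σ _ _) (solve 4 (λ a u v Z → a :* (u :* Z) :+ a :* (v :* Z) := a :* ((u :+ v) :* Z)) refl (fromNat k) u v Z)))
        where
        piece : ∀ X u U V → (X * σ ^ suc k + fromNat k * (τ ^ suc k * (u * U))) * V ≈ (X * V) * σ ^ suc k + fromNat k * (u * (τ ^ suc k * (U * V)))
        piece X u U V = solve 7 (λ X S a T u U V → (X :* S :+ a :* (T :* (u :* U))) :* V := (X :* V) :* S :+ a :* (u :* (T :* (U :* V)))) refl
          X (σ ^ suc k) (fromNat k) (τ ^ suc k) u U V

    extremum : {X : Set} (_⊑_ : X → X → Set) (xs : List X) → (∀ {x y} → x ∈ xs → y ∈ xs → x ⊑ y ⊎ y ⊑ x) →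
      (∀ {x y z} → x ⊑ y → y ⊑ z → x ⊑ z) → ∀ {x} → x ∈ xs → ∃[ m ] (m ∈ xs × (∀ {y} → y ∈ xs → y ⊑ m))
    extremum _⊑_ (x ∷ xs) tot tr _ with xs
    ... | [] = x , here ≡.refl , λ { (here ≡.refl) → self }
      where
      self : x ⊑ x
      self with tot {x} {x} (here ≡.refl) (here ≡.refl)
      ... | inj₁ p = p
      ... | inj₂ p = p
    ... | z ∷ zs with extremum _⊑_ (z ∷ zs) (λ p q → tot (there p) (there q)) tr (here ≡.refl)
    ...   | m , m∈ , max with tot {x} {m} (here ≡.refl) (there m∈)
    ...     | inj₁ x⊑m = m , there m∈ , λ { (here ≡.refl) → x⊑m ; (there y∈) → max y∈ }
    ...     | inj₂ m⊑x = x , here ≡.refl , λ { (here ≡.refl) → self ; (there y∈) → tr (max y∈) m⊑x }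
      where
      self : x ⊑ x
      self with tot {x} {x} (here ≡.refl) (here ≡.refl)
      ... | inj₁ p = p
      ... | inj₂ p = p

    ≈0-isSubgroup : IsSubgroup (_≈ 0#)
    ≈0-isSubgroup = record
      { resp  = λ e p → trans (sym e) p
      ; zero′ = refl
      ; add   = λ p q → trans (+-cong p q) (+-identityʳ 0#)
      ; neg   = λ p → trans (-‿cong p) (solve 0 (:- con 0ℤ := con 0ℤ) refl) }

    open Torsion (_≈ 0#) ≈0-isSubgroup
      using (Span; Span-isSubgroup; Span-∷; Span-gen)

    module _ (e : ℕ → Carrier) where

      vectors : ℕ → List Carrier
      vectors zero    = []
      vectors (suc k) = e k ∷ vectors k

      Lin : ℕ → Carrier → Set
      Lin k = Span (vectors k)

      module L k = IsSubgroup (Span-isSubgroup (vectors k))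

      Lin-suc : ∀ k {v} → Lin k v → Lin (suc k) v
      Lin-suc k {v} = Span-∷ {e k} {vectors k} {v}

      Coset : ℕ → Equivalence Carrier
      Coset k = record
        { _~_     = λ x y → Lin k (x - y)
        ; ~-refl  = λ {x} → L.resp k (sym (-‿inverseʳ x)) (L.zero′ k)
        ; ~-sym   = λ {x} {y} p → L.resp k (solve 2 (λ x y → :- (x :- y) := y :- x) refl x y) (L.neg k p)
        ; ~-trans = λ {x} {y} {z} p q → L.resp k (solve 3 (λ x y z → (x :- y) :+ (y :- z) := x :- z) refl x y z) (L.add k p q) }

      -- Size plus an error term counting strings in the first k directions.
      μ : ℕ → List Carrier → ℕ
      μ zero    S = size S
      μ (suc k) S = μ k S ℕ.+ 2 ℕ.^ k ℕ.* # (String (e k)) S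

      ≈⇒String : ∀ {c x y} → x ≈ y → _~_ (String c) x y
      ≈⇒String {c} {x} {y} eq = 0ℤ , trans (+-congʳ eq) (solve 2 (λ y c → y :- y := con 0ℤ :* c) refl y c)

      ⊆≈⇒⊆String : ∀ {c S T} → S ⊆[ ≈E ] T → S ⊆[ String c ] T
      ⊆≈⇒⊆String {c} sub x∈ = let (y , y∈ , eq) = sub x∈ in y , y∈ , ≈⇒String {c} eq

      μ-mono : ∀ k {S T} → S ⊆[ ≈E ] T → μ k S ℕ.≤ μ k T
      μ-mono zero    sub = #-mono ≈E sub
      μ-mono (suc k) {S} {T} sub = ℕ.+-mono-≤ (μ-mono k sub) (ℕ.*-monoʳ-≤ (2 ℕ.^ k) (#-mono (String (e k)) (⊆≈⇒⊆String {e k} {S} {T} sub)))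

      String⇒Lin : ∀ k {x y} → _~_ (String (e k)) x y → Lin (suc k) (x - y)
      String⇒Lin k {x} {y} (z , p) = z , L.resp k (sym (trans (+-congʳ p) (-‿inverseʳ _))) (L.zero′ k)

      -- A string in one of the first k directions stays within a coset of `Lin k`, so the numbers
      -- of strings add up just as the sizes do.
      μ-separated : ∀ k {S T U} → S ⊆[ ≈E ] U → T ⊆[ ≈E ] U → (∀ {x y} → x ∈ S → y ∈ T → ¬ Lin k (x - y)) →
        μ k S ℕ.+ μ k T ℕ.≤ μ k U
      μ-separated zero    S⊆ T⊆ sep = #-disjoint ≈E S⊆ T⊆ (λ x∈ y∈ eq → sep x∈ y∈ (trans (+-congʳ eq) (-‿inverseʳ _)))
      μ-separated (suc k) {S} {T} {U} S⊆ T⊆ sep = begin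
        (μ k S ℕ.+ c ℕ.* s) ℕ.+ (μ k T ℕ.+ c ℕ.* t)    ≡⟨ ℕ-lemma (μ k S) (c ℕ.* s) (μ k T) (c ℕ.* t) ⟩
        (μ k S ℕ.+ μ k T) ℕ.+ (c ℕ.* s ℕ.+ c ℕ.* t)    ≡⟨ ≡.cong ((μ k S ℕ.+ μ k T) ℕ.+_) (ℕ.*-distribˡ-+ c s t) ⟨
        (μ k S ℕ.+ μ k T) ℕ.+ c ℕ.* (s ℕ.+ t)          ≤⟨ ℕ.+-mono-≤ (μ-separated k S⊆ T⊆ (λ x∈ y∈ p → sep x∈ y∈ (Lin-suc k p)))
             (ℕ.*-monoʳ-≤ c (#-disjoint (String (e k)) (⊆≈⇒⊆String {e k} {S} {U} S⊆) (⊆≈⇒⊆String {e k} {T} {U} T⊆) (λ {x} {y} x∈ y∈ p → sep x∈ y∈ (String⇒Lin k {x} {y} p)))) ⟩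
        μ (suc k) U                                  ∎
        where
        open ℕ.≤-Reasoning
        c = 2 ℕ.^ k
        s = # (String (e k)) S
        t = # (String (e k)) T
        ℕ-lemma : ∀ a b c d → (a ℕ.+ b) ℕ.+ (c ℕ.+ d) ≡ (a ℕ.+ c) ℕ.+ (b ℕ.+ d)
        ℕ-lemma = N.solve 4 (λ a b c d → (a N.:+ b) N.:+ (c N.:+ d) N.:= (a N.:+ c) N.:+ (b N.:+ d)) ≡.refl

      μ-≤ : ∀ k S → μ k S ℕ.≤ 2 ℕ.^ k ℕ.* size S
      μ-≤ zero    S = ℕ.≤-reflexive (≡.sym (ℕ.+-identityʳ _))
      μ-≤ (suc k) S = ℕ.≤-trans (ℕ.+-mono-≤ (μ-≤ k S) (ℕ.*-monoʳ-≤ (2 ℕ.^ k) (#-coarser (String (e k)) ≈E (≈⇒String {e k}) S)))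
        (ℕ.≤-reflexive (≡.trans (≡.sym (ℕ.*-distribʳ-+ (size S) (2 ℕ.^ k) (2 ℕ.^ k))) (≡.cong (λ c → (2 ℕ.^ k ℕ.+ c) ℕ.* size S) (≡.sym (ℕ.+-identityʳ _)))))

      class : ℕ → Carrier → List Carrier → List Carrier
      class k p P = select (λ q → Lin k (q - p)) P

      rest : ℕ → Carrier → List Carrier → List Carrier
      rest k p P = select (λ q → ¬ Lin k (q - p)) P

      ⊕-mono : ∀ {P P′ Q Q′} → P′ ⊆ P → Q′ ⊆ Q → (P′ ⊕ Q′) ⊆[ ≈E ] (P ⊕ Q)
      ⊕-mono {P} {P′} {Q} {Q′} P⊆ Q⊆ x∈ = let (a , b , a∈ , b∈ , eq) = ⊕-∈ {A = P′} {Q′} x∈ in _ , ∈-⊕ (P⊆ a∈) (Q⊆ b∈) , reflexive eq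

      ⊕-comm⊆ : ∀ P Q → (P ⊕ Q) ⊆[ ≈E ] (Q ⊕ P)
      ⊕-comm⊆ P Q x∈ = let (a , b , a∈ , b∈ , eq) = ⊕-∈ {A = P} {Q} x∈ in _ , ∈-⊕ b∈ a∈ , trans (reflexive eq) (+-comm a b)

      -- Brunn–Minkowski for subsets of cosets of a lattice of rank k.
      BM : ℕ → Set
      BM k = ∀ P Q {p₀ q₀} → p₀ ∈ P → q₀ ∈ Q → (∀ {p} → p ∈ P → Lin k (p - p₀)) → (∀ {q} → q ∈ Q → Lin k (q - q₀)) →
        ∀ t s {x y} → 0# ≤ x → 0# ≤ y → fromNat t * x ^ k ≤ fromNat s * fromNat (size P) → fromNat t * y ^ k ≤ fromNat s * fromNat (size Q) →
        fromNat t * (x + y) ^ k ≤ fromNat s * fromNat (μ k (P ⊕ Q))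

      BM-zero : BM 0
      BM-zero P Q p∈ q∈ _ _ t s 0≤x 0≤y hp hq = ≤-trans hp (*-monoˡ-≤ (0≤fromNat s) (fromNat-mono (size-⊕ˡ P q∈)))

      class-⊆ : ∀ k p {P} → class k p P ⊆ P
      class-⊆ k p = proj₁ ∘ ∈-select⁻

      rest-⊆ : ∀ k p {P} → rest k p P ⊆ P
      rest-⊆ k p = proj₁ ∘ ∈-select⁻

      class-self : ∀ k {p P} → p ∈ P → p ∈ class k p P
      class-self k {p} p∈ = ∈-select⁺ p∈ (~-refl (Coset k) {p})

      size-class-mono : ∀ k p {P P′} → P′ ⊆ P → size (class k p P′) ℕ.≤ size (class k p P)
      size-class-mono k p sub = size-mono (λ x∈ → let (x∈P , l) = ∈-select⁻ {P = λ q → Lin k (q - p)} x∈ in ∈-select⁺ (sub x∈P) l)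

      size-class-~ : ∀ k p p′ {P} → Lin k (p - p′) → size (class k p P) ℕ.≤ size (class k p′ P)
      size-class-~ k p p′ pp′ = size-mono (λ {x} x∈ → let (x∈P , l) = ∈-select⁻ {P = λ q → Lin k (q - p)} x∈ in
        ∈-select⁺ x∈P (~-trans (Coset k) {x} {p} {p′} l pp′))

      size-split : ∀ k p P → size P ℕ.≤ size (rest k p P) ℕ.+ size (class k p P)
      size-split k p P = ℕ.≤-trans (#-select ≈E (λ q → Lin k (q - p)) P) (ℕ.≤-reflexive (ℕ.+-comm (size (class k p P)) _))

      -- `p̂` and `q̂` will be the sizes of the largest classes of P and Q modulo `Lin k`; they stay
      -- fixed while other classes are removed.
      record Pivot (k : ℕ) : Set where
        field
          p̂ q̂ : ℕ
          u v : Carrier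
          0≤u : 0# ≤ u
          0≤v : 0# ≤ v
          uᵏ : u ^ k ≈ fromNat p̂
          vᵏ : v ^ k ≈ fromNat q̂

        h : Carrier
        h = (u + v) ^ k

        0≤h : 0# ≤ h
        0≤h = ^-nonNeg k (≤-trans 0≤u (≤-by 0≤v refl))

        -- In terms of quotients, μ(P + Q) ≥ h (∣P∣/p̂ + ∣Q∣/q̂ - 1). As this is linear in ∣P∣ and
        -- ∣Q∣, it can be proved by removing one class at a time.
        Claim : List Carrier → List Carrier → Set
        Claim P Q = h * (fromNat (size P) * fromNat q̂ + fromNat (size Q) * fromNat p̂) ≤
          fromNat p̂ * fromNat q̂ * fromNat (μ k (P ⊕ Q)) + fromNat p̂ * fromNat q̂ * h

      swap : ∀ {k} → Pivot k → Pivot k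
      swap V = record { p̂ = q̂ ; q̂ = p̂ ; u = v ; v = u ; 0≤u = 0≤v ; 0≤v = 0≤u ; uᵏ = vᵏ ; vᵏ = uᵏ }
        where open Pivot V

      Claim-swap : ∀ {k} (V : Pivot k) P Q → Pivot.Claim (swap V) Q P → Pivot.Claim V P Q
      Claim-swap {k} V P Q c = begin
        h * (fromNat (size P) * fromNat q̂ + fromNat (size Q) * fromNat p̂)
          ≈⟨ *-cong (^-congˡ k (+-comm u v)) (+-comm _ _) ⟩
        (v + u) ^ k * (fromNat (size Q) * fromNat p̂ + fromNat (size P) * fromNat q̂)   ≤⟨ c ⟩
        fromNat q̂ * fromNat p̂ * fromNat (μ k (Q ⊕ P)) + fromNat q̂ * fromNat p̂ * (v + u) ^ k
          ≤⟨ +-mono-≤ (*-monoˡ-≤ (*-nonNeg (0≤fromNat q̂) (0≤fromNat p̂)) (fromNat-mono (μ-mono k (⊕-comm⊆ Q P))))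
               (≤-reflexive (*-congˡ (^-congˡ k (+-comm v u)))) ⟩
        fromNat q̂ * fromNat p̂ * fromNat (μ k (P ⊕ Q)) + fromNat q̂ * fromNat p̂ * h
          ≈⟨ +-cong (*-congʳ (*-comm _ _)) (*-congʳ (*-comm _ _)) ⟩
        fromNat p̂ * fromNat q̂ * fromNat (μ k (P ⊕ Q)) + fromNat p̂ * fromNat q̂ * h ∎
        where
        open ≤-R
        open Pivot V

      -- Removing from P a class whose sum with some class of Q is separated from the other sums.
      remove : ∀ {k} → BM k → (V : Pivot k) → let open Pivot V in ∀ {P Q p q} → p ∈ P → q ∈ Q →
        size (class k p P) ℕ.* q̂ ℕ.≤ size (class k q Q) ℕ.* p̂ →
        (∀ {x y x′ y′} → x ∈ rest k p P → y ∈ Q → x′ ∈ class k p P → y′ ∈ class k q Q → ¬ Lin k ((x + y) - (x′ + y′))) →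
        Claim (rest k p P) Q → Claim P Q
      remove {k} bm V {P} {Q} {p} {q} p∈ q∈ w sep ih = begin
        h * (fromNat (size P) * q′ + fromNat (size Q) * p′)
          ≤⟨ *-monoˡ-≤ 0≤h (+-mono-≤ (*-monoʳ-≤ (0≤fromNat q̂) (≤-respʳ (fromNat-+ (size P₀) (size P₁)) (fromNat-mono (size-split k p P)))) ≤-refl) ⟩
        h * ((fromNat (size P₀) + n₁) * q′ + fromNat (size Q) * p′)
          ≈⟨ solve 6 (λ h a n q b p → h :* ((a :+ n) :* q :+ b :* p) := h :* (a :* q :+ b :* p) :+ q :* (n :* h)) refl h (fromNat (size P₀)) n₁ q′ (fromNat (size Q)) p′ ⟩
        h * (fromNat (size P₀) * q′ + fromNat (size Q) * p′) + q′ * (n₁ * h)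
          ≤⟨ +-mono-≤ ih (*-monoˡ-≤ (0≤fromNat q̂) step) ⟩
        (p′ * q′ * fromNat (μ k (P₀ ⊕ Q)) + p′ * q′ * h) + q′ * (p′ * fromNat (μ k (P₁ ⊕ Q₁)))
          ≈⟨ solve 5 (λ p q a h b → (p :* q :* a :+ p :* q :* h) :+ q :* (p :* b) := p :* q :* (a :+ b) :+ p :* q :* h) refl p′ q′ (fromNat (μ k (P₀ ⊕ Q))) h (fromNat (μ k (P₁ ⊕ Q₁))) ⟩
        p′ * q′ * (fromNat (μ k (P₀ ⊕ Q)) + fromNat (μ k (P₁ ⊕ Q₁))) + p′ * q′ * h
          ≤⟨ +-mono-≤ (*-monoˡ-≤ (*-nonNeg (0≤fromNat p̂) (0≤fromNat q̂)) (≤-respˡ (fromNat-+ (μ k (P₀ ⊕ Q)) (μ k (P₁ ⊕ Q₁)))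
               (fromNat-mono (μ-separated k (⊕-mono (rest-⊆ k p) (λ z → z)) (⊕-mono (class-⊆ k p) (class-⊆ k q)) sep′)))) ≤-refl ⟩
        p′ * q′ * fromNat (μ k (P ⊕ Q)) + p′ * q′ * h ∎
        where
        open ≤-R
        open Pivot V
        P₀ = rest k p P
        P₁ = class k p P
        Q₁ = class k q Q
        p′ = fromNat p̂
        q′ = fromNat q̂
        n₁ = fromNat (size P₁)
        -- The factor ∣P₁∣/p̂ scales the pivot of P to the size of P₁, and that of Q to at most the
        -- size of Q₁ by the comparison `w`.
        step : n₁ * h ≤ p′ * fromNat (μ k (P₁ ⊕ Q₁))
        step = bm P₁ Q₁ (class-self k p∈) (class-self k q∈) (proj₂ ∘ ∈-select⁻ {P = λ x → Lin k (x - p)}) (proj₂ ∘ ∈-select⁻ {P = λ x → Lin k (x - q)})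
          (size P₁) p̂ 0≤u 0≤v
          (≤-reflexive (trans (*-congˡ uᵏ) (*-comm _ _)))
          (≤-respˡ (sym (*-congˡ vᵏ)) (≤-respʳ (*-comm _ _) (≤-respˡ (fromNat-* (size P₁) q̂) (≤-respʳ (fromNat-* (size Q₁) p̂) (fromNat-mono w)))))
        sep′ : ∀ {x y} → x ∈ (P₀ ⊕ Q) → y ∈ (P₁ ⊕ Q₁) → ¬ Lin k (x - y)
        sep′ x∈ y∈ l = let (a , b , a∈ , b∈ , eq) = ⊕-∈ {A = P₀} {Q} x∈
                           (c , d , c∈ , d∈ , eq′) = ⊕-∈ {A = P₁} {Q₁} y∈
                       in sep a∈ b∈ c∈ d∈ (L.resp k (+-cong (reflexive eq) (-‿cong (reflexive eq′))) l)

      module Step (k : ℕ) (bm : BM k) (independent : ∀ z → Lin k (fromInt z * e k) → z ≡ 0ℤ) where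

        -- y lies at most as far as x in the direction c = ± e k.
        Before : Carrier → Carrier → Carrier → Set
        Before c x y = ∃[ i ] Lin k ((y - x) - fromNat i * c)

        Direction : Carrier → Set
        Direction c = ∀ i → Lin k (fromNat i * c) → i ≡ 0

        e-direction : Direction (e k)
        e-direction i l = ℤ.+-injective (independent (ℤ.+ i) l)

        -e-direction : Direction (- e k)
        -e-direction i l = ℤ.+-injective (independent (ℤ.+ i)
          (L.resp k (solve 2 (λ i c → :- (i :* (:- c)) := i :* c) refl (fromNat i) (e k)) (L.neg k l)))

        Line : Carrier → List Carrier → Set
        Line p₀ P = ∀ {p} → p ∈ P → Lin (suc k) (p - p₀)

        before-trans : ∀ {c x y z} → Before c x y → Before c y z → Before c x z
        before-trans {c} {x} {y} {z} (i , l) (j , m) = i ℕ.+ j , L.resp k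
          (trans (solve 6 (λ x y z i j c → ((y :- x) :- i :* c) :+ ((z :- y) :- j :* c) := (z :- x) :- (i :+ j) :* c) refl x y z (fromNat i) (fromNat j) c)
            (+-congˡ (-‿cong (*-congʳ (sym (fromNat-+ i j)))))) (L.add k l m)

        before-total : ∀ {c p₀ P} → c ≡ e k ⊎ c ≡ - e k → Line p₀ P → ∀ {x y} → x ∈ P → y ∈ P → Before c x y ⊎ Before c y x
        before-total {c} {p₀} dir line {x} {y} x∈ y∈ = go dir (proj₁ (line y∈) ℤ.- proj₁ (line x∈))
            (L.resp k (trans (solve 6 (λ x y a i j c → ((y :- a) :- j :* c) :- ((x :- a) :- i :* c) := (y :- x) :- (j :- i) :* c) refl
                         x y p₀ (fromInt (proj₁ (line x∈))) (fromInt (proj₁ (line y∈))) (e k))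
               (+-congˡ (-‿cong (*-congʳ (sym (trans (fromInt-+ (proj₁ (line y∈)) (ℤ.- proj₁ (line x∈))) (+-congˡ (fromInt-neg (proj₁ (line x∈))))))))))
              (L.sub k (proj₂ (line y∈)) (proj₂ (line x∈))))
          where
          go : c ≡ e k ⊎ c ≡ - e k → ∀ z → Lin k ((y - x) - fromInt z * e k) → Before c x y ⊎ Before c y x
          go (inj₁ ≡.refl) (ℤ.+ n)    l = inj₁ (n , l)
          go (inj₁ ≡.refl) ℤ.-[1+ n ] l = inj₂ (suc n , L.resp k
            (solve 4 (λ x y n c → :- ((y :- x) :- (:- n) :* c) := (x :- y) :- n :* c) refl x y (fromNat (suc n)) (e k)) (L.neg k l))
          go (inj₂ ≡.refl) (ℤ.+ n)    l = inj₂ (n , L.resp k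
            (solve 4 (λ x y n c → :- ((y :- x) :- n :* c) := (x :- y) :- n :* (:- c)) refl x y (fromNat n) (e k)) (L.neg k l))
          go (inj₂ ≡.refl) ℤ.-[1+ n ] l = inj₁ (suc n , L.resp k
            (solve 4 (λ x y n c → (y :- x) :- (:- n) :* c := (y :- x) :- n :* (:- c)) refl x y (fromNat (suc n)) (e k)) l)

        before-class : ∀ {c x y x′} → Before c x y → Lin k (x′ - y) → Before c x x′
        before-class {c} {x} {y} {x′} (i , l) m = i , L.resp k
          (solve 5 (λ x y z i c → (z :- y) :+ ((y :- x) :- i :* c) := (z :- x) :- i :* c) refl x y x′ (fromNat i) c) (L.add k m l)

        -- The offsets from x to x′ and from y to y′ along c are both nonnegative, so if the two
        -- sums are congruent, their total vanishes and so does each of them.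
        separated : ∀ {c x y x′ y′} → Direction c → Before c x x′ → Before c y y′ → ¬ Lin k (x′ - x) → ¬ Lin k ((x + y) - (x′ + y′))
        separated {c} {x} {y} {x′} {y′} dir (i , l) (j , m) x≁ s = x≁ (L.resp k
            (trans (+-congˡ (-‿cong (trans (*-congʳ (reflexive (≡.cong fromNat i≡0))) (zeroˡ c)))) (solve 2 (λ u v → (u :- v) :- con 0ℤ := u :- v) refl x′ x)) l)
          where
          i+j≡0 : i ℕ.+ j ≡ 0
          i+j≡0 = dir (i ℕ.+ j) (L.resp k
            (trans (solve 7 (λ x y x′ y′ i j c → :- (((x′ :- x) :- i :* c) :+ ((y′ :- y) :- j :* c)) :- ((x :+ y) :- (x′ :+ y′)) := (i :+ j) :* c) refl
                      x y x′ y′ (fromNat i) (fromNat j) c) (*-congʳ (sym (fromNat-+ i j))))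
            (L.sub k (L.neg k (L.add k l m)) s))
          i≡0 : i ≡ 0
          i≡0 = ℕ.m+n≡0⇒m≡0 i i+j≡0

        record Data (V : Pivot k) (p* q* : Carrier) (P Q : List Carrier) : Set where
          open Pivot V
          field
            p*∈   : p* ∈ P
            q*∈   : q* ∈ Q
            lineP : Line p* P
            lineQ : Line q* Q
            boundP : ∀ {p} → p ∈ P → size (class k p P) ℕ.≤ p̂
            boundQ : ∀ {q} → q ∈ Q → size (class k q Q) ℕ.≤ q̂
            pivotP : p̂ ℕ.≤ size (class k p* P)
            pivotQ : q̂ ℕ.≤ size (class k q* Q)

        Data-swap : ∀ {V p* q* P Q} → Data V p* q* P Q → Data (swap V) q* p* Q P
        Data-swap D = record
          { p*∈ = q*∈ ; q*∈ = p*∈ ; lineP = lineQ ; lineQ = lineP ; boundP = boundQ ; boundQ = boundP ; pivotP = pivotQ ; pivotQ = pivotP }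
          where open Data D

        Data-remove : ∀ {V p* q* P Q p} → Data V p* q* P Q → ¬ Lin k (p* - p) → Data V p* q* (rest k p P) Q
        Data-remove {V} {p*} {q*} {P} {Q} {p} D p*≁p = record
          { p*∈ = ∈-select⁺ p*∈ p*≁p ; q*∈ = q*∈ ; lineP = λ x∈ → lineP (rest-⊆ k p x∈) ; lineQ = lineQ
          ; boundP = λ {x} x∈ → ℕ.≤-trans (size-class-mono k x (rest-⊆ k p)) (boundP (rest-⊆ k p x∈))
          ; boundQ = boundQ
          ; pivotP = ℕ.≤-trans pivotP (size-mono (λ {x} x∈ → let (x∈P , l) = ∈-select⁻ {P = λ q → Lin k (q - p*)} x∈ in
              ∈-select⁺ (∈-select⁺ x∈P (λ m → p*≁p (~-trans (Coset k) {p*} {x} {p} (~-sym (Coset k) {x} {p*} l) m))) l))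
          ; pivotQ = pivotQ }
          where open Data D

        module _ (V : Pivot k) where
          open Pivot V

          Rec : Carrier → Carrier → List Carrier → List Carrier → Set
          Rec p* q* P Q = (∀ {P′} → length P′ ℕ.< length P → Data V p* q* P′ Q → Claim P′ Q) ×
                          (∀ {Q′} → length Q′ ℕ.< length Q → Data V p* q* P Q′ → Claim P Q′)

          Ends : Carrier → Carrier → Carrier → List Carrier → List Carrier → Set
          Ends c p q P Q = (∀ {x} → x ∈ P → Before c x p) × (∀ {x} → x ∈ Q → Before c x q)

          -- The relatively smaller of the two end classes is removed, since its sum with the other
          -- one is separated from the remaining sums. Should it be the pivot, then the other end
          -- class, being at most its own pivot, is not relatively larger and can be removed
          -- instead.
          peel-at : ∀ {p* q* P Q c p q} → Direction c → Data V p* q* P Q → Rec p* q* P Q → p ∈ P → q ∈ Q →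
            Ends c p q P Q → Claim P Q ⊎ Ends c p* q* P Q
          peel-at {p*} {q*} {P} {Q} {c} {p} {q} dir D (recP , recQ) p∈ q∈ (maxP , maxQ) = decide (dec em) (dec em) (ℕ.≤-total (wp ℕ.* q̂) (wq ℕ.* p̂))
            where
            open Data D
            wp = size (class k p P)
            wq = size (class k q Q)
            dec : ∀ {X : Set} → Dec X → X ⊎ ¬ X
            dec (yes a) = inj₁ a
            dec (no a)  = inj₂ a
            sepP : ∀ {x y x′ y′} → x ∈ rest k p P → y ∈ Q → x′ ∈ class k p P → y′ ∈ class k q Q → ¬ Lin k ((x + y) - (x′ + y′))
            sepP {x} {y} {x′} {y′} x∈ y∈ x′∈ y′∈ = separated dir (before-class (maxP (rest-⊆ k p x∈)) lx′)
                (before-class (maxQ y∈) (proj₂ (∈-select⁻ {P = λ x → Lin k (x - q)} y′∈)))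
                (λ l → proj₂ (∈-select⁻ {P = λ x → ¬ Lin k (x - p)} x∈) (~-trans (Coset k) {x} {x′} {p} (~-sym (Coset k) {x′} {x} l) lx′))
              where lx′ = proj₂ (∈-select⁻ {P = λ x → Lin k (x - p)} x′∈)
            sepQ : ∀ {x y x′ y′} → x ∈ rest k q Q → y ∈ P → x′ ∈ class k q Q → y′ ∈ class k p P → ¬ Lin k ((x + y) - (x′ + y′))
            sepQ {x} {y} {x′} {y′} x∈ y∈ x′∈ y′∈ = separated dir (before-class (maxQ (rest-⊆ k q x∈)) lx′)
                (before-class (maxP y∈) (proj₂ (∈-select⁻ {P = λ x → Lin k (x - p)} y′∈)))
                (λ l → proj₂ (∈-select⁻ {P = λ x → ¬ Lin k (x - q)} x∈) (~-trans (Coset k) {x} {x′} {q} (~-sym (Coset k) {x′} {x} l) lx′))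
              where lx′ = proj₂ (∈-select⁻ {P = λ x → Lin k (x - q)} x′∈)
            removeP : ¬ Lin k (p* - p) → wp ℕ.* q̂ ℕ.≤ wq ℕ.* p̂ → Claim P Q
            removeP p*≁p w = remove bm V p∈ q∈ w sepP (recP (length-select-< {P = λ x → ¬ Lin k (x - p)} p∈ (λ n → n (~-refl (Coset k) {p}))) (Data-remove D p*≁p))
            removeQ : ¬ Lin k (q* - q) → wq ℕ.* p̂ ℕ.≤ wp ℕ.* q̂ → Claim P Q
            removeQ q*≁q w = Claim-swap V P Q (remove bm (swap V) q∈ p∈ w sepQ (Claim-swap (swap V) (rest k q Q) P
              (recQ (length-select-< {P = λ x → ¬ Lin k (x - q)} q∈ (λ n → n (~-refl (Coset k) {q}))) (Data-swap (Data-remove (Data-swap D) q*≁q)))))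
            p̂≤wp : Lin k (p* - p) → p̂ ℕ.≤ wp
            p̂≤wp l = ℕ.≤-trans pivotP (size-class-~ k p* p l)
            q̂≤wq : Lin k (q* - q) → q̂ ℕ.≤ wq
            q̂≤wq l = ℕ.≤-trans pivotQ (size-class-~ k q* q l)
            decide : (Lin k (p* - p) ⊎ ¬ Lin k (p* - p)) → (Lin k (q* - q) ⊎ ¬ Lin k (q* - q)) →
              wp ℕ.* q̂ ℕ.≤ wq ℕ.* p̂ ⊎ wq ℕ.* p̂ ℕ.≤ wp ℕ.* q̂ → Claim P Q ⊎ Ends c p* q* P Q
            decide (inj₁ lp) (inj₁ lq) _ = inj₂ ((λ x∈ → before-class (maxP x∈) lp) , (λ y∈ → before-class (maxQ y∈) lq))
            decide (inj₂ np) _ (inj₁ w) = inj₁ (removeP np w)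
            decide _ (inj₂ nq) (inj₂ w) = inj₁ (removeQ nq w)
            decide (inj₁ lp) (inj₂ nq) (inj₁ w) = inj₁ (removeQ nq (ℕ.≤-trans (ℕ.*-monoˡ-≤ p̂ (boundQ q∈)) (ℕ.≤-trans (ℕ.≤-reflexive (ℕ.*-comm q̂ p̂)) (ℕ.*-monoˡ-≤ q̂ (p̂≤wp lp)))))
            decide (inj₂ np) (inj₁ lq) (inj₂ w) = inj₁ (removeP np (ℕ.≤-trans (ℕ.*-monoˡ-≤ q̂ (boundP p∈)) (ℕ.≤-trans (ℕ.≤-reflexive (ℕ.*-comm p̂ q̂)) (ℕ.*-monoˡ-≤ p̂ (q̂≤wq lq)))))

          -- Either a class at the end of P or Q in direction c can be removed, or both ends are pivots.
          peel : ∀ {p* q* P Q c} → c ≡ e k ⊎ c ≡ - e k → Direction c → Data V p* q* P Q → Rec p* q* P Q →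
            Claim P Q ⊎ Ends c p* q* P Q
          peel {p*} {q*} {P} {Q} {c} is-e dir D rec =
            let (p , p∈ , maxP) = extremum (Before c) P (before-total is-e (Data.lineP D)) before-trans (Data.p*∈ D)
                (q , q∈ , maxQ) = extremum (Before c) Q (before-total is-e (Data.lineQ D)) before-trans (Data.q*∈ D)
            in peel-at dir D rec p∈ q∈ (maxP , maxQ)

          -- With the pivot last both along e k and along - e k, the two offsets add up to zero.
          squeeze : ∀ {p p*} → Before (e k) p p* → Before (- e k) p p* → Lin k (p - p*)
          squeeze {p} {p*} (i , l) (j , m) = L.resp k
              (trans (-‿cong (+-congˡ (-‿cong (trans (*-congʳ (reflexive (≡.cong fromNat (ℕ.m+n≡0⇒m≡0 i i+j≡0)))) (zeroˡ (e k))))))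
                (solve 2 (λ u v → :- ((u :- v) :- con 0ℤ) := v :- u) refl p* p)) (L.neg k l)
            where
            i+j≡0 : i ℕ.+ j ≡ 0
            i+j≡0 = e-direction (i ℕ.+ j) (L.resp k
              (trans (solve 5 (λ u v i j c → ((v :- u) :- j :* (:- c)) :- ((v :- u) :- i :* c) := (i :+ j) :* c) refl p p* (fromNat i) (fromNat j) (e k))
                (*-congʳ (sym (fromNat-+ i j)))) (L.sub k m l))

          -- Both ends are peeled until only the pivot classes remain; for these the claim reduces
          -- to the inequality of rank k.
          claim : ∀ n {p* q*} P Q → length P ℕ.+ length Q ℕ.≤ n → Data V p* q* P Q → Claim P Q
          claim zero    []      _ _  D with Data.p*∈ D
          ... | ()
          claim zero    (_ ∷ _) _ () D
          claim (suc n) {p*} {q*} P Q le D = finish (peel (inj₁ ≡.refl) e-direction D rec) (peel (inj₂ ≡.refl) -e-direction D rec)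
            where
            open Data D
            rec : Rec p* q* P Q
            rec = (λ {P′} lt D′ → claim n P′ Q (ℕ.≤-pred (ℕ.≤-trans (ℕ.+-monoˡ-< (length Q) lt) le)) D′) ,
                  (λ {Q′} lt D′ → claim n P Q′ (ℕ.≤-pred (ℕ.≤-trans (ℕ.+-monoʳ-< (length P) lt) le)) D′)
            finish : Claim P Q ⊎ Ends (e k) p* q* P Q →
                     Claim P Q ⊎ Ends (- e k) p* q* P Q → Claim P Q
            finish (inj₁ c) _ = c
            finish (inj₂ _) (inj₁ c) = c
            finish (inj₂ (p⁺ , q⁺)) (inj₂ (p⁻ , q⁻)) = begin
                h * (fromNat (size P) * q′ + fromNat (size Q) * p′)
                  ≤⟨ *-monoˡ-≤ 0≤h (+-mono-≤ (*-monoʳ-≤ (0≤fromNat q̂) (fromNat-mono P≤)) (*-monoʳ-≤ (0≤fromNat p̂) (fromNat-mono Q≤))) ⟩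
                h * (p′ * q′ + q′ * p′)        ≈⟨ solve 3 (λ h p q → h :* (p :* q :+ q :* p) := p :* q :* h :+ p :* q :* h) refl h p′ q′ ⟩
                p′ * q′ * h + p′ * q′ * h      ≤⟨ +-mono-≤ (*-monoˡ-≤ (*-nonNeg (0≤fromNat p̂) (0≤fromNat q̂)) h≤μ) ≤-refl ⟩
                p′ * q′ * fromNat (μ k (P ⊕ Q)) + p′ * q′ * h ∎
              where
              open ≤-R
              p′ = fromNat p̂
              q′ = fromNat q̂
              P~ : ∀ {p} → p ∈ P → Lin k (p - p*)
              P~ p∈ = squeeze (p⁺ p∈) (p⁻ p∈)
              Q~ : ∀ {q} → q ∈ Q → Lin k (q - q*)
              Q~ q∈ = squeeze (q⁺ q∈) (q⁻ q∈)
              P≤ : size P ℕ.≤ p̂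
              P≤ = ℕ.≤-trans (size-mono (λ x∈ → ∈-select⁺ x∈ (P~ x∈))) (boundP p*∈)
              Q≤ : size Q ℕ.≤ q̂
              Q≤ = ℕ.≤-trans (size-mono (λ x∈ → ∈-select⁺ x∈ (Q~ x∈))) (boundQ q*∈)
              unit : ∀ {x} m n → x ≈ fromNat m → m ℕ.≤ n → fromNat 1 * x ≤ fromNat 1 * fromNat n
              unit m n eq le = *-monoˡ-≤ (0≤fromNat 1) (≤-respˡ (sym eq) (fromNat-mono le))
              h≤μ : h ≤ fromNat (μ k (P ⊕ Q))
              h≤μ = fromNat-*-cancelˡ {n = 1} (s≤s z≤n) (bm P Q p*∈ q*∈ P~ Q~ 1 1 0≤u 0≤v
                (unit p̂ (size P) uᵏ (ℕ.≤-trans pivotP (size-mono (class-⊆ k p*))))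
                (unit q̂ (size Q) vᵏ (ℕ.≤-trans pivotQ (size-mono (class-⊆ k q*)))))

        -- Rank 0 is treated apart because `root` concerns positive exponents: a class then has a
        -- single element, and u = 1 will do.
        class-root : ∀ p {P} → p ∈ P → ∃[ u ] (0# ≤ u × ¬ (u ≈ 0#) × u ^ k ≈ fromNat (size (class k p P)))
        class-root p {P} p∈ = go k ≡.refl
          where
          n = size (class k p P)
          1≤n : 1 ℕ.≤ n
          1≤n = #-pos ≈E (class-self k p∈)
          go : ∀ k′ → k ≡ k′ → ∃[ u ] (0# ≤ u × ¬ (u ≈ 0#) × u ^ k′ ≈ fromNat n)
          go zero     ≡.refl = 1# , 0≤1 , (λ q → 0≉1 (sym q)) , trans (sym fromNat-1) (reflexive (≡.cong fromNat (ℕ.≤-antisym 1≤n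
            (#-length ≈E (class 0 p P) {[ p ]} _≈_ (λ x∈ → p , here ≡.refl , x-y≈0⇒x≈y (proj₂ (∈-select⁻ {P = λ x → x - p ≈ 0#} x∈)))
              (λ a b → trans a (sym b))))))
          go (suc k′) ≡.refl = let (u , 0≤u , eq) = root (suc k′) (s≤s z≤n) (0≤fromNat n) in
            u , 0≤u , (λ u≈0 → fromNat≉0 1≤n (trans (sym eq) (trans (*-congʳ u≈0) (zeroˡ _)))) , eq

        -- `radon` turns `claim` into the inequality of rank k + 1, up to the loss of h. Strings pay
        -- for this: the sum of the pivot classes lies in one coset of `Lin k`, so by independence
        -- its elements lie on different strings of step e k, and h is at most 2ᵏ times their number
        -- by `μ-≤`. Hence the weights 2ᵏ in `μ`.
        bm-suc : BM (suc k)
        bm-suc P Q {p₀} {q₀} p₀∈ q₀∈ lineP lineQ t s {x} {y} 0≤x 0≤y hp hq =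
            *-cancelˡ-≤ 0≤pq (*-pos (fromNat≉0 (#-pos ≈E (class-self k p*∈))) (fromNat≉0 (#-pos ≈E (class-self k q*∈)))) (begin
              pq * (t′ * (x + y) ^ suc k)
                ≈⟨ *-congʳ (sym (*-cong uᵏ vᵏ)) ⟩
              (u ^ k * v ^ k) * (t′ * (x + y) ^ suc k)
                ≈⟨ solve 4 (λ U V t X → (U :* V) :* (t :* X) := t :* (X :* (U :* V))) refl (u ^ k) (v ^ k) t′ ((x + y) ^ suc k) ⟩
              t′ * ((x + y) ^ suc k * (u ^ k * v ^ k))
                ≤⟨ *-monoˡ-≤ (0≤fromNat t) (radon k 0≤x 0≤y 0≤u 0≤v u≉0) ⟩
              t′ * (h * (x ^ suc k * v ^ k + y ^ suc k * u ^ k))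
                ≈⟨ solve 6 (λ t h X V Y U → t :* (h :* (X :* V :+ Y :* U)) := h :* ((t :* X) :* V :+ (t :* Y) :* U)) refl t′ h (x ^ suc k) (v ^ k) (y ^ suc k) (u ^ k) ⟩
              h * ((t′ * x ^ suc k) * v ^ k + (t′ * y ^ suc k) * u ^ k)
                ≤⟨ *-monoˡ-≤ 0≤h (+-mono-≤ (*-monoʳ-≤ (^-nonNeg k 0≤v) hp) (*-monoʳ-≤ (^-nonNeg k 0≤u) hq)) ⟩
              h * ((s′ * fromNat (size P)) * v ^ k + (s′ * fromNat (size Q)) * u ^ k)
                ≈⟨ *-congˡ (+-cong (*-congˡ vᵏ) (*-congˡ uᵏ)) ⟩
              h * ((s′ * fromNat (size P)) * fromNat q̂ + (s′ * fromNat (size Q)) * fromNat p̂)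
                ≈⟨ solve 6 (λ h s P q Q p → h :* ((s :* P) :* q :+ (s :* Q) :* p) := s :* (h :* (P :* q :+ Q :* p))) refl h s′ (fromNat (size P)) (fromNat q̂) (fromNat (size Q)) (fromNat p̂) ⟩
              s′ * (h * (fromNat (size P) * fromNat q̂ + fromNat (size Q) * fromNat p̂))
                ≤⟨ *-monoˡ-≤ (0≤fromNat s) (claim V _ P Q ℕ.≤-refl D) ⟩
              s′ * (pq * fromNat (μ k (P ⊕ Q)) + pq * h)
                ≤⟨ *-monoˡ-≤ (0≤fromNat s) (+-mono-≤ ≤-refl (*-monoˡ-≤ 0≤pq h≤)) ⟩
              s′ * (pq * fromNat (μ k (P ⊕ Q)) + pq * fromNat (2 ℕ.^ k ℕ.* # (String (e k)) (P ⊕ Q)))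
                ≈⟨ *-congˡ (trans (sym (distribˡ pq _ _)) (*-congˡ (sym (fromNat-+ (μ k (P ⊕ Q)) _)))) ⟩
              s′ * (pq * fromNat (μ (suc k) (P ⊕ Q)))
                ≈⟨ solve 3 (λ s p m → s :* (p :* m) := p :* (s :* m)) refl s′ pq _ ⟩
              pq * (s′ * fromNat (μ (suc k) (P ⊕ Q))) ∎)
          where
          open ≤-R
          maxP = maximiser (λ p → size (class k p P)) p₀∈
          maxQ = maximiser (λ q → size (class k q Q)) q₀∈
          p* = proj₁ maxP
          q* = proj₁ maxQ
          p*∈ : p* ∈ P
          p*∈ = proj₁ (proj₂ maxP)
          q*∈ : q* ∈ Q
          q*∈ = proj₁ (proj₂ maxQ)
          p̂ = size (class k p* P)
          q̂ = size (class k q* Q)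
          t′ = fromNat t
          s′ = fromNat s
          pq = fromNat p̂ * fromNat q̂
          0≤pq : 0# ≤ pq
          0≤pq = *-nonNeg (0≤fromNat p̂) (0≤fromNat q̂)
          rootP = class-root p* p*∈
          rootQ = class-root q* q*∈
          u = proj₁ rootP
          v = proj₁ rootQ
          0≤u = proj₁ (proj₂ rootP)
          0≤v = proj₁ (proj₂ rootQ)
          u≉0 = proj₁ (proj₂ (proj₂ rootP))
          uᵏ = proj₂ (proj₂ (proj₂ rootP))
          vᵏ = proj₂ (proj₂ (proj₂ rootQ))
          V : Pivot k
          V = record { p̂ = p̂ ; q̂ = q̂ ; u = u ; v = v ; 0≤u = 0≤u ; 0≤v = 0≤v ; uᵏ = uᵏ ; vᵏ = vᵏ }
          open Pivot V using (h; 0≤h)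
          line : ∀ {P : List Carrier} {p₀ p* : Carrier} → p* ∈ P → Line p₀ P → Line p* P
          line {P} {p₀} {p*} p*∈ l {p} p∈ = ~-trans (Coset (suc k)) {p} {p₀} {p*} (l p∈) (~-sym (Coset (suc k)) {p*} {p₀} (l p*∈))
          D : Data V p* q* P Q
          D = record
            { p*∈ = p*∈ ; q*∈ = q*∈ ; lineP = line p*∈ lineP ; lineQ = line q*∈ lineQ
            ; boundP = proj₂ (proj₂ maxP) ; boundQ = proj₂ (proj₂ maxQ) ; pivotP = ℕ.≤-refl ; pivotQ = ℕ.≤-refl }
          P* = class k p* P
          Q* = class k q* Q
          strings : size (P* ⊕ Q*) ℕ.≤ # (String (e k)) (P ⊕ Q)
          strings = #-≤ ≈E (String (e k)) _≈_ (λ x∈ → ⊕-mono (class-⊆ k p*) (class-⊆ k q*) x∈)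
            (λ {x} {x′} {y} {y′} x∈ x′∈ x≈y x′≈y′ (z , yy′) →
              let (a , b , a∈ , b∈ , eq) = ⊕-∈ {A = P*} {Q*} x∈
                  (a′ , b′ , a′∈ , b′∈ , eq′) = ⊕-∈ {A = P*} {Q*} x′∈
                  l = λ {p : Carrier} {P : List Carrier} {a : Carrier} (a∈ : a ∈ class k p P) → proj₂ (∈-select⁻ {P = λ q → Lin k (q - p)} a∈)
                  xx′≈ = trans (+-cong x≈y (-‿cong x′≈y′)) yy′
                  z≡0 = independent z (L.resp k (trans
                    (solve 6 (λ a b a′ b′ p q → ((a :- p) :+ (b :- q)) :- ((a′ :- p) :+ (b′ :- q)) := (a :+ b) :- (a′ :+ b′)) refl a b a′ b′ p* q*)
                    (trans (sym (+-cong (reflexive eq) (-‿cong (reflexive eq′)))) xx′≈))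
                    (L.sub k (L.add k (l a∈) (l b∈)) (L.add k (l a′∈) (l b′∈))))
              in x-y≈0⇒x≈y (trans xx′≈ (trans (*-congʳ (reflexive (≡.cong fromInt z≡0))) (zeroˡ _))))
          h≤ : h ≤ fromNat (2 ℕ.^ k ℕ.* # (String (e k)) (P ⊕ Q))
          h≤ = ≤-trans (fromNat-*-cancelˡ {n = 1} (s≤s z≤n) (bm P* Q* (class-self k p*∈) (class-self k q*∈)
                 (proj₂ ∘ ∈-select⁻ {P = λ q → Lin k (q - p*)}) (proj₂ ∘ ∈-select⁻ {P = λ q → Lin k (q - q*)}) 1 1 0≤u 0≤v
                 (≤-reflexive (*-congˡ uᵏ)) (≤-reflexive (*-congˡ vᵏ))))
               (fromNat-mono (ℕ.≤-trans (μ-≤ k (P* ⊕ Q*)) (ℕ.*-monoʳ-≤ (2 ℕ.^ k) strings)))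

      module _ (d : ℕ) (independent : ∀ k → k ℕ.< d → ∀ z → Lin k (fromInt z * e k) → z ≡ 0ℤ) where

        lattice : ∀ k → k ℕ.≤ d → BM k
        lattice zero    _  = BM-zero
        lattice (suc k) lt = Step.bm-suc k (lattice k (ℕ.≤-trans (ℕ.n≤1+n k) lt)) (independent k lt)

        -- Only one class of Q is added, so the sums coming from different cosets in P are
        -- separated, and the inequalities for these cosets can be added, each weighted by its size.
        cosets : ∀ {p̂ u v q* Q} → 0# ≤ u → 0# ≤ v → u ^ d ≈ fromNat p̂ → v ^ d ≈ fromNat (size (class d q* Q)) → q* ∈ Q →
          ∀ n P → length P ℕ.≤ n → (∀ {p} → p ∈ P → size (class d p P) ℕ.≤ p̂) →
          (u + v) ^ d * fromNat (size P) ≤ fromNat p̂ * fromNat (μ d (P ⊕ class d q* Q))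
        cosets {p̂} {q* = q*} {Q} _ _ _ _ _ n [] _ _ = ≤-respˡ (sym (trans (*-congˡ (reflexive (≡.cong fromNat (size-empty {[]} (λ ()))))) (zeroʳ _)))
          (*-nonNeg (0≤fromNat p̂) (0≤fromNat (μ d ([] ⊕ class d q* Q))))
        cosets {p̂} {u} {v} {q*} {Q} 0≤u 0≤v uᵈ vᵈ q*∈ (suc n) P@(p ∷ P′) (s≤s le) bound = begin
          h * fromNat (size P)                       ≤⟨ *-monoˡ-≤ 0≤h (≤-respʳ (fromNat-+ (size P₀) (size P₁)) (fromNat-mono (size-split d p P))) ⟩
          h * (fromNat (size P₀) + fromNat (size P₁)) ≈⟨ trans (distribˡ h _ _) (+-congˡ (*-comm h _)) ⟩
          h * fromNat (size P₀) + fromNat (size P₁) * h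
            ≤⟨ +-mono-≤ (cosets 0≤u 0≤v uᵈ vᵈ q*∈ n P₀ (ℕ.≤-pred (ℕ.≤-trans (length-select-< {P = λ q → ¬ Lin d (q - p)} {xs = P} (here ≡.refl) (λ n → n (~-refl (Coset d) {p}))) (s≤s le)))
                 (λ {x} x∈ → ℕ.≤-trans (size-class-mono d x (rest-⊆ d p)) (bound (rest-⊆ d p x∈))))
               (lattice d ℕ.≤-refl P₁ Q* (class-self d {p} {P} (here ≡.refl)) (class-self d q*∈)
                 (proj₂ ∘ ∈-select⁻ {P = λ q → Lin d (q - p)}) (proj₂ ∘ ∈-select⁻ {P = λ q → Lin d (q - q*)})
                 (size P₁) p̂ 0≤u 0≤v (≤-reflexive (trans (*-congˡ uᵈ) (*-comm _ _)))
                 (≤-respˡ (sym (*-congˡ vᵈ)) (*-monoʳ-≤ (0≤fromNat (size Q*)) (fromNat-mono (bound (here ≡.refl)))))) ⟩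
          fromNat p̂ * fromNat (μ d (P₀ ⊕ Q*)) + fromNat p̂ * fromNat (μ d (P₁ ⊕ Q*))
            ≈⟨ trans (sym (distribˡ (fromNat p̂) _ _)) (*-congˡ (sym (fromNat-+ (μ d (P₀ ⊕ Q*)) (μ d (P₁ ⊕ Q*))))) ⟩
          fromNat p̂ * fromNat (μ d (P₀ ⊕ Q*) ℕ.+ μ d (P₁ ⊕ Q*))
            ≤⟨ *-monoˡ-≤ (0≤fromNat p̂) (fromNat-mono (μ-separated d (⊕-mono (rest-⊆ d p) (λ z → z)) (⊕-mono (class-⊆ d p) (λ z → z)) sep)) ⟩
          fromNat p̂ * fromNat (μ d (P ⊕ Q*)) ∎
          where
          open ≤-R
          P₀ = rest d p P
          P₁ = class d p P
          Q* = class d q* Q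
          h = (u + v) ^ d
          0≤h : 0# ≤ h
          0≤h = ^-nonNeg d (≤-trans 0≤u (≤-by 0≤v refl))
          sep : ∀ {x y} → x ∈ (P₀ ⊕ Q*) → y ∈ (P₁ ⊕ Q*) → ¬ Lin d (x - y)
          sep x∈ y∈ l =
            let (a , b , a∈ , b∈ , eq) = ⊕-∈ {A = P₀} {Q*} x∈
                (a′ , b′ , a′∈ , b′∈ , eq′) = ⊕-∈ {A = P₁} {Q*} y∈
                lb  = proj₂ (∈-select⁻ {P = λ q → Lin d (q - q*)} b∈)
                lb′ = proj₂ (∈-select⁻ {P = λ q → Lin d (q - q*)} b′∈)
                la′ = proj₂ (∈-select⁻ {P = λ q → Lin d (q - p)} a′∈)
            in proj₂ (∈-select⁻ {P = λ q → ¬ Lin d (q - p)} a∈) (L.resp d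
                 (solve 6 (λ a b a′ b′ p q → (((a :+ b) :- (a′ :+ b′)) :- ((b :- q) :- (b′ :- q))) :+ (a′ :- p) := a :- p) refl a b a′ b′ p q*)
                 (L.add d (L.sub d (L.resp d (+-cong (reflexive eq) (-‿cong (reflexive eq′))) l) (L.sub d lb lb′)) la′))

        module _ (0<d : 0 ℕ.< d) where

          private
            -- P is the set with more elements relative to its largest class. Since ∣Q∣/q̂ is at
            -- most ∣P∣/p̂, replacing Q by its largest class and scaling by ∣P∣/p̂ loses nothing
            -- that the assumptions on x and y claim.
            half : ∀ P Q {p q} → p ∈ P → q ∈ Q → (∀ {x} → x ∈ P → size (class d x P) ℕ.≤ size (class d p P)) →
              size Q ℕ.* size (class d p P) ℕ.≤ size P ℕ.* size (class d q Q) →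
              ∀ t s {x y} → 0# ≤ x → 0# ≤ y → fromNat t * x ^ d ≤ fromNat s * fromNat (size P) → fromNat t * y ^ d ≤ fromNat s * fromNat (size Q) →
              fromNat t * (x + y) ^ d ≤ fromNat s * fromNat (μ d (P ⊕ Q))
            half P Q {p} {q} p∈ q∈ max w t s {x} {y} 0≤x 0≤y hp hq = fromNat-*-cancelˡ {n = p̂} 0<p̂ (begin
                fromNat p̂ * (fromNat t * (x + y) ^ d)     ≈⟨ *-cong (sym uᵈ) (*-congʳ (sym ωᵈ)) ⟩
                u ^ d * (ω ^ d * (x + y) ^ d)             ≈⟨ *-congˡ (sym (^-distrib-* ω (x + y) d)) ⟩
                u ^ d * (ω * (x + y)) ^ d                 ≈⟨ sym (^-distrib-* u (ω * (x + y)) d) ⟩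
                (u * (ω * (x + y))) ^ d                   ≤⟨ ^-mono d (*-nonNeg 0≤u (*-nonNeg 0≤ω (≤-trans 0≤x (≤-by 0≤y refl)))) sum≤ ⟩
                (θ * (u + v)) ^ d                         ≈⟨ trans (^-distrib-* θ (u + v) d) (*-congʳ θᵈ) ⟩
                (fromNat s * fromNat (size P)) * (u + v) ^ d
                  ≈⟨ solve 3 (λ s P h → (s :* P) :* h := s :* (h :* P)) refl (fromNat s) (fromNat (size P)) ((u + v) ^ d) ⟩
                fromNat s * ((u + v) ^ d * fromNat (size P))
                  ≤⟨ *-monoˡ-≤ (0≤fromNat s) (cosets 0≤u 0≤v uᵈ vᵈ q∈ (length P) P ℕ.≤-refl max) ⟩
                fromNat s * (fromNat p̂ * fromNat (μ d (P ⊕ class d q Q)))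
                  ≤⟨ *-monoˡ-≤ (0≤fromNat s) (*-monoˡ-≤ (0≤fromNat p̂) (fromNat-mono (μ-mono d (⊕-mono {P} {P} (λ z → z) (class-⊆ d q))))) ⟩
                fromNat s * (fromNat p̂ * fromNat (μ d (P ⊕ Q)))
                  ≈⟨ solve 3 (λ s p m → s :* (p :* m) := p :* (s :* m)) refl (fromNat s) (fromNat p̂) _ ⟩
                fromNat p̂ * (fromNat s * fromNat (μ d (P ⊕ Q))) ∎)
              where
              open ≤-R
              p̂ = size (class d p P)
              q̂ = size (class d q Q)
              0<p̂ : 0 ℕ.< p̂
              0<p̂ = #-pos ≈E (class-self d p∈)
              rt : ∀ {c} → 0# ≤ c → ∃[ x ] (0# ≤ x × x ^ d ≈ c)
              rt = root d 0<d
              u = proj₁ (rt (0≤fromNat p̂))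
              v = proj₁ (rt (0≤fromNat q̂))
              ω = proj₁ (rt (0≤fromNat t))
              0≤sP : 0# ≤ fromNat s * fromNat (size P)
              0≤sP = *-nonNeg (0≤fromNat s) (0≤fromNat (size P))
              θ = proj₁ (rt 0≤sP)
              0≤u = proj₁ (proj₂ (rt (0≤fromNat p̂)))
              0≤v = proj₁ (proj₂ (rt (0≤fromNat q̂)))
              0≤ω = proj₁ (proj₂ (rt (0≤fromNat t)))
              0≤θ = proj₁ (proj₂ (rt 0≤sP))
              uᵈ = proj₂ (proj₂ (rt (0≤fromNat p̂)))
              vᵈ = proj₂ (proj₂ (rt (0≤fromNat q̂)))
              ωᵈ = proj₂ (proj₂ (rt (0≤fromNat t)))
              θᵈ = proj₂ (proj₂ (rt 0≤sP))
              compare : ∀ {x u′} → 0# ≤ u′ → fromNat p̂ * (fromNat t * x ^ d) ≤ (fromNat s * fromNat (size P)) * u′ ^ d → u * (ω * x) ≤ θ * u′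
              compare {x} {u′} 0≤u′ le = ^-cancel-≤ d 0<d (*-nonNeg 0≤θ 0≤u′) (begin
                (u * (ω * x)) ^ d                          ≈⟨ trans (^-distrib-* u _ d) (*-congˡ (^-distrib-* ω x d)) ⟩
                u ^ d * (ω ^ d * x ^ d)                    ≈⟨ *-cong uᵈ (*-congʳ ωᵈ) ⟩
                fromNat p̂ * (fromNat t * x ^ d)            ≤⟨ le ⟩
                (fromNat s * fromNat (size P)) * u′ ^ d    ≈⟨ sym (trans (^-distrib-* θ u′ d) (*-congʳ θᵈ)) ⟩
                (θ * u′) ^ d                               ∎)
              sum≤ : u * (ω * (x + y)) ≤ θ * (u + v)
              sum≤ = ≤-respˡ (solve 4 (λ u o x y → u :* (o :* x) :+ u :* (o :* y) := u :* (o :* (x :+ y))) refl u ω x y)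
                (≤-respʳ (sym (distribˡ θ u v)) (+-mono-≤
                  (compare 0≤u (≤-respʳ (trans (*-comm _ _) (*-congˡ (sym uᵈ))) (*-monoˡ-≤ (0≤fromNat p̂) hp)))
                  (compare 0≤v (begin
                    fromNat p̂ * (fromNat t * y ^ d)                    ≤⟨ *-monoˡ-≤ (0≤fromNat p̂) hq ⟩
                    fromNat p̂ * (fromNat s * fromNat (size Q))
                      ≈⟨ trans (solve 3 (λ p s Q → p :* (s :* Q) := s :* (Q :* p)) refl (fromNat p̂) (fromNat s) (fromNat (size Q))) (*-congˡ (sym (fromNat-* (size Q) p̂))) ⟩
                    fromNat s * fromNat (size Q ℕ.* p̂)                 ≤⟨ *-monoˡ-≤ (0≤fromNat s) (fromNat-mono w) ⟩
                    fromNat s * fromNat (size P ℕ.* q̂)                 ≈⟨ trans (*-congˡ (fromNat-* (size P) q̂)) (sym (*-assoc _ _ _)) ⟩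
                    (fromNat s * fromNat (size P)) * fromNat q̂         ≈⟨ *-congˡ vᵈ ⟨
                    (fromNat s * fromNat (size P)) * v ^ d             ∎))))

          -- Up to the common factor s/t, the numbers x and y stand for d-th roots of ∣P∣ and ∣Q∣.
          -- The factor lets x and y be roots of numbers of classes when the inequality is applied
          -- to the classes themselves.
          brunn-minkowski : ∀ P Q {p₀ q₀} → p₀ ∈ P → q₀ ∈ Q → ∀ t s {x y} → 0# ≤ x → 0# ≤ y →
            fromNat t * x ^ d ≤ fromNat s * fromNat (size P) → fromNat t * y ^ d ≤ fromNat s * fromNat (size Q) →
            fromNat t * (x + y) ^ d ≤ fromNat s * fromNat (μ d (P ⊕ Q))
          brunn-minkowski P Q p₀∈ q₀∈ t s {x} {y} 0≤x 0≤y hp hq =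
            let (p , p∈ , maxP) = maximiser (λ p → size (class d p P)) p₀∈
                (q , q∈ , maxQ) = maximiser (λ q → size (class d q Q)) q₀∈
            in decide p∈ q∈ maxP maxQ (ℕ.≤-total (size Q ℕ.* size (class d p P)) (size P ℕ.* size (class d q Q)))
            where
            decide : ∀ {p q} → p ∈ P → q ∈ Q → (∀ {x} → x ∈ P → size (class d x P) ℕ.≤ size (class d p P)) →
              (∀ {x} → x ∈ Q → size (class d x Q) ℕ.≤ size (class d q Q)) →
              size Q ℕ.* size (class d p P) ℕ.≤ size P ℕ.* size (class d q Q) ⊎ size P ℕ.* size (class d q Q) ℕ.≤ size Q ℕ.* size (class d p P) →
              fromNat t * (x + y) ^ d ≤ fromNat s * fromNat (μ d (P ⊕ Q))
            decide p∈ q∈ maxP maxQ (inj₁ w) = half P Q p∈ q∈ maxP w t s 0≤x 0≤y hp hq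
            decide p∈ q∈ maxP maxQ (inj₂ w) = ≤-respˡ (*-congˡ (^-congˡ d (+-comm y x)))
              (≤-trans (half Q P q∈ p∈ maxQ w t s 0≤y 0≤x hq hp) (*-monoˡ-≤ (0≤fromNat s) (fromNat-mono (μ-mono d (⊕-comm⊆ Q P)))))

  -- Adding up bounds over the classes of a partition.

  module Partition where

    open Reals R hiding (_⊕_; _·_; sum)
    open import Data.Nat.ListAction using (sum)
    open Field
    open Counting em
    open Sumsets

    open Equivalence

    #-≥⇒⊆ : ∀ {X : Set} (E : Equivalence X) {xs ys : List X} → xs ⊆[ E ] ys → # E ys ℕ.≤ # E xs → ys ⊆[ E ] xs
    #-≥⇒⊆ E {xs} {ys} xs⊆ le {y} y∈ with em {y ∈[ E ] xs}
    ... | yes p = p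
    ... | no ¬p = ⊥-elim (ℕ.<-irrefl ≡.refl (ℕ.≤-trans (ℕ.≤-trans (ℕ.+-monoˡ-≤ (# E xs) (#-pos E {[ y ]} (here ≡.refl)))
      (#-disjoint E {[ y ]} {xs} {ys} (λ { (here ≡.refl) → y , y∈ , ~-refl E }) xs⊆
        (λ { (here ≡.refl) z∈ y~z → ¬p (_ , z∈ , y~z) }))) le))

    #-classes-scaled : ∀ {X Y : Set} (D : Equivalence Y) (E : Equivalence X) (C : Y → List X) {ys : List Y} {zs : List X} {c : ℕ} (m : ℕ) →
      (∀ {y} → y ∈ ys → C y ⊆[ E ] zs) → (∀ {y} → y ∈ ys → c ℕ.≤ m ℕ.* # E (C y)) →
      (∀ {y y′ x x′} → y ∈ ys → y′ ∈ ys → x ∈ C y → x′ ∈ C y′ → _~_ E x x′ → _~_ D y y′) →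
      # D ys ℕ.* c ℕ.≤ m ℕ.* # E zs
    #-classes-scaled D E C {ys} {zs} {c} m C⊆ big dis = begin
      # D ys ℕ.* c                                         ≡⟨ ≡.cong (ℕ._* c) (#-reps D ys) ⟩
      length (reps D ys) ℕ.* c                             ≤⟨ sum-≥ (reps D ys) (λ r∈ → big (reps-⊆ D r∈)) ⟩
      sum (map (λ r → m ℕ.* # E (C r)) (reps D ys))        ≡⟨ scale (reps D ys) ⟩
      m ℕ.* sum (map (λ r → # E (C r)) (reps D ys))
        ≤⟨ ℕ.*-monoʳ-≤ m (sum-#-≤ E C {D = _~_ D} (reps-indep D ys) (C⊆ ∘ reps-⊆ D) (λ a b → dis (reps-⊆ D a) (reps-⊆ D b))) ⟩
      m ℕ.* # E zs                                         ∎
      where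
      open ℕ.≤-Reasoning
      scale : ∀ rs → sum (map (λ r → m ℕ.* # E (C r)) rs) ≡ m ℕ.* sum (map (λ r → # E (C r)) rs)
      scale []       = ≡.sym (ℕ.*-zeroʳ m)
      scale (r ∷ rs) = ≡.trans (≡.cong (m ℕ.* # E (C r) ℕ.+_) (scale rs)) (≡.sym (ℕ.*-distribˡ-+ m _ _))

    sum-real : ∀ {X : Set} (f g : X → ℕ) {a b c w : Carrier} (rs : List X) →
      (∀ {r} → r ∈ rs → a * fromNat (f r) ≤ (b * fromNat (g r) + c * fromNat (f r)) + w) →
      a * fromNat (sum (map f rs)) ≤ (b * fromNat (sum (map g rs)) + c * fromNat (sum (map f rs))) + fromNat (length rs) * w
    sum-real f g {a} {b} {c} {w} [] h = ≤-reflexive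
      (solve 4 (λ a b c w → a :* con 0ℤ := (b :* con 0ℤ :+ c :* con 0ℤ) :+ con 0ℤ :* w) refl a b c w)
    sum-real f g {a} {b} {c} {w} (r ∷ rs) h = begin
      a * fromNat (f r ℕ.+ F)                     ≈⟨ trans (*-congˡ (fromNat-+ (f r) F)) (distribˡ a _ _) ⟩
      a * fromNat (f r) + a * fromNat F           ≤⟨ +-mono-≤ (h (here ≡.refl)) (sum-real f g rs (h ∘ there)) ⟩
      ((b * fromNat (g r) + c * fromNat (f r)) + w) + ((b * fromNat G + c * fromNat F) + fromNat (length rs) * w)
        ≈⟨ solve 8 (λ b gr c fr w G F n → ((b :* gr :+ c :* fr) :+ w) :+ ((b :* G :+ c :* F) :+ n :* w)
             := (b :* (gr :+ G) :+ c :* (fr :+ F)) :+ (con 1ℤ :+ n) :* w) refl b (fromNat (g r)) c (fromNat (f r)) w (fromNat G) (fromNat F) (fromNat (length rs)) ⟩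
      (b * (fromNat (g r) + fromNat G) + c * (fromNat (f r) + fromNat F)) + fromNat (suc (length rs)) * w
        ≈⟨ +-congʳ (+-cong (*-congˡ (sym (fromNat-+ (g r) G))) (*-congˡ (sym (fromNat-+ (f r) F)))) ⟩
      (b * fromNat (g r ℕ.+ G) + c * fromNat (f r ℕ.+ F)) + fromNat (suc (length rs)) * w ∎
      where
      open ≤-R
      F = sum (map f rs)
      G = sum (map g rs)

    classOf : Equivalence Carrier → Carrier → List Carrier → List Carrier
    classOf E x A = select (λ y → _~_ E y x) A

    module _ (E : Equivalence Carrier) where

      classOf-⊆ : ∀ {x A} → classOf E x A ⊆ A
      classOf-⊆ = proj₁ ∘ ∈-select⁻

      classOf-~ : ∀ {x A y} → y ∈ classOf E x A → _~_ E y x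
      classOf-~ {x} = proj₂ ∘ ∈-select⁻ {P = λ y → _~_ E y x}

      classOf-self : ∀ {x A} → x ∈ A → x ∈ classOf E x A
      classOf-self {x} x∈ = ∈-select⁺ x∈ (~-refl E)

    size-proper : ∀ {X A y} → X ⊆ A → y ∈ A → (∀ {x} → x ∈ X → ¬ (y ≈ x)) → size X ℕ.< size A
    size-proper {X} {A} {y} X⊆ y∈ y∉ = ℕ.≤-trans (ℕ.+-monoˡ-≤ (size X) (#-pos ≈E {[ y ]} (here ≡.refl)))
      (#-disjoint ≈E {[ y ]} {X} {A} (λ { (here ≡.refl) → y , y∈ , refl }) (⊆⇒⊆[] ≈E X⊆) (λ { (here ≡.refl) x∈ → y∉ x∈ }))

    -- The part of A + αA for which the bounds of the individual classes account.
    diagonal : Carrier → Equivalence Carrier → List Carrier → List Carrier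
    diagonal α E A = concatMap (λ r → classOf E r A ⊕ α · classOf E r A) (reps E A)

    Splits : Carrier → Equivalence Carrier → List Carrier → Set
    Splits α E A = ∀ {x x′ y y′} → x ∈ A → x′ ∈ A → y ∈ A → y′ ∈ A → _~_ E x x′ → _~_ E y y′ → x + α * x′ ≈ y + α * y′ → _~_ E x y

    ⊕·-∈ : ∀ {α A B z} → z ∈ (A ⊕ α · B) → ∃[ a ] ∃[ b ] (a ∈ A × b ∈ B × z ≡ a + α * b)
    ⊕·-∈ {α} {A} {B} z∈ with ⊕-∈ {A = A} {α · B} z∈
    ... | a , w , a∈ , w∈ , ≡.refl with ·-∈ {c = α} w∈
    ...   | b , b∈ , ≡.refl = a , b , a∈ , b∈ , ≡.refl

    diagonal-∈ : ∀ {α E A z} → z ∈ diagonal α E A → ∃[ x ] ∃[ y ] (x ∈ A × y ∈ A × _~_ E x y × z ≡ x + α * y)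
    diagonal-∈ {α} {E} {A} z∈ =
      let (r , r∈ , z∈′) = find (∈-concatMap⁻ (λ r → classOf E r A ⊕ α · classOf E r A) {xs = reps E A} z∈)
          (x , y , x∈ , y∈ , eq) = ⊕·-∈ {α} {classOf E r A} {classOf E r A} z∈′
      in x , y , classOf-⊆ E x∈ , classOf-⊆ E y∈ , ~-trans E (classOf-~ E x∈) (~-sym E (classOf-~ E y∈)) , eq

    module _ {α : Carrier} {E : Equivalence Carrier} {A A′ : List Carrier} {H c : Carrier} {K B w : ℕ} where

      -- The hypothesis covers classes with at least ∣A∣/B elements. A smaller class C has H ∣C∣ ≤ K
      -- ∣A∣/B, and w is the allowance for this after multiplication by B.
      sum-bound : A′ ⊆ A → Splits α E A → H ≤ fromNat K → 0# ≤ c →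
        (∀ {X} → size X ℕ.< size A → size A ℕ.≤ B ℕ.* size X → H * fromNat (size X) ≤ fromNat (size (X ⊕ α · X)) + c * fromNat (size X)) →
        (∀ {x} → x ∈ A′ → ∃[ y ] (y ∈ A × ¬ _~_ E y x)) →
        (∀ {x} → x ∈ A′ → size A ℕ.≤ B ℕ.* size (classOf E x A′) ⊎ K ℕ.* size A ℕ.≤ w) →
        fromNat B * H * fromNat (size A′) ≤ (fromNat B * fromNat (size (diagonal α E A′)) + fromNat B * c * fromNat (size A′)) + fromNat (# E A′) * fromNat w
      sum-bound A′⊆ splits H≤K 0≤c ih proper big = begin
        fromNat B * H * fromNat (size A′)         ≈⟨ *-congˡ (reflexive (≡.cong fromNat sizes)) ⟩
        fromNat B * H * fromNat (sum (map f rs))   ≤⟨ sum-real f g rs each ⟩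
        (fromNat B * fromNat (sum (map g rs)) + fromNat B * c * fromNat (sum (map f rs))) + fromNat (length rs) * fromNat w
          ≤⟨ +-mono-≤ (+-mono-≤ (*-monoˡ-≤ (0≤fromNat B) (fromNat-mono gs)) (≤-reflexive (*-congˡ (reflexive (≡.cong fromNat (≡.sym sizes))))))
               (≤-reflexive (*-congʳ (reflexive (≡.cong fromNat (≡.sym (#-reps E A′)))))) ⟩
        (fromNat B * fromNat (size (diagonal α E A′)) + fromNat B * c * fromNat (size A′)) + fromNat (# E A′) * fromNat w ∎
        where
        open ≤-R
        rs = reps E A′
        cl = λ r → classOf E r A′
        f = λ r → size (cl r)
        g = λ r → size (cl r ⊕ α · cl r)
        sizes : size A′ ≡ sum (map f rs)
        sizes = ℕ.≤-antisym
          (#-concat-≤ ≈E cl rs (λ {z} z∈ → let (r , r∈ , z~r) = reps-cover E z∈ in r , r∈ , z , ∈-select⁺ z∈ z~r , refl))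
          (sum-#-≤ ≈E (λ r → filtered r) {D = _~_ E} (reps-indep E A′) (λ _ → ⊆⇒⊆[] ≈E (classOf-⊆ E)) disjoint)
          where
          filtered = cl
          disjoint : ∀ {r s x y} → r ∈ rs → s ∈ rs → x ∈ cl r → y ∈ cl s → x ≈ y → _~_ E r s
          disjoint {r} {s} {x} {y} r∈ s∈ x∈ y∈ x≈y = ~-trans E (~-sym E (classOf-~ E x∈)) (~-trans E x~y (classOf-~ E y∈))
            where
            x~y : _~_ E x y
            x~y = splits (A′⊆ (classOf-⊆ E x∈)) (A′⊆ (classOf-⊆ E x∈)) (A′⊆ (classOf-⊆ E y∈)) (A′⊆ (classOf-⊆ E y∈))
              (~-refl E) (~-refl E) (+-cong x≈y (*-congˡ x≈y))
        gs : sum (map g rs) ℕ.≤ size (diagonal α E A′)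
        gs = sum-#-≤ ≈E (λ r → cl r ⊕ α · cl r) {D = _~_ E} (reps-indep E A′)
          (λ r∈ z∈ → _ , ∈-concatMap⁺ (λ r → cl r ⊕ α · cl r) (lose r∈ z∈) , refl) disjoint
          where
          disjoint : ∀ {r s x y} → r ∈ rs → s ∈ rs → x ∈ (cl r ⊕ α · cl r) → y ∈ (cl s ⊕ α · cl s) → x ≈ y → _~_ E r s
          disjoint {r} {s} r∈ s∈ x∈ y∈ x≈y =
            let (a , b , a∈ , b∈ , eq) = ⊕·-∈ {α} {cl r} {cl r} x∈
                (a′ , b′ , a′∈ , b′∈ , eq′) = ⊕·-∈ {α} {cl s} {cl s} y∈
                sub = λ {r : Carrier} {z : Carrier} (z∈ : z ∈ cl r) → A′⊆ (classOf-⊆ E z∈)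
            in ~-trans E (~-sym E (classOf-~ E a∈)) (~-trans E
                 (splits (sub a∈) (sub b∈) (sub a′∈) (sub b′∈)
                   (~-trans E (classOf-~ E a∈) (~-sym E (classOf-~ E b∈))) (~-trans E (classOf-~ E a′∈) (~-sym E (classOf-~ E b′∈)))
                   (trans (sym (reflexive eq)) (trans x≈y (reflexive eq′))))
                 (classOf-~ E a′∈))
        each : ∀ {r} → r ∈ rs → fromNat B * H * fromNat (f r) ≤ (fromNat B * fromNat (g r) + fromNat B * c * fromNat (f r)) + fromNat w
        each {r} r∈ = go (ℕ.≤-total (size A) (B ℕ.* f r)) (big (reps-⊆ E r∈))
          where
          0≤rest : 0# ≤ fromNat B * fromNat (g r) + fromNat B * c * fromNat (f r)
          0≤rest = ≤-respˡ (+-identityʳ 0#) (+-mono-≤ (*-nonNeg (0≤fromNat B) (0≤fromNat (g r))) (*-nonNeg (*-nonNeg (0≤fromNat B) 0≤c) (0≤fromNat (f r))))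
          large : size A ℕ.≤ B ℕ.* f r → fromNat B * H * fromNat (f r) ≤ (fromNat B * fromNat (g r) + fromNat B * c * fromNat (f r)) + fromNat w
          large le = begin
            fromNat B * H * fromNat (f r)                    ≈⟨ *-assoc _ H _ ⟩
            fromNat B * (H * fromNat (f r))                  ≤⟨ *-monoˡ-≤ (0≤fromNat B) (ih (size-proper (A′⊆ ∘ classOf-⊆ E) (proj₁ (proj₂ y)) y∉) le) ⟩
            fromNat B * (fromNat (g r) + c * fromNat (f r))  ≈⟨ trans (distribˡ _ _ _) (+-congˡ (sym (*-assoc _ c _))) ⟩
            fromNat B * fromNat (g r) + fromNat B * c * fromNat (f r) ≤⟨ ≤-by (0≤fromNat w) refl ⟩
            (fromNat B * fromNat (g r) + fromNat B * c * fromNat (f r)) + fromNat w ∎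
            where
            y = proper (reps-⊆ E r∈)
            y∉ : ∀ {x} → x ∈ cl r → ¬ (proj₁ y ≈ x)
            y∉ {x} x∈ eq = proj₂ (proj₂ y) (~-trans E (splits (proj₁ (proj₂ y)) (proj₁ (proj₂ y)) (A′⊆ (classOf-⊆ E x∈)) (A′⊆ (classOf-⊆ E x∈))
              (~-refl E) (~-refl E) (+-cong eq (*-congˡ eq))) (classOf-~ E x∈))
          small : B ℕ.* f r ℕ.≤ size A → K ℕ.* size A ℕ.≤ w → fromNat B * H * fromNat (f r) ≤ (fromNat B * fromNat (g r) + fromNat B * c * fromNat (f r)) + fromNat w
          small le le′ = begin
            fromNat B * H * fromNat (f r)                    ≈⟨ solve 3 (λ b h f → b :* h :* f := h :* (b :* f)) refl (fromNat B) H (fromNat (f r)) ⟩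
            H * (fromNat B * fromNat (f r))                  ≤⟨ *-monoʳ-≤ (*-nonNeg (0≤fromNat B) (0≤fromNat (f r))) H≤K ⟩
            fromNat K * (fromNat B * fromNat (f r))          ≈⟨ *-congˡ (fromNat-* B (f r)) ⟨
            fromNat K * fromNat (B ℕ.* f r)                  ≤⟨ *-monoˡ-≤ (0≤fromNat K) (fromNat-mono le) ⟩
            fromNat K * fromNat (size A)                     ≈⟨ fromNat-* K (size A) ⟨
            fromNat (K ℕ.* size A)                           ≤⟨ fromNat-mono le′ ⟩
            fromNat w                                        ≤⟨ ≤-by 0≤rest (+-comm _ _) ⟩
            (fromNat B * fromNat (g r) + fromNat B * c * fromNat (f r)) + fromNat w ∎
          go : size A ℕ.≤ B ℕ.* f r ⊎ B ℕ.* f r ℕ.≤ size A → size A ℕ.≤ B ℕ.* f r ⊎ K ℕ.* size A ℕ.≤ w →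
            fromNat B * H * fromNat (f r) ≤ (fromNat B * fromNat (g r) + fromNat B * c * fromNat (f r)) + fromNat w
          go (inj₁ le) _          = large le
          go (inj₂ _)  (inj₁ le)  = large le
          go (inj₂ le) (inj₂ le′) = small le le′

  -- The inductive step: structure of a set that violates the bound.

  module Core where

    open Reals R hiding (_⊕_; _·_; sum)
    open import Data.Nat.ListAction using (sum)
    open Field
    open Roots using (root)
    open Structure using (two-elements)
    open import Algebra.Properties.Semiring.Exp semiring using (^-congˡ)
    open Counting em
    open Sumsets
    open Partition
    open Index using (IsSubgroup; ⟨_⟩; gen; ⟨⟩-isSubgroup; ⟨⟩-least)

    open Equivalence

    -- Blocks contain at least 1/k₁ of A and fine classes at least 1/k₂; there are at most kₘ classes of each kind;
    -- gains of 1/η of A are impossible; Bₘ is the least ratio between consecutive scales.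
    k₁ k₂ kₘ η q Bₘ : ℕ → ℕ
    k₁ K = 4 ℕ.* (K ℕ.* K)
    k₂ K = 2 ℕ.* k₁ K ℕ.* K
    kₘ K = k₁ K ℕ.* K
    η  K = 2 ℕ.* k₁ K
    q  K = 2 ℕ.* η K ℕ.* K
    Bₘ K = 2 ℕ.* η K ℕ.* (kₘ K ℕ.* K)

    congruence : (P : Carrier → Set) → IsSubgroup P → Equivalence Carrier
    congruence P sub = record
      { _~_     = λ x y → P (x - y)
      ; ~-refl  = λ {x} → resp (sym (-‿inverseʳ x)) zero′
      ; ~-sym   = λ {x} {y} p → resp (solve 2 (λ x y → :- (x :- y) := y :- x) refl x y) (neg p)
      ; ~-trans = λ {x} {y} {z} p r → resp (solve 3 (λ x y z → (x :- y) :+ (y :- z) := x :- z) refl x y z) (add p r) }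
      where open IsSubgroup sub

    -- For invertible c this is the dilate of P by the inverse of c; dilates of subgroups are
    -- written in this way throughout.
    preimage : ∀ {P} c → IsSubgroup P → IsSubgroup (λ x → P (c * x))
    preimage c sub = record
      { resp  = λ e → resp (*-congˡ e)
      ; zero′ = resp (sym (zeroʳ c)) zero′
      ; add   = λ p r → resp (sym (distribˡ c _ _)) (add p r)
      ; neg   = λ {x} p → resp (solve 2 (λ c x → :- (c :* x) := c :* (:- x)) refl c x) (neg p) }
      where open IsSubgroup sub

    intersection : ∀ {P Q} → IsSubgroup P → IsSubgroup Q → IsSubgroup (λ x → P x × Q x)
    intersection sub sub′ = record
      { resp  = λ e (p , r) → P.resp e p , Q.resp e r
      ; zero′ = P.zero′ , Q.zero′
      ; add   = λ (p , r) (p′ , r′) → P.add p p′ , Q.add r r′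
      ; neg   = λ (p , r) → P.neg p , Q.neg r }
      where
      module P = IsSubgroup sub
      module Q = IsSubgroup sub′

    module Induction (K : ℕ) (1≤K : 1 ℕ.≤ K) (H : Carrier) (0≤H : 0# ≤ H) (H≤K : H ≤ fromNat K)
      (B : ℕ) (Bₘ≤B : Bₘ K ℕ.≤ B) (v : Carrier) (0≤v : 0# ≤ v) (A : List Carrier) (large : k₁ K ℕ.< size A) where

      n : ℕ
      n = size A

      private
        0<n : 0 ℕ.< n
        0<n = ℕ.≤-trans (s≤s z≤n) large

        instance
          K≢0 : ℕ.NonZero K
          K≢0 = ℕ.>-nonZero 1≤K
          k₁≢0 : ℕ.NonZero (k₁ K)
          k₁≢0 = ℕ.m*n≢0 4 (K ℕ.* K) ⦃ _ ⦄ ⦃ ℕ.m*n≢0 K K ⦄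

        0<k₁ : 0 ℕ.< k₁ K
        0<k₁ = ℕ.>-nonZero⁻¹ (k₁ K)

        0<η : 0 ℕ.< η K
        0<η = ℕ.≤-trans 0<k₁ (ℕ.m≤m+n (k₁ K) _)

        0<B : 0 ℕ.< B
        0<B = ℕ.≤-trans (ℕ.*-mono-≤ (ℕ.*-mono-≤ {1} {2} (s≤s z≤n) 0<η) (ℕ.*-mono-≤ (ℕ.*-mono-≤ 0<k₁ 1≤K) 1≤K)) Bₘ≤B

      G : Carrier → Set
      G = ⟨ Diff A ⟩

      module G = IsSubgroup (⟨⟩-isSubgroup (Diff A))

      diff : ∀ {a b} → a ∈ A → b ∈ A → G (a - b)
      diff a∈ b∈ = gen (_ , _ , a∈ , b∈ , refl)

      -- Classes of A modulo N and the dilates of G, with δ either α or its inverse.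

      module Side (N : Carrier → Set) (N-sub : IsSubgroup N) (δ ε : Carrier) (δε : δ * ε ≈ 1#)
        (toG : ∀ {x} → N x → G x) (toδ : ∀ {x} → N x → G (δ * x)) (toε : ∀ {x} → N x → G (ε * x))
        (mkN : ∀ {x} → G x → G (δ * x) → G (ε * x) → N x)
        (ih : ∀ {X} → size X ℕ.< n → n ℕ.≤ B ℕ.* size X →
           H * fromNat (size X) ≤ fromNat (size (X ⊕ δ · X)) + (fromNat (suc (q K)) * v) * fromNat (size X))
        (fail : ¬ (H * fromNat n ≤ fromNat (size (A ⊕ δ · A)) + fromNat (q K) * v * fromNat n)) where

        module N′ = IsSubgroup N-sub

        S : List Carrier
        S = A ⊕ δ · A

        cancelδ : ∀ x → ε * (δ * x) ≈ x
        cancelδ x = trans (sym (*-assoc ε δ x)) (trans (*-congʳ (trans (*-comm ε δ) δε)) (*-identityˡ x))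

        cancelε : ∀ x → δ * (ε * x) ≈ x
        cancelε x = trans (sym (*-assoc δ ε x)) (trans (*-congʳ δε) (*-identityˡ x))

        S-small : fromNat (size S) + fromNat (q K) * v * fromNat n ≤ H * fromNat n
        S-small = ≰⇒≥ fail

        size-S : size S ℕ.≤ K ℕ.* n
        size-S = fromNat-cancel (begin
          fromNat (size S)                                        ≤⟨ ≤-by (*-nonNeg (*-nonNeg (0≤fromNat (q K)) 0≤v) (0≤fromNat n)) refl ⟩
          fromNat (size S) + fromNat (q K) * v * fromNat n        ≤⟨ S-small ⟩
          H * fromNat n                                           ≤⟨ *-monoʳ-≤ (0≤fromNat n) H≤K ⟩
          fromNat K * fromNat n                                   ≈⟨ fromNat-* K n ⟨
          fromNat (K ℕ.* n)                                       ∎)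
          where open ≤-R

        -- Otherwise the error alone would exceed H ∣A∣ and the bound could not fail.
        qv≤K : fromNat (q K) * v ≤ fromNat K
        qv≤K = fromNat-*-cancelˡ {n = n} 0<n (begin
          fromNat n * (fromNat (q K) * v)                         ≈⟨ *-comm _ _ ⟩
          fromNat (q K) * v * fromNat n                           ≤⟨ ≤-by (0≤fromNat (size S)) (+-comm _ _) ⟩
          fromNat (size S) + fromNat (q K) * v * fromNat n        ≤⟨ S-small ⟩
          H * fromNat n                                           ≤⟨ *-monoʳ-≤ (0≤fromNat n) H≤K ⟩
          fromNat K * fromNat n                                   ≈⟨ *-comm _ _ ⟩
          fromNat n * fromNat K                                   ∎)
          where open ≤-R

        -- This uses q = 2 η K. In `gain` the resulting loss v ∣A∣ takes up half of the slack ∣A∣/η;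
        -- the other half is reserved, through `Bₘ`, for the classes too small for the induction
        -- hypothesis.
        v-small : fromNat (2 ℕ.* η K) * v ≤ 1#
        v-small = fromNat-*-cancelˡ {n = K} 1≤K (begin
          fromNat K * (fromNat (2 ℕ.* η K) * v)     ≈⟨ solve 3 (λ k e v → k :* (e :* v) := (e :* k) :* v) refl (fromNat K) (fromNat (2 ℕ.* η K)) v ⟩
          fromNat (2 ℕ.* η K) * fromNat K * v       ≈⟨ *-congʳ (sym (fromNat-* (2 ℕ.* η K) K)) ⟩
          fromNat (q K) * v                         ≤⟨ qv≤K ⟩
          fromNat K                                 ≈⟨ *-identityʳ _ ⟨
          fromNat K * 1#                            ∎)
          where open ≤-R

        c : Carrier
        c = fromNat (suc (q K)) * v

        0≤c : 0# ≤ c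
        0≤c = *-nonNeg (0≤fromNat (suc (q K))) 0≤v

        -- A subset Y of A + δA outside the diagonal is small: otherwise the induction hypothesis on the classes
        -- would give more than H ∣ A ∣ elements.
        gain : ∀ {E A′ Y} (ρ : ℕ) → Splits δ E A → # E A ℕ.≤ kₘ K → A′ ⊆ A → Y ⊆[ ≈E ] S →
          (∀ {x y} → x ∈ diagonal δ E A′ → y ∈ Y → ¬ (x ≈ y)) → (∀ {x} → x ∈ A′ → ∃[ y ] (y ∈ A × ¬ _~_ E y x)) →
          n ℕ.≤ size A′ ℕ.+ ρ → η K ℕ.* size Y ℕ.≤ η K ℕ.* K ℕ.* ρ ℕ.+ n
        gain {E} {A′} {Y} ρ splits few A′⊆ Y⊆ dis proper cover = fromNat-cancel (fromNat-*-cancelˡ {n = 2 ℕ.* B} (ℕ.*-mono-≤ {1} {2} (s≤s z≤n) 0<B) (begin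
          fromNat (2 ℕ.* B) * fromNat (η K ℕ.* size Y)
            ≈⟨ *-cong (fromNat-* 2 B) (fromNat-* (η K) (size Y)) ⟩
          (fromNat 2 * b) * (e * y)
            ≈⟨ solve 4 (λ t b e y → (t :* b) :* (e :* y) := (t :* e) :* (b :* y)) refl (fromNat 2) b e y ⟩
          (fromNat 2 * e) * (b * y)
            ≤⟨ *-monoˡ-≤ (*-nonNeg (0≤fromNat 2) (0≤fromNat (η K))) by ⟩
          (fromNat 2 * e) * ((b * k * r + b * v * N′n) + fromNat (kₘ K ℕ.* K) * N′n)
            ≈⟨ solve 8 (λ t e b k r v n m → (t :* e) :* ((b :* k :* r :+ b :* v :* n) :+ m :* n)
                 := ((t :* b) :* (e :* k :* r) :+ (b :* n) :* ((t :* e) :* v)) :+ ((t :* e) :* m) :* n) refl (fromNat 2) e b k r v N′n (fromNat (kₘ K ℕ.* K)) ⟩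
          ((fromNat 2 * b) * (e * k * r) + (b * N′n) * ((fromNat 2 * e) * v)) + ((fromNat 2 * e) * fromNat (kₘ K ℕ.* K)) * N′n
            ≤⟨ +-mono-≤ (+-mono-≤ ≤-refl (*-monoˡ-≤ (*-nonNeg (0≤fromNat B) (0≤fromNat n)) (≤-respˡ (*-congʳ (fromNat-* 2 (η K))) v-small)))
                 (*-monoʳ-≤ (0≤fromNat n) (≤-respˡ (trans (fromNat-* (2 ℕ.* η K) (kₘ K ℕ.* K)) (*-congʳ (fromNat-* 2 (η K)))) (fromNat-mono Bₘ≤B))) ⟩
          ((fromNat 2 * b) * (e * k * r) + (b * N′n) * 1#) + b * N′n
            ≈⟨ solve 6 (λ b e k r n t → ((t :* b) :* (e :* k :* r) :+ (b :* n) :* con 1ℤ) :+ b :* n := (t :* b) :* (e :* k :* r) :+ ((con 1ℤ :+ con 1ℤ) :* b) :* n) refl b e k r N′n (fromNat 2) ⟩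
          (fromNat 2 * b) * (e * k * r) + ((1# + 1#) * b) * N′n
            ≈⟨ +-congˡ (*-congʳ (*-congʳ (solve 0 (con 1ℤ :+ con 1ℤ := con 1ℤ :+ (con 1ℤ :+ con 0ℤ)) refl))) ⟩
          (fromNat 2 * b) * (e * k * r) + (fromNat 2 * b) * N′n
            ≈⟨ sym (distribˡ _ _ _) ⟩
          (fromNat 2 * b) * (e * k * r + N′n)
            ≈⟨ *-cong (sym (fromNat-* 2 B)) (trans (+-congʳ (trans (*-congʳ (sym (fromNat-* (η K) K))) (sym (fromNat-* (η K ℕ.* K) ρ)))) (sym (fromNat-+ (η K ℕ.* K ℕ.* ρ) n))) ⟩
          fromNat (2 ℕ.* B) * fromNat (η K ℕ.* K ℕ.* ρ ℕ.+ n) ∎))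
          where
          open ≤-R
          b = fromNat B
          e = fromNat (η K)
          y = fromNat (size Y)
          k = fromNat K
          r = fromNat ρ
          N′n = fromNat n
          a′ = fromNat (size A′)
          D = fromNat (size (diagonal δ E A′))
          s = fromNat (size S)
          qv = fromNat (q K) * v
          D⊆ : diagonal δ E A′ ⊆[ ≈E ] S
          D⊆ z∈ = let (x , x′ , x∈ , x′∈ , _ , eq) = diagonal-∈ {δ} {E} {A′} z∈ in _ , ∈-⊕ (A′⊆ x∈) (∈-· {c = δ} (A′⊆ x′∈)) , reflexive eq
          D+y≤s : D + y ≤ s
          D+y≤s = ≤-respˡ (fromNat-+ (size (diagonal δ E A′)) (size Y)) (fromNat-mono (#-disjoint ≈E D⊆ Y⊆ dis))
          bound : b * H * a′ ≤ (b * D + b * c * a′) + fromNat (kₘ K ℕ.* K) * N′n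
          bound = ≤-trans (sum-bound {δ} {E} {A} {A′} {H} {c} {K} {B} {K ℕ.* n} A′⊆ splits H≤K 0≤c ih proper (λ _ → inj₂ ℕ.≤-refl))
            (+-mono-≤ ≤-refl (≤-respˡ (fromNat-* (# E A′) (K ℕ.* n)) (≤-respʳ (fromNat-* (kₘ K ℕ.* K) n)
              (fromNat-mono (ℕ.≤-trans (ℕ.*-monoˡ-≤ (K ℕ.* n) (ℕ.≤-trans (#-mono E (⊆⇒⊆[] E A′⊆)) few)) (ℕ.≤-reflexive (≡.sym (ℕ.*-assoc (kₘ K) K n))))))))
          a′≤n : a′ ≤ N′n
          a′≤n = fromNat-mono (size-mono A′⊆)
          Hn≤ : H * N′n ≤ H * a′ + k * r
          Hn≤ = ≤-trans (*-monoˡ-≤ 0≤H (≤-respʳ (fromNat-+ (size A′) ρ) (fromNat-mono cover)))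
            (≤-respˡ (sym (distribˡ H _ _)) (+-mono-≤ ≤-refl (*-monoʳ-≤ (0≤fromNat ρ) H≤K)))
          ca′≤ : c * a′ ≤ qv * N′n + v * N′n
          ca′≤ = ≤-trans (*-monoˡ-≤ 0≤c a′≤n) (≤-reflexive (solve 3 (λ q v n → ((con 1ℤ :+ q) :* v) :* n := (q :* v) :* n :+ v :* n) refl (fromNat (q K)) v N′n))
          by : b * y ≤ (b * k * r + b * v * N′n) + fromNat (kₘ K ℕ.* K) * N′n
          by = +-cancelʳ-≤ (((b * D + b * (H * a′)) + b * (qv * N′n))) (begin
            b * y + ((b * D + b * (H * a′)) + b * (qv * N′n))
              ≈⟨ solve 5 (λ b y d h q → b :* y :+ ((b :* d :+ b :* h) :+ b :* q) := b :* ((d :+ y) :+ q) :+ b :* h) refl b y D (H * a′) (qv * N′n) ⟩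
            b * ((D + y) + qv * N′n) + b * (H * a′)
              ≤⟨ +-mono-≤ (*-monoˡ-≤ (0≤fromNat B) (≤-trans (+-mono-≤ D+y≤s ≤-refl) (≤-trans S-small Hn≤))) (≤-respˡ (*-assoc b H a′) bound) ⟩
            b * (H * a′ + k * r) + ((b * D + b * c * a′) + fromNat (kₘ K ℕ.* K) * N′n)
              ≤⟨ +-mono-≤ ≤-refl (+-mono-≤ (+-mono-≤ ≤-refl (≤-respˡ (sym (*-assoc b c a′)) (*-monoˡ-≤ (0≤fromNat B) ca′≤))) ≤-refl) ⟩
            b * (H * a′ + k * r) + ((b * D + b * (qv * N′n + v * N′n)) + fromNat (kₘ K ℕ.* K) * N′n)
              ≈⟨ solve 8 (λ b h k r d q w m → b :* (h :+ k :* r) :+ ((b :* d :+ b :* (q :+ w)) :+ m)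
                   := ((b :* k :* r :+ b :* w) :+ m) :+ ((b :* d :+ b :* h) :+ b :* q)) refl b (H * a′) k r D (qv * N′n) (v * N′n) (fromNat (kₘ K ℕ.* K) * N′n) ⟩
            ((b * k * r + b * (v * N′n)) + fromNat (kₘ K ℕ.* K) * N′n) + ((b * D + b * (H * a′)) + b * (qv * N′n))
              ≈⟨ +-congʳ (+-congʳ (+-congˡ (sym (*-assoc b v N′n)))) ⟩
            ((b * k * r + b * v * N′n) + fromNat (kₘ K ℕ.* K) * N′n) + ((b * D + b * (H * a′)) + b * (qv * N′n)) ∎)

        -- Congruence modulo δG, N and N ∩ δN; `Col` is congruence modulo εG. By the choice of N,
        -- elements of A in the same row and the same column are in the same block.
        Row Blk Fine : Equivalence Carrier
        Row  = congruence (λ x → G (ε * x)) (preimage ε (⟨⟩-isSubgroup (Diff A)))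
        Blk  = congruence N N-sub
        Fine = congruence (λ x → N x × N (ε * x)) (intersection N-sub (preimage ε N-sub))

        Col : Equivalence Carrier
        Col = congruence (λ x → G (δ * x)) (preimage δ (⟨⟩-isSubgroup (Diff A)))

        -- All disjointness statements rest on this: for elements of A, a coincidence of sums puts x
        -- - y into δG and x′ - y′ into εG.
        collide : ∀ {x x′ y y′} → x + δ * x′ ≈ y + δ * y′ → x - y ≈ δ * (y′ - x′)
        collide {x} {x′} {y} {y′} eq = +-cancelʳ-≈ (y + δ * x′) (begin
          (x - y) + (y + δ * x′)              ≈⟨ solve 3 (λ x y z → (x :- y) :+ (y :+ z) := x :+ z) refl x y (δ * x′) ⟩
          x + δ * x′                          ≈⟨ eq ⟩
          y + δ * y′                          ≈⟨ solve 4 (λ y d a b → y :+ d :* b := d :* (b :- a) :+ (y :+ d :* a)) refl y δ x′ y′ ⟩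
          δ * (y′ - x′) + (y + δ * x′)        ∎)
          where open import Relation.Binary.Reasoning.Setoid setoid

        collide′ : ∀ {x x′ y y′} → x + δ * x′ ≈ y + δ * y′ → ε * (x - y) ≈ y′ - x′
        collide′ eq = trans (*-congˡ (collide eq)) (cancelδ _)

        rowOf : ∀ {x x′ y y′} → x′ ∈ A → y′ ∈ A → x + δ * x′ ≈ y + δ * y′ → _~_ Row x y
        rowOf x′∈ y′∈ eq = resp (sym (collide′ eq)) (diff y′∈ x′∈)
          where open G

        colOf : ∀ {x x′ y y′} → x ∈ A → y ∈ A → x + δ * x′ ≈ y + δ * y′ → _~_ Col x′ y′
        colOf {x} {x′} {y} {y′} x∈ y∈ eq = G.resp (sym (trans (solve 3 (λ d a b → d :* (a :- b) := :- (d :* (b :- a))) refl δ x′ y′)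
          (trans (-‿cong (sym (collide eq))) (solve 2 (λ x y → :- (x :- y) := y :- x) refl x y)))) (diff y∈ x∈)

        blk : ∀ {x y} → x ∈ A → y ∈ A → _~_ Row x y → _~_ Col x y → _~_ Blk x y
        blk x∈ y∈ r c = mkN (diff x∈ y∈) c r

        Blk⇒Row : ∀ {x y} → _~_ Blk x y → _~_ Row x y
        Blk⇒Row = toε

        Blk⇒Col : ∀ {x y} → _~_ Blk x y → _~_ Col x y
        Blk⇒Col = toδ

        blkOf : ∀ {x x′ y y′} → x ∈ A → x′ ∈ A → y ∈ A → y′ ∈ A → _~_ Blk x x′ → _~_ Blk y y′ → x + δ * x′ ≈ y + δ * y′ → _~_ Blk x y
        blkOf {x} {x′} {y} {y′} x∈ x′∈ y∈ y′∈ xx′ yy′ eq = blk x∈ y∈ (rowOf x′∈ y′∈ eq)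
          (~-trans Col {x} {x′} {y} (Blk⇒Col xx′) (~-trans Col {x′} {y′} {y} (colOf x∈ y∈ eq) (Blk⇒Col (~-sym Blk {y} {y′} yy′))))

        -- Once `blkOf` has placed all four elements in one block, y′ - x′ lies in N and x - y = δ
        -- (y′ - x′) in δN.
        fineOf : ∀ {x x′ y y′} → x ∈ A → x′ ∈ A → y ∈ A → y′ ∈ A → _~_ Blk x x′ → _~_ Blk y y′ → x + δ * x′ ≈ y + δ * y′ → _~_ Fine x y
        fineOf {x} {x′} {y} {y′} x∈ x′∈ y∈ y′∈ xx′ yy′ eq = xy , N′.resp (sym (collide′ eq))
            (~-trans Blk {y′} {y} {x′} (~-sym Blk {y} {y′} yy′) (~-trans Blk {y} {x} {x′} (~-sym Blk {x} {y} xy) xx′))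
          where xy = blkOf x∈ x′∈ y∈ y′∈ xx′ yy′ eq

        Row-splits : Splits δ Row A
        Row-splits _ x′∈ _ y′∈ _ _ eq = rowOf x′∈ y′∈ eq

        Blk-splits : Splits δ Blk A
        Blk-splits = blkOf

        Fine-splits : Splits δ Fine A
        Fine-splits x∈ x′∈ y∈ y′∈ (p , _) (p′ , _) eq = fineOf x∈ x′∈ y∈ y′∈ p p′ eq

        ⊕·⊆S : ∀ {X Y} → X ⊆ A → Y ⊆ A → (X ⊕ δ · Y) ⊆[ ≈E ] S
        ⊕·⊆S {X} {Y} X⊆ Y⊆ z∈ = let (x , y , x∈ , y∈ , eq) = ⊕·-∈ {δ} {X} {Y} z∈ in _ , ∈-⊕ (X⊆ x∈) (∈-· {c = δ} (Y⊆ y∈)) , reflexive eq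

        others : Equivalence Carrier → Carrier → List Carrier
        others E a = select (λ x → ¬ _~_ E x a) A

        others-⊆ : ∀ E {a} → others E a ⊆ A
        others-⊆ E = proj₁ ∘ ∈-select⁻

        others-≁ : ∀ E {a x} → x ∈ others E a → ¬ _~_ E x a
        others-≁ E {a} = proj₂ ∘ ∈-select⁻ {P = λ x → ¬ _~_ E x a}

        others-cover : ∀ E a → n ℕ.≤ size (others E a) ℕ.+ size (classOf E a A)
        others-cover E a = ℕ.≤-trans (#-select ≈E (λ x → _~_ E x a) A) (ℕ.≤-reflexive (ℕ.+-comm (size (classOf E a A)) _))

        others-proper : ∀ E {a} → a ∈ A → ∀ {x} → x ∈ others E a → ∃[ y ] (y ∈ A × ¬ _~_ E y x)
        others-proper E {a} a∈ x∈ = a , a∈ , λ p → others-≁ E x∈ (~-sym E p)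

        -- With at most K ∣A∣ elements, A + δA has room for no more than m K disjoint sets of size
        -- at least ∣A∣/m.
        count-≤ : ∀ E (C : Carrier → List Carrier) m → (∀ {y} → y ∈ A → C y ⊆[ ≈E ] S) → (∀ {y} → y ∈ A → n ℕ.≤ m ℕ.* size (C y)) →
          (∀ {y y′ x x′} → y ∈ A → y′ ∈ A → x ∈ C y → x′ ∈ C y′ → x ≈ x′ → _~_ E y y′) → # E A ℕ.≤ m ℕ.* K
        count-≤ E C m C⊆ big dis = ℕ.*-cancelʳ-≤ (# E A) (m ℕ.* K) n ⦃ ℕ.>-nonZero 0<n ⦄ (ℕ.≤-trans
          (#-classes-scaled E ≈E C m C⊆ big dis)
          (ℕ.≤-trans (ℕ.*-monoʳ-≤ m size-S) (ℕ.≤-reflexive (≡.sym (ℕ.*-assoc m K n)))))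

        rowSum : Carrier → List Carrier
        rowSum y = classOf Row y A ⊕ δ · A

        size-rowSum : ∀ {y} → y ∈ A → n ℕ.≤ size (rowSum y)
        size-rowSum y∈ = ℕ.≤-trans (size-·-≥ δ≉0 A) (size-⊕ʳ (δ · A) (classOf-self Row y∈))
          where
          δ≉0 : ¬ (δ ≈ 0#)
          δ≉0 e = 0≉1 (trans (sym (trans (*-congʳ e) (zeroˡ ε))) δε)

        K≤kₘ : ∀ m → m ℕ.≤ k₁ K → m ℕ.* K ℕ.≤ kₘ K
        K≤kₘ m = ℕ.*-monoˡ-≤ K

        few-rows : # Row A ℕ.≤ kₘ K
        few-rows = ℕ.≤-trans (count-≤ Row rowSum 1 (λ _ → ⊕·⊆S (classOf-⊆ Row) (λ z → z))
          (λ y∈ → ℕ.≤-trans (size-rowSum y∈) (ℕ.≤-reflexive (≡.sym (ℕ.+-identityʳ _)))) dis) (K≤kₘ 1 0<k₁)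
          where
          dis : ∀ {y y′ x x′} → y ∈ A → y′ ∈ A → x ∈ rowSum y → x′ ∈ rowSum y′ → x ≈ x′ → _~_ Row y y′
          dis {y} {y′} y∈ y′∈ x∈ x′∈ eq =
            let (a , b , a∈ , b∈ , e) = ⊕·-∈ {δ} {classOf Row y A} {A} x∈
                (a′ , b′ , a′∈ , b′∈ , e′) = ⊕·-∈ {δ} {classOf Row y′ A} {A} x′∈
            in ~-trans Row {y} {a} {y′} (~-sym Row {a} {y} (classOf-~ Row a∈))
                 (~-trans Row {a} {a′} {y′} (rowOf b∈ b′∈ (trans (sym (reflexive e)) (trans eq (reflexive e′)))) (classOf-~ Row a′∈))

        -- The sum of a row with δA has at least ∣A∣ elements and misses the diagonal of the other
        -- rows. Such a gain is compatible with `gain` only if the row that was left out is large.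
        rows-large : ∀ {a} → a ∈ A → n ℕ.≤ 2 ℕ.* K ℕ.* size (classOf Row a A)
        rows-large {a} a∈ = ℕ.*-cancelˡ-≤ (η K) ⦃ ℕ.>-nonZero 0<η ⦄ (ℕ.+-cancelʳ-≤ (η K ℕ.* n) _ _ (begin
            η K ℕ.* n ℕ.+ η K ℕ.* n            ≤⟨ ℕ.+-mono-≤ g g ⟩
            (X ℕ.+ n) ℕ.+ (X ℕ.+ n)            ≡⟨ N.solve 2 (λ x n → (x N.:+ n) N.:+ (x N.:+ n) N.:= (x N.:+ x) N.:+ N.con 2 N.:* n) ≡.refl X n ⟩
            (X ℕ.+ X) ℕ.+ 2 ℕ.* n              ≤⟨ ℕ.+-monoʳ-≤ _ (ℕ.*-monoˡ-≤ n 2≤η) ⟩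
            (X ℕ.+ X) ℕ.+ η K ℕ.* n            ≡⟨ ≡.cong (ℕ._+ η K ℕ.* n) (N.solve 3 (λ e k s → e N.:* k N.:* s N.:+ e N.:* k N.:* s N.:= e N.:* (N.con 2 N.:* k N.:* s)) ≡.refl (η K) K r) ⟩
            η K ℕ.* (2 ℕ.* K ℕ.* r) ℕ.+ η K ℕ.* n ∎))
          where
          open ℕ.≤-Reasoning
          r = size (classOf Row a A)
          X = η K ℕ.* K ℕ.* r
          2≤η : 2 ℕ.≤ η K
          2≤η = ℕ.*-monoʳ-≤ 2 0<k₁
          dis : ∀ {x y} → x ∈ diagonal δ Row (others Row a) → y ∈ rowSum a → ¬ (x ≈ y)
          dis {x} {y} x∈ y∈ eq =
            let (u , u′ , u∈ , u′∈ , _ , e) = diagonal-∈ {δ} {Row} {others Row a} x∈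
                (w , w′ , w∈ , w′∈ , e′) = ⊕·-∈ {δ} {classOf Row a A} {A} y∈
            in others-≁ Row u∈ (~-trans Row {u} {w} {a} (rowOf (others-⊆ Row u′∈) w′∈ (trans (sym (reflexive e)) (trans eq (reflexive e′)))) (classOf-~ Row w∈))
          g : η K ℕ.* n ℕ.≤ X ℕ.+ n
          g = ℕ.≤-trans (ℕ.*-monoʳ-≤ (η K) (size-rowSum a∈)) (gain {Row} {others Row a} {rowSum a} r Row-splits few-rows (others-⊆ Row)
                (⊕·⊆S (classOf-⊆ Row) (λ z → z)) dis (others-proper Row a∈) (others-cover Row a))

        cell : Carrier → Carrier → List Carrier
        cell a a′ = classOf Row a A ⊕ δ · classOf Col a′ A

        size-cell : ∀ {a a′} → a ∈ A → a′ ∈ A → n ℕ.≤ 2 ℕ.* K ℕ.* size (cell a a′)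
        size-cell {a} {a′} a∈ a′∈ = ℕ.≤-trans (rows-large a∈) (ℕ.*-monoʳ-≤ (2 ℕ.* K)
          (size-⊕ˡ (classOf Row a A) (∈-· {c = δ} (classOf-self Col a′∈))))

        cell-collide : ∀ {a a′ z x y} → z ∈ cell a a′ → x ∈ A → y ∈ A → z ≈ x + δ * y → _~_ Row x a × _~_ Col y a′
        cell-collide {a} {a′} {z} {x} {y} z∈ x∈ y∈ eq =
          let (w , w′ , w∈ , w′∈ , e) = ⊕·-∈ {δ} {classOf Row a A} {classOf Col a′ A} z∈
              eq′ = trans (sym eq) (reflexive e)
          in ~-trans Row {x} {w} {a} (rowOf y∈ (classOf-⊆ Col w′∈) eq′) (classOf-~ Row w∈) ,
             ~-trans Col {y} {w′} {a′} (colOf x∈ (classOf-⊆ Row w∈) eq′) (classOf-~ Col w′∈)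

        few-blocks : # Blk A ℕ.≤ kₘ K
        few-blocks = ℕ.≤-trans (count-≤ Blk (λ y → cell y y) (2 ℕ.* K) (λ _ → ⊕·⊆S (classOf-⊆ Row) (classOf-⊆ Col)) (λ y∈ → size-cell y∈ y∈) dis)
          (K≤kₘ (2 ℕ.* K) (ℕ.≤-trans (ℕ.m≤m*n (2 ℕ.* K) (2 ℕ.* K) ⦃ ℕ.m*n≢0 2 K ⦄) (ℕ.≤-reflexive (N.solve 1 (λ k → (N.con 2 N.:* k) N.:* (N.con 2 N.:* k) N.:= N.con 4 N.:* (k N.:* k)) ≡.refl K))))
          where
          dis : ∀ {y y′ x x′} → y ∈ A → y′ ∈ A → x ∈ cell y y → x′ ∈ cell y′ y′ → x ≈ x′ → _~_ Blk y y′
          dis {y} {y′} y∈ y′∈ x∈ x′∈ eq =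
            let (w , w′ , w∈ , w′∈ , e) = ⊕·-∈ {δ} {classOf Row y′ A} {classOf Col y′ A} x′∈
                (p , r) = cell-collide {y} {y} x∈ (classOf-⊆ Row w∈) (classOf-⊆ Col w′∈) (trans eq (reflexive e))
            in blk y∈ y′∈ (~-trans Row {y} {w} {y′} (~-sym Row {w} {y} p) (classOf-~ Row w∈)) (~-trans Col {y} {w′} {y′} (~-sym Col {w′} {y} r) (classOf-~ Col w′∈))

        Block : Carrier → Carrier → List Carrier
        Block a a′ = select (λ x → _~_ Row x a × _~_ Col x a′) A

        -- The row of a and the column of a′ might not meet a priori. If they had few elements in
        -- common, the cell formed by this row and this column would be a gain over the diagonal of
        -- the remaining blocks. Hence every row meets every column substantially.
        blocks-large : ∀ {a a′} → a ∈ A → a′ ∈ A → n ℕ.≤ k₁ K ℕ.* size (Block a a′)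
        blocks-large {a} {a′} a∈ a′∈ = ℕ.*-cancelˡ-≤ (η K) ⦃ ℕ.>-nonZero 0<η ⦄ (ℕ.+-cancelʳ-≤ (η K ℕ.* n) _ _ (begin
            η K ℕ.* n ℕ.+ η K ℕ.* n                        ≡⟨ N.solve 2 (λ e n → e N.:* n N.:+ e N.:* n N.:= N.con 2 N.:* (e N.:* n)) ≡.refl (η K) n ⟩
            2 ℕ.* (η K ℕ.* n)                              ≤⟨ ℕ.*-monoʳ-≤ 2 (ℕ.*-monoʳ-≤ (η K) (size-cell a∈ a′∈)) ⟩
            2 ℕ.* (η K ℕ.* (2 ℕ.* K ℕ.* size (cell a a′)))
              ≡⟨ N.solve 3 (λ e k s → N.con 2 N.:* (e N.:* (N.con 2 N.:* k N.:* s)) N.:= N.con 2 N.:* (N.con 2 N.:* k) N.:* (e N.:* s)) ≡.refl (η K) K (size (cell a a′)) ⟩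
            2 ℕ.* (2 ℕ.* K) ℕ.* (η K ℕ.* size (cell a a′)) ≤⟨ ℕ.*-monoʳ-≤ (2 ℕ.* (2 ℕ.* K)) g ⟩
            2 ℕ.* (2 ℕ.* K) ℕ.* (η K ℕ.* K ℕ.* r ℕ.+ n)
              ≡⟨ N.solve 4 (λ e k r n → N.con 2 N.:* (N.con 2 N.:* k) N.:* (e N.:* k N.:* r N.:+ n)
                   N.:= e N.:* (N.con 4 N.:* (k N.:* k) N.:* r) N.:+ N.con 4 N.:* k N.:* n) ≡.refl (η K) K r n ⟩
            η K ℕ.* (k₁ K ℕ.* r) ℕ.+ 4 ℕ.* K ℕ.* n         ≤⟨ ℕ.+-monoʳ-≤ _ (ℕ.*-monoˡ-≤ n 4K≤η) ⟩
            η K ℕ.* (k₁ K ℕ.* r) ℕ.+ η K ℕ.* n             ∎))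
          where
          open ℕ.≤-Reasoning
          P : Carrier → Set
          P x = _~_ Row x a × _~_ Col x a′
          r = size (Block a a′)
          A′ = select (λ x → ¬ P x) A
          4K≤η : 4 ℕ.* K ℕ.≤ η K
          4K≤η = ℕ.≤-trans (ℕ.*-monoʳ-≤ 4 (ℕ.m≤m*n K K)) (ℕ.m≤m+n (k₁ K) _)
          dis : ∀ {x y} → x ∈ diagonal δ Blk A′ → y ∈ cell a a′ → ¬ (x ≈ y)
          dis {x} {y} x∈ y∈ eq =
            let (u , u′ , u∈ , u′∈ , uu′ , e) = diagonal-∈ {δ} {Blk} {A′} x∈
                (p , r) = cell-collide {a} {a′} y∈ (proj₁ (∈-select⁻ u∈)) (proj₁ (∈-select⁻ u′∈)) (trans (sym eq) (reflexive e))
            in proj₂ (∈-select⁻ {P = λ x → ¬ P x} u∈) (p , ~-trans Col {u} {u′} {a′} (Blk⇒Col uu′) r)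
          proper : ∀ {x} → x ∈ A′ → ∃[ y ] (y ∈ A × ¬ _~_ Blk y x)
          proper {x} x∈ with em {_~_ Blk a x}
          ... | no a≁ = a , a∈ , a≁
          ... | yes a~ = a′ , a′∈ , λ a′~ → proj₂ (∈-select⁻ {P = λ x → ¬ P x} x∈)
            (~-sym Row {a} {x} (Blk⇒Row a~) , ~-sym Col {a′} {x} (Blk⇒Col a′~))
          g : η K ℕ.* size (cell a a′) ℕ.≤ η K ℕ.* K ℕ.* r ℕ.+ n
          g = gain {Blk} {A′} {cell a a′} r Blk-splits few-blocks (proj₁ ∘ ∈-select⁻) (⊕·⊆S (classOf-⊆ Row) (classOf-⊆ Col)) dis proper
            (ℕ.≤-trans (#-select ≈E P A) (ℕ.≤-reflexive (ℕ.+-comm r _)))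

        block-member : ∀ {a a′} → a ∈ A → a′ ∈ A → ∃[ x ] (x ∈ A × _~_ Row x a × _~_ Col x a′)
        block-member {a} {a′} a∈ a′∈ with Block a a′ in eq
        ... | x ∷ _ = let (x∈ , p , r) = ∈-select⁻ {P = λ x → _~_ Row x a × _~_ Col x a′} (≡.subst (x ∈_) (≡.sym eq) (here ≡.refl)) in x , x∈ , p , r
        ... | [] = ⊥-elim (ℕ.<⇒≱ 0<n (ℕ.≤-trans (blocks-large a∈ a′∈) (ℕ.≤-reflexive (≡.trans (≡.cong (k₁ K ℕ.*_)
          (size-empty {Block a a′} (λ {x} x∈ → none (≡.subst (x ∈_) eq x∈)))) (ℕ.*-zeroʳ (k₁ K))))))
          where
          none : ∀ {x : Carrier} → x ∈ [] → ⊥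
          none ()

        Blk-large : ∀ {a} → a ∈ A → n ℕ.≤ k₁ K ℕ.* size (classOf Blk a A)
        Blk-large {a} a∈ = ℕ.≤-trans (blocks-large a∈ a∈) (ℕ.*-monoʳ-≤ (k₁ K) (size-mono (λ x∈ →
          let (x∈A , p , r) = ∈-select⁻ {P = λ x → _~_ Row x a × _~_ Col x a} x∈ in ∈-select⁺ x∈A (blk x∈A a∈ p r))))

        -- A cell contains no classes modulo δN other than those of the diagonal of its block.
        no-new-classes : ∀ {a a′ z} → a ∈ A → a′ ∈ A → z ∈ A → _~_ Row z a → _~_ Col z a′ →
          ∃[ x ] ∃[ y ] (x ∈ A × y ∈ A × _~_ Blk x z × _~_ Blk y z × N (ε * ((a + δ * a′) - (x + δ * y))))
        no-new-classes {a} {a′} {z} a∈ a′∈ z∈ za za′ with em {∃[ x ] ∃[ y ] (x ∈ A × y ∈ A × _~_ Blk x z × _~_ Blk y z × N (ε * ((a + δ * a′) - (x + δ * y))))}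
        ... | yes p = p
        ... | no ¬p with em {∃[ y ] (y ∈ A × ¬ _~_ Blk y z)}
        -- With a single block the sum serves as its own witness; the other case provides the proper
        -- classes that `gain` requires.
        ...   | no ¬∃ = ⊥-elim (¬p (a , a′ , a∈ , a′∈ , all a∈ , all a′∈ , N′.resp (solve 2 (λ e u → con 0ℤ := e :* (u :- u)) refl ε (a + δ * a′)) N′.zero′))
          where
          all : ∀ {y} → y ∈ A → _~_ Blk y z
          all {y} y∈ with em {_~_ Blk y z}
          ... | yes q = q
          ... | no ¬q = ⊥-elim (¬∃ (y , y∈ , ¬q))
        ...   | yes (y₀ , y₀∈ , y₀≁) = ⊥-elim (ℕ.<⇒≱ strict (ℕ.≤-trans g (ℕ.≤-reflexive (≡.cong (ℕ._+ n) (ℕ.*-zeroʳ (η K ℕ.* K))))))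
          where
          -- If the class of a + δa′ modulo δN were new, this whole translate of a dilated block
          -- would avoid the diagonal.
          Y : List Carrier
          Y = [ a ] ⊕ δ · classOf Blk a′ A
          single : ∀ {u} → u ∈ [ a ] → u ≡ a
          single (here ≡.refl) = ≡.refl
          Y⊆ : Y ⊆[ ≈E ] S
          Y⊆ = ⊕·⊆S (λ { (here ≡.refl) → a∈ }) (classOf-⊆ Blk)
          dis : ∀ {x y} → x ∈ diagonal δ Blk A → y ∈ Y → ¬ (x ≈ y)
          dis {x} {y} x∈ y∈ eq =
            let (u , u′ , u∈ , u′∈ , uu′ , e) = diagonal-∈ {δ} {Blk} {A} x∈
                (w , w′ , w∈ , w′∈ , e′) = ⊕·-∈ {δ} {[ a ]} {classOf Blk a′ A} y∈
                eq₁ = trans (sym (reflexive e)) (trans eq (trans (reflexive e′) (+-congʳ (reflexive (single w∈)))))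
                w′A = classOf-⊆ Blk w′∈
                ua = rowOf {u} {u′} {a} {w′} u′∈ w′A eq₁
                u′w′ = colOf {u} {u′} {a} {w′} u∈ a∈ eq₁
                u′a′ = ~-trans Col {u′} {w′} {a′} u′w′ (Blk⇒Col (classOf-~ Blk w′∈))
                uz = blk u∈ z∈ (~-trans Row {u} {a} {z} ua (~-sym Row {z} {a} za))
                       (~-trans Col {u} {u′} {z} (Blk⇒Col uu′) (~-trans Col {u′} {a′} {z} u′a′ (~-sym Col {z} {a′} za′)))
                u′z = ~-trans Blk {u′} {u} {z} (~-sym Blk {u} {u′} uu′) uz
            in ¬p (u , u′ , u∈ , u′∈ , uz , u′z , N′.resp
                 (sym (trans (*-congˡ (trans (+-congˡ (-‿cong eq₁)) (solve 4 (λ a d s t → (a :+ d :* s) :- (a :+ d :* t) := d :* (s :- t)) refl a δ a′ w′))) (cancelδ (a′ - w′))))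
                 (~-sym Blk {w′} {a′} (classOf-~ Blk w′∈)))
          proper : ∀ {x} → x ∈ A → ∃[ y ] (y ∈ A × ¬ _~_ Blk y x)
          proper {x} x∈ with em {_~_ Blk x z}
          ... | yes xz = y₀ , y₀∈ , λ y₀x → y₀≁ (~-trans Blk {y₀} {x} {z} y₀x xz)
          ... | no ¬xz = z , z∈ , λ zx → ¬xz (~-sym Blk {z} {x} zx)
          g : η K ℕ.* size Y ℕ.≤ η K ℕ.* K ℕ.* 0 ℕ.+ n
          g = gain {Blk} {A} {Y} 0 Blk-splits few-blocks (λ x∈ → x∈) Y⊆ dis proper (ℕ.≤-reflexive (≡.sym (ℕ.+-identityʳ n)))
          n≤ : n ℕ.≤ k₁ K ℕ.* size Y
          n≤ = ℕ.≤-trans (Blk-large a′∈) (ℕ.*-monoʳ-≤ (k₁ K) (ℕ.≤-trans (size-·-≥ δ≉0 (classOf Blk a′ A)) (size-⊕ʳ (δ · classOf Blk a′ A) (here ≡.refl))))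
            where
            δ≉0 : ¬ (δ ≈ 0#)
            δ≉0 e = 0≉1 (trans (sym (trans (*-congʳ e) (zeroˡ ε))) δε)
          -- Here ρ = 0, and since η = 2 k₁, a set of ∣A∣/k₁ elements is already more than `gain`
          -- allows.
          strict : n ℕ.< η K ℕ.* size Y
          strict = ℕ.≤-trans (ℕ.+-monoˡ-≤ n 0<n) (ℕ.≤-trans (ℕ.+-mono-≤ n≤ n≤) (ℕ.≤-reflexive
            (N.solve 2 (λ k s → k N.:* s N.:+ k N.:* s N.:= N.con 2 N.:* k N.:* s) ≡.refl (k₁ K) (size Y))))

        Z : Carrier → List Carrier
        Z z = classOf Blk z A

        module _ {z : Carrier} (z∈ : z ∈ A) where

          -- The stabiliser, under translation by δg, of the set of residues modulo δN that occur in
          -- the block of z; only one inclusion is demanded.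
          Inv : Carrier → Set
          Inv g = ∀ {x} → x ∈ A → _~_ Blk x z → ∃[ y ] (y ∈ A × _~_ Blk y z × N (ε * ((x + δ * g) - y)))

          -- Closure under negation comes from finiteness: translation by δg is injective on the
          -- residues of the block, hence surjective, and can be undone.
          Inv-isSubgroup : IsSubgroup Inv
          Inv-isSubgroup = record
            { resp  = λ e i x∈ xz → let (y , y∈ , yz , p) = i x∈ xz in y , y∈ , yz , N′.resp (*-congˡ (+-congʳ (+-congˡ (*-congˡ e)))) p
            ; zero′ = λ {x} x∈ xz → x , x∈ , xz , N′.resp (solve 3 (λ e x d → con 0ℤ := e :* ((x :+ d :* con 0ℤ) :- x)) refl ε x δ) N′.zero′
            ; add   = λ {g} {h} i j {x} x∈ xz →
                let (y , y∈ , yz , p) = i x∈ xz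
                    (w , w∈ , wz , r) = j y∈ yz
                in w , w∈ , wz , N′.resp (solve 7 (λ e d x y w g h → e :* ((x :+ d :* g) :- y) :+ e :* ((y :+ d :* h) :- w) := e :* ((x :+ d :* (g :+ h)) :- w))
                     refl ε δ x y w g h) (N′.add p r)
            ; neg   = negate }
            where
            Res : Equivalence Carrier
            Res = congruence (λ x → N (ε * x)) (preimage ε N-sub)
            negate : ∀ {g} → Inv g → Inv (- g)
            negate {g} i {x} x∈ xz =
              let (w , w∈ , p) = #-≥⇒⊆ Res {map (_+ δ * g) (Z z)} {Z z} shifted (#-map Res Res (_+ δ * g)
                    (λ {x} {y} → N′.resp (*-congˡ (solve 3 (λ x y g → (x :+ g) :- (y :+ g) := x :- y) refl x y (δ * g)))) (Z z)) (∈-select⁺ x∈ xz)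
                  (y , y∈ , eq) = ∈-map⁻ (_+ δ * g) w∈
              in y , classOf-⊆ Blk y∈ , classOf-~ Blk y∈ , N′.resp
                   (trans (*-congˡ (+-congˡ (-‿cong (reflexive eq)))) (solve 5 (λ e x y d g → e :* (x :- (y :+ d :* g)) := e :* ((x :+ d :* (:- g)) :- y)) refl ε x y δ g)) p
              where
              shifted : map (_+ δ * g) (Z z) ⊆[ Res ] Z z
              shifted w∈ =
                let (x , x∈ , eq) = ∈-map⁻ (_+ δ * g) w∈
                    (y , y∈ , yz , p) = i (classOf-⊆ Blk x∈) (classOf-~ Blk x∈)
                in y , ∈-select⁺ y∈ yz , N′.resp (*-congˡ (+-congʳ (sym (reflexive eq)))) p

          InCol : Carrier → Set
          InCol g = ∃[ a ] (a ∈ A × _~_ Col a z × g ≈ a - z)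

          col⊆Inv : ∀ {g} → ⟨ InCol ⟩ g → Inv g
          col⊆Inv = ⟨⟩-least Inv-isSubgroup λ {g} (a , a∈ , az , eq) {x} x∈ xz →
            let (x₁ , y₁ , x₁∈ , y₁∈ , x₁z , y₁z , p) = no-new-classes x∈ a∈ z∈ (~-sym Row {x} {z} (Blk⇒Row xz)) (~-sym Col {a} {z} az)
            in x₁ , x₁∈ , x₁z , N′.resp
                 (trans (+-congˡ (sym (cancelδ (y₁ - z)))) (trans
                   (solve 7 (λ e d x a x₁ y z → e :* ((x :+ d :* a) :- (x₁ :+ d :* y)) :+ e :* (d :* (y :- z)) := e :* ((x :+ d :* (a :- z)) :- x₁))
                      refl ε δ x a x₁ y₁ z)
                   (*-congˡ (+-congʳ (+-congˡ (*-congˡ (sym eq)))))))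
                 (N′.add p y₁z)

          -- Every row meets the column of z, so each element of A is congruent modulo δG to one in
          -- that column.
          generates : ∀ {g} → G g → ∃[ h ] (⟨ InCol ⟩ h × G (ε * (g - h)))
          generates = ⟨⟩-least sub-approx λ {x} (a , b , a∈ , b∈ , eq) →
            let (a′ , a′∈ , ra , ca) = block-member a∈ z∈
                (b′ , b′∈ , rb , cb) = block-member b∈ z∈
            in (a′ - z) - (b′ - z) , C.sub (gen (a′ , a′∈ , ca , refl)) (gen (b′ , b′∈ , cb , refl)) ,
               G.resp (trans (solve 6 (λ e a b a′ b′ z → e :* (b′ :- b) :- e :* (a′ :- a) := e :* ((a :- b) :- ((a′ :- z) :- (b′ :- z)))) refl ε a b a′ b′ z)
                        (*-congˡ (+-congʳ (sym eq)))) (G.sub rb ra)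
            where
            module C = IsSubgroup (⟨⟩-isSubgroup InCol)
            sub-approx : IsSubgroup (λ g → ∃[ h ] (⟨ InCol ⟩ h × G (ε * (g - h))))
            sub-approx = record
              { resp  = λ e (h , p , r) → h , p , G.resp (*-congˡ (+-congʳ e)) r
              ; zero′ = 0# , C.zero′ , G.resp (solve 1 (λ e → con 0ℤ := e :* (con 0ℤ :- con 0ℤ)) refl ε) G.zero′
              ; add   = λ {x} {y} (h , p , r) (h′ , p′ , r′) → h + h′ , C.add p p′ ,
                  G.resp (solve 5 (λ e x y h h′ → e :* (x :- h) :+ e :* (y :- h′) := e :* ((x :+ y) :- (h :+ h′))) refl ε x y h h′) (G.add r r′)
              ; neg   = λ {x} (h , p , r) → - h , C.neg p , G.resp (solve 3 (λ e x h → :- (e :* (x :- h)) := e :* ((:- x) :- (:- h))) refl ε x h) (G.neg r) }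

          -- The block of z meets every class of z + N modulo δN.
          fully-distributed : ∀ {m} → N m → ∃[ y ] (y ∈ A × _~_ Blk y z × N (ε * ((z + m) - y)))
          fully-distributed {m} Nm =
            let (h , p , r) = generates {ε * m} (toε Nm)
                Gh = ⟨⟩-least (⟨⟩-isSubgroup (Diff A)) (λ (a , a∈ , _ , eq) → G.resp (sym eq) (diff a∈ z∈)) p
                Gδh = ⟨⟩-least (preimage δ (⟨⟩-isSubgroup (Diff A))) (λ (a , a∈ , c , eq) → G.resp (*-congˡ (sym eq)) c) p
                -- The remainder εm - h lies in N, not only in δG. Thus z + m and z + δh are
                -- congruent modulo δN, and the translation by δh belongs to the stabiliser.
                Nr = mkN (G.sub (toε Nm) Gh)
                       (G.resp (trans (+-congʳ (sym (cancelε m))) (solve 3 (λ d x h → d :* x :- d :* h := d :* (x :- h)) refl δ (ε * m) h)) (G.sub (toG Nm) Gδh)) r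
                (y , y∈ , yz , s) = col⊆Inv p z∈ (~-refl Blk {z})
            in y , y∈ , yz , N′.resp (trans
                 (+-congˡ (sym (cancelδ (ε * m - h))))
                 (trans (solve 6 (λ e d z m h y → e :* ((z :+ d :* h) :- y) :+ e :* (d :* (m :- h)) := e :* ((z :+ d :* m) :- y)) refl ε δ z (ε * m) h y)
                   (*-congˡ (+-congʳ (+-congˡ (cancelε m)))))) (N′.add s Nr)

        fineSum : Carrier → List Carrier
        fineSum y = classOf Fine y A ⊕ δ · classOf Blk y A

        size-fineSum : ∀ {y} → y ∈ A → n ℕ.≤ k₁ K ℕ.* size (fineSum y)
        size-fineSum {y} y∈ = ℕ.≤-trans (Blk-large y∈) (ℕ.*-monoʳ-≤ (k₁ K)
          (ℕ.≤-trans (size-·-≥ δ≉0 (classOf Blk y A)) (size-⊕ʳ (δ · classOf Blk y A) (classOf-self Fine y∈))))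
          where
          δ≉0 : ¬ (δ ≈ 0#)
          δ≉0 e = 0≉1 (trans (sym (trans (*-congʳ e) (zeroˡ ε))) δε)

        fineSum-collide : ∀ {a z x y} → z ∈ fineSum a → x ∈ A → y ∈ A → _~_ Blk x y → z ≈ x + δ * y → _~_ Fine x a
        fineSum-collide {a} {z} {x} {y} z∈ x∈ y∈ xy eq =
          let (w , w′ , w∈ , w′∈ , e) = ⊕·-∈ {δ} {classOf Fine a A} {classOf Blk a A} z∈
              ww′ = ~-trans Blk {w} {a} {w′} (proj₁ (classOf-~ Fine w∈)) (~-sym Blk {w′} {a} (classOf-~ Blk w′∈))
          in ~-trans Fine {x} {w} {a} (fineOf x∈ y∈ (classOf-⊆ Fine w∈) (classOf-⊆ Blk w′∈) xy ww′ (trans (sym eq) (reflexive e))) (classOf-~ Fine w∈)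

        few-fine : # Fine A ℕ.≤ kₘ K
        few-fine = count-≤ Fine fineSum (k₁ K) (λ _ → ⊕·⊆S (classOf-⊆ Fine) (classOf-⊆ Blk)) size-fineSum
          λ {y} {y′} y∈ y′∈ x∈ x′∈ eq →
            let (w , w′ , w∈ , w′∈ , e) = ⊕·-∈ {δ} {classOf Fine y′ A} {classOf Blk y′ A} x′∈
                ww′ = ~-trans Blk {w} {y′} {w′} (proj₁ (classOf-~ Fine w∈)) (~-sym Blk {w′} {y′} (classOf-~ Blk w′∈))
            in ~-trans Fine {y} {w} {y′} (~-sym Fine {w} {y} (fineSum-collide {y} x∈ (classOf-⊆ Fine w∈) (classOf-⊆ Blk w′∈) ww′ (trans eq (reflexive e)))) (classOf-~ Fine w∈)

        -- The argument for rows one level further down: the sum of a fine class with its whole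
        -- dilated block is the gain.
        fine-large : ∀ {a} → a ∈ A → n ℕ.≤ k₂ K ℕ.* size (classOf Fine a A)
        fine-large {a} a∈ = ℕ.*-cancelˡ-≤ (k₁ K) (ℕ.+-cancelʳ-≤ (k₁ K ℕ.* n) _ _ (begin
            k₁ K ℕ.* n ℕ.+ k₁ K ℕ.* n                      ≡⟨ N.solve 2 (λ k n → k N.:* n N.:+ k N.:* n N.:= N.con 2 N.:* k N.:* n) ≡.refl (k₁ K) n ⟩
            η K ℕ.* n                                      ≤⟨ ℕ.*-monoʳ-≤ (η K) (size-fineSum a∈) ⟩
            η K ℕ.* (k₁ K ℕ.* size (fineSum a))            ≡⟨ N.solve 3 (λ e k s → e N.:* (k N.:* s) N.:= k N.:* (e N.:* s)) ≡.refl (η K) (k₁ K) (size (fineSum a)) ⟩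
            k₁ K ℕ.* (η K ℕ.* size (fineSum a))            ≤⟨ ℕ.*-monoʳ-≤ (k₁ K) g ⟩
            k₁ K ℕ.* (η K ℕ.* K ℕ.* r ℕ.+ n)               ≡⟨ N.solve 4 (λ k K r n → k N.:* (N.con 2 N.:* k N.:* K N.:* r N.:+ n) N.:= k N.:* (N.con 2 N.:* k N.:* K N.:* r) N.:+ k N.:* n) ≡.refl (k₁ K) K r n ⟩
            k₁ K ℕ.* (k₂ K ℕ.* r) ℕ.+ k₁ K ℕ.* n           ∎))
          where
          open ℕ.≤-Reasoning
          r = size (classOf Fine a A)
          dis : ∀ {x y} → x ∈ diagonal δ Fine (others Fine a) → y ∈ fineSum a → ¬ (x ≈ y)
          dis {x} {y} x∈ y∈ eq =
            let (u , u′ , u∈ , u′∈ , uu′ , e) = diagonal-∈ {δ} {Fine} {others Fine a} x∈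
            in others-≁ Fine u∈ (fineSum-collide {a} y∈ (others-⊆ Fine u∈) (others-⊆ Fine u′∈) (proj₁ uu′) (trans (sym eq) (reflexive e)))
          g : η K ℕ.* size (fineSum a) ℕ.≤ η K ℕ.* K ℕ.* r ℕ.+ n
          g = gain {Fine} {others Fine a} {fineSum a} r Fine-splits few-fine (others-⊆ Fine) (⊕·⊆S (classOf-⊆ Fine) (classOf-⊆ Blk)) dis
            (others-proper Fine a∈) (others-cover Fine a)

        FineCol : Equivalence Carrier
        FineCol = congruence (λ x → N x × N (δ * x)) (intersection N-sub (preimage δ N-sub))

        -- As the block of z meets all classes, representatives of its fine classes, shifted by z,
        -- form a complete system of residues of N modulo δN. The index bound thus applies to the
        -- number of fine classes.
        residues : ∀ {z} → z ∈ A → ∀ {m} → N m → ∃[ w ] (w ∈ map (_- z) (reps Fine (Z z)) × N (ε * (m - w)))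
        residues {z} z∈ {m} Nm =
          let (y , y∈ , yz , p) = fully-distributed z∈ Nm
              (r , r∈ , (_ , yr)) = reps-cover Fine {Z z} (∈-select⁺ {P = λ y → _~_ Blk y z} y∈ yz)
          in r - z , ∈-map⁺ (_- z) r∈ , N′.resp (solve 5 (λ e z m y r → e :* ((z :+ m) :- y) :+ e :* (y :- r) := e :* (m :- (r :- z))) refl ε z m y r) (N′.add p yr)

        -- Brunn-Minkowski for the smallest fine class.

        module _ {d : ℕ} {err : ℕ} (v≉0 : ¬ (v ≈ 0#)) (err≤ : fromNat (kₘ K ℕ.* err) ≤ v * fromNat n)
          (bm : ∀ P Q {p q} → P ⊆ A → Q ⊆ A → p ∈ P → q ∈ Q → ∀ t s {x y} → 0# ≤ x → 0# ≤ y →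
            fromNat t * x ^ d ≤ fromNat s * fromNat (size P) → fromNat t * y ^ d ≤ fromNat s * fromNat (size Q) →
            fromNat t * (x + y) ^ d ≤ fromNat s * fromNat (size (P ⊕ δ · Q) ℕ.+ err))
          {z r : Carrier} (z∈ : z ∈ A) (r∈ : r ∈ Z z)
          (few-cols : # FineCol (Z z) ℕ.≤ kₘ K)
          (smallest : ∀ {w} → w ∈ Z z → # Fine (Z z) ℕ.* size (classOf Fine r A) ℕ.≤ # FineCol (Z z) ℕ.* size (classOf FineCol w A))
          {x y : Carrier} (0≤x : 0# ≤ x) (0≤y : 0# ≤ y) (xᵈ : x ^ d ≈ fromNat (# FineCol (Z z))) (yᵈ : y ^ d ≈ fromNat (# Fine (Z z)))
          (H≤ : H ≤ (x + y) ^ d) where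

          private
            n′ m′ ρ : ℕ
            n′ = # FineCol (Z z)
            m′ = # Fine (Z z)
            P Y A′ : List Carrier
            P = classOf Fine r A
            ρ = size P
            Y = P ⊕ δ · Z z
            A′ = others Fine r
            rA : r ∈ A
            rA = classOf-⊆ Blk r∈
            piece : Carrier → List Carrier
            piece w = P ⊕ δ · classOf FineCol w A

            FineCol⇒Z : ∀ {w u} → w ∈ Z z → u ∈ classOf FineCol w A → u ∈ Z z
            FineCol⇒Z {w} {u} w∈ u∈ = ∈-select⁺ {P = λ y → _~_ Blk y z} (classOf-⊆ FineCol u∈) (~-trans Blk {u} {w} {z} (proj₁ (classOf-~ FineCol u∈)) (classOf-~ Blk w∈))

            -- The first summands are congruent modulo N, so a coincidence puts δ (u - u′) into N,
            -- which is the condition that `FineCol` adds to being in one block.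
            pieces-disjoint : ∀ {w w′ a b} → w ∈ Z z → w′ ∈ Z z → a ∈ piece w → b ∈ piece w′ → a ≈ b → _~_ FineCol w w′
            pieces-disjoint {w} {w′} w∈ w′∈ a∈ b∈ eq =
              let (p , u , p∈ , u∈ , e) = ⊕·-∈ {δ} {P} {classOf FineCol w A} a∈
                  (p′ , u′ , p′∈ , u′∈ , e′) = ⊕·-∈ {δ} {P} {classOf FineCol w′ A} b∈
                  eq′ = trans (sym (reflexive e)) (trans eq (reflexive e′))
                  uz = classOf-~ Blk {z} {A} (FineCol⇒Z w∈ u∈)
                  u′z = classOf-~ Blk {z} {A} (FineCol⇒Z w′∈ u′∈)
                  p~p′ = ~-trans Fine {p} {r} {p′} (classOf-~ Fine p∈) (~-sym Fine {p′} {r} (classOf-~ Fine p′∈))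
                  u~u′ : _~_ FineCol u u′
                  u~u′ = ~-trans Blk {u} {z} {u′} uz (~-sym Blk {u′} {z} u′z) ,
                    N′.resp (trans (-‿cong (collide eq′)) (solve 3 (λ d u u′ → :- (d :* (u′ :- u)) := d :* (u :- u′)) refl δ u u′)) (N′.neg (proj₁ p~p′))
              in ~-trans FineCol {w} {u} {w′} (~-sym FineCol {u} {w} (classOf-~ FineCol u∈)) (~-trans FineCol {u} {u′} {w′} u~u′ (classOf-~ FineCol u′∈))

            0<n′ : 0 ℕ.< n′
            0<n′ = #-pos FineCol r∈

            -- One application of `bm` for each of the n′ classes modulo N ∩ εN in the block, scaled
            -- by ρ/n′: then xᵈ = n′ corresponds to P, and yᵈ = m′ to the other class by `smallest`.
            -- The pieces are disjoint, so the sum over all classes contains n′ copies of Hρ, and n′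
            -- cancels.
            Hρ≤ : H * fromNat ρ ≤ fromNat (size Y) + fromNat (n′ ℕ.* err)
            Hρ≤ = fromNat-*-cancelˡ {n = n′} 0<n′ (begin
              fromNat n′ * (H * fromNat ρ)
                ≈⟨ trans (*-comm _ _) (trans (*-congʳ (*-comm H _)) (*-congˡ (reflexive (≡.cong fromNat (≡.trans (#-reps FineCol (Z z)) (≡.sym (ones rs))))))) ⟩
              (fromNat ρ * H) * fromNat (sum (map (λ _ → 1) rs))
                ≤⟨ sum-real (λ _ → 1) (λ w → size (piece w)) {b = fromNat n′} {c = 0#} {w = fromNat n′ * fromNat err} rs each ⟩
              (fromNat n′ * fromNat (sum (map (λ w → size (piece w)) rs)) + 0# * fromNat (sum (map (λ _ → 1) rs))) + fromNat (length rs) * (fromNat n′ * fromNat err)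
                ≤⟨ +-mono-≤ (+-mono-≤ (*-monoˡ-≤ (0≤fromNat n′) (fromNat-mono pieces≤)) (≤-reflexive (zeroˡ _)))
                     (≤-reflexive (*-cong (reflexive (≡.cong fromNat (≡.sym (#-reps FineCol (Z z))))) (sym (fromNat-* n′ err)))) ⟩
              (fromNat n′ * fromNat (size Y) + 0#) + fromNat n′ * fromNat (n′ ℕ.* err)
                ≈⟨ solve 3 (λ n y e → (n :* y :+ con 0ℤ) :+ n :* e := n :* (y :+ e)) refl (fromNat n′) (fromNat (size Y)) (fromNat (n′ ℕ.* err)) ⟩
              fromNat n′ * (fromNat (size Y) + fromNat (n′ ℕ.* err)) ∎)
              where
              open ≤-R
              rs = reps FineCol (Z z)
              ones : ∀ (rs : List Carrier) → sum (map (λ _ → 1) rs) ≡ length rs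
              ones []       = ≡.refl
              ones (_ ∷ rs) = ≡.cong suc (ones rs)
              pieces≤ : sum (map (λ w → size (piece w)) rs) ℕ.≤ size Y
              pieces≤ = sum-#-≤ ≈E piece {D = _~_ FineCol} (reps-indep FineCol (Z z))
                (λ {w} w∈ a∈ → let (p , u , p∈ , u∈ , e) = ⊕·-∈ {δ} {P} {classOf FineCol w A} a∈ in
                   _ , ∈-⊕ p∈ (∈-· {c = δ} (FineCol⇒Z (reps-⊆ FineCol w∈) u∈)) , reflexive e)
                (λ w∈ w′∈ → pieces-disjoint (reps-⊆ FineCol w∈) (reps-⊆ FineCol w′∈))
              each : ∀ {w} → w ∈ rs → (fromNat ρ * H) * fromNat 1 ≤ (fromNat n′ * fromNat (size (piece w)) + 0# * fromNat 1) + fromNat n′ * fromNat err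
              each {w} w∈ = begin
                (fromNat ρ * H) * fromNat 1                ≈⟨ trans (*-congˡ fromNat-1) (*-identityʳ _) ⟩
                fromNat ρ * H                              ≤⟨ *-monoˡ-≤ (0≤fromNat ρ) H≤ ⟩
                fromNat ρ * (x + y) ^ d                    ≤⟨ bm P (classOf FineCol w A) (classOf-⊆ Fine) (classOf-⊆ FineCol) (classOf-self Fine rA) (classOf-self FineCol wA) ρ n′ 0≤x 0≤y
                     (≤-reflexive (trans (*-congˡ xᵈ) (*-comm _ _)))
                     (≤-respˡ (trans (fromNat-* m′ ρ) (trans (*-comm _ _) (*-congˡ (sym yᵈ)))) (≤-respʳ (fromNat-* n′ (size (classOf FineCol w A))) (fromNat-mono (smallest wZ)))) ⟩
                fromNat n′ * fromNat (size (piece w) ℕ.+ err)   ≈⟨ *-congˡ (fromNat-+ (size (piece w)) err) ⟩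
                fromNat n′ * (fromNat (size (piece w)) + fromNat err)
                  ≈⟨ solve 3 (λ n p e → n :* (p :+ e) := (n :* p :+ con 0ℤ :* (con 1ℤ :+ con 0ℤ)) :+ n :* e) refl (fromNat n′) (fromNat (size (piece w))) (fromNat err) ⟩
                (fromNat n′ * fromNat (size (piece w)) + 0# * fromNat 1) + fromNat n′ * fromNat err ∎
                where
                wZ = reps-⊆ FineCol w∈
                wA = classOf-⊆ Blk wZ

            k₂≤B : k₂ K ℕ.≤ B
            k₂≤B = ℕ.≤-trans (ℕ.*-mono-≤ (ℕ.m≤m+n (η K) _) (ℕ.m≤n*m K (kₘ K) ⦃ ℕ.m*n≢0 (k₁ K) K ⦄)) Bₘ≤B

            -- All fine classes have at least ∣A∣/k₂ elements and k₂ ≤ B, so the induction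
            -- hypothesis applies to each of them and the allowance for small classes is 0.
            Ha′≤ : H * fromNat (size A′) ≤ fromNat (size (diagonal δ Fine A′)) + c * fromNat (size A′)
            Ha′≤ = fromNat-*-cancelˡ {n = B} 0<B (begin
              fromNat B * (H * fromNat (size A′))    ≈⟨ *-assoc _ H _ ⟨
              fromNat B * H * fromNat (size A′)
                ≤⟨ sum-bound {δ} {Fine} {A} {A′} {H} {c} {K} {B} {0} (others-⊆ Fine) Fine-splits H≤K 0≤c ih (others-proper Fine rA)
                     (λ {x} x∈ → inj₁ (ℕ.≤-trans (fine-large (others-⊆ Fine x∈)) (ℕ.≤-trans (ℕ.*-monoˡ-≤ _ k₂≤B) (ℕ.*-monoʳ-≤ B (size-mono (λ {u} u∈ →
                        ∈-select⁺ (∈-select⁺ (classOf-⊆ Fine u∈) (λ ur → others-≁ Fine x∈ (~-trans Fine {x} {u} {r} (~-sym Fine {u} {x} (classOf-~ Fine u∈)) ur))) (classOf-~ Fine u∈))))))) ⟩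
              (fromNat B * D + fromNat B * c * fromNat (size A′)) + fromNat (# Fine A′) * fromNat 0
                ≈⟨ solve 5 (λ b d c a w → (b :* d :+ b :* c :* a) :+ w :* con 0ℤ := b :* (d :+ c :* a)) refl (fromNat B) D c (fromNat (size A′)) (fromNat (# Fine A′)) ⟩
              fromNat B * (D + c * fromNat (size A′)) ∎)
              where
              open ≤-R
              D = fromNat (size (diagonal δ Fine A′))

            Y⊆ : Y ⊆[ ≈E ] S
            Y⊆ = ⊕·⊆S (classOf-⊆ Fine) (classOf-⊆ Blk)

            disjoint : ∀ {a b} → a ∈ diagonal δ Fine A′ → b ∈ Y → ¬ (a ≈ b)
            disjoint {a} {b} a∈ b∈ eq =
              let (u , u′ , u∈ , u′∈ , uu′ , e) = diagonal-∈ {δ} {Fine} {A′} a∈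
                  (p , w , p∈ , w∈ , e′) = ⊕·-∈ {δ} {P} {Z z} b∈
                  pw = ~-trans Blk {p} {r} {w} (proj₁ (classOf-~ Fine p∈)) (~-trans Blk {r} {z} {w} (classOf-~ Blk r∈) (~-sym Blk {w} {z} (classOf-~ Blk w∈)))
              in others-≁ Fine u∈ (~-trans Fine {u} {p} {r} (fineOf (others-⊆ Fine u∈) (others-⊆ Fine u′∈) (classOf-⊆ Fine p∈) (classOf-⊆ Blk w∈) (proj₁ uu′) pw
                   (trans (sym (reflexive e)) (trans eq (reflexive e′)))) (classOf-~ Fine p∈))

            D⊆ : diagonal δ Fine A′ ⊆[ ≈E ] S
            D⊆ a∈ = let (u , u′ , u∈ , u′∈ , _ , e) = diagonal-∈ {δ} {Fine} {A′} a∈ in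
              _ , ∈-⊕ (others-⊆ Fine u∈) (∈-· {c = δ} (others-⊆ Fine u′∈)) , reflexive e

            a′+ρ≤n : size A′ ℕ.+ ρ ℕ.≤ n
            a′+ρ≤n = #-disjoint ≈E (⊆⇒⊆[] ≈E (others-⊆ Fine)) (⊆⇒⊆[] ≈E (classOf-⊆ Fine))
              (λ {u} {w} u∈ w∈ eq → others-≁ Fine u∈ (~-trans Fine {u} {w} {r}
                (Fine-splits (others-⊆ Fine u∈) (others-⊆ Fine u∈) (classOf-⊆ Fine w∈) (classOf-⊆ Fine w∈) (~-refl Fine {u}) (~-refl Fine {w}) (+-cong eq (*-congˡ eq)))
                (classOf-~ Fine w∈)))

          -- The failure of the bound and the estimates for A′ and P give q v ∣A∣ ≤ (q + 1) v (∣A∣ -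
          -- ρ) + v ∣A∣. But q = 2 k₂ and k₂ ρ ≥ ∣A∣, so the saving (q + 1) v ρ exceeds 2 v ∣A∣.
          contradiction : ⊥
          contradiction = v≉0 (≤-antisym (fromNat-*-cancelˡ {n = ρ} 0<ρ (≤-respʳ (sym (zeroʳ _)) vρ≤0)) 0≤v)
            where
            open ≤-R
            a′ = fromNat (size A′)
            D = fromNat (size (diagonal δ Fine A′))
            y′ = fromNat (size Y)
            s′ = fromNat (size S)
            E = fromNat (n′ ℕ.* err)
            q′ = fromNat (q K)
            ρ′ = fromNat ρ
            N₀ = fromNat n
            0<ρ : 0 ℕ.< ρ
            0<ρ = #-pos ≈E (classOf-self Fine rA)
            E≤ : E ≤ v * N₀
            E≤ = ≤-trans (fromNat-mono (ℕ.*-monoˡ-≤ err few-cols)) err≤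
            step₁ : q′ * v * N₀ ≤ c * a′ + E
            step₁ = +-cancelʳ-≤ (s′ + H * a′ + H * ρ′) (begin
              q′ * v * N₀ + (s′ + H * a′ + H * ρ′)
                ≈⟨ solve 4 (λ w s a r → w :+ (s :+ a :+ r) := (s :+ w) :+ (a :+ r)) refl (q′ * v * N₀) s′ (H * a′) (H * ρ′) ⟩
              (s′ + q′ * v * N₀) + (H * a′ + H * ρ′)
                ≤⟨ +-mono-≤ (≤-trans S-small (≤-trans (*-monoˡ-≤ 0≤H (≤-respʳ (fromNat-+ (size A′) ρ) (fromNat-mono (others-cover Fine r)))) (≤-reflexive (distribˡ H _ _))))
                     (+-mono-≤ Ha′≤ Hρ≤) ⟩
              (H * a′ + H * ρ′) + ((D + c * a′) + (y′ + E))
                ≈⟨ solve 6 (λ a r d c y e → (a :+ r) :+ ((d :+ c) :+ (y :+ e)) := (c :+ e) :+ ((d :+ y) :+ a :+ r)) refl (H * a′) (H * ρ′) D (c * a′) y′ E ⟩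
              (c * a′ + E) + ((D + y′) + H * a′ + H * ρ′)
                ≤⟨ +-mono-≤ ≤-refl (+-mono-≤ (+-mono-≤ (≤-respˡ (fromNat-+ (size (diagonal δ Fine A′)) (size Y)) (fromNat-mono (#-disjoint ≈E D⊆ Y⊆ disjoint))) ≤-refl) ≤-refl) ⟩
              (c * a′ + E) + (s′ + H * a′ + H * ρ′) ∎)
            2n≤qρ : fromNat 2 * N₀ ≤ q′ * ρ′
            2n≤qρ = ≤-respˡ (fromNat-* 2 n) (≤-respʳ (fromNat-* (q K) ρ) (fromNat-mono (ℕ.≤-trans (ℕ.*-monoʳ-≤ 2 (fine-large rA))
              (ℕ.≤-reflexive (N.solve 3 (λ k K r → N.con 2 N.:* (N.con 2 N.:* k N.:* K N.:* r) N.:= N.con 2 N.:* (N.con 2 N.:* k) N.:* K N.:* r) ≡.refl (k₁ K) K ρ)))))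
            vρ≤0 : ρ′ * v ≤ 0#
            vρ≤0 = +-cancelʳ-≤ ((v * (fromNat 2 * N₀) + q′ * v * N₀) + c * a′) (begin
              ρ′ * v + ((v * (fromNat 2 * N₀) + q′ * v * N₀) + c * a′)
                ≤⟨ +-mono-≤ ≤-refl (+-mono-≤ (+-mono-≤ (*-monoˡ-≤ 0≤v 2n≤qρ) step₁) ≤-refl) ⟩
              ρ′ * v + ((v * (q′ * ρ′) + (c * a′ + E)) + c * a′)
                ≈⟨ solve 6 (λ r v q a e o → r :* v :+ ((v :* (q :* r) :+ (((con 1ℤ :+ q) :* v) :* a :+ e)) :+ ((con 1ℤ :+ q) :* v) :* a)
                     := (((con 1ℤ :+ q) :* v) :* (a :+ r) :+ e) :+ ((con 1ℤ :+ q) :* v) :* a) refl ρ′ v q′ a′ E 1# ⟩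
              (c * (a′ + ρ′) + E) + c * a′
                ≤⟨ +-mono-≤ (+-mono-≤ (*-monoˡ-≤ 0≤c (≤-respˡ (fromNat-+ (size A′) ρ) (fromNat-mono a′+ρ≤n))) E≤) ≤-refl ⟩
              (c * N₀ + v * N₀) + c * a′
                ≈⟨ solve 4 (λ v q n a → (((con 1ℤ :+ q) :* v) :* n :+ v :* n) :+ ((con 1ℤ :+ q) :* v) :* a
                     := con 0ℤ :+ ((v :* ((con 1ℤ :+ (con 1ℤ :+ con 0ℤ)) :* n) :+ q :* v :* n) :+ ((con 1ℤ :+ q) :* v) :* a)) refl v q′ N₀ a′ ⟩
              0# + ((v * (fromNat 2 * N₀) + q′ * v * N₀) + c * a′) ∎)

      -- Multiplication by β maps P + αQ onto Q + βP. In this way hypotheses and failure for α carry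
      -- over to β.
      flip-≤ : ∀ {α β} → α * β ≈ 1# → ∀ P Q → size (P ⊕ α · Q) ℕ.≤ size (Q ⊕ β · P)
      flip-≤ {α} {β} αβ P Q = #-≤ ≈E ≈E (λ x y → β * x ≈ y)
        (λ {x} x∈ → let (p , q , p∈ , q∈ , eq) = ⊕·-∈ {α} {P} {Q} x∈ in q + β * p , ∈-⊕ q∈ (∈-· {c = β} p∈) ,
           trans (*-congˡ (reflexive eq)) (trans (solve 4 (λ a b p q → b :* (p :+ a :* q) := (a :* b) :* q :+ b :* p) refl α β p q)
             (+-congʳ (trans (*-congʳ αβ) (*-identityˡ q)))))
        (λ {x} {x′} _ _ e e′ y≈y′ → *-cancelˡ-≈ β≉0 (trans e (trans y≈y′ (sym e′))))
        where
        β≉0 : ¬ (β ≈ 0#)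
        β≉0 e = 0≉1 (trans (sym (trans (*-congˡ e) (zeroʳ α))) αβ)

      -- The choice between α and its inverse.

      module Both (α β : Carrier) (αβ : α * β ≈ 1#) (v≉0 : ¬ (v ≈ 0#))
        (ih : ∀ {X} → size X ℕ.< n → n ℕ.≤ B ℕ.* size X →
           H * fromNat (size X) ≤ fromNat (size (X ⊕ α · X)) + (fromNat (suc (q K)) * v) * fromNat (size X))
        (fail : ¬ (H * fromNat n ≤ fromNat (size (A ⊕ α · A)) + fromNat (q K) * v * fromNat n))
        {d : ℕ} (0<d : 0 ℕ.< d) {err : ℕ} (err≤ : fromNat (kₘ K ℕ.* err) ≤ v * fromNat n)
        (bm : ∀ P Q {p q} → P ⊆ A → Q ⊆ A → p ∈ P → q ∈ Q → ∀ t s {x y} → 0# ≤ x → 0# ≤ y →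
            fromNat t * x ^ d ≤ fromNat s * fromNat (size P) → fromNat t * y ^ d ≤ fromNat s * fromNat (size Q) →
            fromNat t * (x + y) ^ d ≤ fromNat s * fromNat (size (P ⊕ α · Q) ℕ.+ err))
        where

        N : Carrier → Set
        N x = G x × (G (α * x) × G (β * x))

        N-sub : IsSubgroup N
        N-sub = intersection sub (intersection (preimage α sub) (preimage β sub))
          where sub = ⟨⟩-isSubgroup (Diff A)

        βα : β * α ≈ 1#
        βα = trans (*-comm β α) αβ

        bm′ : ∀ P Q {p q} → P ⊆ A → Q ⊆ A → p ∈ P → q ∈ Q → ∀ t s {x y} → 0# ≤ x → 0# ≤ y →
          fromNat t * x ^ d ≤ fromNat s * fromNat (size P) → fromNat t * y ^ d ≤ fromNat s * fromNat (size Q) →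
          fromNat t * (x + y) ^ d ≤ fromNat s * fromNat (size (P ⊕ β · Q) ℕ.+ err)
        bm′ P Q P⊆ Q⊆ p∈ q∈ t s 0≤x 0≤y hp hq = ≤-respˡ (*-congˡ (^-congˡ d (+-comm _ _)))
          (≤-trans (bm Q P Q⊆ P⊆ q∈ p∈ t s 0≤y 0≤x hq hp)
            (*-monoˡ-≤ (0≤fromNat s) (fromNat-mono (ℕ.+-monoˡ-≤ err (flip-≤ αβ Q P)))))

        ih′ : ∀ {X} → size X ℕ.< n → n ℕ.≤ B ℕ.* size X →
          H * fromNat (size X) ≤ fromNat (size (X ⊕ β · X)) + (fromNat (suc (q K)) * v) * fromNat (size X)
        ih′ {X} lt le = ≤-trans (ih lt le) (+-mono-≤ (fromNat-mono (flip-≤ αβ X X)) ≤-refl)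

        fail′ : ¬ (H * fromNat n ≤ fromNat (size (A ⊕ β · A)) + fromNat (q K) * v * fromNat n)
        fail′ le = fail (≤-trans le (+-mono-≤ (fromNat-mono (flip-≤ βα A A)) ≤-refl))

        toα : ∀ {x} → N x → G (α * x)
        toα p = proj₁ (proj₂ p)

        toβ : ∀ {x} → N x → G (β * x)
        toβ p = proj₂ (proj₂ p)

        mkα : ∀ {x} → G x → G (α * x) → G (β * x) → N x
        mkα g gα gβ = g , gα , gβ

        mkβ : ∀ {x} → G x → G (β * x) → G (α * x) → N x
        mkβ g gβ gα = g , gα , gβ

        Blk Fineα Fineβ : Equivalence Carrier
        Blk   = Side.Blk N N-sub α β αβ proj₁ toα toβ mkα (λ {X} → ih {X}) fail
        Fineα = Side.Fine N N-sub α β αβ proj₁ toα toβ mkα (λ {X} → ih {X}) fail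
        Fineβ = Side.Fine N N-sub β α βα proj₁ toβ toα mkβ (λ {X} → ih′ {X}) fail′

        Block : Carrier → List Carrier
        Block = Side.Z N N-sub α β αβ proj₁ toα toβ mkα (λ {X} → ih {X}) fail

        minimal-class : ∀ (E : Equivalence Carrier) {P z} → z ∈ P → ∃[ r ] (r ∈ P × (∀ {w} → w ∈ P → size (classOf E r A) ℕ.≤ size (classOf E w A)))
        minimal-class E {P} z∈ =
          let (r , r∈ , max) = maximiser (λ w → n ℕ.∸ size (classOf E w A)) z∈
          in r , r∈ , λ {w} w∈ → ℕ.≤-trans (ℕ.≤-reflexive (≡.sym (ℕ.m∸[m∸n]≡n (le r)))) (ℕ.≤-trans (ℕ.∸-monoʳ-≤ n (max w∈)) (ℕ.≤-reflexive (ℕ.m∸[m∸n]≡n (le w))))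
          where
          le : ∀ w → size (classOf E w A) ℕ.≤ n
          le w = size-mono (classOf-⊆ E)

        module _ {m₀ n₀ : ℕ}
          (index : ∀ {x} → ¬ (x ≈ 0#) → N x → ∀ Z₀ → (∀ {m} → N m → ∃[ w ] (w ∈ Z₀ × N (β * (m - w)))) → m₀ ℕ.≤ length Z₀)
          (index′ : ∀ {x} → ¬ (x ≈ 0#) → N x → ∀ Z₀ → (∀ {m} → N m → ∃[ w ] (w ∈ Z₀ × N (α * (m - w)))) → n₀ ℕ.≤ length Z₀)
          {r s : Carrier} (0≤r : 0# ≤ r) (0≤s : 0# ≤ s) (rᵈ : r ^ d ≤ fromNat n₀) (sᵈ : s ^ d ≤ fromNat m₀) (H≤ : H ≤ (r + s) ^ d)
          {z : Carrier} (z∈ : z ∈ A) where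

          private
            mα nβ : ℕ
            mα = # Fineα (Block z)
            nβ = # Fineβ (Block z)

            zZ : z ∈ Block z
            zZ = classOf-self Blk z∈

            -- The index bound starts from a nonzero element of N. As ∣A∣ > k₁, the block of z has
            -- two distinct elements, whose difference will do.
            nonzero : ∃[ x ] (¬ (x ≈ 0#) × N x)
            nonzero = let (x , y , x∈ , y∈ , x≉y) = two-elements {Block z} (ℕ.≰⇒> too-small) in
              x - y , (λ e → x≉y (x-y≈0⇒x≈y e)) , ~-trans Blk {x} {z} {y} (classOf-~ Blk x∈) (~-sym Blk {y} {z} (classOf-~ Blk y∈))
              where
              too-small : ¬ (size (Block z) ℕ.≤ 1)
              too-small le = ℕ.<⇒≱ large (ℕ.≤-trans (Side.Blk-large N N-sub α β αβ proj₁ toα toβ mkα (λ {X} → ih {X}) fail z∈) (ℕ.≤-trans (ℕ.*-monoʳ-≤ (k₁ K) le) (ℕ.≤-reflexive (ℕ.*-identityʳ _))))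

            length-reps : ∀ E P → length (map (_- z) (reps E P)) ≡ # E P
            length-reps E P = ≡.trans (length-map (_- z) (reps E P)) (≡.sym (#-reps E P))

            m₀≤ : m₀ ℕ.≤ mα
            m₀≤ = ℕ.≤-trans (index (proj₁ (proj₂ nonzero)) (proj₂ (proj₂ nonzero)) _ (Side.residues N N-sub α β αβ proj₁ toα toβ mkα (λ {X} → ih {X}) fail z∈)) (ℕ.≤-reflexive (length-reps Fineα (Block z)))

            n₀≤ : n₀ ℕ.≤ nβ
            n₀≤ = ℕ.≤-trans (index′ (proj₁ (proj₂ nonzero)) (proj₂ (proj₂ nonzero)) _ (Side.residues N N-sub β α βα proj₁ toβ toα mkβ (λ {X} → ih′ {X}) fail′ z∈)) (ℕ.≤-reflexive (length-reps Fineβ (Block z)))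

            few : ∀ E → # E A ℕ.≤ kₘ K → # E (Block z) ℕ.≤ kₘ K
            few E le = ℕ.≤-trans (#-mono E (⊆⇒⊆[] E (classOf-⊆ Blk))) le

            x y : Carrier
            x = proj₁ (root d 0<d (0≤fromNat nβ))
            y = proj₁ (root d 0<d (0≤fromNat mα))
            0≤x = proj₁ (proj₂ (root d 0<d (0≤fromNat nβ)))
            0≤y = proj₁ (proj₂ (root d 0<d (0≤fromNat mα)))
            xᵈ : x ^ d ≈ fromNat nβ
            xᵈ = proj₂ (proj₂ (root d 0<d (0≤fromNat nβ)))
            yᵈ : y ^ d ≈ fromNat mα
            yᵈ = proj₂ (proj₂ (root d 0<d (0≤fromNat mα)))

            -- More residues than the index bound guarantees only increase the right-hand side.
            H≤xy : H ≤ (x + y) ^ d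
            H≤xy = ≤-trans H≤ (^-mono d (≤-trans 0≤r (≤-by 0≤s refl)) (+-mono-≤
              (^-cancel-≤ d 0<d 0≤x (≤-trans rᵈ (≤-respʳ (sym xᵈ) (fromNat-mono n₀≤))))
              (^-cancel-≤ d 0<d 0≤y (≤-trans sᵈ (≤-respʳ (sym yᵈ) (fromNat-mono m₀≤))))))

          -- The class used as P has to be small in relation to all classes of the other kind.
          -- Comparing the smallest classes of the two kinds, weighted by the numbers of classes in
          -- the block, shows for which of α and β this holds; the column classes of one side are
          -- the fine classes of the other.
          impossible : ⊥
          impossible =
            let (a , a∈ , minα) = minimal-class Fineα zZ
                (b , b∈ , minβ) = minimal-class Fineβ zZ
            in decide a∈ minα b∈ minβ (ℕ.≤-total (mα ℕ.* size (classOf Fineα a A)) (nβ ℕ.* size (classOf Fineβ b A)))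
            where
            decide : ∀ {a b} → a ∈ Block z → (∀ {w} → w ∈ Block z → size (classOf Fineα a A) ℕ.≤ size (classOf Fineα w A)) →
              b ∈ Block z → (∀ {w} → w ∈ Block z → size (classOf Fineβ b A) ℕ.≤ size (classOf Fineβ w A)) →
              mα ℕ.* size (classOf Fineα a A) ℕ.≤ nβ ℕ.* size (classOf Fineβ b A) ⊎ nβ ℕ.* size (classOf Fineβ b A) ℕ.≤ mα ℕ.* size (classOf Fineα a A) → ⊥
            decide a∈ minα b∈ minβ (inj₁ le) = Side.contradiction N N-sub α β αβ proj₁ toα toβ mkα (λ {X} → ih {X}) fail {d} {err} v≉0 err≤ bm z∈ a∈ (few Fineβ (Side.few-fine N N-sub β α βα proj₁ toβ toα mkβ (λ {X} → ih′ {X}) fail′))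
              (λ w∈ → ℕ.≤-trans le (ℕ.*-monoʳ-≤ nβ (minβ w∈))) 0≤x 0≤y xᵈ yᵈ H≤xy
            decide a∈ minα b∈ minβ (inj₂ le) = Side.contradiction N N-sub β α βα proj₁ toβ toα mkβ (λ {X} → ih′ {X}) fail′ {d} {err} v≉0 err≤ bm′ z∈ b∈ (few Fineα (Side.few-fine N N-sub α β αβ proj₁ toα toβ mkα (λ {X} → ih {X}) fail))
              (λ w∈ → ℕ.≤-trans le (ℕ.*-monoʳ-≤ mα (minα w∈))) 0≤y 0≤x yᵈ xᵈ (≤-respʳ (^-congˡ d (+-comm x y)) H≤xy)

  -- The minimal polynomial as a list, and that of the inverse.

  module Conjugate where

    open Reals R hiding (_⊕_; _·_)
    open import Data.Fin.Properties using (toℕ-fromℕ<)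
    open Field
    open Polynomial
    open import Algebra.Properties.CommutativeMonoid.Sum +-commutativeMonoid using (sum-cong-≋)
    open import Data.Integer.Divisibility.Signed using (divides; ∣⇒∣ᵤ) renaming (_∣_ to _∣ℤ_)

    eval-tabulate : ∀ {n} (a : Fin n → ℤ) x → eval a x ≈ ⟦ tabulate a ⟧ x
    eval-tabulate {n} a x = trans (sum-cong-≋ {n} {λ i → fromInt (a i) * x ^ toℕ i} (λ i → *-congˡ (sym (*-identityˡ _)))) (trans (go a 1#) (*-identityˡ _))
      where
      go : ∀ {n} (a : Fin n → ℤ) c → sum (λ i → fromInt (a i) * (c * x ^ toℕ i)) ≈ c * ⟦ tabulate a ⟧ x
      go {zero}  a c = sym (zeroʳ c)
      go {suc n} a c = trans (+-congˡ (trans (sum-cong-≋ {n} {λ i → fromInt (a (suc i)) * (c * (x * x ^ toℕ i))} (λ i → *-congˡ (sym (*-assoc c x _)))) (go (a ∘ suc) (c * x))))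
        (solve 4 (λ a c x f → a :* (c :* con 1ℤ) :+ (c :* x) :* f := c :* (a :+ x :* f)) refl (fromInt (a zero)) c x (⟦ tabulate (a ∘ suc) ⟧ x))

    coefficients : ∀ n f x → length f ℕ.≤ n → ⟦ tabulate {n = n} (λ i → f ! toℕ i) ⟧ x ≈ ⟦ f ⟧ x
    coefficients zero    []      x _       = refl
    coefficients (suc n) []      x _       = trans (+-identityˡ _) (trans (*-congˡ (coefficients n [] x z≤n)) (zeroʳ x))
    coefficients (suc n) (c ∷ f) x (s≤s l) = +-congˡ (*-congˡ (coefficients n f x l))

    !-beyond : ∀ f {n} → length f ℕ.≤ n → f ! n ≡ 0ℤ
    !-beyond []      _       = ≡.refl
    !-beyond (c ∷ f) (s≤s l) = !-beyond f l

    !⇒All : ∀ {P : ℤ → Set} f → (∀ n → P (f ! n)) → All P f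
    !⇒All []      h = []
    !⇒All (c ∷ f) h = h 0 ∷ !⇒All f (h ∘ suc)

    All⇒! : ∀ {P : ℤ → Set} f → P 0ℤ → All P f → ∀ n → P (f ! n)
    All⇒! []      p0 _        n       = p0
    All⇒! (c ∷ f) p0 (p ∷ ps) zero    = p
    All⇒! (c ∷ f) p0 (p ∷ ps) (suc n) = All⇒! f p0 ps n

    All-reverse : ∀ {P : ℤ → Set} f → All P f → All P (reverse f)
    All-reverse []      []       = []
    All-reverse (c ∷ f) (p ∷ ps) = ≡.subst (All _) (≡.sym (unfold-reverse c f)) (All.∷ʳ⁺ (All-reverse f ps) p)

    -- Reversal permutes the coefficients in the list; the assumption on 0 covers the positions
    -- beyond its end.
    !-reverse : ∀ {P : ℤ → Set} f → P 0ℤ → (∀ n → P (reverse f ! n)) → ∀ n → P (f ! n)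
    !-reverse {P} f p0 h = All⇒! f p0 (≡.subst (All P) (reverse-involutive f) (All-reverse (reverse f) (!⇒All (reverse f) h)))

    tabulate-! : ∀ {n} (a : Fin n → ℤ) i → tabulate a ! toℕ i ≡ a i
    tabulate-! a zero    = ≡.refl
    tabulate-! a (suc i) = tabulate-! (a ∘ suc) i

    tabulate-last : ∀ d (a : Fin (suc d) → ℤ) → ∃[ l ] (tabulate a ≡ l ∷ʳ a (fromℕ d) × length l ≡ d)
    tabulate-last zero    a = [] , ≡.refl , ≡.refl
    tabulate-last (suc d) a = let (l , eq , len) = tabulate-last d (a ∘ suc) in a zero ∷ l , ≡.cong (a zero ∷_) eq , ≡.cong suc len

    -- Reversal turns f into yⁿ f(1/y) with n one less than the length of the list. The factor x on
    -- the right makes up for this difference and includes the empty list.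
    reciprocal : ∀ {x y} → x * y ≈ 1# → ∀ f → x ^ length f * ⟦ reverse f ⟧ y ≈ x * ⟦ f ⟧ x
    reciprocal {x} {y} xy []      = trans (zeroʳ _) (sym (zeroʳ x))
    reciprocal {x} {y} xy (c ∷ f) = begin
      (x * X) * ⟦ reverse (c ∷ f) ⟧ y                   ≈⟨ *-congˡ (reflexive (≡.cong (λ g → ⟦ g ⟧ y) (unfold-reverse c f))) ⟩
      (x * X) * ⟦ reverse f ∷ʳ c ⟧ y                    ≈⟨ *-congˡ (trans (⟦++⟧ (reverse f) [ c ] y) (+-congˡ (*-congʳ (reflexive (≡.cong (y ^_) (length-reverse f)))))) ⟩
      (x * X) * (⟦ reverse f ⟧ y + Y * (fromInt c + y * 0#))
        ≈⟨ solve 6 (λ x X F Y c y → (x :* X) :* (F :+ Y :* (c :+ y :* con 0ℤ)) := x :* (X :* F) :+ x :* ((X :* Y) :* c)) refl x X (⟦ reverse f ⟧ y) Y (fromInt c) y ⟩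
      x * (X * ⟦ reverse f ⟧ y) + x * ((X * Y) * fromInt c)
        ≈⟨ +-cong (*-congˡ (reciprocal xy f)) (*-congˡ (*-congʳ (power (length f)))) ⟩
      x * (x * ⟦ f ⟧ x) + x * (1# * fromInt c)          ≈⟨ solve 3 (λ x F c → x :* (x :* F) :+ x :* (con 1ℤ :* c) := x :* (c :+ x :* F)) refl x (⟦ f ⟧ x) (fromInt c) ⟩
      x * (fromInt c + x * ⟦ f ⟧ x)                     ∎
      where
      open import Relation.Binary.Reasoning.Setoid setoid
      X = x ^ length f
      Y = y ^ length f
      power : ∀ n → x ^ n * y ^ n ≈ 1#
      power zero    = *-identityˡ 1#
      power (suc n) = trans (solve 4 (λ x X y Y → (x :* X) :* (y :* Y) := (x :* y) :* (X :* Y)) refl x (x ^ n) y (y ^ n))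
        (trans (*-cong xy (power n)) (*-identityˡ 1#))

    reverse-root : ∀ {x y} → x * y ≈ 1# → ¬ (x ≈ 0#) → ∀ f → ⟦ f ⟧ x ≈ 0# → ⟦ reverse f ⟧ y ≈ 0#
    reverse-root {x} xy x≉0 f eq = *-zero-factor (trans (reciprocal xy f) (trans (*-congˡ eq) (zeroʳ x))) (^-≉0 (length f) x≉0)

    -- Reversal exchanges the polynomials vanishing at x with those vanishing at its inverse and
    -- preserves the length and the collection of coefficients, so minimality and primitivity carry
    -- over.
    reverse-minimal : ∀ {x y d a₀ p c l} → x * y ≈ 1# → Minimal x d a₀ p → c ≢ 0ℤ → reverse (a₀ ∷ p) ≡ c ∷ l → Minimal y d c l
    reverse-minimal {x} {y} {d} {a₀} {p} {c} {l} xy M c≢0 eq = record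
      { x≉0         = y≉0
      ; a₀≢0        = c≢0
      ; length-p    = ℕ.suc-injective (≡.trans (≡.cong length (≡.sym eq)) (≡.trans (length-reverse (a₀ ∷ p)) (≡.cong suc length-p)))
      ; root        = trans (reflexive (≡.cong (λ g → ⟦ g ⟧ y) (≡.sym eq))) (reverse-root xy x≉0 (a₀ ∷ p) root)
      ; minimal     = λ f len e → !-reverse {_≡ 0ℤ} f ≡.refl (minimal (reverse f) (≡.subst (ℕ._≤ d) (≡.sym (length-reverse f)) len)
          (reverse-root (trans (*-comm y x) xy) y≉0 f e))
      ; isPrimitive = λ q pr h → isPrimitive q pr (!-reverse {(ℤ.+ q) ∣ℤ_} (a₀ ∷ p) (divides 0ℤ ≡.refl) (λ n → ≡.subst (λ g → (ℤ.+ q) ∣ℤ g ! n) (≡.sym eq) (h n))) }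
      where
      open Minimal M
      y≉0 : ¬ (y ≈ 0#)
      y≉0 e = 0≉1 (trans (sym (trans (*-congˡ e) (zeroʳ x))) xy)

    module _ {α : Carrier} {d : ℕ} {a : Fin (suc d) → ℤ} (min : IsMinimalPolynomial a α) where
      open IsMinimalPolynomial min renaming (root to eval-root; minimal to eval-minimal)

      tail : Poly
      tail = tabulate (a ∘ suc)

      tabulate-root : ⟦ a zero ∷ tail ⟧ α ≈ 0#
      tabulate-root = trans (sym (eval-tabulate a α)) eval-root

      list-minimal : ∀ f → length f ℕ.≤ d → ⟦ f ⟧ α ≈ 0# → ∀ n → f ! n ≡ 0ℤ
      list-minimal f len eq n with n ℕ.<? d
      ... | yes n<d = ≡.trans (≡.cong (f !_) (≡.sym (toℕ-fromℕ< n<d)))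
            (eval-minimal (λ i → f ! toℕ i) (trans (eval-tabulate (λ (i : Fin d) → f ! toℕ i) α) (trans (coefficients d f α len) eq)) (fromℕ< n<d))
      ... | no n≮d  = !-beyond f (ℕ.≤-trans len (ℕ.≮⇒≥ n≮d))

      last-! : a (fromℕ d) ≡ (a zero ∷ tail) ! d
      last-! = ≡.sym (≡.trans (≡.cong ((a zero ∷ tail) !_) (≡.sym (toℕ-fromℕ′ d))) (tabulate-! a (fromℕ d)))
        where
        open import Data.Fin.Properties using () renaming (toℕ-fromℕ to toℕ-fromℕ′)

      isPrimitive′ : Primitive (a zero ∷ tail)
      isPrimitive′ q pr h = coprime q pr (λ i → ∣⇒∣ᵤ (≡.subst ((ℤ.+ q) ∣ℤ_) (tabulate-! a i) (h (toℕ i))))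

      0<d : 0 ℕ.< d
      0<d = ℕ.n≢0⇒n>0 λ { ≡.refl → leading≢0 (fromInt-≈0 (trans (sym (trans (+-congˡ (zeroʳ α)) (+-identityʳ _))) tabulate-root)) }

      minimal-list : ¬ (α ≈ 0#) → Minimal α d (a zero) tail
      minimal-list α≉0 = record
        { x≉0 = α≉0 ; a₀≢0 = a₀≢0 ; length-p = length-tabulate (a ∘ suc) ; root = tabulate-root ; minimal = list-minimal ; isPrimitive = isPrimitive′ }
        where
        -- If a₀ were 0, cancelling α would make `tail` vanish at α. By minimality all its
        -- coefficients would be 0, including the leading one.
        a₀≢0 : a zero ≢ 0ℤ
        a₀≢0 z = leading≢0 (≡.trans last-! (top d 0<d (list-minimal tail (ℕ.≤-reflexive (length-tabulate (a ∘ suc)))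
          (*-zero-factor (trans (sym (+-identityˡ _)) (trans (+-congʳ (sym (reflexive (≡.cong fromInt z)))) tabulate-root)) α≉0))))
          where
          top : ∀ d → 0 ℕ.< d → (∀ n → tail ! n ≡ 0ℤ) → (a zero ∷ tail) ! d ≡ 0ℤ
          top (suc d) _ h = h d

      minimal-reverse : ∀ {β} → α * β ≈ 1# → ¬ (α ≈ 0#) → ∃[ l ] Minimal β d (a (fromℕ d)) l
      minimal-reverse αβ α≉0 = let (l , eq , _) = tabulate-last d a in
        reverse l , reverse-minimal αβ (minimal-list α≉0) leading≢0 (≡.trans (≡.cong reverse eq) (reverse-++ l [ a (fromℕ d) ]))

      -- For α = 0 the polynomial is ± x.
      zero-case : α ≈ 0# → a zero ≡ 0ℤ × ℤ.∣ a (fromℕ d) ∣ ℕ.≤ 1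
      zero-case α≈0 = a₀≡0 , unit
        where
        a₀≡0 : a zero ≡ 0ℤ
        a₀≡0 = fromInt-≈0 (trans (sym (trans (+-congˡ (trans (*-congʳ α≈0) (zeroˡ _))) (+-identityʳ _))) tabulate-root)
        x : Poly
        x = 0ℤ ∷ 1ℤ ∷ []
        -- The monic polynomial x vanishes at 0, which minimality forbids for d ≥ 2.
        d≤1 : d ℕ.≤ 1
        d≤1 with d ℕ.≤? 1
        ... | yes p = p
        ... | no ¬p with list-minimal x (ℕ.≰⇒> ¬p) (trans (+-identityˡ _) (trans (*-congʳ α≈0) (zeroˡ _))) 1
        ...   | ()
        -- All other coefficients are 0, so a prime factor of the leading one would contradict
        -- primitivity.
        unit : ℤ.∣ a (fromℕ d) ∣ ℕ.≤ 1
        unit with ℤ.∣ a (fromℕ d) ∣ ℕ.≤? 1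
        ... | yes p = p
        ... | no ¬p = let (q , pr , q∣) = prime-divisor _ (ℕ.≰⇒> ¬p) in ⊥-elim (isPrimitive′ q pr (every q q∣))
          where
          open import Data.Integer.Divisibility.Signed using (∣ᵤ⇒∣)
          import Data.Nat.Divisibility as ℕ
          every : ∀ q → q ℕ.∣ ℤ.∣ a (fromℕ d) ∣ → q ∣ᴾ (a zero ∷ tail)
          every q q∣ zero    = ≡.subst ((ℤ.+ q) ∣ℤ_) (≡.sym a₀≡0) (divides 0ℤ ≡.refl)
          every q q∣ (suc n) with suc n ℕ.≤? d
          ... | no ¬p = ≡.subst ((ℤ.+ q) ∣ℤ_) (≡.sym (!-beyond tail (≡.subst (ℕ._≤ n) (≡.sym (length-tabulate (a ∘ suc))) (ℕ.≤-pred (ℕ.≰⇒> ¬p))))) (divides 0ℤ ≡.refl)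
          ... | yes p = ≡.subst ((ℤ.+ q) ∣ℤ_) (≡.trans last-! (≡.cong ((a zero ∷ tail) !_) (ℕ.≤-antisym (ℕ.≤-trans d≤1 (s≤s z≤n)) p))) (∣ᵤ⇒∣ q∣)

  -- The directions e, αe, ... and the Brunn-Minkowski error of A + αA.

  module Dimension where

    open Reals R hiding (_⊕_; _·_; sum)
    open Field
    open Counting em
    open Sumsets
    open Structure using (String; module SmallDoubling)
    open Partition using (⊕·-∈)
    open BrunnMinkowski using (Lin; μ; ⊆≈⇒⊆String; brunn-minkowski)
    open Polynomial using (Poly; _!_; _⊞_; ⊞-!; ⟦_⟧; ⟦⊞⟧; length-⊞)
    open Conjugate using (!-beyond; list-minimal)

    monomial : ℕ → ℤ → Poly
    monomial k c = replicate k 0ℤ ++ [ c ]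

    monomial-! : ∀ k c → monomial k c ! k ≡ c
    monomial-! zero    c = ≡.refl
    monomial-! (suc k) c = monomial-! k c

    length-monomial : ∀ k c → length (monomial k c) ≡ suc k
    length-monomial zero    c = ≡.refl
    length-monomial (suc k) c = ≡.cong suc (length-monomial k c)

    ⟦monomial⟧ : ∀ k c x → ⟦ monomial k c ⟧ x ≈ fromInt c * x ^ k
    ⟦monomial⟧ zero    c x = solve 2 (λ c x → c :+ x :* con 0ℤ := c :* con 1ℤ) refl (fromInt c) x
    ⟦monomial⟧ (suc k) c x = trans (+-congˡ (*-congˡ (⟦monomial⟧ k c x)))
      (solve 3 (λ c x X → con 0ℤ :+ x :* (c :* X) := c :* (x :* X)) refl (fromInt c) x (x ^ k))

    Lin-polynomial : ∀ α e k {v} → Lin (λ j → α ^ j * e) k v → ∃[ f ] (length f ℕ.≤ k × v ≈ ⟦ f ⟧ α * e)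
    Lin-polynomial α e zero    v≈0 = [] , z≤n , trans v≈0 (sym (zeroˡ e))
    Lin-polynomial α e (suc k) {v} (c , p) =
      let (f , len , eq) = Lin-polynomial α e k p in
      f ⊞ monomial k c ,
      length-⊞ f (monomial k c) (ℕ.m≤n⇒m≤1+n len) (ℕ.≤-reflexive (length-monomial k c)) ,
      (begin
        v                                                   ≈⟨ solve 2 (λ v w → v := (v :- w) :+ w) refl v (fromInt c * (α ^ k * e)) ⟩
        (v - fromInt c * (α ^ k * e)) + fromInt c * (α ^ k * e)
          ≈⟨ +-cong eq (trans (sym (*-assoc _ _ e)) (*-congʳ (sym (⟦monomial⟧ k c α)))) ⟩
        ⟦ f ⟧ α * e + ⟦ monomial k c ⟧ α * e                ≈⟨ trans (*-congʳ (⟦⊞⟧ f (monomial k c) α)) (distribʳ e _ _) ⟨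
        ⟦ f ⊞ monomial k c ⟧ α * e                          ∎)
      where open import Relation.Binary.Reasoning.Setoid setoid

    -- The error part of `μ`, split off so that it can be replaced by its value on all of A + αA,
    -- the same for all subsets P and Q.
    excess : (ℕ → Carrier) → ℕ → List Carrier → ℕ
    excess e zero    S = 0
    excess e (suc k) S = excess e k S ℕ.+ 2 ℕ.^ k ℕ.* # (String (e k)) S

    μ≡ : ∀ e k S → μ e k S ≡ size S ℕ.+ excess e k S
    μ≡ e zero    S = ≡.sym (ℕ.+-identityʳ _)
    μ≡ e (suc k) S = ≡.trans (≡.cong (ℕ._+ 2 ℕ.^ k ℕ.* # (String (e k)) S) (μ≡ e k S)) (ℕ.+-assoc (size S) _ _)

    excess-mono : ∀ e k {S T} → S ⊆[ ≈E ] T → excess e k S ℕ.≤ excess e k T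
    excess-mono e zero    sub = z≤n
    excess-mono e (suc k) {S} {T} sub = ℕ.+-mono-≤ (excess-mono e k {S} {T} sub)
      (ℕ.*-monoʳ-≤ (2 ℕ.^ k) (#-mono (String (e k)) (⊆≈⇒⊆String e {e k} {S} {T} sub)))

    -- The term b on the left closes the induction, since 1 + 2 + ... + 2ᵏ⁻¹ = 2ᵏ - 1.
    excess-≤ : ∀ e k S {M b} → (∀ j → j ℕ.< k → # (String (e j)) S ℕ.* M ℕ.≤ b) → excess e k S ℕ.* M ℕ.+ b ℕ.≤ 2 ℕ.^ k ℕ.* b
    excess-≤ e zero    S {M} {b} h = ℕ.≤-reflexive (≡.sym (ℕ.+-identityʳ b))
    excess-≤ e (suc k) S {M} {b} h = begin
      (x ℕ.+ p ℕ.* s) ℕ.* M ℕ.+ b       ≡⟨ N.solve 5 (λ x p s M b → (x N.:+ p N.:* s) N.:* M N.:+ b N.:= (x N.:* M N.:+ b) N.:+ p N.:* (s N.:* M)) ≡.refl x p s M b ⟩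
      (x ℕ.* M ℕ.+ b) ℕ.+ p ℕ.* (s ℕ.* M) ≤⟨ ℕ.+-mono-≤ (excess-≤ e k S (λ j j<k → h j (ℕ.m<n⇒m<1+n j<k))) (ℕ.*-monoʳ-≤ p (h k ℕ.≤-refl)) ⟩
      p ℕ.* b ℕ.+ p ℕ.* b               ≡⟨ N.solve 2 (λ p b → p N.:* b N.:+ p N.:* b N.:= N.con 2 N.:* p N.:* b) ≡.refl p b ⟩
      2 ℕ.* p ℕ.* b                     ∎
      where
      open ℕ.≤-Reasoning
      x = excess e k S
      p = 2 ℕ.^ k
      s = # (String (e k)) S

    -- The constants of SmallDoubling.strings.
    κ stringBound : ℕ → ℕ
    κ K = K ℕ.^ 5
    stringBound K = 2 ℕ.* (κ K ℕ.* κ K)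

    dimensionBound : ℕ → ℕ → ℕ
    dimensionBound K d = K ℕ.* K ℕ.* κ K ℕ.* κ K ℕ.* (K ℕ.* K ℕ.* κ K) ℕ.^ d ℕ.* κ K ℕ.* κ K

    dimensionBound-mono : ∀ K → 1 ℕ.≤ K → ∀ {j k} → j ℕ.≤ k → dimensionBound K j ℕ.≤ dimensionBound K k
    dimensionBound-mono K 1≤K {j} {k} j≤k = ℕ.*-monoˡ-≤ (κ K) (ℕ.*-monoˡ-≤ (κ K) (ℕ.*-monoʳ-≤ (K ℕ.* K ℕ.* κ K ℕ.* κ K)
      (ℕ.^-monoʳ-≤ (K ℕ.* K ℕ.* κ K) ⦃ ℕ.m*n≢0 (K ℕ.* K) (κ K) ⦃ ℕ.m*n≢0 K K ⦄ ⦃ ℕ.m^n≢0 K 5 ⦄ ⦄ j≤k)))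
      where
      instance
        K≢0 : ℕ.NonZero K
        K≢0 = ℕ.>-nonZero 1≤K

    module _ {α : Carrier} {d : ℕ} {a : Fin (suc d) → ℤ} (min : IsMinimalPolynomial a α) where

      -- A relation would give an integer polynomial of length at most d that vanishes at α and has
      -- - z as its coefficient of degree k.
      independent : ∀ {e} → ¬ (e ≈ 0#) → ∀ k → k ℕ.< d → ∀ z → Lin (λ j → α ^ j * e) k (fromInt z * (α ^ k * e)) → z ≡ 0ℤ
      independent {e} e≉0 k k<d z p = ℤ.neg-injective (≡.trans (≡.sym coefficient) (list-minimal min g len root k))
        where
        f = proj₁ (Lin-polynomial α e k p)
        f≤ = proj₁ (proj₂ (Lin-polynomial α e k p))
        f≈ = proj₂ (proj₂ (Lin-polynomial α e k p))
        g : Poly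
        g = f ⊞ monomial k (ℤ.- z)
        len : length g ℕ.≤ d
        len = ℕ.≤-trans (length-⊞ f _ (ℕ.m≤n⇒m≤1+n f≤) (ℕ.≤-reflexive (length-monomial k (ℤ.- z)))) k<d
        coefficient : g ! k ≡ ℤ.- z
        coefficient = ≡.trans (⊞-! f _ k) (≡.trans (≡.cong₂ ℤ._+_ (!-beyond f f≤) (monomial-! k (ℤ.- z))) (ℤ.+-identityˡ _))
        root : ⟦ g ⟧ α ≈ 0#
        root = *-zero-factor (begin
          e * ⟦ g ⟧ α                                       ≈⟨ *-congˡ (trans (⟦⊞⟧ f _ α) (+-congˡ (trans (⟦monomial⟧ k (ℤ.- z) α) (*-congʳ (fromInt-neg z))))) ⟩
          e * (⟦ f ⟧ α + - fromInt z * α ^ k)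
            ≈⟨ solve 4 (λ e f z X → e :* (f :+ (:- z) :* X) := f :* e :- z :* (X :* e)) refl e (⟦ f ⟧ α) (fromInt z) (α ^ k) ⟩
          ⟦ f ⟧ α * e - fromInt z * (α ^ k * e)             ≈⟨ +-congʳ (sym f≈) ⟩
          fromInt z * (α ^ k * e) - fromInt z * (α ^ k * e) ≈⟨ -‿inverseʳ _ ⟩
          0#                                                ∎) e≉0
          where open import Relation.Binary.Reasoning.Setoid setoid

      -- A + α A looks d-dimensional in the directions e, α e, …, so that the Brunn–Minkowski inequality holds up to
      -- the number of strings.
      brunn-minkowski-error : ¬ (α ≈ 0#) → 0 ℕ.< d → ∀ A {a₀} → a₀ ∈ A → ∀ K → 1 ℕ.≤ K → size (A ⊕ α · A) ℕ.≤ K ℕ.* size A →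
        ∀ J → (κ K ℕ.^ stringBound K) ℕ.^ J ℕ.< size A →
        ∃[ err ] (err ℕ.* 2 ℕ.^ J ℕ.≤ 2 ℕ.^ d ℕ.* (dimensionBound K d ℕ.* size A) ×
          (∀ P Q {p q} → P ⊆ A → Q ⊆ A → p ∈ P → q ∈ Q → ∀ t s {x y} → 0# ≤ x → 0# ≤ y →
            fromNat t * x ^ d ≤ fromNat s * fromNat (size P) → fromNat t * y ^ d ≤ fromNat s * fromNat (size Q) →
            fromNat t * (x + y) ^ d ≤ fromNat s * fromNat (size (P ⊕ α · Q) ℕ.+ err)))
      brunn-minkowski-error α≉0 0<d A a₀∈ K 1≤K small J lt =
        excess e d S , ℕ.≤-trans (ℕ.m≤m+n _ _) (excess-≤ e d S few) , bm
        where
        st = SmallDoubling.strings α α≉0 A a₀∈ K small J lt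
        e₀ = proj₁ st
        e : ℕ → Carrier
        e j = α ^ j * e₀
        S = A ⊕ α · A
        few : ∀ j → j ℕ.< d → # (String (e j)) S ℕ.* 2 ℕ.^ J ℕ.≤ dimensionBound K d ℕ.* size A
        few j j<d = ℕ.≤-trans (proj₂ (proj₂ st) j) (ℕ.*-monoˡ-≤ (size A) (dimensionBound-mono K 1≤K (ℕ.<⇒≤ j<d)))
        sub : ∀ {P Q} → P ⊆ A → Q ⊆ A → (P ⊕ α · Q) ⊆[ ≈E ] S
        sub {P} {Q} P⊆ Q⊆ x∈ = let (p , q , p∈ , q∈ , eq) = ⊕·-∈ {α} {P} {Q} x∈ in _ , ∈-⊕ (P⊆ p∈) (∈-· {c = α} (Q⊆ q∈)) , reflexive eq
        bm : ∀ P Q {p q} → P ⊆ A → Q ⊆ A → p ∈ P → q ∈ Q → ∀ t s {x y} → 0# ≤ x → 0# ≤ y →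
          fromNat t * x ^ d ≤ fromNat s * fromNat (size P) → fromNat t * y ^ d ≤ fromNat s * fromNat (size Q) →
          fromNat t * (x + y) ^ d ≤ fromNat s * fromNat (size (P ⊕ α · Q) ℕ.+ excess e d S)
        bm P Q P⊆ Q⊆ p∈ q∈ t s 0≤x 0≤y hp hq = ≤-trans
          (brunn-minkowski e d (independent (proj₁ (proj₂ st))) 0<d P (α · Q) p∈ (∈-· {c = α} q∈) t s 0≤x 0≤y hp
            (≤-trans hq (*-monoˡ-≤ (0≤fromNat s) (fromNat-mono (size-·-≥ α≉0 Q)))))
          (*-monoˡ-≤ (0≤fromNat s) (fromNat-mono (ℕ.≤-trans (ℕ.≤-reflexive (μ≡ e d (P ⊕ α · Q)))
            (ℕ.+-monoʳ-≤ (size (P ⊕ α · Q)) (excess-mono e d {P ⊕ α · Q} {S} (sub P⊆ Q⊆))))))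

  -- From geometric decay over the scales to a power of ∣A∣.

  module Growth where

    open Reals R hiding (_⊕_; _·_; sum)
    open Field
    open Roots using (1^; ^ᴿ-lower)
    open Index using (bernoulli)
    open import Algebra.Properties.Semiring.Exp semiring using (^-congˡ; ^-assocʳ)
    open import Algebra.Properties.CommutativeSemiring.Exp commutativeSemiring using (^-distrib-*)

    logarithm : ∀ B → 2 ℕ.≤ B → ∀ n → 0 ℕ.< n → ∃[ J ] (B ℕ.^ J ℕ.≤ n × n ℕ.< B ℕ.^ suc J)
    logarithm B 2≤B (suc zero)    _ = 0 , ℕ.≤-refl , ≡.subst (2 ℕ.≤_) (≡.sym (ℕ.*-identityʳ B)) 2≤B
    logarithm B 2≤B (suc (suc n)) _ = next (logarithm B 2≤B (suc n) (s≤s z≤n))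
      where
      next : ∃[ J ] (B ℕ.^ J ℕ.≤ suc n × suc n ℕ.< B ℕ.^ suc J) → ∃[ J ] (B ℕ.^ J ℕ.≤ suc (suc n) × suc (suc n) ℕ.< B ℕ.^ suc J)
      next (J , lo , hi) with suc (suc n) ℕ.<? B ℕ.^ suc J
      ... | yes p = J , ℕ.m≤n⇒m≤1+n lo , p
      ... | no ¬p = suc J , ℕ.≮⇒≥ ¬p , (begin-strict
        suc (suc n)            ≤⟨ hi ⟩
        B ℕ.^ suc J            <⟨ ℕ.m<m+n (B ℕ.^ suc J) (ℕ.<-≤-trans (s≤s z≤n) hi) ⟩
        B ℕ.^ suc J ℕ.+ B ℕ.^ suc J ≡⟨ ≡.cong (B ℕ.^ suc J ℕ.+_) (≡.sym (ℕ.+-identityʳ _)) ⟩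
        2 ℕ.* B ℕ.^ suc J      ≤⟨ ℕ.*-monoˡ-≤ (B ℕ.^ suc J) 2≤B ⟩
        B ℕ.^ suc (suc J)      ∎)
        where open ℕ.≤-Reasoning

    module _ (q D₀ : ℕ) (0<q : 0 ℕ.< q) where

      -- The ratio for which q v(J) = (q + 1) v(J + 1): a bound with constant q on one scale is a
      -- bound with constant q + 1 on the next.
      γ : Carrier
      γ = fromNat q * fromNat (suc q) ⁻¹

      v : ℕ → Carrier
      v J = fromNat D₀ * γ ^ J

      private
        q+1≉0 : ¬ (fromNat (suc q) ≈ 0#)
        q+1≉0 = fromNat≉0 {suc q} (s≤s z≤n)

      γ-suc : fromNat (suc q) * γ ≈ fromNat q
      γ-suc = trans (solve 3 (λ s q i → s :* (q :* i) := (s :* i) :* q) refl (fromNat (suc q)) (fromNat q) (fromNat (suc q) ⁻¹))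
        (trans (*-congʳ (⁻¹-inverse q+1≉0)) (*-identityˡ _))

      0≤γ : 0# ≤ γ
      0≤γ = *-nonNeg (0≤fromNat q) (≉0⇒⁻¹≥0 (0≤fromNat (suc q)) q+1≉0)

      γ≤1 : γ ≤ 1#
      γ≤1 = fromNat-*-cancelˡ {n = suc q} (s≤s z≤n) (≤-respˡ (sym γ-suc) (≤-respʳ (sym (*-identityʳ _)) (fromNat-mono (ℕ.n≤1+n q))))

      -- Ensures that D₀ γᴶ stays above D₀ 2⁻ᴶ, the order of magnitude of the Brunn-Minkowski error
      -- at scale J.
      1≤2γ : 1# ≤ fromNat 2 * γ
      1≤2γ = fromNat-*-cancelˡ {n = suc q} (s≤s z≤n) (begin
        fromNat (suc q) * 1#              ≈⟨ *-identityʳ _ ⟩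
        fromNat (suc q)                   ≤⟨ fromNat-mono (ℕ.≤-trans (ℕ.+-monoˡ-≤ q 0<q) (ℕ.≤-reflexive (≡.cong (q ℕ.+_) (≡.sym (ℕ.+-identityʳ q))))) ⟩
        fromNat (2 ℕ.* q)                 ≈⟨ fromNat-* 2 q ⟩
        fromNat 2 * fromNat q             ≈⟨ *-congˡ γ-suc ⟨
        fromNat 2 * (fromNat (suc q) * γ) ≈⟨ solve 3 (λ t s g → t :* (s :* g) := s :* (t :* g)) refl (fromNat 2) (fromNat (suc q)) γ ⟩
        fromNat (suc q) * (fromNat 2 * γ) ∎)
        where open ≤-R

      γ≉0 : ¬ (γ ≈ 0#)
      γ≉0 e = ¬1≤0 (≤-respʳ (trans (*-congˡ e) (zeroʳ _)) 1≤2γ)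

      0≤v : ∀ J → 0# ≤ v J
      0≤v J = *-nonNeg (0≤fromNat D₀) (^-nonNeg J 0≤γ)

      v≉0 : 0 ℕ.< D₀ → ∀ J → ¬ (v J ≈ 0#)
      v≉0 0<D₀ J e = ^-≉0 J γ≉0 (*-zero-factor e (fromNat≉0 0<D₀))

      v-step : ∀ J → fromNat (suc q) * v (suc J) ≈ fromNat q * v J
      v-step J = trans (solve 4 (λ s d g G → s :* (d :* (g :* G)) := (s :* g) :* (d :* G)) refl (fromNat (suc q)) (fromNat D₀) γ (γ ^ J)) (*-congʳ γ-suc)

      v-anti : ∀ {I J} → I ℕ.≤ J → v J ≤ v I
      v-anti I≤J = *-monoˡ-≤ (0≤fromNat D₀) (powers I≤J)
        where
        ^≤1 : ∀ J → γ ^ J ≤ 1#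
        ^≤1 J = ≤-respʳ (1^ J) (^-mono J 0≤γ γ≤1)
        powers : ∀ {I J} → I ℕ.≤ J → γ ^ J ≤ γ ^ I
        powers {J = J} z≤n   = ^≤1 J
        powers (s≤s p) = *-monoˡ-≤ 0≤γ (powers p)

      D₀≤v2ᴶ : ∀ J → fromNat D₀ ≤ v J * fromNat (2 ℕ.^ J)
      D₀≤v2ᴶ J = begin
        fromNat D₀                                  ≈⟨ *-identityʳ _ ⟨
        fromNat D₀ * 1#                             ≈⟨ *-congˡ (1^ J) ⟨
        fromNat D₀ * 1# ^ J                         ≤⟨ *-monoˡ-≤ (0≤fromNat D₀) (^-mono J 0≤1 1≤2γ) ⟩
        fromNat D₀ * (fromNat 2 * γ) ^ J            ≈⟨ *-congˡ (^-distrib-* (fromNat 2) γ J) ⟩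
        fromNat D₀ * (fromNat 2 ^ J * γ ^ J)        ≈⟨ *-congˡ (*-congʳ (fromNat-^ 2 J)) ⟨
        fromNat D₀ * (fromNat (2 ℕ.^ J) * γ ^ J)    ≈⟨ solve 3 (λ d p g → d :* (p :* g) := (d :* g) :* p) refl (fromNat D₀) (fromNat (2 ℕ.^ J)) (γ ^ J) ⟩
        v J * fromNat (2 ℕ.^ J)                     ∎
        where open ≤-R

      module _ (B : ℕ) where

        -- Chosen such that Bernoulli's inequality gives (1 + 1/q)ˢ ≥ B, that is, γˢ ≤ 1/B. For σ =
        -- 1/s the decay γᴶ is then at most n^(-σ) whenever n ≤ Bᴶ.
        s : ℕ
        s = suc (q ℕ.* B)

        σ : Carrier
        σ = fromNat s ⁻¹

        s≉0 : ¬ (fromNat s ≈ 0#)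
        s≉0 = fromNat≉0 {s} (s≤s z≤n)

        0≤σ : 0# ≤ σ
        0≤σ = ≉0⇒⁻¹≥0 (0≤fromNat s) s≉0

        σ≉0 : ¬ (σ ≈ 0#)
        σ≉0 e = 0≉1 (trans (sym (zeroʳ _)) (trans (*-congˡ (sym e)) (⁻¹-inverse s≉0)))

        Bqˢ≤ : B ℕ.* q ℕ.^ s ℕ.≤ suc q ℕ.^ s
        Bqˢ≤ = ℕ.*-cancelˡ-≤ q ⦃ ℕ.>-nonZero 0<q ⦄ (begin
          q ℕ.* (B ℕ.* q ℕ.^ s)           ≡⟨ N.solve 3 (λ q B P → q N.:* (B N.:* P) N.:= P N.:* (q N.:* B)) ≡.refl q B (q ℕ.^ s) ⟩
          q ℕ.^ s ℕ.* (q ℕ.* B)           ≤⟨ ℕ.*-monoʳ-≤ (q ℕ.^ s) (ℕ.≤-trans (ℕ.n≤1+n _) (ℕ.m≤n+m s q)) ⟩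
          q ℕ.^ s ℕ.* (q ℕ.+ s)           ≤⟨ bernoulli q s ⟩
          q ℕ.* suc q ℕ.^ s               ∎)
          where open ℕ.≤-Reasoning

        Bγˢ≤1 : fromNat B * γ ^ s ≤ 1#
        Bγˢ≤1 = fromNat-*-cancelˡ {n = suc q ℕ.^ s} (ℕ.m^n>0 (suc q) s) (begin
          fromNat (suc q ℕ.^ s) * (fromNat B * γ ^ s)   ≈⟨ *-congʳ (fromNat-^ (suc q) s) ⟩
          fromNat (suc q) ^ s * (fromNat B * γ ^ s)     ≈⟨ solve 3 (λ x b g → x :* (b :* g) := b :* (x :* g)) refl (fromNat (suc q) ^ s) (fromNat B) (γ ^ s) ⟩
          fromNat B * (fromNat (suc q) ^ s * γ ^ s)     ≈⟨ *-congˡ (trans (sym (^-distrib-* (fromNat (suc q)) γ s)) (^-congˡ s γ-suc)) ⟩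
          fromNat B * fromNat q ^ s                     ≈⟨ trans (fromNat-* B (q ℕ.^ s)) (*-congˡ (fromNat-^ q s)) ⟨
          fromNat (B ℕ.* q ℕ.^ s)                       ≤⟨ fromNat-mono Bqˢ≤ ⟩
          fromNat (suc q ℕ.^ s)                         ≈⟨ *-identityʳ _ ⟨
          fromNat (suc q ℕ.^ s) * 1#                    ∎)
          where open ≤-R

        N-γ-bound : ∀ {J n} → n ℕ.≤ B ℕ.^ J → fromNat n * (γ ^ J) ^ s ≤ 1#
        N-γ-bound {J} {n} le = begin
          fromNat n * (γ ^ J) ^ s               ≤⟨ *-monoʳ-≤ (^-nonNeg s (^-nonNeg J 0≤γ)) (fromNat-mono le) ⟩
          fromNat (B ℕ.^ J) * (γ ^ J) ^ s       ≈⟨ *-cong (fromNat-^ B J) (trans (^-assocʳ γ J s) (trans (reflexive (≡.cong (γ ^_) (ℕ.*-comm J s))) (sym (^-assocʳ γ s J)))) ⟩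
          fromNat B ^ J * (γ ^ s) ^ J           ≈⟨ ^-distrib-* (fromNat B) (γ ^ s) J ⟨
          (fromNat B * γ ^ s) ^ J               ≤⟨ ^-mono J (*-nonNeg (0≤fromNat B) (^-nonNeg s 0≤γ)) Bγˢ≤1 ⟩
          1# ^ J                                ≈⟨ 1^ J ⟩
          1#                                    ∎
          where open ≤-R

        -- The rational exponent that witnesses `PowerBelow` is q B/s, which equals 1 - σ.
        below : ∀ b J → suc b ℕ.≤ B ℕ.^ J → fromNat (suc b) * γ ^ J ≤ suc b ^ᴿ (1# - σ)
        below b J le = ^ᴿ-lower b (≤-by 0≤σ (solve 1 (λ s → (con 1ℤ :- s) :+ s := con 1ℤ) refl σ))
          (*-nonNeg (0≤fromNat (suc b)) (^-nonNeg J 0≤γ) , q ℕ.* B , 0 , s , s≤s z≤n , ≤-reflexive exponent , power)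
          where
          n = fromNat (suc b)
          p = fromNat (q ℕ.* B)
          exponent : p ≈ fromNat s * (1# - σ) + 0#
          exponent = sym (begin
            fromNat s * (1# - σ) + 0#       ≈⟨ solve 2 (λ p i → (con 1ℤ :+ p) :* (con 1ℤ :- i) :+ con 0ℤ := (con 1ℤ :+ p) :- (con 1ℤ :+ p) :* i) refl p σ ⟩
            fromNat s - fromNat s * σ       ≈⟨ +-congˡ (-‿cong (⁻¹-inverse s≉0)) ⟩
            (1# + p) - 1#                   ≈⟨ solve 1 (λ p → (con 1ℤ :+ p) :- con 1ℤ := p) refl p ⟩
            p                               ∎)
            where open import Relation.Binary.Reasoning.Setoid setoid
          power : (n * γ ^ J) ^ s * n ^ 0 ≤ n ^ (q ℕ.* B)
          power = begin
            (n * γ ^ J) ^ s * 1#                        ≈⟨ trans (*-identityʳ _) (^-distrib-* n (γ ^ J) s) ⟩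
            (n * n ^ (q ℕ.* B)) * (γ ^ J) ^ s           ≈⟨ solve 3 (λ n P g → (n :* P) :* g := P :* (n :* g)) refl n (n ^ (q ℕ.* B)) ((γ ^ J) ^ s) ⟩
            n ^ (q ℕ.* B) * (n * (γ ^ J) ^ s)           ≤⟨ *-monoˡ-≤ (^-nonNeg (q ℕ.* B) (0≤fromNat (suc b))) (N-γ-bound {J} le) ⟩
            n ^ (q ℕ.* B) * 1#                          ≈⟨ *-identityʳ _ ⟩
            n ^ (q ℕ.* B)                               ∎
            where open ≤-R

        -- A set of scale J has fewer than Bᴶ⁺¹ elements, so `below` is applied at J + 1. Rewriting
        -- q v(J) as (q + 1) v(J + 1) produces the constant (q + 1) D₀.
        error-bound : ∀ b J → suc b ℕ.< B ℕ.^ suc J → fromNat q * v J * fromNat (suc b) ≤ fromNat (suc q ℕ.* D₀) * (suc b ^ᴿ (1# - σ))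
        error-bound b J lt = begin
          fromNat q * v J * n                             ≈⟨ *-congʳ (sym (v-step J)) ⟩
          fromNat (suc q) * (fromNat D₀ * γ ^ suc J) * n
            ≈⟨ solve 4 (λ s d g n → s :* (d :* g) :* n := (s :* d) :* (n :* g)) refl (fromNat (suc q)) (fromNat D₀) (γ ^ suc J) n ⟩
          (fromNat (suc q) * fromNat D₀) * (n * γ ^ suc J) ≈⟨ *-congʳ (fromNat-* (suc q) D₀) ⟨
          fromNat (suc q ℕ.* D₀) * (n * γ ^ suc J)        ≤⟨ *-monoˡ-≤ (0≤fromNat (suc q ℕ.* D₀)) (below b (suc J) (ℕ.<⇒≤ lt)) ⟩
          fromNat (suc q ℕ.* D₀) * (suc b ^ᴿ (1# - σ))    ∎
          where
          open ≤-R
          n = fromNat (suc b)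

  -- The induction over the scales, and the theorem.

  module Main where

    open Reals R hiding (_⊕_; _·_; sum)
    open import Data.Nat.Induction using (<-wellFounded)
    open import Induction.WellFounded using (Acc; acc)
    open Field
    open Roots using (root; 1^; ^ᴿ-upper; ^ᴿ-nonNeg)
    open Counting em
    open Sumsets hiding (Minimal)
    open Polynomial using (Minimal)
    open Index using (IsSubgroup; ⟨_⟩; ⟨⟩-least; module Torsion; module IndexBound)
    open Core using (k₁; kₘ; q; Bₘ; module Induction)
    open Conjugate using (0<d; minimal-list; minimal-reverse; zero-case)
    open Dimension using (κ; stringBound; dimensionBound; brunn-minkowski-error)
    open Growth

    by-contradiction : {P : Set} → (¬ P → ⊥) → P
    by-contradiction {P} f with em {P}
    ... | yes p = p
    ... | no ¬p = ⊥-elim (f ¬p)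

    element : ∀ A → 0 ℕ.< size A → ∃[ x ] (x ∈ A)
    element []      p = ⊥-elim (ℕ.<⇒≢ p (≡.sym (size-empty {[]} (λ ()))))
    element (x ∷ A) _ = x , here ≡.refl

    -- Supplies the finite generation that the index bound requires: N lies in G, which is generated
    -- by the differences with one fixed element of A.
    index-≤ : ∀ {ν ν⁻} → ν * ν⁻ ≈ 1# → ∀ {d a₀ p} → 0 ℕ.< d → Minimal ν d a₀ p → ∀ {A a} → a ∈ A →
      ∀ N → IsSubgroup N → (∀ {v} → N v → ⟨ Diff A ⟩ v) → ∀ {x} → ¬ (x ≈ 0#) → N x →
      ∀ Z₀ → (∀ {m} → N m → ∃[ w ] (w ∈ Z₀ × N (ν⁻ * (m - w)))) → ℤ.∣ a₀ ∣ ℕ.≤ length Z₀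
    index-≤ νν⁻ {suc d} 0<d M {A} {a} a∈ N N-sub N⊆ x≉0 Nx Z₀ residues =
      IndexBound.index-bound νν⁻ M x≉0 N N-sub Nx Z₀ residues gs (λ Nv → ⟨⟩-least (Span-isSubgroup gs) difference (N⊆ Nv))
      where
      open Torsion (IndexBound.Y νν⁻ M x≉0) (IndexBound.Y-isSubgroup νν⁻ M x≉0)
      gs = map (_- a) A
      difference : ∀ {v} → Diff A v → Span gs v
      difference {v} (b , c , b∈ , c∈ , eq) = S.resp
        (trans (solve 3 (λ a b c → (b :- a) :- (c :- a) := b :- c) refl a b c) (sym eq))
        (S.sub (Span-gen (∈-map⁺ (_- a) b∈)) (Span-gen (∈-map⁺ (_- a) c∈)))
        where module S = IsSubgroup (Span-isSubgroup gs)

    module FractionalPower {d : ℕ} (0<d : 0 ℕ.< d) where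

      private
        t : Carrier
        t = fromNat d ⁻¹

        dt : fromNat d * t ≈ 1#
        dt = ⁻¹-inverse (fromNat≉0 0<d)

      0≤t : 0# ≤ t
      0≤t = ≉0⇒⁻¹≥0 (0≤fromNat d) (fromNat≉0 0<d)

      t≤1 : t ≤ 1#
      t≤1 = ≤-respʳ dt (≤-respˡ (*-identityˡ t) (*-monoʳ-≤ 0≤t (≤-respˡ fromNat-1 (fromNat-mono 0<d))))

      root≤ : ∀ m → m ^ᴿ t ≤ fromNat m
      root≤ m = ^ᴿ-upper m 1 (s≤s z≤n) 0≤t (≤-respˡ (sym (trans (*-congʳ fromNat-1) (*-identityˡ t))) t≤1) (0≤fromNat m)
        (≤-reflexive (sym (*-identityʳ _)))

      rootᵈ : ∀ m → (m ^ᴿ t) ^ d ≤ fromNat m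
      rootᵈ m = let (ρ , 0≤ρ , ρᵈ) = root d 0<d (0≤fromNat m) in
        ≤-respʳ ρᵈ (^-mono d (^ᴿ-nonNeg m 0≤t t≤1) (^ᴿ-upper m d 0<d 0≤t (≤-reflexive dt) 0≤ρ (≤-reflexive (sym ρᵈ))))

    module _ {α : Carrier} {d : ℕ} {a : Fin (suc d) → ℤ} (min : IsMinimalPolynomial a α) (α≉0 : ¬ (α ≈ 0#)) where

      private
        β : Carrier
        β = α ⁻¹

        αβ : α * β ≈ 1#
        αβ = ⁻¹-inverse α≉0

        -- K is an integer bound for H and hence for the doubling of a set violating the bound. In
        -- D₀, the summand K makes scale 0 trivial and the other one dominates the Brunn-Minkowski
        -- errors of at most kₘ classes. B is at least `Bₘ`, exceeds k₁, so that sets beyond scale 0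
        -- are large, and exceeds the base that governs the existence of the step e.
        m₀ n₀ K D₀ B : ℕ
        m₀ = ℤ.∣ a zero ∣
        n₀ = ℤ.∣ a (fromℕ d) ∣
        K  = suc (n₀ ℕ.+ m₀) ℕ.^ d
        D₀ = kₘ K ℕ.* (2 ℕ.^ d ℕ.* dimensionBound K d) ℕ.+ K
        B  = Bₘ K ℕ.+ (suc (k₁ K) ℕ.+ suc (κ K ℕ.^ stringBound K))

        1≤K : 1 ℕ.≤ K
        1≤K = ℕ.m^n>0 (suc (n₀ ℕ.+ m₀)) d

        instance
          K≢0 : ℕ.NonZero K
          K≢0 = ℕ.>-nonZero 1≤K
          k₁≢0 : ℕ.NonZero (k₁ K)
          k₁≢0 = ℕ.m*n≢0 4 (K ℕ.* K) ⦃ _ ⦄ ⦃ ℕ.m*n≢0 K K ⦄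

        0<q : 0 ℕ.< q K
        0<q = ℕ.>-nonZero⁻¹ (q K) ⦃ ℕ.m*n≢0 (2 ℕ.* (2 ℕ.* k₁ K)) K ⦃ ℕ.m*n≢0 2 (2 ℕ.* k₁ K) ⦃ _ ⦄ ⦃ ℕ.m*n≢0 2 (k₁ K) ⦄ ⦄ ⦄

        0<D₀ : 0 ℕ.< D₀
        0<D₀ = ℕ.≤-trans 1≤K (ℕ.m≤n+m K _)

        Bₘ≤B : Bₘ K ℕ.≤ B
        Bₘ≤B = ℕ.m≤m+n (Bₘ K) _

        k₁<B : k₁ K ℕ.< B
        k₁<B = ℕ.≤-trans (ℕ.m≤m+n (suc (k₁ K)) _) (ℕ.m≤n+m _ (Bₘ K))

        string<B : κ K ℕ.^ stringBound K ℕ.< B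
        string<B = ℕ.≤-trans (ℕ.m≤n+m _ (suc (k₁ K))) (ℕ.m≤n+m _ (Bₘ K))

        2≤B : 2 ℕ.≤ B
        2≤B = ℕ.≤-trans (s≤s (ℕ.>-nonZero⁻¹ (k₁ K))) k₁<B

        0<B : 0 ℕ.< B
        0<B = ℕ.≤-trans (s≤s z≤n) 2≤B

        V : ℕ → Carrier
        V = v (q K) D₀ 0<q

      module _ {H r s : Carrier} (0≤H : 0# ≤ H) (H≤K : H ≤ fromNat K) (0≤r : 0# ≤ r) (0≤s : 0# ≤ s)
        (rᵈ : r ^ d ≤ fromNat n₀) (sᵈ : s ^ d ≤ fromNat m₀) (H≤ : H ≤ (r + s) ^ d) where

        private
          Bound : ℕ → List Carrier → Set
          Bound J A = H * fromNat (size A) ≤ fromNat (size (A ⊕ α · A)) + fromNat (q K) * V J * fromNat (size A)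

        -- A set X with B ∣X∣ ≥ ∣A∣ belongs to a scale I with J ≤ I + 1, so its bound with constant
        -- q v(I) = (q + 1) v(I + 1) implies the one with (q + 1) v(J) that the inductive step uses.
        bound : ∀ A → Acc ℕ._<_ (size A) → ∀ J → B ℕ.^ J ℕ.≤ size A → size A ℕ.< B ℕ.^ suc J → Bound J A
        bound A _ zero _ _ = begin
          H * n                                           ≤⟨ *-monoʳ-≤ (0≤fromNat (size A)) H≤K ⟩
          fromNat K * n                                   ≤⟨ *-monoʳ-≤ (0≤fromNat (size A)) (≤-respʳ (trans (fromNat-* (q K) D₀) (*-congˡ (sym (*-identityʳ _))))
                                                               (fromNat-mono (ℕ.≤-trans (ℕ.m≤n+m K _) (ℕ.m≤n*m D₀ (q K) ⦃ ℕ.>-nonZero 0<q ⦄)))) ⟩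
          fromNat (q K) * V 0 * n                         ≤⟨ ≤-by (0≤fromNat (size (A ⊕ α · A))) (+-comm _ _) ⟩
          fromNat (size (A ⊕ α · A)) + fromNat (q K) * V 0 * n ∎
          where
          open ≤-R
          n = fromNat (size A)
        bound A (acc rec) (suc j) lo hi = by-contradiction (λ fail → contradiction fail (element A 0<n))
          where
          J = suc j
          n = size A
          0<n : 0 ℕ.< n
          0<n = ℕ.≤-trans (ℕ.m^n>0 B ⦃ ℕ.>-nonZero 0<B ⦄ J) lo
          B≤n : B ℕ.≤ n
          B≤n = ℕ.≤-trans (ℕ.m≤m*n B (B ℕ.^ j) ⦃ ℕ.m^n≢0 B j ⦃ ℕ.>-nonZero 0<B ⦄ ⦄) lo
          ih : ∀ {X} → size X ℕ.< n → n ℕ.≤ B ℕ.* size X →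
            H * fromNat (size X) ≤ fromNat (size (X ⊕ α · X)) + (fromNat (suc (q K)) * V J) * fromNat (size X)
          ih {X} lt le = let (I , lo′ , hi′) = logarithm B 2≤B (size X) 0<x in
            ≤-trans (bound X (rec lt) I lo′ hi′) (+-mono-≤ ≤-refl (*-monoʳ-≤ (0≤fromNat (size X))
              (≤-respˡ (v-step (q K) D₀ 0<q I) (*-monoˡ-≤ (0≤fromNat (suc (q K))) (v-anti (q K) D₀ 0<q (J≤ I hi′))))))
            where
            0<x : 0 ℕ.< size X
            0<x = ℕ.n≢0⇒n>0 (λ e → ℕ.<⇒≱ 0<n (ℕ.≤-trans le (ℕ.≤-reflexive (≡.trans (≡.cong (B ℕ.*_) e) (ℕ.*-zeroʳ B)))))
            J≤ : ∀ I → size X ℕ.< B ℕ.^ suc I → J ℕ.≤ suc I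
            J≤ I hi′ = ℕ.≮⇒≥ (λ I<J → ℕ.<⇒≱ (ℕ.*-monoʳ-< B ⦃ ℕ.>-nonZero 0<B ⦄ hi′)
              (ℕ.≤-trans (ℕ.^-monoʳ-≤ B ⦃ ℕ.>-nonZero 0<B ⦄ I<J) (ℕ.≤-trans lo le)))
          contradiction : ¬ Bound J A → ∃[ z ] (z ∈ A) → ⊥
          contradiction fail (z , z∈) = impossible
            (index-≤ αβ (0<d min) (minimal-list min α≉0) z∈ N N-sub proj₁)
            (index-≤ (trans (*-comm β α) αβ) (0<d min) (proj₂ (minimal-reverse min αβ α≉0)) z∈ N N-sub proj₁)
            0≤r 0≤s rᵈ sᵈ H≤ z∈
            where
            small : size (A ⊕ α · A) ℕ.≤ K ℕ.* n
            small = fromNat-cancel (≤-trans (≤-by (*-nonNeg (*-nonNeg (0≤fromNat (q K)) (0≤v (q K) D₀ 0<q J)) (0≤fromNat n)) refl)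
              (≤-trans (≰⇒≥ fail) (≤-respʳ (sym (fromNat-* K n)) (*-monoʳ-≤ (0≤fromNat n) H≤K))))
            bm = brunn-minkowski-error min α≉0 (0<d min) A z∈ K 1≤K small J
              (ℕ.<-≤-trans (ℕ.^-monoˡ-< J string<B) lo)
            err = proj₁ bm
            err≤ : fromNat (kₘ K ℕ.* err) ≤ V J * fromNat n
            err≤ = fromNat-*-cancelˡ {n = 2 ℕ.^ J} (ℕ.m^n>0 2 J) (begin
              fromNat (2 ℕ.^ J) * fromNat (kₘ K ℕ.* err)   ≈⟨ fromNat-* (2 ℕ.^ J) (kₘ K ℕ.* err) ⟨
              fromNat (2 ℕ.^ J ℕ.* (kₘ K ℕ.* err))         ≤⟨ fromNat-mono scaled ⟩
              fromNat (D₀ ℕ.* n)                           ≈⟨ fromNat-* D₀ n ⟩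
              fromNat D₀ * fromNat n                       ≤⟨ *-monoʳ-≤ (0≤fromNat n) (D₀≤v2ᴶ (q K) D₀ 0<q J) ⟩
              V J * fromNat (2 ℕ.^ J) * fromNat n          ≈⟨ solve 3 (λ v p n → (v :* p) :* n := p :* (v :* n)) refl (V J) (fromNat (2 ℕ.^ J)) (fromNat n) ⟩
              fromNat (2 ℕ.^ J) * (V J * fromNat n)        ∎)
              where
              open ≤-R
              scaled : 2 ℕ.^ J ℕ.* (kₘ K ℕ.* err) ℕ.≤ D₀ ℕ.* n
              scaled = ℕ.≤-trans (ℕ.≤-reflexive (N.solve 3 (λ p k e → p N.:* (k N.:* e) N.:= k N.:* (e N.:* p)) ≡.refl (2 ℕ.^ J) (kₘ K) err))
                (ℕ.≤-trans (ℕ.*-monoʳ-≤ (kₘ K) (proj₁ (proj₂ bm)))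
                (ℕ.≤-trans (ℕ.≤-reflexive (N.solve 4 (λ k p c n → k N.:* (p N.:* (c N.:* n)) N.:= (k N.:* (p N.:* c)) N.:* n) ≡.refl (kₘ K) (2 ℕ.^ d) (dimensionBound K d) n))
                  (ℕ.*-monoˡ-≤ n (ℕ.m≤m+n (kₘ K ℕ.* (2 ℕ.^ d ℕ.* dimensionBound K d)) K))))
            impossible = Induction.Both.impossible K 1≤K H 0≤H H≤K B Bₘ≤B (V J) (0≤v (q K) D₀ 0<q J) A (ℕ.<-≤-trans k₁<B B≤n)
              α β αβ (v≉0 (q K) D₀ 0<q 0<D₀ J) (λ {X} → ih {X}) fail {d} (0<d min) {err} err≤ (proj₂ (proj₂ bm))
            N : Carrier → Set
            N = Induction.Both.N K 1≤K H 0≤H H≤K B Bₘ≤B (V J) (0≤v (q K) D₀ 0<q J) A (ℕ.<-≤-trans k₁<B B≤n)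
              α β αβ (v≉0 (q K) D₀ 0<q 0<D₀ J) (λ {X} → ih {X}) fail {d} (0<d min) {err} err≤ (proj₂ (proj₂ bm))
            N-sub : IsSubgroup N
            N-sub = Induction.Both.N-sub K 1≤K H 0≤H H≤K B Bₘ≤B (V J) (0≤v (q K) D₀ 0<q J) A (ℕ.<-≤-trans k₁<B B≤n)
              α β αβ (v≉0 (q K) D₀ 0<q 0<D₀ J) (λ {X} → ih {X}) fail {d} (0<d min) {err} err≤ (proj₂ (proj₂ bm))

        sumset-bound : ∀ A → H * fromNat (size A) ≤ fromNat (size (A ⊕ α · A)) + fromNat (suc (q K) ℕ.* D₀) * (size A ^ᴿ (1# - σ (q K) D₀ 0<q B))
        sumset-bound A = split (size A) ≡.refl
          where
          pow : ℕ → Carrier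
          pow n = fromNat (suc (q K) ℕ.* D₀) * (n ^ᴿ (1# - σ (q K) D₀ 0<q B))
          split : ∀ n → n ≡ size A → H * fromNat n ≤ fromNat (size (A ⊕ α · A)) + pow n
          -- The empty set belongs to no scale.
          split zero    _  = ≤-respˡ (sym (zeroʳ H)) (≤-respʳ (sym (trans (+-congˡ (zeroʳ _)) (+-identityʳ _))) (0≤fromNat (size (A ⊕ α · A))))
          split (suc b) eq = let (J , lo , hi) = logarithm B 2≤B (suc b) (s≤s z≤n) in
            ≤-trans (≡.subst (λ n → H * fromNat n ≤ fromNat (size (A ⊕ α · A)) + fromNat (q K) * V J * fromNat n) (≡.sym eq)
              (bound A (<-wellFounded (size A)) J (≡.subst (B ℕ.^ J ℕ.≤_) eq lo) (≡.subst (ℕ._< B ℕ.^ suc J) eq hi)))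
              (+-mono-≤ ≤-refl (error-bound (q K) D₀ 0<q B b J hi))

      constants : ∃[ D ] ∃[ σ ] ((0# < D × 0# < σ) × (∀ {H r s} → 0# ≤ H → H ≤ fromNat K → 0# ≤ r → 0# ≤ s →
        r ^ d ≤ fromNat n₀ → s ^ d ≤ fromNat m₀ → H ≤ (r + s) ^ d →
        ∀ A → H * fromNat (size A) ≤ fromNat (size (A ⊕ α · A)) + D * (size A ^ᴿ (1# - σ))))
      constants = fromNat (suc (q K) ℕ.* D₀) , σ (q K) D₀ 0<q B ,
        ((0≤fromNat (suc (q K) ℕ.* D₀) , λ e → fromNat≉0 {suc (q K) ℕ.* D₀} (ℕ.*-mono-≤ {1} {suc (q K)} {1} (s≤s z≤n) 0<D₀) (sym e)) ,
         (0≤σ (q K) D₀ 0<q B , λ e → σ≉0 (q K) D₀ 0<q B (sym e))) ,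
        λ 0≤H H≤K 0≤r 0≤s rᵈ sᵈ H≤ A → sumset-bound 0≤H H≤K 0≤r 0≤s rᵈ sᵈ H≤ A

      nonzero-case : let t = fromNat d ⁻¹ in
        ∃[ D ] ∃[ σ ] (0# < D × 0# < σ × (∀ A → (n₀ ^ᴿ t + m₀ ^ᴿ t) ^ d * fromNat (size A) ≤ fromNat (size (A ⊕ α · A)) + D * (size A ^ᴿ (1# - σ))))
      nonzero-case = let (D , σ , (0<D , 0<σ) , h) = constants in D , σ , 0<D , 0<σ ,
        h (^-nonNeg d 0≤r+s) (≤-respʳ (sym (fromNat-^ (suc (n₀ ℕ.+ m₀)) d)) (^-mono d 0≤r+s r+s≤)) 0≤r 0≤s (rootᵈ n₀) (rootᵈ m₀) ≤-refl
        where
        open FractionalPower (0<d min)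
        0≤r = ^ᴿ-nonNeg n₀ 0≤t t≤1
        0≤s = ^ᴿ-nonNeg m₀ 0≤t t≤1
        0≤r+s : 0# ≤ n₀ ^ᴿ (fromNat d ⁻¹) + m₀ ^ᴿ (fromNat d ⁻¹)
        0≤r+s = ≤-trans 0≤r (≤-by 0≤s refl)
        r+s≤ : n₀ ^ᴿ (fromNat d ⁻¹) + m₀ ^ᴿ (fromNat d ⁻¹) ≤ fromNat (suc (n₀ ℕ.+ m₀))
        r+s≤ = ≤-trans (≤-respʳ (sym (fromNat-+ n₀ m₀)) (+-mono-≤ (root≤ n₀) (root≤ m₀))) (fromNat-mono {n₀ ℕ.+ m₀} (ℕ.n≤1+n _))

    trivial-bound : ∀ c A → size A ℕ.≤ size (A ⊕ c · A)
    trivial-bound c []       = ℕ.≤-trans (ℕ.≤-reflexive (size-empty {[]} (λ ()))) z≤n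
    trivial-bound c (x ∷ A) = size-⊕ˡ (x ∷ A) (∈-· {c = c} (here ≡.refl))

    main : ∀ {α d} {a : Fin (suc d) → ℤ} → IsMinimalPolynomial a α → let t = fromNat d ⁻¹ in
      ∃[ D ] ∃[ σ ] (0# < D × 0# < σ × (∀ A → (ℤ.∣ a (fromℕ d) ∣ ^ᴿ t + ℤ.∣ a zero ∣ ^ᴿ t) ^ d * fromNat (size A) ≤
        fromNat (size (A ⊕ α · A)) + D * (size A ^ᴿ (1# - σ))))
    main {α} {d} {a} min with em {α ≈ 0#}
    ... | no α≉0  = nonzero-case min α≉0
    -- By `zero-case` the factor is at most 1, and A + 0·A has as many elements as A, so that
    -- arbitrary positive constants with σ ≤ 1 serve.
    ... | yes α≈0 = 1# , 1# , (0≤1 , 0≉1) , (0≤1 , 0≉1) , λ A → ≤-trans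
          (≤-respʳ (*-identityˡ _) (*-monoʳ-≤ (0≤fromNat (size A)) H≤1))
          (≤-trans (fromNat-mono (trivial-bound α A)) (≤-by (*-nonNeg 0≤1 (^ᴿ-nonNeg (size A) (≤-reflexive (sym (-‿inverseʳ 1#))) (≤-respˡ (sym (-‿inverseʳ 1#)) 0≤1))) refl))
      where
      open FractionalPower (0<d min)
      r≤1 : ℤ.∣ a (fromℕ d) ∣ ^ᴿ (fromNat d ⁻¹) ≤ 1#
      r≤1 = ≤-trans (root≤ ℤ.∣ a (fromℕ d) ∣) (≤-respʳ fromNat-1 (fromNat-mono (proj₂ (zero-case min α≈0))))
      s≤0 : ℤ.∣ a zero ∣ ^ᴿ (fromNat d ⁻¹) ≤ 0#
      s≤0 = root≤′ (≡.cong ℤ.∣_∣ (proj₁ (zero-case min α≈0)))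
        where
        root≤′ : ∀ {m} → m ≡ 0 → m ^ᴿ (fromNat d ⁻¹) ≤ 0#
        root≤′ ≡.refl = ≤-refl
      H≤1 : (ℤ.∣ a (fromℕ d) ∣ ^ᴿ (fromNat d ⁻¹) + ℤ.∣ a zero ∣ ^ᴿ (fromNat d ⁻¹)) ^ d ≤ 1#
      H≤1 = ≤-respʳ (1^ d) (^-mono d (≤-trans (^ᴿ-nonNeg ℤ.∣ a (fromℕ d) ∣ 0≤t t≤1) (≤-by (^ᴿ-nonNeg ℤ.∣ a zero ∣ 0≤t t≤1) refl))
        (≤-respʳ (+-identityʳ 1#) (+-mono-≤ r≤1 s≤0)))

theorem1p5 :
  (em : ExcludedMiddle 0ℓ) (R : RealField) →
  let open Reals R in
  (α : Carrier) (d : ℕ) (a : Fin (suc d) → ℤ) →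
  IsMinimalPolynomial a α →
  ∃[ D ] ∃[ σ ]
    (0# < D × 0# < σ ×
     ((A : FiniteSubset) →
      (∣ a (fromℕ d) ∣ ^ᴿ (fromNat d ⁻¹) + ∣ a zero ∣ ^ᴿ (fromNat d ⁻¹)) ^ d
          * fromNat (card em A)
        - D * (card em A ^ᴿ (1# - σ))
      ≤ fromNat (card em (A ⊕ α · A))))
theorem1p5 em R α d a min =
  let (D , σ , 0<D , 0<σ , bound) = Main.main em R min in D , σ , 0<D , 0<σ , λ A → transfer D σ _ A (bound A)
  where
  open Reals R
  open Field em R using (x≤y; ≤-respʳ; 0≤y-x; solve; _:=_; _:+_; _:-_)
  open Sumsets em R using (size; card≡; card-⊕·) renaming (_⊕_ to _⊕′_; _·_ to _·′_)
  transfer : ∀ D σ H A → H * fromNat (size A) ≤ fromNat (size (A ⊕′ α ·′ A)) + D * (size A ^ᴿ (1# - σ)) →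
    H * fromNat (card em A) - D * (card em A ^ᴿ (1# - σ)) ≤ fromNat (card em (A ⊕ α · A))
  transfer D σ H A le = ≡.subst₂ (λ n m → H * fromNat n - D * (n ^ᴿ (1# - σ)) ≤ fromNat m) (≡.sym (card≡ A)) (≡.sym (card-⊕· α A))
    (x≤y (≤-respʳ (solve 3 (λ s p h → (s :+ p) :- h := s :- (h :- p)) refl _ _ _) (0≤y-x le)))
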